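{- Let $G=(V,E)$ be a simple undirected graph (possibly with isolated vertices) with $|V|=n$, $|E|=m\ge1$, and let $\varepsilon\in(0,1)$. With high probability, the algorithm $\mathtt{FullNonAdaptiveEdge}$ described in the context returns a $(1\pm\varepsilon)$-approximation of the number of edges, i.e. a number $\widetilde m$ with $|\widetilde m-m|\le\varepsilon m$.
   Context: Queries: $\mathtt{Deg}(v)$ returns the degree of $v\in V$; $\mathtt{RandEdge}$ returns an edge chosen uniformly at random from $E$, independently of other queries. Procedure $\mathtt{IsCollision}$: for each $i=1,\dots,O(\log n)$, sample $\lceil\sqrt{2n}\,\rceil$ edges independently and uniformly at random (with replacement) by $\mathtt{RandEdge}$, and set $k_i=1$ if some edge is sampled at least twice in this round and $k_i=0$ otherwise. If more than half of the $k_i$ are $1$, output $1$; otherwise output $0$. Procedure $\mathtt{NonAdaptiveEdge}$: put $\gamma=\varepsilon/10$, $t=\lceil\log_{1+\gamma}n\rceil+1$, and for $0\le i\le t-1$ let $B_i=\{v\in V:\deg(v)\in((1+\gamma)^{i-1},(1+\gamma)^i]\}$. Select a multiset $S$ of $\widetilde O(\sqrt n/\varepsilon^{2.5})$ vertices independently and uniformly at random from $V$ and query their degrees; let $S_i=S\cap B_i$ (with multiplicity) and $I_{\mathrm H}=\{i: |S_i|/|S|\ge\frac1t\sqrt{\varepsilon/(6n)}\}$. Let $\widetilde d_{\mathrm H}=\frac{n}{|S|}\sum_{i\in I_{\mathrm H}}|S_i|(1+\gamma)^i$. Make $\widetilde O(\sqrt{\varepsilon n})$ $\mathtt{RandEdge}$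 queries and for each returned edge pick one of its two endpoints, each with probability $1/2$; let $T$ be the multiset of picked vertices and $T_i=T\cap S_i$, where $|T_i|$ counts the pairs (element of $T$, element of $S_i$) that are the same vertex. Let $\widetilde p_{\mathrm H}=\frac{n}{|S|}\cdot\frac1{|T|}\sum_{i\in I_{\mathrm H}}|T_i|$ and output $\frac12\,\widetilde d_{\mathrm H}/\widetilde p_{\mathrm H}$. Algorithm $\mathtt{FullNonAdaptiveEdge}$: (1) run $\mathtt{IsCollision}$, with output $k$; (2) sample $s=\Theta(\sqrt n\log n/\varepsilon)$ edges independently and uniformly at random by $\mathtt{RandEdge}$, and let $r$ be the number of collisions, i.e. of pairs of samples $1\le i<j\le s$ that are the same edge; (3) run $\mathtt{NonAdaptiveEdge}$, with output $\widetilde m_{\mathrm{non\text{ - }coll}}$; (4) if $r>0$ and $k=1$, output $\widetilde m_{\mathrm{coll}}=\binom s2/r$; otherwise output $\widetilde m_{\mathrm{non\text{ - }coll}}$. All hidden factors (constants in $O,\Theta$; polynomials in $\log n$ and $1/\varepsilon$ in $\widetilde O$) are chosen sufficiently large. "With high probability" means with probability at least $1-n^{ -c}$ for some constant $c>0$.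
   Formalization: The accuracy parameter ε ranges over the rational numbers in (0,1) rather than over all real numbers in (0,1). -}

module Defs where

open import Algebra.Definitions.RawSemiring using ()
open import Data.Bool.Base using (Bool; not; if_then_else_; _∧_)
open import Data.Fin.Base using (Fin; toℕ)
import Data.Fin.Properties as Fin
open import Data.Integer.Base using (+_; ∣_∣)
open import Data.List.Base as List using (List; allFin; cartesianProduct; length; filter)
open import Data.Maybe.Base as Maybe using (Maybe; just; nothing)
open import Data.Maybe.Relation.Unary.Any as MaybeAny using ()
open import Data.Nat.Base as ℕ using (ℕ; zero; suc; NonZero)
open import Data.Nat.Combinatorics using (_C_)
open import Data.Nat.Logarithm using (⌈log₂_⌉)
import Data.Nat.Properties as ℕ
open import Data.Product.Base using (_×_; _,_; proj₁; proj₂)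
open import Data.Rational.Base as ℚ
  using (ℚ; 0ℚ; 1ℚ; ½; _+_; _*_; _-_; 1/_; _/_; _≤_; _<_; Positive; ceiling; ↥_; ↧ₙ_)
import Data.Rational.Properties as ℚ
open import Data.Vec.Base as Vec using (Vec; []; _∷_; count)
open import Data.Vec.Relation.Unary.AllPairs using (allPairs?)
open import Data.Vec.Relation.Unary.Unique.Propositional using (Unique)
open import Level using (0ℓ)
open import Relation.Binary.Core using (Rel)
open import Relation.Binary.Definitions as B using (DecidableEquality; Symmetric)
open import Relation.Nullary using (does; yes; no; ¬_; ¬?; _×-dec_)
open import Relation.Unary using (Pred; Decidable)

open Algebra.Definitions.RawSemiring ℚ.+-*-rawSemiring public using (_^_; sum)

private
  variable
    A B : Set
    P : Pred A 0ℓ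

fromℕ : ℕ → ℚ
fromℕ k = + k / 1

-- The least k ≤ b with P k; equals b if there is none below b.
least : {P : Pred ℕ 0ℓ} → Decidable P → (b : ℕ) → ℕ
least P? zero    = zero
least P? (suc b) = if does (P? 0) then 0 else suc (least (λ k → P? (suc k)) b)

-- ⌈ x √ y ⌉ is the integer ceiling of x·√y, for x , y ≥ 0. The search bound
-- suffices because z ≤ ⌈z⌉ ≤ ⌈z⌉² for z = x²y ≥ 0.
⌈_√_⌉ : ℚ → ℚ → ℕ
⌈ x √ y ⌉ = least (λ k → x ^ 2 * y ℚ.≤? fromℕ k ^ 2) ∣ ceiling (x ^ 2 * y) ∣

-- ⌈log[1+ γ ] n ⌉ is the integer ceiling of log_{1+γ} n, for n ≥ 1. The search
-- bound suffices because (1 + γ)^i ≥ 1 + i γ.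
⌈log[1+_]_⌉ : (γ : ℚ) .{{_ : Positive γ}} → ℕ → ℕ
⌈log[1+ γ ] n ⌉ =
  least (λ i → fromℕ n ℚ.≤? (1ℚ + γ) ^ i)
        ∣ ceiling (fromℕ n * (1/ γ) {{ℚ.pos⇒nonZero γ}}) ∣

_÷?_ : ℚ → ℚ → Maybe ℚ
p ÷? q with q ℚ.≟ 0ℚ
... | yes _  = nothing
... | no q≢0 = just ((p ℚ.÷ q) {{ℚ.≢-nonZero q≢0}})

record SimpleGraph (n : ℕ) : Set₁ where
  infix 4 _~_ _~?_
  field
    _~_      : Rel (Fin n) 0ℓ
    _~?_     : B.Decidable _~_
    ~-sym    : Symmetric _~_
    ~-irrefl : ∀ {v} → ¬ (v ~ v)

  deg : Fin n → ℕ
  deg v = length (filter (v ~?_) (allFin n))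

  -- Each edge {u , v} is listed once, as the pair (u , v) with u < v.
  edges : List (Fin n × Fin n)
  edges = filter (λ (u , v) → u Fin.<? v ×-dec u ~? v)
                 (cartesianProduct (allFin n) (allFin n))

  ∣E∣ : ℕ
  ∣E∣ = length edges

  Edge : Set
  Edge = Fin ∣E∣

  endpoints : Edge → Fin n × Fin n
  endpoints = List.lookup edges

open SimpleGraph

∣E∣-nonZero⇒nonZero : ∀ {n} (G : SimpleGraph n) → .{{NonZero (∣E∣ G)}} → NonZero n
∣E∣-nonZero⇒nonZero {suc n} G = _

-- Each draw is uniform on Fin k and independent of all the others.
data Rand (A : Set) : Set where
  pure : A → Rand A
  draw : (k : ℕ) .{{_ : NonZero k}} → (Fin k → Rand A) → Rand A

infixl 1 _>>=_
_>>=_ : Rand A → (A → Rand B) → Rand B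
pure a   >>= g = g a
draw k f >>= g = draw k λ i → f i >>= g

uniform : (k : ℕ) .{{_ : NonZero k}} → Rand (Fin k)
uniform k = draw k pure

repeat : (k : ℕ) → Rand A → Rand (Vec A k)
repeat zero    c = pure []
repeat (suc k) c = do
  x  ← c
  xs ← repeat k c
  pure (x ∷ xs)

Pr[_∈_] : Rand A → {P : Pred A 0ℓ} → Decidable P → ℚ
Pr[ pure a   ∈ P? ] = if does (P? a) then 1ℚ else 0ℚ
Pr[ draw k f ∈ P? ] = (+ 1 / k) * sum λ i → Pr[ f i ∈ P? ]

-- p ≥ 1 - n^{-c} for a probability p and c = a/b > 0, written without roots as
-- (1 - p)^b · n^a ≤ 1.
HighProbability : (n : ℕ) (c p : ℚ) → Set
HighProbability n c p = (1ℚ - p) ^ (↧ₙ c) * fromℕ n ^ ∣ ↥ c ∣ ≤ 1ℚ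

-- coeff · (log n)^logExp · (1/ε)^εExp
record PolyFactor : Set where
  constructor polyFactor
  field
    coeff logExp εExp : ℕ

record HiddenFactors : Set where
  field
    roundsFactor   : ℕ           -- O(log n) rounds of IsCollision
    samplesFactor  : ℕ           -- Θ(√n log n / ε) edges for counting collisions
    verticesFactor : PolyFactor  -- Õ(√n / ε^2.5) vertices
    edgesFactor    : PolyFactor  -- Õ(√(ε n)) edges

record _≼_ (f g : PolyFactor) : Set where
  private
    module f = PolyFactor f
    module g = PolyFactor g
  field
    coeff≤  : f.coeff ℕ.≤ g.coeff
    logExp≤ : f.logExp ℕ.≤ g.logExp
    εExp≤   : f.εExp ℕ.≤ g.εExp

record _⊑_ (h k : HiddenFactors) : Set where
  private
    module h = HiddenFactors h
    module k = HiddenFactors k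
  field
    rounds≤   : h.roundsFactor ℕ.≤ k.roundsFactor
    samples≤  : h.samplesFactor ℕ.≤ k.samplesFactor
    vertices≼ : h.verticesFactor ≼ k.verticesFactor
    edges≼    : h.edgesFactor ≼ k.edgesFactor

-- The number of pairs i < j with equal i-th and j-th entries.
collisions : DecidableEquality A → ∀ {k} → Vec A k → ℕ
collisions _≟_ []       = 0
collisions _≟_ (x ∷ xs) = count (x ≟_) xs ℕ.+ collisions _≟_ xs

module Algorithm
  {n : ℕ} (G : SimpleGraph n) .{{_ : NonZero (∣E∣ G)}}
  (ε : ℚ) .{{_ : Positive ε}}
  (h : HiddenFactors)
  where

  open HiddenFactors h

  private instance
    n≢0 : NonZero n
    n≢0 = ∣E∣-nonZero⇒nonZero G

  ε⁻¹ : ℚ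
  ε⁻¹ = (1/ ε) {{ℚ.pos⇒nonZero ε}}

  logn : ℕ
  logn = ⌈log₂ n ⌉

  polyFactorℚ : PolyFactor → ℚ
  polyFactorℚ (polyFactor C a b) = fromℕ C * fromℕ logn ^ a * ε⁻¹ ^ b

  randVertex : Rand (Fin n)
  randVertex = uniform n

  randEdge : Rand (Edge G)
  randEdge = uniform (∣E∣ G)

  randEndpoint : Rand (Fin n)
  randEndpoint = do
    e    ← randEdge
    coin ← uniform 2
    pure (pick coin (endpoints G e))
    where
    pick : Fin 2 → Fin n × Fin n → Fin n
    pick Fin.zero    = proj₁
    pick (Fin.suc _) = proj₂

  rounds : ℕ
  rounds = roundsFactor ℕ.* logn

  hasCollision : ∀ {k} → Vec (Edge G) k → Bool
  hasCollision xs = not (does (unique? xs))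
    where
    unique? : ∀ {k} → Decidable (Unique {A = Edge G} {k})
    unique? = allPairs? λ e f → ¬? (e Fin.≟ f)

  isCollision : Rand Bool
  isCollision = do
    ks ← repeat rounds do
           xs ← repeat ⌈ 1ℚ √ fromℕ (2 ℕ.* n) ⌉ randEdge
           pure (hasCollision xs)
    pure (rounds ℕ.<ᵇ 2 ℕ.* Vec.countᵇ (λ k → k) ks)

  γ : ℚ
  γ = ε * (+ 1 / 10)

  private instance
    γ>0 : Positive γ
    γ>0 = ℚ.pos*pos⇒pos ε (+ 1 / 10)

  t : ℕ
  t = ⌈log[1+ γ ] n ⌉ ℕ.+ 1

  -- (1+γ)^(i-1) < deg v ≤ (1+γ)^i; the first inequality is multiplied by 1 + γ
  -- to keep the exponent natural when i = 0.
  _∈B_ : Fin n → Fin t → Set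
  v ∈B i = (1ℚ + γ) ^ toℕ i < (1ℚ + γ) * fromℕ (deg G v)
         × fromℕ (deg G v) ≤ (1ℚ + γ) ^ toℕ i

  _∈B?_ : B.Decidable _∈B_
  v ∈B? i = (_ ℚ.<? _) ×-dec (_ ℚ.≤? _)

  ∣S∣ : ℕ
  ∣S∣ = ⌈ polyFactorℚ verticesFactor * ε⁻¹ ^ 2 √ fromℕ n * ε⁻¹ ⌉

  ∣T∣ : ℕ
  ∣T∣ = ⌈ polyFactorℚ edgesFactor √ ε * fromℕ n ⌉

  module _ (S : Vec (Fin n) ∣S∣) (T : Vec (Fin n) ∣T∣) where

    ∣S∩B_∣ : Fin t → ℕ
    ∣S∩B i ∣ = count (_∈B? i) S

    ∣T∩S_∣ : Fin t → ℕ
    ∣T∩S i ∣ = Vec.sum (Vec.map (λ x → count (λ y → x Fin.≟ y ×-dec y ∈B? i) S) T)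

    -- |Sᵢ| / |S| ≥ (1/t) √(ε/(6n)), squared and cleared of denominators.
    Heavy : Fin t → Set
    Heavy i = ε * fromℕ ∣S∣ ^ 2 ≤ fromℕ (6 ℕ.* n) * (fromℕ t * fromℕ ∣S∩B i ∣) ^ 2

    heavy? : Decidable Heavy
    heavy? i = _ ℚ.≤? _

    sumHeavy : (Fin t → ℚ) → ℚ
    sumHeavy f = sum λ i → if does (heavy? i) then f i else 0ℚ

    nonCollEstimate : Maybe ℚ
    nonCollEstimate =
      fromℕ n ÷? fromℕ ∣S∣ Maybe.>>= λ n/∣S∣ →
      1ℚ ÷? fromℕ ∣T∣ Maybe.>>= λ 1/∣T∣ →
      let d̃ = n/∣S∣ * sumHeavy λ i → fromℕ ∣S∩B i ∣ * (1ℚ + γ) ^ toℕ i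
          p̃ = n/∣S∣ * 1/∣T∣ * sumHeavy λ i → fromℕ ∣T∩S i ∣
      in (½ * d̃) ÷? p̃

  nonAdaptiveEdge : Rand (Maybe ℚ)
  nonAdaptiveEdge = do
    S ← repeat ∣S∣ randVertex
    T ← repeat ∣T∣ randEndpoint
    pure (nonCollEstimate S T)

  s : ℕ
  s = ⌈ fromℕ (samplesFactor ℕ.* logn) * ε⁻¹ √ fromℕ n ⌉

  fullNonAdaptiveEdge : Rand (Maybe ℚ)
  fullNonAdaptiveEdge = do
    k      ← isCollision
    xs     ← repeat s randEdge
    m̃-non  ← nonAdaptiveEdge
    let r = collisions Fin._≟_ xs
    pure (if (0 ℕ.<ᵇ r) ∧ k then fromℕ (s C 2) ÷? fromℕ r else m̃-non)

open Algorithm public using (fullNonAdaptiveEdge)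

-- An undefined output approximates nothing.
Approximates : (ε m : ℚ) → Maybe ℚ → Set
Approximates ε m = MaybeAny.Any λ m̃ → ℚ.∣ m̃ - m ∣ ≤ ε * m

approximates? : ∀ ε m → Decidable (Approximates ε m)
approximates? ε m = MaybeAny.dec λ m̃ → _ ℚ.≤? _

{-# OPTIONS --safe #-}
-- All tail bounds come from one exponential supermartingale. Fix a grid 1/D
-- containing every exponent that occurs; z ↦ (1 + 1/D)^z is then a rational
-- substitute for exp (z/D), and 𝔼[exp (Λ z)] ≤ exp (2W) for a centred, bounded
-- increment z. Stopping the process when it leaves a good set gives Chernoff
-- bounds and also the concentration of the number r of collisions: drawing one
-- more edge x after xs changes m r - (k choose 2) by m N(x) - k, where N(x) is
-- the number of occurrences of x in xs, and the conditional variance is an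
-- affine function of r itself. If s ≲ m log n the counts N are logarithmic and
-- bound the increments; if s ≳ m log n the process is stopped as soon as r is
-- too large, which bounds the variance and hence every single increment.
--
-- The collision test answers 1 if m ≤ n/6 and 0 if m ≥ 8n, so it remains to
-- show that the collision estimate is accurate for m ≤ 8n and that the other
-- estimate is accurate for m ≥ n/6. Given S, the quantity d̃/2 is within a factor
-- 1 + γ of m times the conditional expectation of p̃, whatever classes are heavy,
-- so only the concentration of p̃ over T matters. It needs the heavy classes to
-- carry a constant fraction of the degrees: every large class is heavy, and the
-- vertices outside the large classes span few edges.
module Submission where

open import Defs
open import Algebra.Bundles using (CommutativeRing)
import Algebra.Properties.Semiring.Sum as SemiringSum
open import Data.Bool.Base using (Bool; true; false; if_then_else_; _∧_; not; T)
import Data.Bool.Properties as Bool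
open import Data.Empty using (⊥; ⊥-elim)
open import Data.Fin.Base as Fin using (Fin; toℕ)
import Data.Fin.Properties as Fin
open import Data.Integer.Base as ℤ using (ℤ; +_; -[1+_]; _⊖_)
import Data.Integer.DivMod as ℤ
import Data.Integer.Properties as ℤ
import Data.Integer.Tactic.RingSolver as ℤR
open import Data.List.Base as List using (List; []; _∷_)
import Data.List.Properties as List
open import Data.Maybe.Base as Maybe using (Maybe; just)
open import Data.Maybe.Relation.Unary.Any as MaybeAny using ()
import Data.Nat.Base as ℕ
open import Data.Nat.Base using (ℕ; zero; suc; NonZero)
open import Data.Nat.Combinatorics using (_C_; nCk+nC[k+1]≡[n+1]C[k+1]; nC1≡n)
import Data.Nat.Coprimality as Coprimality
open import Data.Nat.Induction using (<-rec)
open import Data.Nat.Logarithm using (⌈log₂_⌉; ⌈log₂⌉-mono-≤; ⌈log₂⌈n/2⌉⌉≡⌈log₂n⌉∸1; ⌈log₂2^n⌉≡n)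
import Data.Nat.DivMod as ℕ
import Data.Nat.Properties as ℕ
import Data.Nat.Tactic.RingSolver as ℕR
open import Data.Product.Base using (_×_; _,_; proj₁; proj₂; ∃-syntax; Σ-syntax)
open import Data.Rational.Base as ℚ using (ℚ; mkℚ; 0ℚ; 1ℚ; ½; _+_; _*_; _-_; -_; _/_; _≤_; _<_; Positive; *≤*)
import Data.Rational.Properties as ℚ
open import Data.Sum.Base using (_⊎_; inj₁; inj₂)
open import Data.Unit.Base using (⊤; tt)
open import Data.Vec.Base as Vec using (Vec; []; _∷_; count)
open import Data.Vec.Relation.Unary.All as VecAll using ([]; _∷_)
open import Data.Vec.Relation.Unary.AllPairs using (allPairs?; []; _∷_)
open import Data.Vec.Relation.Unary.Unique.Propositional using (Unique)
open import Function.Base using (_∘_)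
open import Level using (0ℓ)
open import Relation.Binary.Definitions using (Tri; tri<; tri≈; tri>)
open import Relation.Binary.PropositionalEquality
open import Relation.Nullary using (¬_; Dec; yes; no; does; contradiction; ¬?; _×-dec_; _⊎-dec_)
open import Relation.Nullary.Decidable using (dec⇒maybe; dec-true; dec-false; decidable-stable)
open import Relation.Unary using (Pred; Decidable)
open import Tactic.RingSolver using (solve-∀)
import Tactic.RingSolver.Core.AlmostCommutativeRing as ACR
open SimpleGraph using (∣E∣)
open SemiringSum (CommutativeRing.semiring ℚ.+-*-commutativeRing)
  using (sum-cong-≗; ∑-distrib-+; ∑-comm; *-distribˡ-sum)
open SemiringSum ℕ.+-*-semiring using () renaming (sum to sumᴺ)

-- Only rationals are available, so real roots, logarithms and exponentials are avoided:
-- inequalities are squared or cleared of denominators, and an integer `Δ` with 1 ≤ εΔ ≤ 2 lets a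
-- relative error 1/(4Δ) stand for ε/4. The grid D = QΛ² is forced: for increments z with 𝔼z² ≤ QW
-- the rate 1/(QΛ) makes both Λz and the growth 2W count whole steps of 1/D, and since (1 + 1/D)^D ≥
-- 2, each further D in the exponent halves a tail. Tails are taken at ½^j with j = 8⌈log₂ n⌉ (plus
-- t where the t classes are unioned), hence at most n⁻⁸ per event, enough for a union over the m ≤
-- n² edges. The thresholds n/6 and 8n come from the round size: ⌈√(2n)⌉ samples form between n/2
-- and 2n pairs, so a round collides with probability at least 3/4, respectively at most 1/4. A
-- class counts as large when its size is at least √(6εn)/(5t); losing a sixth of its expected
-- sample then still meets the heavy threshold √(ε/(6n))/t exactly.

private
  variable
    X Y : Set

-- Ordered-ring arithmetic in ℚ and the embeddings of ℕ and ℤ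

ℚ-ring : ACR.AlmostCommutativeRing 0ℓ 0ℓ
ℚ-ring = ACR.fromCommutativeRing ℚ.+-*-commutativeRing λ x → dec⇒maybe (0ℚ ℚ.≟ x)

fromℤ : ℤ → ℚ
fromℤ i = i / 1

-- `i / 1` normalises through a gcd and is stuck for a variable i; rewriting with this form exposes
-- numerator and denominator, so the facts below reduce to integers.
fromℤ≡mkℚ : ∀ i → fromℤ i ≡ mkℚ i 0 (Coprimality.sym (Coprimality.1-coprimeTo _))
fromℤ≡mkℚ i = ℚ.↥p/↧p≡p (mkℚ i 0 (Coprimality.sym (Coprimality.1-coprimeTo _)))

fromℤ-+ : ∀ i j → fromℤ (i ℤ.+ j) ≡ fromℤ i + fromℤ j
fromℤ-+ i j rewrite fromℤ≡mkℚ i | fromℤ≡mkℚ j =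
  cong fromℤ (cong₂ ℤ._+_ (sym (ℤ.*-identityʳ i)) (sym (ℤ.*-identityʳ j)))

fromℤ-* : ∀ i j → fromℤ (i ℤ.* j) ≡ fromℤ i * fromℤ j
fromℤ-* i j rewrite fromℤ≡mkℚ i | fromℤ≡mkℚ j = refl

fromℤ-neg : ∀ i → fromℤ (ℤ.- i) ≡ - fromℤ i
fromℤ-neg i = begin
  fromℤ (ℤ.- i)                          ≡⟨ lem (fromℤ i) _ ⟩
  (fromℤ i + fromℤ (ℤ.- i)) - fromℤ i    ≡⟨ cong (_- fromℤ i) (sym (fromℤ-+ i (ℤ.- i))) ⟩
  fromℤ (i ℤ.- i) - fromℤ i              ≡⟨ cong (λ j → fromℤ j - fromℤ i) (ℤ.+-inverseʳ i) ⟩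
  0ℚ - fromℤ i                           ≡⟨ ℚ.+-identityˡ _ ⟩
  - fromℤ i ∎
  where
  open ≡-Reasoning
  lem : ∀ x y → y ≡ (x + y) - x
  lem = solve-∀ ℚ-ring

fromℤ-mono-≤ : ∀ {i j} → i ℤ.≤ j → fromℤ i ≤ fromℤ j
fromℤ-mono-≤ {i} {j} i≤j rewrite fromℤ≡mkℚ i | fromℤ≡mkℚ j =
  *≤* (subst₂ ℤ._≤_ (sym (ℤ.*-identityʳ i)) (sym (ℤ.*-identityʳ j)) i≤j)

fromℤ-cancel-≤ : ∀ {i j} → fromℤ i ≤ fromℤ j → i ℤ.≤ j
fromℤ-cancel-≤ {i} {j} i≤j rewrite fromℤ≡mkℚ i | fromℤ≡mkℚ j with i≤j
... | *≤* p = subst₂ ℤ._≤_ (ℤ.*-identityʳ i) (ℤ.*-identityʳ j) p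

fromℕ-+ : ∀ m n → fromℕ (m ℕ.+ n) ≡ fromℕ m + fromℕ n
fromℕ-+ m n = fromℤ-+ (+ m) (+ n)

fromℕ-* : ∀ m n → fromℕ (m ℕ.* n) ≡ fromℕ m * fromℕ n
fromℕ-* m n = trans (cong fromℤ (ℤ.pos-* m n)) (fromℤ-* (+ m) (+ n))

fromℕ-mono-≤ : ∀ {m n} → m ℕ.≤ n → fromℕ m ≤ fromℕ n
fromℕ-mono-≤ m≤n = fromℤ-mono-≤ (ℤ.+≤+ m≤n)

fromℕ-cancel-≤ : ∀ {m n} → fromℕ m ≤ fromℕ n → m ℕ.≤ n
fromℕ-cancel-≤ {m} {n} m≤n = ℤ.drop‿+≤+ (fromℤ-cancel-≤ {+ m} {+ n} m≤n)

fromℕ-^ : ∀ m k → fromℕ (m ℕ.^ k) ≡ fromℕ m ^ k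
fromℕ-^ m zero    = refl
fromℕ-^ m (suc k) = trans (fromℕ-* m (m ℕ.^ k)) (cong (fromℕ m *_) (fromℕ-^ m k))

0≤fromℕ : ∀ n → 0ℚ ≤ fromℕ n
0≤fromℕ n = fromℕ-mono-≤ {0} {n} ℕ.z≤n

inv : (k : ℕ) .{{_ : NonZero k}} → ℚ
inv k = + 1 / k

inv-* : ∀ k .{{_ : NonZero k}} → inv k * fromℕ k ≡ 1ℚ
inv-* (suc k-1) rewrite fromℤ≡mkℚ (+ suc k-1) | ℚ.normalize-coprime (Coprimality.1-coprimeTo (suc k-1)) =
  ℚ.*-inverseˡ (mkℚ (+ suc k-1) 0 (Coprimality.sym (Coprimality.1-coprimeTo (suc k-1))))

0≤inv : ∀ k .{{_ : NonZero k}} → 0ℚ ≤ inv k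
0≤inv k = ℚ.nonNegative⁻¹ (inv k) {{ℚ.normalize-nonNeg 1 k}}

0<inv : ∀ k .{{_ : NonZero k}} → 0ℚ < inv k
0<inv k = ℚ.positive⁻¹ (inv k) {{ℚ.normalize-pos 1 k}}

+-nonNeg : ∀ {x y} → 0ℚ ≤ x → 0ℚ ≤ y → 0ℚ ≤ x + y
+-nonNeg = ℚ.+-mono-≤

*-monoˡ-≤ : ∀ {r x y} → 0ℚ ≤ r → x ≤ y → r * x ≤ r * y
*-monoˡ-≤ {r} 0≤r = ℚ.*-monoˡ-≤-nonNeg r {{ℚ.nonNegative 0≤r}}

*-monoʳ-≤ : ∀ {r x y} → 0ℚ ≤ r → x ≤ y → x * r ≤ y * r
*-monoʳ-≤ {r} 0≤r = ℚ.*-monoʳ-≤-nonNeg r {{ℚ.nonNegative 0≤r}}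

*-nonNeg : ∀ {x y} → 0ℚ ≤ x → 0ℚ ≤ y → 0ℚ ≤ x * y
*-nonNeg {x} {y} 0≤x 0≤y = subst (_≤ x * y) (ℚ.*-zeroʳ x) (*-monoˡ-≤ 0≤x 0≤y)

*-mono-≤ : ∀ {x x′ y y′} → 0ℚ ≤ x → x ≤ x′ → 0ℚ ≤ y → y ≤ y′ → x * y ≤ x′ * y′
*-mono-≤ 0≤x x≤x′ 0≤y y≤y′ =
  ℚ.≤-trans (*-monoʳ-≤ 0≤y x≤x′) (*-monoˡ-≤ (ℚ.≤-trans 0≤x x≤x′) y≤y′)

*-cancelˡ-≤ : ∀ {r x y} → 0ℚ < r → r * x ≤ r * y → x ≤ y
*-cancelˡ-≤ {r} 0<r = ℚ.*-cancelˡ-≤-pos r {{ℚ.positive 0<r}}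

*-pos : ∀ {x y} → 0ℚ < x → 0ℚ < y → 0ℚ < x * y
*-pos {x} {y} 0<x 0<y = ℚ.positive⁻¹ (x * y) {{ℚ.pos*pos⇒pos x {{ℚ.positive 0<x}} y {{ℚ.positive 0<y}}}}

-- The form in which most polynomial inequalities are proved: name the nonnegative difference p and
-- leave y ≡ x + p to the ring solver.
≤-by : ∀ {x y p} → 0ℚ ≤ p → y ≡ x + p → x ≤ y
≤-by {x} {p = p} 0≤p refl = subst (_≤ x + p) (ℚ.+-identityʳ x) (ℚ.+-monoʳ-≤ x 0≤p)

p≤q⇒0≤q-p : ∀ {p q} → p ≤ q → 0ℚ ≤ q - p
p≤q⇒0≤q-p {p} {q} p≤q = subst (_≤ q - p) (ℚ.+-inverseʳ p) (ℚ.+-monoˡ-≤ (- p) p≤q)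

p-q≡-1*[q-p] : ∀ p q → p - q ≡ - 1ℚ * (q - p)
p-q≡-1*[q-p] = solve-∀ ℚ-ring

[p-q]²≡[q-p]² : ∀ p q → (p - q) * (p - q) ≡ (q - p) * (q - p)
[p-q]²≡[q-p]² = solve-∀ ℚ-ring

0≤x² : ∀ x → 0ℚ ≤ x * x
0≤x² x with ℚ.≤-total 0ℚ x
... | inj₁ 0≤x = *-nonNeg 0≤x 0≤x
... | inj₂ x≤0 = subst (0ℚ ≤_) (lem x) (*-nonNeg -x -x)
  where
  -x = ℚ.neg-antimono-≤ x≤0
  lem : ∀ x → (- x) * (- x) ≡ x * x
  lem = solve-∀ ℚ-ring

^-nonNeg : ∀ {x} k → 0ℚ ≤ x → 0ℚ ≤ x ^ k
^-nonNeg zero    0≤x = ℚ.nonNegative⁻¹ 1ℚ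
^-nonNeg (suc k) 0≤x = *-nonNeg 0≤x (^-nonNeg k 0≤x)

^-pos : ∀ {x} k → 0ℚ < x → 0ℚ < x ^ k
^-pos zero    0<x = ℚ.positive⁻¹ 1ℚ
^-pos (suc k) 0<x = *-pos 0<x (^-pos k 0<x)

^-mono-≤ : ∀ {x y} k → 0ℚ ≤ x → x ≤ y → x ^ k ≤ y ^ k
^-mono-≤ zero    0≤x x≤y = ℚ.≤-refl
^-mono-≤ (suc k) 0≤x x≤y = *-mono-≤ 0≤x x≤y (^-nonNeg k 0≤x) (^-mono-≤ k 0≤x x≤y)

^-+ : ∀ x j k → x ^ (j ℕ.+ k) ≡ x ^ j * x ^ k
^-+ x zero    k = sym (ℚ.*-identityˡ _)
^-+ x (suc j) k = trans (cong (x *_) (^-+ x j k)) (sym (ℚ.*-assoc x _ _))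

^-* : ∀ x j k → x ^ (j ℕ.* k) ≡ (x ^ k) ^ j
^-* x zero    k = refl
^-* x (suc j) k = trans (^-+ x k (j ℕ.* k)) (cong (x ^ k *_) (^-* x j k))

*-^ : ∀ x y k → (x * y) ^ k ≡ x ^ k * y ^ k
*-^ x y zero    = refl
*-^ x y (suc k) = trans (cong (x * y *_) (*-^ x y k)) (lem x y (x ^ k) (y ^ k))
  where
  lem : ∀ x y a b → x * y * (a * b) ≡ x * a * (y * b)
  lem = solve-∀ ℚ-ring

1≤^ : ∀ {x} k → 1ℚ ≤ x → 1ℚ ≤ x ^ k
1≤^ zero    1≤x = ℚ.≤-refl
1≤^ (suc k) 1≤x = *-mono-≤ (ℚ.nonNegative⁻¹ 1ℚ) 1≤x (ℚ.nonNegative⁻¹ 1ℚ) (1≤^ k 1≤x)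

^-monoʳ-≤ : ∀ {x j k} → 1ℚ ≤ x → j ℕ.≤ k → x ^ j ≤ x ^ k
^-monoʳ-≤ {x} {k = k} 1≤x ℕ.z≤n = 1≤^ k 1≤x
^-monoʳ-≤ {x} 1≤x (ℕ.s≤s j≤k) = *-monoˡ-≤ (ℚ.≤-trans (ℚ.nonNegative⁻¹ 1ℚ) 1≤x) (^-monoʳ-≤ 1≤x j≤k)

^-antimonoʳ-≤ : ∀ {x j k} → 0ℚ ≤ x → x ≤ 1ℚ → j ℕ.≤ k → x ^ k ≤ x ^ j
^-antimonoʳ-≤ {x} {k = k} 0≤x x≤1 ℕ.z≤n = subst (x ^ k ≤_) (1^ k) (^-mono-≤ k 0≤x x≤1)
  where
  1^ : ∀ k → 1ℚ ^ k ≡ 1ℚ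
  1^ zero    = refl
  1^ (suc k) = trans (ℚ.*-identityˡ _) (1^ k)
^-antimonoʳ-≤ 0≤x x≤1 (ℕ.s≤s j≤k) = *-monoˡ-≤ 0≤x (^-antimonoʳ-≤ 0≤x x≤1 j≤k)

bernoulli : ∀ {x} k → - 1ℚ ≤ x → 1ℚ + fromℕ k * x ≤ (1ℚ + x) ^ k
bernoulli {x} zero    -1≤x = ℚ.≤-reflexive (lem x)
  where
  lem : ∀ x → 1ℚ + 0ℚ * x ≡ 1ℚ
  lem = solve-∀ ℚ-ring
bernoulli {x} (suc k) -1≤x = begin
  1ℚ + fromℕ (suc k) * x             ≡⟨ cong (λ z → 1ℚ + z * x) (fromℕ-+ 1 k) ⟩
  1ℚ + (1ℚ + fromℕ k) * x            ≤⟨ ≤-by (*-nonNeg (0≤fromℕ k) (0≤x² x)) (lem x (fromℕ k)) ⟩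
  (1ℚ + x) * (1ℚ + fromℕ k * x)      ≤⟨ *-monoˡ-≤ (ℚ.+-monoʳ-≤ 1ℚ -1≤x) (bernoulli k -1≤x) ⟩
  (1ℚ + x) * (1ℚ + x) ^ k            ∎
  where
  open ℚ.≤-Reasoning
  lem : ∀ x k → (1ℚ + x) * (1ℚ + k * x) ≡ (1ℚ + (1ℚ + k) * x) + k * (x * x)
  lem = solve-∀ ℚ-ring

-- Surrogate exponential: z ↦ (1 + 1/D)^z approximates exp (z/D) and, unlike
-- exp, is rational on the grid ℤ/D.

module Exp (D : ℕ) .{{_ : NonZero D}} where

  -- β is 1/b written out as D/(D+1), so that negative powers need no division.
  θ b β : ℚ
  θ = inv D
  b = 1ℚ + θ
  β = fromℕ D * inv (suc D)

  0≤θ : 0ℚ ≤ θ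
  0≤θ = 0≤inv D

  0<b : 0ℚ < b
  0<b = ℚ.<-≤-trans (ℚ.positive⁻¹ 1ℚ) (≤-by 0≤θ refl)

  bβ≡1 : b * β ≡ 1ℚ
  bβ≡1 = begin
    (1ℚ + θ) * (fromℕ D * inv (suc D))              ≡⟨ lem θ (fromℕ D) (inv (suc D)) ⟩
    (θ * fromℕ D + fromℕ D) * inv (suc D)           ≡⟨ cong (λ z → (z + fromℕ D) * inv (suc D)) (inv-* D) ⟩
    (1ℚ + fromℕ D) * inv (suc D)                    ≡⟨ cong (_* inv (suc D)) (sym (fromℕ-+ 1 D)) ⟩
    fromℕ (suc D) * inv (suc D)                     ≡⟨ ℚ.*-comm (fromℕ (suc D)) (inv (suc D)) ⟩
    inv (suc D) * fromℕ (suc D)                     ≡⟨ inv-* (suc D) ⟩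
    1ℚ ∎
    where
    open ≡-Reasoning
    lem : ∀ t d i → (1ℚ + t) * (d * i) ≡ (t * d + d) * i
    lem = solve-∀ ℚ-ring

  0<β : 0ℚ < β
  0<β = *-pos (ℚ.positive⁻¹ (fromℕ D) {{ℚ.normalize-pos D 1}}) (0<inv (suc D))

  exp : ℤ → ℚ
  exp (+ k)    = b ^ k
  exp -[1+ k ] = β ^ suc k

  0<exp : ∀ z → 0ℚ < exp z
  0<exp (+ k)    = ^-pos k 0<b
  0<exp -[1+ k ] = ^-pos (suc k) 0<β

  0≤exp : ∀ z → 0ℚ ≤ exp z
  0≤exp z = ℚ.<⇒≤ (0<exp z)

  exp-⊖ : ∀ j k → exp (j ⊖ k) ≡ b ^ j * β ^ k
  exp-⊖ zero    zero    = refl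
  exp-⊖ zero    (suc k) = sym (ℚ.*-identityˡ _)
  exp-⊖ (suc j) zero    = sym (ℚ.*-identityʳ _)
  exp-⊖ (suc j) (suc k) = begin
    exp (suc j ⊖ suc k)        ≡⟨ cong exp (ℤ.[1+m]⊖[1+n]≡m⊖n j k) ⟩
    exp (j ⊖ k)                ≡⟨ exp-⊖ j k ⟩
    b ^ j * β ^ k              ≡⟨ sym (ℚ.*-identityˡ _) ⟩
    1ℚ * (b ^ j * β ^ k)       ≡⟨ cong (_* (b ^ j * β ^ k)) (sym bβ≡1) ⟩
    b * β * (b ^ j * β ^ k)    ≡⟨ lem b β (b ^ j) (β ^ k) ⟩
    b ^ suc j * β ^ suc k      ∎
    where
    open ≡-Reasoning
    lem : ∀ x y a b → x * y * (a * b) ≡ x * a * (y * b)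
    lem = solve-∀ ℚ-ring

  exp-+ : ∀ y z → exp (y ℤ.+ z) ≡ exp y * exp z
  exp-+ (+ j)    (+ k)    = ^-+ b j k
  exp-+ (+ j)    -[1+ k ] = exp-⊖ j (suc k)
  exp-+ -[1+ j ] (+ k)    = trans (exp-⊖ k (suc j)) (ℚ.*-comm (b ^ k) (β ^ suc j))
  exp-+ -[1+ j ] -[1+ k ] = trans (cong (λ i → β ^ suc i) (sym (ℕ.+-suc j k))) (^-+ β (suc j) (suc k))

  exp-*ℕ : ∀ z k → exp (+ k ℤ.* z) ≡ exp z ^ k
  exp-*ℕ z zero    = refl
  exp-*ℕ z (suc k) = begin
    exp (+ suc k ℤ.* z)         ≡⟨ cong exp (ℤ.suc-* (+ k) z) ⟩
    exp (z ℤ.+ + k ℤ.* z)       ≡⟨ exp-+ z (+ k ℤ.* z) ⟩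
    exp z * exp (+ k ℤ.* z)     ≡⟨ cong (exp z *_) (exp-*ℕ z k) ⟩
    exp z * exp z ^ k           ∎
    where open ≡-Reasoning

  exp-mono-≤ : ∀ {y z} → y ℤ.≤ z → exp y ≤ exp z
  exp-mono-≤ {y} {z} y≤z = begin
    exp y                        ≡⟨ sym (ℚ.*-identityˡ _) ⟩
    1ℚ * exp y                   ≤⟨ *-monoʳ-≤ (0≤exp y) (1≤exp (ℤ.i≤j⇒0≤j-i y≤z)) ⟩
    exp (z ℤ.- y) * exp y        ≡⟨ sym (exp-+ (z ℤ.- y) y) ⟩
    exp (z ℤ.- y ℤ.+ y)          ≡⟨ cong exp (lem y z) ⟩
    exp z                        ∎
    where
    open ℚ.≤-Reasoning
    1≤exp : ∀ {i} → + 0 ℤ.≤ i → 1ℚ ≤ exp i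
    1≤exp {+ k} _ = 1≤^ k (≤-by 0≤θ refl)
    lem : ∀ y z → z ℤ.- y ℤ.+ y ≡ z
    lem = ℤR.solve-∀

  1+x≤exp : ∀ k → 1ℚ + fromℕ k * θ ≤ exp (+ k)
  1+x≤exp k = bernoulli k (ℚ.≤-trans (ℚ.nonPositive⁻¹ (- 1ℚ)) 0≤θ)

  2≤expD : 1ℚ + 1ℚ ≤ exp (+ D)
  2≤expD = ℚ.≤-trans (ℚ.≤-reflexive (cong (λ z → 1ℚ + z) (sym (trans (ℚ.*-comm (fromℕ D) θ) (inv-* D))))) (1+x≤exp D)

  -- Put x = |z|/D. Multiplying by a linear factor removes the power: for z ≥ 0 the factor 1 - x ≤
  -- (1 - 1/D)^z works because (1 - 1/D)(1 + 1/D) ≤ 1, for z < 0 the factor 1 + x ≤ b^|z|. What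
  -- remains is (1 - x)(1 + x + 2x²) ≥ 1, where x ≤ 1/2 enters, and (1 + x)(1 - x + 2x²) ≥ 1.
  exp≤quadratic : ∀ z → 2 ℕ.* ℤ.∣ z ∣ ℕ.≤ D →
    exp z ≤ 1ℚ + fromℤ z * θ + (1ℚ + 1ℚ) * ((fromℤ z * θ) * (fromℤ z * θ))
  exp≤quadratic (+ k) 2k≤D = *-cancelˡ-≤ {1ℚ - x} 0<1-x (begin
    (1ℚ - x) * b ^ k            ≤⟨ *-monoʳ-≤ (0≤exp (+ k)) (bernoulli′ k) ⟩
    (1ℚ - θ) ^ k * b ^ k        ≡⟨ sym (*-^ (1ℚ - θ) b k) ⟩
    ((1ℚ - θ) * b) ^ k          ≤⟨ ^-mono-≤ k (*-nonNeg 0≤1-θ (ℚ.<⇒≤ 0<b)) (≤-by (0≤x² θ) (lem₁ θ)) ⟩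
    1ℚ ^ k                      ≤⟨ 1^k≤1 k ⟩
    1ℚ                          ≤⟨ ≤-by (*-nonNeg (0≤x² x) 0≤1-2x) (lem₂ x) ⟩
    (1ℚ - x) * (1ℚ + x + (1ℚ + 1ℚ) * (x * x)) ∎)
    where
    open ℚ.≤-Reasoning
    x = fromℕ k * θ
    2x≤1 : (1ℚ + 1ℚ) * x ≤ 1ℚ
    2x≤1 = begin
      (1ℚ + 1ℚ) * (fromℕ k * θ)  ≡⟨ sym (ℚ.*-assoc (1ℚ + 1ℚ) (fromℕ k) θ) ⟩
      fromℕ 2 * fromℕ k * θ      ≡⟨ cong (_* θ) (sym (fromℕ-* 2 k)) ⟩
      fromℕ (2 ℕ.* k) * θ        ≤⟨ *-monoʳ-≤ 0≤θ (fromℕ-mono-≤ 2k≤D) ⟩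
      fromℕ D * θ                ≡⟨ trans (ℚ.*-comm (fromℕ D) θ) (inv-* D) ⟩
      1ℚ ∎
    0≤1-2x : 0ℚ ≤ 1ℚ - (1ℚ + 1ℚ) * x
    0≤1-2x = p≤q⇒0≤q-p 2x≤1
    0<1-x : 0ℚ < 1ℚ - x
    0<1-x = ℚ.<-≤-trans (ℚ.positive⁻¹ ½) (≤-by (*-nonNeg (ℚ.nonNegative⁻¹ ½) 0≤1-2x) (lem x))
      where
      lem : ∀ x → 1ℚ - x ≡ ½ + ½ * (1ℚ - (1ℚ + 1ℚ) * x)
      lem = solve-∀ ℚ-ring
    0≤1-θ : 0ℚ ≤ 1ℚ - θ
    0≤1-θ = p≤q⇒0≤q-p (begin
      θ              ≡⟨ sym (ℚ.*-identityʳ θ) ⟩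
      θ * 1ℚ         ≤⟨ *-monoˡ-≤ 0≤θ (fromℕ-mono-≤ (ℕ.>-nonZero⁻¹ D)) ⟩
      θ * fromℕ D    ≡⟨ inv-* D ⟩
      1ℚ ∎)
    bernoulli′ : ∀ k → 1ℚ - fromℕ k * θ ≤ (1ℚ - θ) ^ k
    bernoulli′ k = ℚ.≤-trans (ℚ.≤-reflexive (lem (fromℕ k) θ)) (bernoulli k (≤-by 0≤1-θ (lem′ θ)))
      where
      lem : ∀ k θ → 1ℚ - k * θ ≡ 1ℚ + k * - θ
      lem = solve-∀ ℚ-ring
      lem′ : ∀ θ → - θ ≡ - 1ℚ + (1ℚ - θ)
      lem′ = solve-∀ ℚ-ring
    1^k≤1 : ∀ k → 1ℚ ^ k ≤ 1ℚ
    1^k≤1 k = ^-antimonoʳ-≤ {k = k} (ℚ.nonNegative⁻¹ 1ℚ) ℚ.≤-refl ℕ.z≤n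
    lem₁ : ∀ θ → 1ℚ ≡ (1ℚ - θ) * (1ℚ + θ) + θ * θ
    lem₁ = solve-∀ ℚ-ring
    lem₂ : ∀ x → (1ℚ - x) * (1ℚ + x + (1ℚ + 1ℚ) * (x * x)) ≡ 1ℚ + (x * x) * (1ℚ - (1ℚ + 1ℚ) * x)
    lem₂ = solve-∀ ℚ-ring
  exp≤quadratic -[1+ k ] _ = *-cancelˡ-≤ {1ℚ + x} 0<1+x (begin
    (1ℚ + x) * β ^ suc k                        ≤⟨ *-monoʳ-≤ (0≤exp -[1+ k ]) (1+x≤exp (suc k)) ⟩
    b ^ suc k * β ^ suc k                       ≡⟨ sym (*-^ b β (suc k)) ⟩
    (b * β) ^ suc k                             ≤⟨ ^-antimonoʳ-≤ {b * β} {0} {suc k} (ℚ.<⇒≤ (*-pos 0<b 0<β)) (ℚ.≤-reflexive bβ≡1) ℕ.z≤n ⟩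
    1ℚ                                          ≤⟨ ≤-by (*-nonNeg (0≤x² x) 0≤1+2x) (lem x) ⟩
    (1ℚ + x) * (1ℚ + - x + (1ℚ + 1ℚ) * (- x * - x))
      ≡⟨ cong (λ z → (1ℚ + x) * (1ℚ + z + (1ℚ + 1ℚ) * (z * z))) (trans (ℚ.neg-distribˡ-* (fromℕ (suc k)) θ) (cong (_* θ) (sym (fromℤ-neg (+ suc k))))) ⟩
    (1ℚ + x) * (1ℚ + y + (1ℚ + 1ℚ) * (y * y)) ∎)
    where
    open ℚ.≤-Reasoning
    x = fromℕ (suc k) * θ
    y = fromℤ -[1+ k ] * θ
    0≤x : 0ℚ ≤ x
    0≤x = *-nonNeg (0≤fromℕ (suc k)) 0≤θ
    0<1+x : 0ℚ < 1ℚ + x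
    0<1+x = ℚ.<-≤-trans (ℚ.positive⁻¹ 1ℚ) (≤-by 0≤x refl)
    0≤1+2x : 0ℚ ≤ 1ℚ + (1ℚ + 1ℚ) * x
    0≤1+2x = +-nonNeg (ℚ.nonNegative⁻¹ 1ℚ) (*-nonNeg (ℚ.nonNegative⁻¹ (1ℚ + 1ℚ)) 0≤x)
    lem : ∀ x → (1ℚ + x) * (1ℚ + - x + (1ℚ + 1ℚ) * (- x * - x)) ≡ 1ℚ + (x * x) * (1ℚ + (1ℚ + 1ℚ) * x)
    lem = solve-∀ ℚ-ring

-- Finite sums and averages

sum-mono : ∀ {n} {f g : Fin n → ℚ} → (∀ i → f i ≤ g i) → sum f ≤ sum g
sum-mono {zero}  f≤g = ℚ.≤-refl
sum-mono {suc n} f≤g = ℚ.+-mono-≤ (f≤g Fin.zero) (sum-mono (f≤g ∘ Fin.suc))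

sum-const : ∀ n q → sum {n} (λ _ → q) ≡ fromℕ n * q
sum-const zero    q = sym (ℚ.*-zeroˡ q)
sum-const (suc n) q = begin
  q + sum {n} (λ _ → q)  ≡⟨ cong (λ z → q + z) (sum-const n q) ⟩
  q + fromℕ n * q        ≡⟨ lem q (fromℕ n) ⟩
  (1ℚ + fromℕ n) * q     ≡⟨ cong (_* q) (sym (fromℕ-+ 1 n)) ⟩
  fromℕ (suc n) * q      ∎
  where
  open ≡-Reasoning
  lem : ∀ q k → q + k * q ≡ (1ℚ + k) * q
  lem = solve-∀ ℚ-ring

average-const : ∀ k .{{_ : NonZero k}} q → inv k * sum {k} (λ _ → q) ≡ q
average-const k q = begin
  inv k * sum {k} (λ _ → q)  ≡⟨ cong (inv k *_) (sum-const k q) ⟩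
  inv k * (fromℕ k * q)      ≡⟨ sym (ℚ.*-assoc (inv k) (fromℕ k) q) ⟩
  inv k * fromℕ k * q        ≡⟨ cong (_* q) (inv-* k) ⟩
  1ℚ * q                     ≡⟨ ℚ.*-identityˡ q ⟩
  q                          ∎
  where open ≡-Reasoning

-- Expectation

𝔼 : Rand X → (X → ℚ) → ℚ
𝔼 (pure a)   f = f a
𝔼 (draw k g) f = inv k * sum λ i → 𝔼 (g i) f

𝔼-cong : ∀ (c : Rand X) {f g} → (∀ a → f a ≡ g a) → 𝔼 c f ≡ 𝔼 c g
𝔼-cong (pure a)   f≗g = f≗g a
𝔼-cong (draw k c) f≗g = cong (inv k *_) (sum-cong-≗ λ i → 𝔼-cong (c i) f≗g)

𝔼-mono : ∀ (c : Rand X) {f g} → (∀ a → f a ≤ g a) → 𝔼 c f ≤ 𝔼 c g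
𝔼-mono (pure a)   f≤g = f≤g a
𝔼-mono (draw k c) f≤g = *-monoˡ-≤ (0≤inv k) (sum-mono λ i → 𝔼-mono (c i) f≤g)

𝔼-+ : ∀ (c : Rand X) f g → 𝔼 c (λ a → f a + g a) ≡ 𝔼 c f + 𝔼 c g
𝔼-+ (pure a)   f g = refl
𝔼-+ (draw k c) f g = begin
  inv k * sum (λ i → 𝔼 (c i) (λ a → f a + g a))
    ≡⟨ cong (inv k *_) (trans (sum-cong-≗ λ i → 𝔼-+ (c i) f g) (∑-distrib-+ (λ i → 𝔼 (c i) f) (λ i → 𝔼 (c i) g))) ⟩
  inv k * (sum (λ i → 𝔼 (c i) f) + sum (λ i → 𝔼 (c i) g))
    ≡⟨ ℚ.*-distribˡ-+ (inv k) _ _ ⟩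
  inv k * sum (λ i → 𝔼 (c i) f) + inv k * sum (λ i → 𝔼 (c i) g) ∎
  where open ≡-Reasoning

𝔼-* : ∀ (c : Rand X) r f → 𝔼 c (λ a → r * f a) ≡ r * 𝔼 c f
𝔼-* (pure a)   r f = refl
𝔼-* (draw k c) r f = begin
  inv k * sum (λ i → 𝔼 (c i) (λ a → r * f a))
    ≡⟨ cong (inv k *_) (trans (sum-cong-≗ λ i → 𝔼-* (c i) r f) (sym (*-distribˡ-sum r (λ i → 𝔼 (c i) f)))) ⟩
  inv k * (r * sum (λ i → 𝔼 (c i) f))
    ≡⟨ lem (inv k) r (sum (λ i → 𝔼 (c i) f)) ⟩
  r * (inv k * sum (λ i → 𝔼 (c i) f)) ∎
  where
  open ≡-Reasoning
  lem : ∀ x y z → x * (y * z) ≡ y * (x * z)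
  lem = solve-∀ ℚ-ring

𝔼-const : ∀ (c : Rand X) q → 𝔼 c (λ _ → q) ≡ q
𝔼-const (pure a)   q = refl
𝔼-const (draw k c) q = trans (cong (inv k *_) (sum-cong-≗ λ i → 𝔼-const (c i) q)) (average-const k q)

𝔼->>= : ∀ (c : Rand X) (g : X → Rand Y) f → 𝔼 (c >>= g) f ≡ 𝔼 c (λ a → 𝔼 (g a) f)
𝔼->>= (pure a)   g f = refl
𝔼->>= (draw k c) g f = cong (inv k *_) (sum-cong-≗ λ i → 𝔼->>= (c i) g f)

𝔼-sum : ∀ {n} (c : Rand X) (f : Fin n → X → ℚ) →
  𝔼 c (λ a → sum λ i → f i a) ≡ sum λ i → 𝔼 c (f i)
𝔼-sum {n = zero}  c f = 𝔼-const c 0ℚ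
𝔼-sum {n = suc n} c f =
  trans (𝔼-+ c (f Fin.zero) (λ a → sum λ i → f (Fin.suc i) a)) (cong (λ z → 𝔼 c (f Fin.zero) + z) (𝔼-sum c (f ∘ Fin.suc)))

𝔼-comm : ∀ (c : Rand X) (d : Rand Y) (f : X → Y → ℚ) →
  𝔼 c (λ a → 𝔼 d (f a)) ≡ 𝔼 d (λ b → 𝔼 c (λ a → f a b))
𝔼-comm (pure a)   d f = refl
𝔼-comm (draw k c) d f = begin
  inv k * sum (λ i → 𝔼 (c i) (λ a → 𝔼 d (f a)))
    ≡⟨ cong (inv k *_) (sum-cong-≗ λ i → 𝔼-comm (c i) d f) ⟩
  inv k * sum (λ i → 𝔼 d (λ b → 𝔼 (c i) (λ a → f a b)))
    ≡⟨ cong (inv k *_) (sym (𝔼-sum d (λ i b → 𝔼 (c i) (λ a → f a b)))) ⟩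
  inv k * 𝔼 d (λ b → sum λ i → 𝔼 (c i) (λ a → f a b))
    ≡⟨ sym (𝔼-* d (inv k) (λ b → sum λ i → 𝔼 (c i) (λ a → f a b))) ⟩
  𝔼 d (λ b → inv k * sum λ i → 𝔼 (c i) (λ a → f a b)) ∎
  where open ≡-Reasoning

-- `repeat` draws the head first; exchanging the independent draws by `𝔼-comm` makes the head the
-- last draw, so that a vector reads as a process whose newest step is its head and whose tails are
-- its past.
𝔼-repeat : ∀ k (c : Rand X) (f : Vec X (suc k) → ℚ) →
  𝔼 (repeat (suc k) c) f ≡ 𝔼 (repeat k c) (λ xs → 𝔼 c (λ x → f (x ∷ xs)))
𝔼-repeat k c f = begin
  𝔼 (repeat (suc k) c) f
    ≡⟨ 𝔼->>= c (λ x → repeat k c >>= λ xs → pure (x ∷ xs)) f ⟩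
  𝔼 c (λ x → 𝔼 (repeat k c >>= λ xs → pure (x ∷ xs)) f)
    ≡⟨ 𝔼-cong c (λ x → 𝔼->>= (repeat k c) (λ xs → pure (x ∷ xs)) f) ⟩
  𝔼 c (λ x → 𝔼 (repeat k c) (λ xs → f (x ∷ xs)))
    ≡⟨ 𝔼-comm c (repeat k c) (λ x xs → f (x ∷ xs)) ⟩
  𝔼 (repeat k c) (λ xs → 𝔼 c (λ x → f (x ∷ xs))) ∎
  where open ≡-Reasoning

-- The growth rate ρ is arbitrary because the lemma serves both the surrogate exponentials and the
-- powers of 4 in `majority`.
supermartingale : ∀ (c : Rand X) (Φ : ∀ {k} → Vec X k → ℚ) {ρ} → 0ℚ ≤ ρ →
  (∀ {k} (xs : Vec X k) → 𝔼 c (λ x → Φ (x ∷ xs)) ≤ ρ * Φ xs) →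
  ∀ k → 𝔼 (repeat k c) Φ ≤ ρ ^ k * Φ []
supermartingale c Φ {ρ} 0≤ρ step zero    = ℚ.≤-reflexive (sym (ℚ.*-identityˡ (Φ [])))
supermartingale c Φ {ρ} 0≤ρ step (suc k) = begin
  𝔼 (repeat (suc k) c) Φ                         ≡⟨ 𝔼-repeat k c Φ ⟩
  𝔼 (repeat k c) (λ xs → 𝔼 c (λ x → Φ (x ∷ xs))) ≤⟨ 𝔼-mono (repeat k c) step ⟩
  𝔼 (repeat k c) (λ xs → ρ * Φ xs)               ≡⟨ 𝔼-* (repeat k c) ρ Φ ⟩
  ρ * 𝔼 (repeat k c) Φ                           ≤⟨ *-monoˡ-≤ 0≤ρ (supermartingale c Φ 0≤ρ step k) ⟩
  ρ * (ρ ^ k * Φ [])                             ≡⟨ sym (ℚ.*-assoc ρ (ρ ^ k) (Φ [])) ⟩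
  ρ * ρ ^ k * Φ []                               ∎
  where open ℚ.≤-Reasoning

-- B has probability at most q; unlike Pr[_∈_] this does not ask B to be decidable.
Unlikely : Rand X → Pred X 0ℓ → ℚ → Set
Unlikely (pure a)   B q = 0ℚ ≤ q × (B a → 1ℚ ≤ q)
Unlikely (draw k f) B q = Σ[ r ∈ (Fin k → ℚ) ] (∀ i → Unlikely (f i) B (r i)) × inv k * sum r ≤ q

unlikely-mono : ∀ (c : Rand X) {B B′ q q′} → (∀ a → B′ a → B a) → q ≤ q′ → Unlikely c B q → Unlikely c B′ q′
unlikely-mono (pure a)   B′⊆B q≤q′ (0≤q , B⇒) = ℚ.≤-trans 0≤q q≤q′ , λ b → ℚ.≤-trans (B⇒ (B′⊆B a b)) q≤q′
unlikely-mono (draw k f) B′⊆B q≤q′ (r , u , r≤q) =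
  r , (λ i → unlikely-mono (f i) B′⊆B ℚ.≤-refl (u i)) , ℚ.≤-trans r≤q q≤q′

-- The witnesses demanded by `Unlikely` are the conditional expectations of f given the draws made
-- so far.
markov : ∀ (c : Rand X) {B : Pred X 0ℓ} (f : X → ℚ) → (∀ a → 0ℚ ≤ f a) → (∀ a → B a → 1ℚ ≤ f a) →
  Unlikely c B (𝔼 c f)
markov (pure a)   f 0≤f B⇒ = 0≤f a , B⇒ a
markov (draw k c) f 0≤f B⇒ = (λ i → 𝔼 (c i) f) , (λ i → markov (c i) f 0≤f B⇒) , ℚ.≤-refl

certain : ∀ (c : Rand X) {B q} → 1ℚ ≤ q → Unlikely c B q
certain c {B} 1≤q = unlikely-mono c (λ _ b → b) (ℚ.≤-trans (ℚ.≤-reflexive (𝔼-const c 1ℚ)) 1≤q)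
  (markov c (λ _ → 1ℚ) (λ _ → ℚ.nonNegative⁻¹ 1ℚ) (λ _ _ → ℚ.≤-refl))

never : ∀ (c : Rand X) {B q} → 0ℚ ≤ q → (∀ a → ¬ B a) → Unlikely c B q
never c {B} 0≤q ¬B = unlikely-mono c (λ _ b → b) (ℚ.≤-trans (ℚ.≤-reflexive (𝔼-const c 0ℚ)) 0≤q)
  (markov c (λ _ → 0ℚ) (λ _ → ℚ.≤-refl) (λ a b → contradiction b (¬B a)))

average-+ : ∀ k .{{_ : NonZero k}} (f g : Fin k → ℚ) →
  inv k * sum (λ i → f i + g i) ≡ inv k * sum f + inv k * sum g
average-+ k f g = trans (cong (inv k *_) (∑-distrib-+ f g)) (ℚ.*-distribˡ-+ (inv k) (sum f) (sum g))

unlikely-∪ : ∀ (c : Rand X) {B B′ q q′} → Unlikely c B q → Unlikely c B′ q′ →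
  Unlikely c (λ a → B a ⊎ B′ a) (q + q′)
unlikely-∪ (pure a) {q = q} {q′} (0≤q , B⇒) (0≤q′ , B′⇒) = +-nonNeg 0≤q 0≤q′ , λ where
  (inj₁ b) → ℚ.≤-trans (B⇒ b) (≤-by 0≤q′ refl)
  (inj₂ b) → ℚ.≤-trans (B′⇒ b) (≤-by 0≤q (ℚ.+-comm q q′))
unlikely-∪ (draw k f) (r , u , r≤q) (r′ , u′ , r′≤q′) =
  (λ i → r i + r′ i) , (λ i → unlikely-∪ (f i) (u i) (u′ i)) ,
  ℚ.≤-trans (ℚ.≤-reflexive (average-+ k r r′)) (ℚ.+-mono-≤ r≤q r′≤q′)

unlikely-⋃ : ∀ {n} (c : Rand X) {B : Fin n → Pred X 0ℓ} {q} → (∀ i → Unlikely c (B i) q) →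
  Unlikely c (λ a → ∃[ i ] B i a) (fromℕ n * q)
unlikely-⋃ {n = zero}  c {q = q} u = never c (ℚ.≤-reflexive (sym (ℚ.*-zeroˡ q))) λ { _ (() , _) }
unlikely-⋃ {n = suc n} c {B} {q} u = unlikely-mono c split (ℚ.≤-reflexive eq)
  (unlikely-∪ c (u Fin.zero) (unlikely-⋃ c (u ∘ Fin.suc)))
  where
  split : ∀ a → (∃[ i ] B i a) → B Fin.zero a ⊎ (∃[ i ] B (Fin.suc i) a)
  split a (Fin.zero  , b) = inj₁ b
  split a (Fin.suc i , b) = inj₂ (i , b)
  lem : ∀ q k → q + k * q ≡ (1ℚ + k) * q
  lem = solve-∀ ℚ-ring
  eq : q + fromℕ n * q ≡ fromℕ (suc n) * q
  eq = trans (lem q (fromℕ n)) (cong (_* q) (sym (fromℕ-+ 1 n)))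

-- A union bound conditioned on the first stage: a bad first outcome is charged to q, and after any
-- other the second stage fails with probability at most r.
unlikely->>= : ∀ (c : Rand X) (g : X → Rand Y) {B D q r} → 0ℚ ≤ r → Unlikely c B q →
  (∀ a → B a ⊎ Unlikely (g a) D r) → Unlikely (c >>= g) D (q + r)
unlikely->>= (pure a) g {q = q} {r} 0≤r (0≤q , B⇒) h with h a
... | inj₁ b = certain (g a) (ℚ.≤-trans (B⇒ b) (≤-by 0≤r refl))
... | inj₂ u = unlikely-mono (g a) (λ _ b → b) (≤-by 0≤q (ℚ.+-comm q r)) u
unlikely->>= (draw k f) g {q = q} {r} 0≤r (s , u , s≤q) h =
  (λ i → s i + r) , (λ i → unlikely->>= (f i) g 0≤r (u i) h) , (begin
    inv k * sum (λ i → s i + r)                  ≡⟨ average-+ k s (λ _ → r) ⟩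
    inv k * sum s + inv k * sum {k} (λ _ → r)    ≡⟨ cong (λ z → inv k * sum s + z) (average-const k r) ⟩
    inv k * sum s + r                            ≤⟨ ℚ.+-monoˡ-≤ r s≤q ⟩
    q + r ∎)
  where open ℚ.≤-Reasoning

unlikely-map : ∀ (c : Rand X) (g : X → Y) {B D q} → Unlikely c B q →
  (∀ a → D (g a) → B a) → Unlikely (c >>= λ a → pure (g a)) D q
unlikely-map (pure a)   g (0≤q , B⇒) D⇒B    = 0≤q , B⇒ ∘ D⇒B a
unlikely-map (draw k f) g (r , u , r≤q) D⇒B = r , (λ i → unlikely-map (f i) g (u i) D⇒B) , r≤q

unlikely⇒Pr : ∀ (c : Rand X) {P : Pred X 0ℓ} (P? : Decidable P) {q} → Unlikely c (λ a → ¬ P a) q →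
  1ℚ - q ≤ Pr[ c ∈ P? ]
unlikely⇒Pr (pure a) P? {q} (0≤q , ¬P⇒) with P? a
... | yes _ = ≤-by 0≤q (lem q)
  where
  lem : ∀ q → 1ℚ ≡ 1ℚ - q + q
  lem = solve-∀ ℚ-ring
... | no ¬p = ≤-by (p≤q⇒0≤q-p (¬P⇒ ¬p)) (lem q)
  where
  lem : ∀ q → 0ℚ ≡ 1ℚ - q + (q - 1ℚ)
  lem = solve-∀ ℚ-ring
unlikely⇒Pr (draw k f) P? {q} (r , u , r≤q) = begin
  1ℚ - q                                                       ≤⟨ ℚ.+-monoʳ-≤ 1ℚ (ℚ.neg-antimono-≤ r≤q) ⟩
  1ℚ - inv k * sum r                                           ≡⟨ cong (_- inv k * sum r) eq ⟩
  inv k * sum (λ i → 1ℚ - r i) + inv k * sum r - inv k * sum r ≡⟨ lem (inv k * sum (λ i → 1ℚ - r i)) (inv k * sum r) ⟩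
  inv k * sum (λ i → 1ℚ - r i)                                 ≤⟨ *-monoˡ-≤ (0≤inv k) (sum-mono λ i → unlikely⇒Pr (f i) P? (u i)) ⟩
  inv k * sum (λ i → Pr[ f i ∈ P? ])                           ∎
  where
  open ℚ.≤-Reasoning
  lem : ∀ x y → x + y - y ≡ x
  lem = solve-∀ ℚ-ring
  lem′ : ∀ x → 1ℚ ≡ 1ℚ - x + x
  lem′ = solve-∀ ℚ-ring
  eq : 1ℚ ≡ inv k * sum (λ i → 1ℚ - r i) + inv k * sum r
  eq = trans (sym (average-const k 1ℚ)) (trans (cong (inv k *_) (sum-cong-≗ (λ i → lem′ (r i)))) (average-+ k (λ i → 1ℚ - r i) r))

fromℤ-- : ∀ i j → fromℤ (i ℤ.- j) ≡ fromℤ i - fromℤ j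
fromℤ-- i j = trans (fromℤ-+ i (ℤ.- j)) (cong (λ z → fromℤ i + z) (fromℤ-neg j))

-- Exponential supermartingales

Always : (∀ {k} → Pred (Vec X k) 0ℓ) → ∀ {k} → Vec X k → Set
Always Good []       = Good []
Always Good (x ∷ xs) = Always Good xs × Good (x ∷ xs)

always? : ∀ {Good : ∀ {k} → Pred (Vec X k) 0ℓ} → (∀ {k} → Decidable (Good {k})) →
  ∀ {k} → Decidable (Always Good {k})
always? good? []       = good? []
always? good? (x ∷ xs) = always? good? xs ×-dec good? (x ∷ xs)

always-head : ∀ {Good : ∀ {k} → Pred (Vec X k) 0ℓ} {k} (xs : Vec X k) → Always Good xs → Good xs
always-head []       g       = g
always-head (x ∷ xs) (_ , g) = g

-- Q is the denominator that makes increments integral, and 1/(QΛ) is the rate of the exponential: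
-- Λz steps of the grid 1/(QΛ²) amount to z/(QΛ).
module Deviation (Q Λ : ℕ) .{{_ : NonZero Q}} .{{_ : NonZero Λ}} where

  D : ℕ
  D = Q ℕ.* (Λ ℕ.* Λ)

  private instance
    Λ²≢0 : NonZero (Λ ℕ.* Λ)
    Λ²≢0 = ℕ.m*n≢0 Λ Λ
    D≢0 : NonZero D
    D≢0 = ℕ.m*n≢0 Q (Λ ℕ.* Λ)

  open Exp D {{D≢0}} public

  -- The bound on z keeps the exponent z/(QΛ) within 1/2, so `exp≤quadratic` applies pointwise. Its
  -- linear term averages to 0, and the variance QW turns the quadratic term into 2W/D; finally 1 +
  -- 2W/D ≤ exp (2W).
  𝔼exp≤exp : ∀ (c : Rand X) (z : X → ℤ) W →
    𝔼 c (fromℤ ∘ z) ≡ 0ℚ → (∀ a → 2 ℕ.* ℤ.∣ z a ∣ ℕ.≤ Q ℕ.* Λ) →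
    𝔼 c (λ a → fromℤ (z a) * fromℤ (z a)) ≤ fromℕ (Q ℕ.* W) →
    𝔼 c (λ a → exp (+ Λ ℤ.* z a)) ≤ exp (+ (2 ℕ.* W))
  𝔼exp≤exp c z W centred bounded variance = begin
    𝔼 c (λ a → exp (+ Λ ℤ.* z a))
      ≤⟨ 𝔼-mono c pointwise ⟩
    𝔼 c (λ a → 1ℚ + (Λθ * fromℤ (z a) + 2Λ²θ² * (fromℤ (z a) * fromℤ (z a))))
      ≡⟨ 𝔼-+ c _ _ ⟩
    𝔼 c (λ _ → 1ℚ) + 𝔼 c (λ a → Λθ * fromℤ (z a) + 2Λ²θ² * (fromℤ (z a) * fromℤ (z a)))
      ≡⟨ cong₂ _+_ (𝔼-const c 1ℚ) (trans (𝔼-+ c _ _) (cong₂ _+_ (𝔼-* c Λθ (fromℤ ∘ z)) (𝔼-* c 2Λ²θ² _))) ⟩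
    1ℚ + (Λθ * 𝔼 c (fromℤ ∘ z) + 2Λ²θ² * V)
      ≡⟨ cong (λ y → 1ℚ + (Λθ * y + 2Λ²θ² * V)) centred ⟩
    1ℚ + (Λθ * 0ℚ + 2Λ²θ² * V)
      ≤⟨ ℚ.+-monoʳ-≤ 1ℚ (ℚ.+-monoʳ-≤ (Λθ * 0ℚ) (*-monoˡ-≤ 0≤2Λ²θ² variance)) ⟩
    1ℚ + (Λθ * 0ℚ + 2Λ²θ² * fromℕ (Q ℕ.* W))
      ≡⟨ cong (λ y → 1ℚ + (Λθ * 0ℚ + 2Λ²θ² * y)) (fromℕ-* Q W) ⟩
    1ℚ + (Λθ * 0ℚ + 2Λ²θ² * (fromℕ Q * fromℕ W))
      ≡⟨ collect (fromℕ Λ) θ (fromℕ Q) (fromℕ W) ⟩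
    1ℚ + (1ℚ + 1ℚ) * fromℕ W * ((fromℕ Q * (fromℕ Λ * fromℕ Λ)) * θ) * θ
      ≡⟨ cong₂ (λ x y → 1ℚ + x * y * θ) (sym (fromℕ-* 2 W)) Dθ≡1 ⟩
    1ℚ + fromℕ (2 ℕ.* W) * 1ℚ * θ
      ≡⟨ cong (λ x → 1ℚ + x * θ) (ℚ.*-identityʳ (fromℕ (2 ℕ.* W))) ⟩
    1ℚ + fromℕ (2 ℕ.* W) * θ
      ≤⟨ 1+x≤exp (2 ℕ.* W) ⟩
    exp (+ (2 ℕ.* W)) ∎
    where
    open ℚ.≤-Reasoning
    V = 𝔼 c (λ a → fromℤ (z a) * fromℤ (z a))
    Λθ = fromℕ Λ * θ
    2Λ²θ² = (1ℚ + 1ℚ) * (Λθ * Λθ)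
    0≤2Λ²θ² : 0ℚ ≤ 2Λ²θ²
    0≤2Λ²θ² = *-nonNeg (ℚ.nonNegative⁻¹ (1ℚ + 1ℚ)) (0≤x² Λθ)
    Dθ≡1 : fromℕ Q * (fromℕ Λ * fromℕ Λ) * θ ≡ 1ℚ
    Dθ≡1 = trans (cong (_* θ) (sym (trans (fromℕ-* Q (Λ ℕ.* Λ)) (cong (fromℕ Q *_) (fromℕ-* Λ Λ)))))
      (trans (ℚ.*-comm (fromℕ D) θ) (inv-* D))
    collect : ∀ l t q w → 1ℚ + (l * t * 0ℚ + (1ℚ + 1ℚ) * (l * t * (l * t)) * (q * w)) ≡
                          1ℚ + (1ℚ + 1ℚ) * w * ((q * (l * l)) * t) * t
    collect = solve-∀ ℚ-ring
    rearrange : ∀ l t y → 1ℚ + l * y * t + (1ℚ + 1ℚ) * (l * y * t * (l * y * t)) ≡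
                          1ℚ + (l * t * y + (1ℚ + 1ℚ) * (l * t * (l * t)) * (y * y))
    rearrange = solve-∀ ℚ-ring
    2∣Λz∣≤D : ∀ a → 2 ℕ.* ℤ.∣ + Λ ℤ.* z a ∣ ℕ.≤ D
    2∣Λz∣≤D a = subst₂ ℕ._≤_
      (trans (lem₁ Λ ℤ.∣ z a ∣) (cong (2 ℕ.*_) (sym (ℤ.abs-* (+ Λ) (z a))))) (lem₂ Q Λ)
      (ℕ.*-monoʳ-≤ Λ (bounded a))
      where
      lem₁ : ∀ l y → l ℕ.* (2 ℕ.* y) ≡ 2 ℕ.* (l ℕ.* y)
      lem₁ = ℕR.solve-∀
      lem₂ : ∀ q l → l ℕ.* (q ℕ.* l) ≡ q ℕ.* (l ℕ.* l)
      lem₂ = ℕR.solve-∀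
    pointwise : ∀ a → exp (+ Λ ℤ.* z a) ≤ 1ℚ + (Λθ * fromℤ (z a) + 2Λ²θ² * (fromℤ (z a) * fromℤ (z a)))
    pointwise a = begin
      exp (+ Λ ℤ.* z a) ≤⟨ exp≤quadratic (+ Λ ℤ.* z a) (2∣Λz∣≤D a) ⟩
      1ℚ + fromℤ (+ Λ ℤ.* z a) * θ + (1ℚ + 1ℚ) * ((fromℤ (+ Λ ℤ.* z a) * θ) * (fromℤ (+ Λ ℤ.* z a) * θ))
        ≡⟨ cong (λ y → 1ℚ + y * θ + (1ℚ + 1ℚ) * ((y * θ) * (y * θ))) (fromℤ-* (+ Λ) (z a)) ⟩
      1ℚ + fromℕ Λ * fromℤ (z a) * θ + (1ℚ + 1ℚ) * ((fromℕ Λ * fromℤ (z a) * θ) * (fromℕ Λ * fromℤ (z a) * θ))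
        ≡⟨ rearrange (fromℕ Λ) θ (fromℤ (z a)) ⟩
      1ℚ + (Λθ * fromℤ (z a) + 2Λ²θ² * (fromℤ (z a) * fromℤ (z a))) ∎

  exp-D≤½ : exp (ℤ.- + D) ≤ ½
  exp-D≤½ = *-cancelˡ-≤ {1ℚ + 1ℚ} (ℚ.positive⁻¹ (1ℚ + 1ℚ)) (begin
    (1ℚ + 1ℚ) * exp (ℤ.- + D)       ≤⟨ *-monoʳ-≤ (0≤exp (ℤ.- + D)) 2≤expD ⟩
    exp (+ D) * exp (ℤ.- + D)       ≡⟨ sym (exp-+ (+ D) (ℤ.- + D)) ⟩
    exp (+ D ℤ.- + D)               ≡⟨ cong exp (ℤ.+-inverseʳ (+ D)) ⟩
    1ℚ                              ∎)
    where open ℚ.≤-Reasoning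

  -- The process Z started at Z [] = 0 (a new draw is consed to the front) is
  -- stopped as soon as it leaves Good.
  module Stopped (c : Rand X) (W : ℕ) (Z : ∀ {k} → Vec X k → ℤ) (Z[]≡0 : Z [] ≡ + 0)
    {Good : ∀ {k} → Pred (Vec X k) 0ℓ} (good? : ∀ {k} → Decidable (Good {k}))
    (step : ∀ {k} (xs : Vec X k) → Good xs →
            𝔼 c (λ x → exp (+ Λ ℤ.* (Z (x ∷ xs) ℤ.- Z xs))) ≤ exp (+ (2 ℕ.* W)))
    where

    Alive : ∀ {k} → Vec X k → Set
    Alive = Always Good

    alive? : ∀ {k} → Decidable (Alive {k})
    alive? = always? good?

    -- Liveness is tested on the tail: the step that leaves `Good` is still taken and its value is
    -- then frozen. `dead⇒u≤` depends on seeing this value.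
    stopped : ∀ {k} → Vec X k → ℤ
    stopped []       = Z []
    stopped (x ∷ xs) = if does (alive? xs) then Z (x ∷ xs) else stopped xs

    stopped-alive : ∀ {k} x (xs : Vec X k) → Alive xs → stopped (x ∷ xs) ≡ Z (x ∷ xs)
    stopped-alive x xs al rewrite dec-true (alive? xs) al = refl

    stopped-dead : ∀ {k} x (xs : Vec X k) → ¬ Alive xs → stopped (x ∷ xs) ≡ stopped xs
    stopped-dead x xs ¬al rewrite dec-false (alive? xs) ¬al = refl

    alive⇒stopped≡Z : ∀ {k} (xs : Vec X k) → Alive xs → stopped xs ≡ Z xs
    alive⇒stopped≡Z []       _        = refl
    alive⇒stopped≡Z (x ∷ xs) (al , _) = stopped-alive x xs al

    Φ : ∀ {k} → Vec X k → ℚ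
    Φ xs = exp (+ Λ ℤ.* stopped xs)

    Φ-step : ∀ {k} (xs : Vec X k) → 𝔼 c (λ x → Φ (x ∷ xs)) ≤ exp (+ (2 ℕ.* W)) * Φ xs
    Φ-step xs with alive? xs
    ... | yes al = begin
      𝔼 c (λ x → exp (+ Λ ℤ.* Z (x ∷ xs)))
        ≡⟨ 𝔼-cong c (λ x → trans (cong exp (split (Z (x ∷ xs)) (Z xs) (+ Λ))) (exp-+ (+ Λ ℤ.* Z xs) _)) ⟩
      𝔼 c (λ x → exp (+ Λ ℤ.* Z xs) * exp (+ Λ ℤ.* (Z (x ∷ xs) ℤ.- Z xs)))
        ≡⟨ 𝔼-* c (exp (+ Λ ℤ.* Z xs)) _ ⟩
      exp (+ Λ ℤ.* Z xs) * 𝔼 c (λ x → exp (+ Λ ℤ.* (Z (x ∷ xs) ℤ.- Z xs)))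
        ≤⟨ *-monoˡ-≤ (0≤exp (+ Λ ℤ.* Z xs)) (step xs (always-head xs al)) ⟩
      exp (+ Λ ℤ.* Z xs) * exp (+ (2 ℕ.* W))
        ≡⟨ ℚ.*-comm (exp (+ Λ ℤ.* Z xs)) (exp (+ (2 ℕ.* W))) ⟩
      exp (+ (2 ℕ.* W)) * exp (+ Λ ℤ.* Z xs)
        ≡⟨ cong (λ z → exp (+ (2 ℕ.* W)) * exp (+ Λ ℤ.* z)) (sym (alive⇒stopped≡Z xs al)) ⟩
      exp (+ (2 ℕ.* W)) * Φ xs ∎
      where
      open ℚ.≤-Reasoning
      split : ∀ y z l → l ℤ.* y ≡ l ℤ.* z ℤ.+ l ℤ.* (y ℤ.- z)
      split = ℤR.solve-∀
    ... | no _ = begin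
      𝔼 c (λ x → Φ xs)             ≡⟨ 𝔼-const c (Φ xs) ⟩
      Φ xs                         ≡⟨ sym (ℚ.*-identityˡ (Φ xs)) ⟩
      1ℚ * Φ xs                    ≤⟨ *-monoʳ-≤ (0≤exp (+ Λ ℤ.* stopped xs)) (exp-mono-≤ {+ 0} {+ (2 ℕ.* W)} (ℤ.+≤+ ℕ.z≤n)) ⟩
      exp (+ (2 ℕ.* W)) * Φ xs     ∎
      where open ℚ.≤-Reasoning

    -- Markov's inequality for exp (Λ · stopped): s steps raise its mean to at most exp (2Ws), so a
    -- threshold u exceeding 2Ws by jD leaves exp (-jD) ≤ ½^j.
    stopped-tail : ∀ {s j u} {B : Pred (Vec X s) 0ℓ} →
      2 ℕ.* W ℕ.* s ℕ.+ j ℕ.* D ℕ.≤ u → (∀ xs → B xs → + u ℤ.≤ + Λ ℤ.* stopped xs) →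
      Unlikely (repeat s c) B (½ ^ j)
    stopped-tail {s} {j} {u} {B} u-large B⇒ = unlikely-mono (repeat s c) (λ _ b → b) (begin
      𝔼 (repeat s c) (λ xs → exp (ℤ.- + u) * Φ xs)
        ≡⟨ 𝔼-* (repeat s c) (exp (ℤ.- + u)) Φ ⟩
      exp (ℤ.- + u) * 𝔼 (repeat s c) Φ
        ≤⟨ *-monoˡ-≤ (0≤exp (ℤ.- + u)) (supermartingale c Φ (0≤exp (+ (2 ℕ.* W))) Φ-step s) ⟩
      exp (ℤ.- + u) * (exp (+ (2 ℕ.* W)) ^ s * Φ [])
        ≡⟨ cong₂ (λ x y → exp (ℤ.- + u) * (x * y)) (sym (exp-*ℕ (+ (2 ℕ.* W)) s)) Φ[]≡1 ⟩
      exp (ℤ.- + u) * (exp (+ s ℤ.* + (2 ℕ.* W)) * 1ℚ)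
        ≡⟨ cong (exp (ℤ.- + u) *_) (ℚ.*-identityʳ _) ⟩
      exp (ℤ.- + u) * exp (+ s ℤ.* + (2 ℕ.* W))
        ≡⟨ sym (exp-+ (ℤ.- + u) (+ s ℤ.* + (2 ℕ.* W))) ⟩
      exp (ℤ.- + u ℤ.+ + s ℤ.* + (2 ℕ.* W))
        ≤⟨ exp-mono-≤ exponent ⟩
      exp (+ j ℤ.* (ℤ.- + D))
        ≡⟨ exp-*ℕ (ℤ.- + D) j ⟩
      exp (ℤ.- + D) ^ j
        ≤⟨ ^-mono-≤ j (0≤exp (ℤ.- + D)) exp-D≤½ ⟩
      ½ ^ j ∎)
      (markov (repeat s c) (λ xs → exp (ℤ.- + u) * Φ xs)
        (λ xs → *-nonNeg (0≤exp (ℤ.- + u)) (0≤exp (+ Λ ℤ.* stopped xs))) (λ xs b → begin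
          1ℚ                            ≡⟨ cong exp (sym (ℤ.+-inverseˡ (+ u))) ⟩
          exp (ℤ.- + u ℤ.+ + u)         ≤⟨ exp-mono-≤ (ℤ.+-monoʳ-≤ (ℤ.- + u) (B⇒ xs b)) ⟩
          exp (ℤ.- + u ℤ.+ + Λ ℤ.* stopped xs) ≡⟨ exp-+ (ℤ.- + u) (+ Λ ℤ.* stopped xs) ⟩
          exp (ℤ.- + u) * Φ xs ∎))
      where
      open ℚ.≤-Reasoning
      Φ[]≡1 : Φ [] ≡ 1ℚ
      Φ[]≡1 = trans (cong (λ z → exp (+ Λ ℤ.* z)) Z[]≡0) (cong exp (ℤ.*-zeroʳ (+ Λ)))
      exponent : ℤ.- + u ℤ.+ + s ℤ.* + (2 ℕ.* W) ℤ.≤ + j ℤ.* (ℤ.- + D)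
      exponent = subst₂ ℤ._≤_ eq₁ eq₂ (ℤ.+-monoˡ-≤ (ℤ.- + (j ℕ.* D) ℤ.- + u) (ℤ.+≤+ u-large))
        where
        lem : ∀ a b u → a ℤ.+ b ℤ.+ (ℤ.- b ℤ.- u) ≡ ℤ.- u ℤ.+ a
        lem = ℤR.solve-∀
        lem′ : ∀ b u → u ℤ.+ (ℤ.- b ℤ.- u) ≡ ℤ.- b
        lem′ = ℤR.solve-∀
        lem″ : ∀ j d → ℤ.- (j ℤ.* d) ≡ j ℤ.* (ℤ.- d)
        lem″ = ℤR.solve-∀
        eq₁ : + (2 ℕ.* W ℕ.* s ℕ.+ j ℕ.* D) ℤ.+ (ℤ.- + (j ℕ.* D) ℤ.- + u) ≡ ℤ.- + u ℤ.+ + s ℤ.* + (2 ℕ.* W)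
        eq₁ = trans (cong (ℤ._+ (ℤ.- + (j ℕ.* D) ℤ.- + u)) (ℤ.pos-+ (2 ℕ.* W ℕ.* s) (j ℕ.* D)))
          (trans (lem (+ (2 ℕ.* W ℕ.* s)) (+ (j ℕ.* D)) (+ u))
            (cong (λ z → ℤ.- + u ℤ.+ z) (trans (cong +_ (ℕ.*-comm (2 ℕ.* W) s)) (ℤ.pos-* s (2 ℕ.* W)))))
        eq₂ : + u ℤ.+ (ℤ.- + (j ℕ.* D) ℤ.- + u) ≡ + j ℤ.* (ℤ.- + D)
        eq₂ = trans (lem′ (+ (j ℕ.* D)) (+ u)) (trans (cong ℤ.-_ (ℤ.pos-* j D)) (lem″ (+ j) (+ D)))

-- Chernoff bounds for sums of bounded weights

total : (X → ℕ) → ∀ {k} → Vec X k → ℕ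
total w []       = 0
total w (x ∷ xs) = w x ℕ.+ total w xs

∣m-n∣≤ : ∀ {m n k} → m ℕ.≤ k → n ℕ.≤ k → ℤ.∣ + m ℤ.- + n ∣ ℕ.≤ k
∣m-n∣≤ {m} {n} {k} m≤k n≤k = subst (λ z → ℤ.∣ z ∣ ℕ.≤ k) (sym (ℤ.m-n≡m⊖n m n))
  (ℕ.≤-trans (ℤ.∣m⊝n∣≤m⊔n m n) (ℕ.⊔-lub m≤k n≤k))

fromℤ-m-n : ∀ m n → fromℤ (+ m ℤ.- + n) ≡ fromℕ m - fromℕ n
fromℤ-m-n m n = fromℤ-- (+ m) (+ n)

increment : ∀ q a t μ k →
  + (q ℕ.* (a ℕ.+ t)) ℤ.- + (suc k ℕ.* μ) ℤ.- (+ (q ℕ.* t) ℤ.- + (k ℕ.* μ)) ≡ + (q ℕ.* a) ℤ.- + μ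
increment q a t μ k = trans
  (cong₂ (λ x y → x ℤ.- y ℤ.- (+ (q ℕ.* t) ℤ.- + (k ℕ.* μ)))
    (trans (cong +_ (ℕ.*-distribˡ-+ q a t)) (ℤ.pos-+ (q ℕ.* a) (q ℕ.* t))) (ℤ.pos-+ μ (k ℕ.* μ)))
  (lem (+ (q ℕ.* a)) (+ (q ℕ.* t)) (+ μ) (+ (k ℕ.* μ)))
  where
  lem : ∀ a t u k → a ℤ.+ t ℤ.- (u ℤ.+ k) ℤ.- (t ℤ.- k) ≡ a ℤ.- u
  lem = ℤR.solve-∀

increment′ : ∀ q a t μ k →
  + (suc k ℕ.* μ) ℤ.- + (q ℕ.* (a ℕ.+ t)) ℤ.- (+ (k ℕ.* μ) ℤ.- + (q ℕ.* t)) ≡ + μ ℤ.- + (q ℕ.* a)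
increment′ q a t μ k = trans
  (cong₂ (λ x y → y ℤ.- x ℤ.- (+ (k ℕ.* μ) ℤ.- + (q ℕ.* t)))
    (trans (cong +_ (ℕ.*-distribˡ-+ q a t)) (ℤ.pos-+ (q ℕ.* a) (q ℕ.* t))) (ℤ.pos-+ μ (k ℕ.* μ)))
  (lem (+ (q ℕ.* a)) (+ (q ℕ.* t)) (+ μ) (+ (k ℕ.* μ)))
  where
  lem : ∀ a t u k → u ℤ.+ k ℤ.- (a ℤ.+ t) ℤ.- (k ℤ.- t) ≡ u ℤ.- a
  lem = ℤR.solve-∀

≤-gap : ∀ u l a b → u ℕ.+ l ℕ.* b ℕ.≤ l ℕ.* a → + u ℤ.≤ + l ℤ.* (+ a ℤ.- + b)
≤-gap u l a b le = subst₂ ℤ._≤_ eq₁ eq₂ (ℤ.+-monoˡ-≤ (ℤ.- + (l ℕ.* b)) (ℤ.+≤+ le))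
  where
  lem : ∀ u b → u ℤ.+ b ℤ.- b ≡ u
  lem = ℤR.solve-∀
  lem′ : ∀ l a b → l ℤ.* a ℤ.- l ℤ.* b ≡ l ℤ.* (a ℤ.- b)
  lem′ = ℤR.solve-∀
  eq₁ = trans (cong (ℤ._- + (l ℕ.* b)) (ℤ.pos-+ u (l ℕ.* b))) (lem (+ u) (+ (l ℕ.* b)))
  eq₂ = trans (cong₂ ℤ._-_ (ℤ.pos-* l a) (ℤ.pos-* l b)) (lem′ (+ l) (+ a) (+ b))

-- Q clears the denominator of the mean, so the centred walk Q · total - kμ has integer values.
module Chernoff (c : Rand X) (w : X → ℕ) (Q μ M : ℕ) .{{_ : NonZero Q}}
  (mean : fromℕ Q * 𝔼 c (fromℕ ∘ w) ≡ fromℕ μ) (w≤M : ∀ a → w a ℕ.≤ M) where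

  private
    m = 𝔼 c (fromℕ ∘ w)

  μ≤QM : μ ℕ.≤ Q ℕ.* M
  μ≤QM = fromℕ-cancel-≤ (begin
    fromℕ μ                         ≡⟨ sym mean ⟩
    fromℕ Q * m                     ≤⟨ *-monoˡ-≤ (0≤fromℕ Q) (𝔼-mono c (fromℕ-mono-≤ ∘ w≤M)) ⟩
    fromℕ Q * 𝔼 c (λ _ → fromℕ M)   ≡⟨ cong (fromℕ Q *_) (𝔼-const c (fromℕ M)) ⟩
    fromℕ Q * fromℕ M               ≡⟨ sym (fromℕ-* Q M) ⟩
    fromℕ (Q ℕ.* M)                 ∎)
    where open ℚ.≤-Reasoning

  𝔼[Qw-μ]≡0 : 𝔼 c (λ a → fromℕ (Q ℕ.* w a) - fromℕ μ) ≡ 0ℚ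
  𝔼[Qw-μ]≡0 = begin
    𝔼 c (λ a → fromℕ (Q ℕ.* w a) - fromℕ μ)
      ≡⟨ 𝔼-+ c (λ a → fromℕ (Q ℕ.* w a)) (λ _ → - fromℕ μ) ⟩
    𝔼 c (λ a → fromℕ (Q ℕ.* w a)) + 𝔼 c (λ _ → - fromℕ μ)
      ≡⟨ cong₂ _+_ (trans (𝔼-cong c (λ a → fromℕ-* Q (w a))) (𝔼-* c (fromℕ Q) (fromℕ ∘ w))) (𝔼-const c (- fromℕ μ)) ⟩
    fromℕ Q * m - fromℕ μ
      ≡⟨ cong (_- fromℕ μ) mean ⟩
    fromℕ μ - fromℕ μ
      ≡⟨ ℚ.+-inverseʳ (fromℕ μ) ⟩
    0ℚ ∎
    where open ≡-Reasoning

  -- From w² ≤ Mw: the square of Qw - μ lies below the affine function r w + μ², the difference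
  -- being Q²w(M - w), and that function has mean QMμ - μ².
  variance : 𝔼 c (λ a → (fromℕ (Q ℕ.* w a) - fromℕ μ) * (fromℕ (Q ℕ.* w a) - fromℕ μ)) ≤ fromℕ (Q ℕ.* (M ℕ.* μ))
  variance = begin
    𝔼 c (λ a → (fromℕ (Q ℕ.* w a) - fromℕ μ) * (fromℕ (Q ℕ.* w a) - fromℕ μ))
      ≤⟨ 𝔼-mono c pointwise ⟩
    𝔼 c (λ a → r * fromℕ (w a) + fromℕ μ * fromℕ μ)
      ≡⟨ trans (𝔼-+ c (λ a → r * fromℕ (w a)) (λ _ → fromℕ μ * fromℕ μ)) (cong₂ _+_ (𝔼-* c r (fromℕ ∘ w)) (𝔼-const c (fromℕ μ * fromℕ μ))) ⟩
    r * m + fromℕ μ * fromℕ μ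
      ≡⟨ lem₁ (fromℕ Q) (fromℕ M) (fromℕ μ) m ⟩
    (fromℕ Q * fromℕ M - fromℕ μ - fromℕ μ) * (fromℕ Q * m) + fromℕ μ * fromℕ μ
      ≡⟨ cong (λ x → (fromℕ Q * fromℕ M - fromℕ μ - fromℕ μ) * x + fromℕ μ * fromℕ μ) mean ⟩
    (fromℕ Q * fromℕ M - fromℕ μ - fromℕ μ) * fromℕ μ + fromℕ μ * fromℕ μ
      ≤⟨ ≤-by (0≤x² (fromℕ μ)) (lem₂ (fromℕ Q) (fromℕ M) (fromℕ μ)) ⟩
    fromℕ Q * (fromℕ M * fromℕ μ)
      ≡⟨ sym (trans (fromℕ-* Q (M ℕ.* μ)) (cong (fromℕ Q *_) (fromℕ-* M μ))) ⟩
    fromℕ (Q ℕ.* (M ℕ.* μ)) ∎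
    where
    open ℚ.≤-Reasoning
    r = fromℕ Q * fromℕ Q * fromℕ M - fromℕ Q * fromℕ μ - fromℕ Q * fromℕ μ
    lem₁ : ∀ q k u e → (q * q * k - q * u - q * u) * e + u * u ≡ (q * k - u - u) * (q * e) + u * u
    lem₁ = solve-∀ ℚ-ring
    lem₂ : ∀ q k u → q * (k * u) ≡ (q * k - u - u) * u + u * u + u * u
    lem₂ = solve-∀ ℚ-ring
    lem₃ : ∀ q k u v → (q * q * k - q * u - q * u) * v + u * u ≡ (q * v - u) * (q * v - u) + q * q * (v * (k - v))
    lem₃ = solve-∀ ℚ-ring
    pointwise : ∀ a → (fromℕ (Q ℕ.* w a) - fromℕ μ) * (fromℕ (Q ℕ.* w a) - fromℕ μ) ≤ r * fromℕ (w a) + fromℕ μ * fromℕ μ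
    pointwise a = subst (λ y → (y - fromℕ μ) * (y - fromℕ μ) ≤ r * fromℕ (w a) + fromℕ μ * fromℕ μ) (sym (fromℕ-* Q (w a))) (≤-by
      (*-nonNeg (0≤x² (fromℕ Q)) (*-nonNeg (0≤fromℕ (w a)) (p≤q⇒0≤q-p (fromℕ-mono-≤ (w≤M a)))))
      (lem₃ (fromℕ Q) (fromℕ M) (fromℕ μ) (fromℕ (w a))))

  -- Increments are at most QM in absolute value, so 2M ≤ Λ meets the size condition of `𝔼exp≤exp`;
  -- the variance bound gives W = Mμ.
  module _ (N Λ j u : ℕ) .{{_ : NonZero Λ}} (2M≤Λ : 2 ℕ.* M ℕ.≤ Λ)
    (u-large : 2 ℕ.* (M ℕ.* μ) ℕ.* N ℕ.+ j ℕ.* (Q ℕ.* (Λ ℕ.* Λ)) ℕ.≤ u) where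

    open Deviation Q Λ hiding (D)

    private
      up down : ∀ {k} → Vec X k → ℤ
      up   {k} xs = + (Q ℕ.* total w xs) ℤ.- + (k ℕ.* μ)
      down {k} xs = + (k ℕ.* μ) ℤ.- + (Q ℕ.* total w xs)

      2QM≤QΛ : 2 ℕ.* (Q ℕ.* M) ℕ.≤ Q ℕ.* Λ
      2QM≤QΛ = subst (ℕ._≤ Q ℕ.* Λ) (lem Q M) (ℕ.*-monoʳ-≤ Q 2M≤Λ)
        where
        lem : ∀ q k → q ℕ.* (2 ℕ.* k) ≡ 2 ℕ.* (q ℕ.* k)
        lem = ℕR.solve-∀

      Qw≤QM : ∀ a → Q ℕ.* w a ℕ.≤ Q ℕ.* M
      Qw≤QM a = ℕ.*-monoʳ-≤ Q (w≤M a)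

      -- Independent bounded weights have uniformly bounded increments, so the walk is never
      -- stopped.
      Anything : ∀ {k} → Pred (Vec X k) 0ℓ
      Anything _ = ⊤

      anything? : ∀ {k} → Decidable (Anything {k})
      anything? _ = yes tt

      up-growth : ∀ {k} (xs : Vec X k) → Anything xs →
        𝔼 c (λ x → exp (+ Λ ℤ.* (up (x ∷ xs) ℤ.- up xs))) ≤ exp (+ (2 ℕ.* (M ℕ.* μ)))
      up-growth {k} xs _ = subst (_≤ exp (+ (2 ℕ.* (M ℕ.* μ))))
        (𝔼-cong c λ x → cong (λ z → exp (+ Λ ℤ.* z)) (sym (increment Q (w x) (total w xs) μ k)))
        (𝔼exp≤exp c (λ a → + (Q ℕ.* w a) ℤ.- + μ) (M ℕ.* μ)
          (trans (𝔼-cong c (λ a → fromℤ-m-n (Q ℕ.* w a) μ)) 𝔼[Qw-μ]≡0)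
          (λ a → ℕ.≤-trans (ℕ.*-monoʳ-≤ 2 (∣m-n∣≤ (Qw≤QM a) μ≤QM)) 2QM≤QΛ)
          (subst (_≤ fromℕ (Q ℕ.* (M ℕ.* μ)))
            (𝔼-cong c λ a → cong (λ z → z * z) (sym (fromℤ-m-n (Q ℕ.* w a) μ))) variance))

      down-growth : ∀ {k} (xs : Vec X k) → Anything xs →
        𝔼 c (λ x → exp (+ Λ ℤ.* (down (x ∷ xs) ℤ.- down xs))) ≤ exp (+ (2 ℕ.* (M ℕ.* μ)))
      down-growth {k} xs _ = subst (_≤ exp (+ (2 ℕ.* (M ℕ.* μ))))
        (𝔼-cong c λ x → cong (λ z → exp (+ Λ ℤ.* z)) (sym (increment′ Q (w x) (total w xs) μ k)))
        (𝔼exp≤exp c (λ a → + μ ℤ.- + (Q ℕ.* w a)) (M ℕ.* μ)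
          (trans (𝔼-cong c (λ a → trans (fromℤ-m-n μ (Q ℕ.* w a)) (p-q≡-1*[q-p] (fromℕ μ) (fromℕ (Q ℕ.* w a)))))
            (trans (𝔼-* c (- 1ℚ) (λ a → fromℕ (Q ℕ.* w a) - fromℕ μ)) (cong (- 1ℚ *_) 𝔼[Qw-μ]≡0)))
          (λ a → ℕ.≤-trans (ℕ.*-monoʳ-≤ 2 (∣m-n∣≤ μ≤QM (Qw≤QM a))) 2QM≤QΛ)
          (subst (_≤ fromℕ (Q ℕ.* (M ℕ.* μ)))
            (𝔼-cong c λ a → trans ([p-q]²≡[q-p]² (fromℕ (Q ℕ.* w a)) (fromℕ μ)) (cong (λ z → z * z) (sym (fromℤ-m-n μ (Q ℕ.* w a))))) variance))

      up[]≡0 : up [] ≡ + 0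
      up[]≡0 = cong (λ n → + n ℤ.- + 0) (ℕ.*-zeroʳ Q)

      down[]≡0 : down [] ≡ + 0
      down[]≡0 = cong (λ n → + 0 ℤ.- + n) (ℕ.*-zeroʳ Q)

      module Up = Stopped c (M ℕ.* μ) up up[]≡0 anything? up-growth
      module Down = Stopped c (M ℕ.* μ) down down[]≡0 anything? down-growth

      up-alive : ∀ {k} (xs : Vec X k) → Up.Alive xs
      up-alive []       = tt
      up-alive (x ∷ xs) = up-alive xs , tt

      down-alive : ∀ {k} (xs : Vec X k) → Down.Alive xs
      down-alive []       = tt
      down-alive (x ∷ xs) = down-alive xs , tt

    upper-tail : Unlikely (repeat N c) (λ xs → u ℕ.+ Λ ℕ.* (N ℕ.* μ) ℕ.≤ Λ ℕ.* (Q ℕ.* total w xs)) (½ ^ j)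
    upper-tail = Up.stopped-tail {j = j} u-large λ xs b →
      subst (λ z → + u ℤ.≤ + Λ ℤ.* z) (sym (Up.alive⇒stopped≡Z xs (up-alive xs))) (≤-gap u Λ _ _ b)

    lower-tail : Unlikely (repeat N c) (λ xs → u ℕ.+ Λ ℕ.* (Q ℕ.* total w xs) ℕ.≤ Λ ℕ.* (N ℕ.* μ)) (½ ^ j)
    lower-tail = Down.stopped-tail {j = j} u-large λ xs b →
      subst (λ z → + u ℤ.≤ + Λ ℤ.* z) (sym (Down.alive⇒stopped≡Z xs (down-alive xs))) (≤-gap u Λ _ _ b)

-- Occurrences in a sample

⟦_⟧ : Bool → ℕ
⟦ b ⟧ = if b then 1 else 0

count-∷ : ∀ {P : Pred X 0ℓ} (P? : Decidable P) x {k} (xs : Vec X k) →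
  count P? (x ∷ xs) ≡ ⟦ does (P? x) ⟧ ℕ.+ count P? xs
count-∷ P? x xs with does (P? x)
... | true  = refl
... | false = refl

sum-select : ∀ {m} (y : Fin m) (f : Fin m → ℚ) → sum (λ x → if does (x Fin.≟ y) then f x else 0ℚ) ≡ f y
sum-select {suc m} Fin.zero f = begin
  f Fin.zero + sum {m} (λ _ → 0ℚ)  ≡⟨ cong (λ z → f Fin.zero + z) (trans (sum-const m 0ℚ) (ℚ.*-zeroʳ (fromℕ m))) ⟩
  f Fin.zero + 0ℚ                  ≡⟨ ℚ.+-identityʳ (f Fin.zero) ⟩
  f Fin.zero                       ∎
  where open ≡-Reasoning
sum-select {suc m} (Fin.suc y) f = trans (ℚ.+-identityˡ _) (sum-select y (f ∘ Fin.suc))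

occurrences : ∀ {m k} → Fin m → Vec (Fin m) k → ℕ
occurrences x xs = count (x Fin.≟_) xs

sum-occurrences : ∀ {m k} (xs : Vec (Fin m) k) → sum (λ x → fromℕ (occurrences x xs)) ≡ fromℕ k
sum-occurrences {m} []               = trans (sum-const m 0ℚ) (ℚ.*-zeroʳ (fromℕ m))
sum-occurrences {m} {suc k} (y ∷ ys) = begin
  sum (λ x → fromℕ (occurrences x (y ∷ ys)))
    ≡⟨ sum-cong-≗ pointwise ⟩
  sum (λ x → (if does (x Fin.≟ y) then 1ℚ else 0ℚ) + fromℕ (occurrences x ys))
    ≡⟨ ∑-distrib-+ (λ x → if does (x Fin.≟ y) then 1ℚ else 0ℚ) (λ x → fromℕ (occurrences x ys)) ⟩
  sum (λ x → if does (x Fin.≟ y) then 1ℚ else 0ℚ) + sum (λ x → fromℕ (occurrences x ys))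
    ≡⟨ cong₂ _+_ (sum-select y (λ _ → 1ℚ)) (sum-occurrences ys) ⟩
  1ℚ + fromℕ k
    ≡⟨ sym (fromℕ-+ 1 k) ⟩
  fromℕ (suc k) ∎
  where
  open ≡-Reasoning
  pointwise : ∀ x → fromℕ (occurrences x (y ∷ ys)) ≡ (if does (x Fin.≟ y) then 1ℚ else 0ℚ) + fromℕ (occurrences x ys)
  pointwise x = trans (cong fromℕ (count-∷ (x Fin.≟_) y ys)) (bools (does (x Fin.≟ y)) (occurrences x ys))
    where
    bools : ∀ b a → fromℕ (⟦ b ⟧ ℕ.+ a) ≡ (if b then 1ℚ else 0ℚ) + fromℕ a
    bools true  a = fromℕ-+ 1 a
    bools false a = sym (ℚ.+-identityˡ (fromℕ a))

∣collisions∣ : ∀ {m k} → Vec (Fin m) k → ℕ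
∣collisions∣ xs = collisions Fin._≟_ xs

-- Both sides count ordered pairs of positions with equal entries: k on the diagonal and two for
-- each collision.
sum-occurrences² : ∀ {m k} (xs : Vec (Fin m) k) →
  sum (λ x → fromℕ (occurrences x xs) * fromℕ (occurrences x xs)) ≡ fromℕ (k ℕ.+ 2 ℕ.* ∣collisions∣ xs)
sum-occurrences² {m} []               = trans (sum-const m 0ℚ) (ℚ.*-zeroʳ (fromℕ m))
sum-occurrences² {m} {suc k} (y ∷ ys) = begin
  sum (λ x → fromℕ (occurrences x (y ∷ ys)) * fromℕ (occurrences x (y ∷ ys)))
    ≡⟨ sum-cong-≗ pointwise ⟩
  sum (λ x → (if does (x Fin.≟ y) then fromℕ (1 ℕ.+ 2 ℕ.* occurrences x ys) else 0ℚ) + fromℕ (occurrences x ys) * fromℕ (occurrences x ys))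
    ≡⟨ ∑-distrib-+ (λ x → if does (x Fin.≟ y) then fromℕ (1 ℕ.+ 2 ℕ.* occurrences x ys) else 0ℚ) (λ x → fromℕ (occurrences x ys) * fromℕ (occurrences x ys)) ⟩
  sum (λ x → if does (x Fin.≟ y) then fromℕ (1 ℕ.+ 2 ℕ.* occurrences x ys) else 0ℚ) + sum (λ x → fromℕ (occurrences x ys) * fromℕ (occurrences x ys))
    ≡⟨ cong₂ _+_ (sum-select y (λ x → fromℕ (1 ℕ.+ 2 ℕ.* occurrences x ys))) (sum-occurrences² ys) ⟩
  fromℕ (1 ℕ.+ 2 ℕ.* occurrences y ys) + fromℕ (k ℕ.+ 2 ℕ.* ∣collisions∣ ys)
    ≡⟨ sym (fromℕ-+ (1 ℕ.+ 2 ℕ.* occurrences y ys) (k ℕ.+ 2 ℕ.* ∣collisions∣ ys)) ⟩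
  fromℕ (1 ℕ.+ 2 ℕ.* occurrences y ys ℕ.+ (k ℕ.+ 2 ℕ.* ∣collisions∣ ys))
    ≡⟨ cong fromℕ (lem₂ (occurrences y ys) k (∣collisions∣ ys)) ⟩
  fromℕ (suc k ℕ.+ 2 ℕ.* ∣collisions∣ (y ∷ ys)) ∎
  where
  open ≡-Reasoning
  lem₁ : ∀ a → (1 ℕ.+ a) ℕ.* (1 ℕ.+ a) ≡ (1 ℕ.+ 2 ℕ.* a) ℕ.+ a ℕ.* a
  lem₁ = ℕR.solve-∀
  lem₂ : ∀ a k r → 1 ℕ.+ 2 ℕ.* a ℕ.+ (k ℕ.+ 2 ℕ.* r) ≡ 1 ℕ.+ k ℕ.+ 2 ℕ.* (a ℕ.+ r)
  lem₂ = ℕR.solve-∀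
  pointwise : ∀ x → fromℕ (occurrences x (y ∷ ys)) * fromℕ (occurrences x (y ∷ ys)) ≡
    (if does (x Fin.≟ y) then fromℕ (1 ℕ.+ 2 ℕ.* occurrences x ys) else 0ℚ) + fromℕ (occurrences x ys) * fromℕ (occurrences x ys)
  pointwise x = trans (cong (λ N → fromℕ N * fromℕ N) (count-∷ (x Fin.≟_) y ys)) (bools (does (x Fin.≟ y)) (occurrences x ys))
    where
    bools : ∀ b a → fromℕ (⟦ b ⟧ ℕ.+ a) * fromℕ (⟦ b ⟧ ℕ.+ a) ≡ (if b then fromℕ (1 ℕ.+ 2 ℕ.* a) else 0ℚ) + fromℕ a * fromℕ a
    bools true  a = begin
      fromℕ (suc a) * fromℕ (suc a)              ≡⟨ sym (fromℕ-* (suc a) (suc a)) ⟩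
      fromℕ (suc a ℕ.* suc a)                    ≡⟨ cong fromℕ (lem₁ a) ⟩
      fromℕ ((1 ℕ.+ 2 ℕ.* a) ℕ.+ a ℕ.* a)        ≡⟨ trans (fromℕ-+ (1 ℕ.+ 2 ℕ.* a) (a ℕ.* a)) (cong (λ z → fromℕ (1 ℕ.+ 2 ℕ.* a) + z) (fromℕ-* a a)) ⟩
      fromℕ (1 ℕ.+ 2 ℕ.* a) + fromℕ a * fromℕ a  ∎
    bools false a = sym (ℚ.+-identityˡ (fromℕ a * fromℕ a))

suc-C-2 : ∀ k → suc k C 2 ≡ k ℕ.+ k C 2
suc-C-2 k = trans (sym (nCk+nC[k+1]≡[n+1]C[k+1] k 1)) (cong (ℕ._+ k C 2) (nC1≡n k))

2*C2 : ∀ k → 2 ℕ.* (k C 2) ℕ.+ k ≡ k ℕ.* k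
2*C2 zero    = refl
2*C2 (suc k) = begin
  2 ℕ.* (suc k C 2) ℕ.+ suc k           ≡⟨ cong (λ c → 2 ℕ.* c ℕ.+ suc k) (suc-C-2 k) ⟩
  2 ℕ.* (k ℕ.+ k C 2) ℕ.+ suc k         ≡⟨ lem₁ k (k C 2) ⟩
  (2 ℕ.* (k C 2) ℕ.+ k) ℕ.+ (1 ℕ.+ 2 ℕ.* k)  ≡⟨ cong (ℕ._+ (1 ℕ.+ 2 ℕ.* k)) (2*C2 k) ⟩
  k ℕ.* k ℕ.+ (1 ℕ.+ 2 ℕ.* k)           ≡⟨ lem₂ k ⟩
  suc k ℕ.* suc k                       ∎
  where
  open ≡-Reasoning
  lem₁ : ∀ k c → 2 ℕ.* (k ℕ.+ c) ℕ.+ (1 ℕ.+ k) ≡ (2 ℕ.* c ℕ.+ k) ℕ.+ (1 ℕ.+ 2 ℕ.* k)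
  lem₁ = ℕR.solve-∀
  lem₂ : ∀ k → k ℕ.* k ℕ.+ (1 ℕ.+ 2 ℕ.* k) ≡ (1 ℕ.+ k) ℕ.* (1 ℕ.+ k)
  lem₂ = ℕR.solve-∀

module CollisionIncrements (m : ℕ) .{{_ : NonZero m}} where

  -- Both signs are followed since the exponential bound is one-sided.
  excess deficit : ∀ {k} → Vec (Fin m) k → ℤ
  excess  {k} xs = + (m ℕ.* ∣collisions∣ xs) ℤ.- + (k C 2)
  deficit {k} xs = + (k C 2) ℤ.- + (m ℕ.* ∣collisions∣ xs)

  excess-∷ : ∀ {k} x (xs : Vec (Fin m) k) →
    excess (x ∷ xs) ℤ.- excess xs ≡ + (m ℕ.* occurrences x xs) ℤ.- + k
  excess-∷ {k} x xs rewrite suc-C-2 k | ℕ.*-distribˡ-+ m (occurrences x xs) (∣collisions∣ xs)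
    | ℤ.pos-+ (m ℕ.* occurrences x xs) (m ℕ.* ∣collisions∣ xs) | ℤ.pos-+ k (k C 2) =
    lem (+ (m ℕ.* occurrences x xs)) (+ (m ℕ.* ∣collisions∣ xs)) (+ k) (+ (k C 2))
    where
    lem : ∀ a r k c → a ℤ.+ r ℤ.- (k ℤ.+ c) ℤ.- (r ℤ.- c) ≡ a ℤ.- k
    lem = ℤR.solve-∀

  deficit-∷ : ∀ {k} x (xs : Vec (Fin m) k) →
    deficit (x ∷ xs) ℤ.- deficit xs ≡ + k ℤ.- + (m ℕ.* occurrences x xs)
  deficit-∷ {k} x xs rewrite suc-C-2 k | ℕ.*-distribˡ-+ m (occurrences x xs) (∣collisions∣ xs)
    | ℤ.pos-+ (m ℕ.* occurrences x xs) (m ℕ.* ∣collisions∣ xs) | ℤ.pos-+ k (k C 2) =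
    lem (+ (m ℕ.* occurrences x xs)) (+ (m ℕ.* ∣collisions∣ xs)) (+ k) (+ (k C 2))
    where
    lem : ∀ a r k c → k ℤ.+ c ℤ.- (a ℤ.+ r) ℤ.- (c ℤ.- r) ≡ k ℤ.- a
    lem = ℤR.solve-∀

  excess[]≡0 : excess [] ≡ + 0
  excess[]≡0 = cong (λ n → + n ℤ.- + 0) (ℕ.*-zeroʳ m)

  deficit[]≡0 : deficit [] ≡ + 0
  deficit[]≡0 = cong (λ n → + 0 ℤ.- + n) (ℕ.*-zeroʳ m)

  module _ {k} (xs : Vec (Fin m) k) where

    private
      N : Fin m → ℚ
      N x = fromℕ (occurrences x xs)
      z : Fin m → ℚ
      z x = fromℕ (m ℕ.* occurrences x xs) - fromℕ k
      q = fromℕ m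
      K = fromℕ k

    𝔼N : q * 𝔼 (uniform m) N ≡ K
    𝔼N = begin
      q * (inv m * sum N)   ≡⟨ sym (ℚ.*-assoc q (inv m) (sum N)) ⟩
      q * inv m * sum N     ≡⟨ cong₂ _*_ (trans (ℚ.*-comm q (inv m)) (inv-* m)) (sum-occurrences xs) ⟩
      1ℚ * K                ≡⟨ ℚ.*-identityˡ K ⟩
      K                     ∎
      where open ≡-Reasoning

    𝔼N² : q * 𝔼 (uniform m) (λ x → N x * N x) ≡ fromℕ (k ℕ.+ 2 ℕ.* ∣collisions∣ xs)
    𝔼N² = begin
      q * (inv m * sum (λ x → N x * N x))   ≡⟨ sym (ℚ.*-assoc q (inv m) (sum (λ x → N x * N x))) ⟩
      q * inv m * sum (λ x → N x * N x)     ≡⟨ cong₂ _*_ (trans (ℚ.*-comm q (inv m)) (inv-* m)) (sum-occurrences² xs) ⟩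
      1ℚ * R                                ≡⟨ ℚ.*-identityˡ R ⟩
      R                                     ∎
      where
      open ≡-Reasoning
      R = fromℕ (k ℕ.+ 2 ℕ.* ∣collisions∣ xs)

    𝔼z≡0 : 𝔼 (uniform m) z ≡ 0ℚ
    𝔼z≡0 = begin
      𝔼 (uniform m) z
        ≡⟨ 𝔼-cong (uniform m) (λ x → cong (_- K) (fromℕ-* m (occurrences x xs))) ⟩
      𝔼 (uniform m) (λ x → q * N x - K)
        ≡⟨ trans (𝔼-+ (uniform m) (λ x → q * N x) (λ _ → - K)) (cong₂ _+_ (𝔼-* (uniform m) q N) (𝔼-const (uniform m) (- K))) ⟩
      q * 𝔼 (uniform m) N - K
        ≡⟨ cong (_- K) 𝔼N ⟩
      K - K
        ≡⟨ ℚ.+-inverseʳ K ⟩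
      0ℚ ∎
      where open ≡-Reasoning

    𝔼z² : 𝔼 (uniform m) (λ x → z x * z x) ≡ fromℕ (m ℕ.* (k ℕ.+ 2 ℕ.* ∣collisions∣ xs)) - K * K
    𝔼z² = begin
      𝔼 (uniform m) (λ x → z x * z x)
        ≡⟨ 𝔼-cong (uniform m) (λ x → trans (cong (λ y → (y - K) * (y - K)) (fromℕ-* m (occurrences x xs))) (lem₁ q K (N x))) ⟩
      𝔼 (uniform m) (λ x → q * q * (N x * N x) + ((- (q * K + q * K)) * N x + K * K))
        ≡⟨ trans (𝔼-+ (uniform m) (λ x → q * q * (N x * N x)) (λ x → (- (q * K + q * K)) * N x + K * K)) (cong₂ _+_ (𝔼-* (uniform m) (q * q) (λ x → N x * N x)) (trans (𝔼-+ (uniform m) (λ x → (- (q * K + q * K)) * N x) (λ _ → K * K)) (cong₂ _+_ (𝔼-* (uniform m) (- (q * K + q * K)) N) (𝔼-const (uniform m) (K * K))))) ⟩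
      q * q * 𝔼 (uniform m) (λ x → N x * N x) + ((- (q * K + q * K)) * 𝔼 (uniform m) N + K * K)
        ≡⟨ lem₂ q K (𝔼 (uniform m) (λ x → N x * N x)) (𝔼 (uniform m) N) ⟩
      q * (q * 𝔼 (uniform m) (λ x → N x * N x)) - (K + K) * (q * 𝔼 (uniform m) N) + K * K
        ≡⟨ cong₂ (λ a b → q * a - (K + K) * b + K * K) 𝔼N² 𝔼N ⟩
      q * fromℕ (k ℕ.+ 2 ℕ.* ∣collisions∣ xs) - (K + K) * K + K * K
        ≡⟨ lem₃ (q * fromℕ (k ℕ.+ 2 ℕ.* ∣collisions∣ xs)) K ⟩
      q * fromℕ (k ℕ.+ 2 ℕ.* ∣collisions∣ xs) - K * K
        ≡⟨ cong (_- K * K) (sym (fromℕ-* m (k ℕ.+ 2 ℕ.* ∣collisions∣ xs))) ⟩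
      fromℕ (m ℕ.* (k ℕ.+ 2 ℕ.* ∣collisions∣ xs)) - K * K ∎
      where
      open ≡-Reasoning
      lem₁ : ∀ q k n → (q * n - k) * (q * n - k) ≡ q * q * (n * n) + ((- (q * k + q * k)) * n + k * k)
      lem₁ = solve-∀ ℚ-ring
      lem₂ : ∀ q k a b → q * q * a + ((- (q * k + q * k)) * b + k * k) ≡ q * (q * a) - (k + k) * (q * b) + k * k
      lem₂ = solve-∀ ℚ-ring
      lem₃ : ∀ a k → a - (k + k) * k + k * k ≡ a - k * k
      lem₃ = solve-∀ ℚ-ring

    -- The hypothesis is 𝔼z² ≤ mW with the square k² moved to the right, that is, the variance
    -- condition of `𝔼exp≤exp` for Q = m.
    module _ {W} (variance : m ℕ.* (k ℕ.+ 2 ℕ.* ∣collisions∣ xs) ℕ.≤ m ℕ.* W ℕ.+ k ℕ.* k) where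

      𝔼z²≤ : 𝔼 (uniform m) (λ x → z x * z x) ≤ fromℕ (m ℕ.* W)
      𝔼z²≤ = begin
        𝔼 (uniform m) (λ x → z x * z x)
          ≡⟨ 𝔼z² ⟩
        fromℕ (m ℕ.* (k ℕ.+ 2 ℕ.* ∣collisions∣ xs)) - K * K
          ≤⟨ ℚ.+-monoˡ-≤ (- (K * K)) (fromℕ-mono-≤ variance) ⟩
        fromℕ (m ℕ.* W ℕ.+ k ℕ.* k) - K * K
          ≡⟨ cong (_- K * K) (trans (fromℕ-+ (m ℕ.* W) (k ℕ.* k)) (cong (λ y → fromℕ (m ℕ.* W) + y) (fromℕ-* k k))) ⟩
        fromℕ (m ℕ.* W) + K * K - K * K
          ≡⟨ lem (fromℕ (m ℕ.* W)) (K * K) ⟩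
        fromℕ (m ℕ.* W) ∎
        where
        open ℚ.≤-Reasoning
        lem : ∀ x y → x + y - y ≡ x
        lem = solve-∀ ℚ-ring

      module _ {Λ} .{{_ : NonZero Λ}}
        (bounded : ∀ x → 2 ℕ.* ℤ.∣ + (m ℕ.* occurrences x xs) ℤ.- + k ∣ ℕ.≤ m ℕ.* Λ) where

        open Deviation m Λ

        excess-growth : 𝔼 (uniform m) (λ x → exp (+ Λ ℤ.* (excess (x ∷ xs) ℤ.- excess xs))) ≤ exp (+ (2 ℕ.* W))
        excess-growth = subst (_≤ exp (+ (2 ℕ.* W)))
          (𝔼-cong (uniform m) λ x → cong (λ y → exp (+ Λ ℤ.* y)) (sym (excess-∷ x xs)))
          (𝔼exp≤exp (uniform m) (λ x → + (m ℕ.* occurrences x xs) ℤ.- + k) W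
            (trans (𝔼-cong (uniform m) (λ x → fromℤ-m-n (m ℕ.* occurrences x xs) k)) 𝔼z≡0)
            bounded
            (subst (_≤ fromℕ (m ℕ.* W))
              (𝔼-cong (uniform m) λ x → cong (λ y → y * y) (sym (fromℤ-m-n (m ℕ.* occurrences x xs) k))) 𝔼z²≤))

        deficit-growth : 𝔼 (uniform m) (λ x → exp (+ Λ ℤ.* (deficit (x ∷ xs) ℤ.- deficit xs))) ≤ exp (+ (2 ℕ.* W))
        deficit-growth = subst (_≤ exp (+ (2 ℕ.* W)))
          (𝔼-cong (uniform m) λ x → cong (λ y → exp (+ Λ ℤ.* y)) (sym (deficit-∷ x xs)))
          (𝔼exp≤exp (uniform m) (λ x → + k ℤ.- + (m ℕ.* occurrences x xs)) W
            (trans (𝔼-cong (uniform m) (λ x → trans (fromℤ-m-n k (m ℕ.* occurrences x xs)) (p-q≡-1*[q-p] K (fromℕ (m ℕ.* occurrences x xs)))))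
              (trans (𝔼-* (uniform m) (- 1ℚ) z) (cong (- 1ℚ *_) 𝔼z≡0)))
            (λ x → subst (λ y → 2 ℕ.* y ℕ.≤ m ℕ.* Λ) (ℤ.∣i-j∣≡∣j-i∣ (+ (m ℕ.* occurrences x xs)) (+ k)) (bounded x))
            (subst (_≤ fromℕ (m ℕ.* W))
              (𝔼-cong (uniform m) λ x → trans ([p-q]²≡[q-p]² (fromℕ (m ℕ.* occurrences x xs)) K) (cong (λ y → y * y) (sym (fromℤ-m-n k (m ℕ.* occurrences x xs))))) 𝔼z²≤))

-- Concentration of the number of collisions

square-cancel-≤ : ∀ {a b} → a ℕ.* a ℕ.≤ b ℕ.* b → a ℕ.≤ b
square-cancel-≤ {a} {b} a²≤b² with a ℕ.≤? b
... | yes a≤b = a≤b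
... | no a≰b  = contradiction a²≤b² (ℕ.<⇒≱ (ℕ.*-mono-< (ℕ.≰⇒> a≰b) (ℕ.≰⇒> a≰b)))

-- The witness ⌊a/d⌋ + 1 may exceed the ceiling by one, but it is positive even for a = 0.
ceiling-quotient : ∀ a d .{{_ : NonZero d}} → ∃[ q ] a ℕ.≤ d ℕ.* q × d ℕ.* q ℕ.≤ a ℕ.+ d × 1 ℕ.≤ q
ceiling-quotient a d = suc (a ℕ./ d) ,
  subst (a ℕ.≤_) (sym (ℕ.*-suc d (a ℕ./ d)))
    (subst (ℕ._≤ d ℕ.+ d ℕ.* (a ℕ./ d)) (sym (trans (ℕ.m≡m%n+[m/n]*n a d) (cong (a ℕ.% d ℕ.+_) (ℕ.*-comm (a ℕ./ d) d))))
      (ℕ.+-monoˡ-≤ (d ℕ.* (a ℕ./ d)) (ℕ.m%n≤n a d))) ,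
  subst (ℕ._≤ a ℕ.+ d) (sym (ℕ.*-suc d (a ℕ./ d)))
    (subst (ℕ._≤ a ℕ.+ d) (ℕ.+-comm (d ℕ.* (a ℕ./ d)) d)
      (ℕ.+-monoˡ-≤ d (subst (ℕ._≤ a) (ℕ.*-comm (a ℕ./ d) d) (ℕ.m/n*n≤m a d)))) ,
  ℕ.s≤s ℕ.z≤n

does-≟-sym : ∀ {m} (x y : Fin m) → does (x Fin.≟ y) ≡ does (y Fin.≟ x)
does-≟-sym Fin.zero    Fin.zero    = refl
does-≟-sym Fin.zero    (Fin.suc y) = refl
does-≟-sym (Fin.suc x) Fin.zero    = refl
does-≟-sym (Fin.suc x) (Fin.suc y) = does-≟-sym x y

total-count : ∀ {P : Pred X 0ℓ} (P? : Decidable P) {k} (xs : Vec X k) →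
  total (λ x → ⟦ does (P? x) ⟧) xs ≡ count P? xs
total-count P? []       = refl
total-count P? (x ∷ xs) = trans (cong (⟦ does (P? x) ⟧ ℕ.+_) (total-count P? xs)) (sym (count-∷ P? x xs))

term≤sum : ∀ {n} (f : Fin n → ℚ) → (∀ i → 0ℚ ≤ f i) → ∀ i → f i ≤ sum f
term≤sum {suc n} f 0≤f Fin.zero = ≤-by
  (subst (_≤ sum (f ∘ Fin.suc)) (trans (sum-const n 0ℚ) (ℚ.*-zeroʳ (fromℕ n))) (sum-mono (0≤f ∘ Fin.suc))) refl
term≤sum f 0≤f (Fin.suc i) = ℚ.≤-trans (term≤sum (f ∘ Fin.suc) (0≤f ∘ Fin.suc) i)
  (≤-by (0≤f Fin.zero) (ℚ.+-comm (f Fin.zero) (sum (f ∘ Fin.suc))))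

occurrences-∷ : ∀ {m k} x y (xs : Vec (Fin m) k) → occurrences x xs ℕ.≤ occurrences x (y ∷ xs)
occurrences-∷ x y xs = subst (occurrences x xs ℕ.≤_) (sym (count-∷ (x Fin.≟_) y xs)) (ℕ.m≤n+m _ ⟦ does (x Fin.≟ y) ⟧)

⟦⟧≤1 : ∀ b → ⟦ b ⟧ ℕ.≤ 1
⟦⟧≤1 true  = ℕ.≤-refl
⟦⟧≤1 false = ℕ.z≤n

-- For each x a Chernoff bound for indicators of mean 1/m, with Λ = 2, then a union over the m
-- values. The hypothesis says M + 1 ≥ 2s/m + 2j.
frequent-unlikely : ∀ m .{{_ : NonZero m}} s j M → 4 ℕ.* s ℕ.+ 4 ℕ.* (j ℕ.* m) ℕ.≤ 2 ℕ.* (m ℕ.* suc M) →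
  Unlikely (repeat s (uniform m)) (λ xs → ∃[ x ] ¬ occurrences x xs ℕ.≤ M) (fromℕ m * ½ ^ j)
frequent-unlikely m s j M M-large = unlikely-⋃ (repeat s (uniform m)) λ x →
  unlikely-mono (repeat s (uniform m)) (event x) ℚ.≤-refl
    (Chernoff.upper-tail (uniform m) (λ y → ⟦ does (x Fin.≟ y) ⟧) m 1 1 (mean x) (λ y → ⟦⟧≤1 (does (x Fin.≟ y)))
      s 2 j _ ℕ.≤-refl ℕ.≤-refl)
  where
  mean : ∀ x → fromℕ m * 𝔼 (uniform m) (λ y → fromℕ ⟦ does (x Fin.≟ y) ⟧) ≡ fromℕ 1
  mean x = begin
    fromℕ m * (inv m * sum (λ y → fromℕ ⟦ does (x Fin.≟ y) ⟧))
      ≡⟨ sym (ℚ.*-assoc (fromℕ m) (inv m) _) ⟩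
    fromℕ m * inv m * sum (λ y → fromℕ ⟦ does (x Fin.≟ y) ⟧)
      ≡⟨ cong₂ _*_ (trans (ℚ.*-comm (fromℕ m) (inv m)) (inv-* m)) (trans (sum-cong-≗ pointwise) (sum-select x (λ _ → 1ℚ))) ⟩
    1ℚ * 1ℚ ∎
    where
    open ≡-Reasoning
    pointwise : ∀ y → fromℕ ⟦ does (x Fin.≟ y) ⟧ ≡ (if does (y Fin.≟ x) then 1ℚ else 0ℚ)
    pointwise y rewrite does-≟-sym x y with does (y Fin.≟ x)
    ... | true  = refl
    ... | false = refl
  event : ∀ x xs → ¬ occurrences x xs ℕ.≤ M →
    2 ℕ.* 1 ℕ.* s ℕ.+ j ℕ.* (m ℕ.* 4) ℕ.+ 2 ℕ.* (s ℕ.* 1) ℕ.≤ 2 ℕ.* (m ℕ.* total (λ y → ⟦ does (x Fin.≟ y) ⟧) xs)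
  event x xs N≰M = begin
    2 ℕ.* 1 ℕ.* s ℕ.+ j ℕ.* (m ℕ.* 4) ℕ.+ 2 ℕ.* (s ℕ.* 1)
      ≡⟨ lem s j m ⟩
    4 ℕ.* s ℕ.+ 4 ℕ.* (j ℕ.* m)
      ≤⟨ M-large ⟩
    2 ℕ.* (m ℕ.* suc M)
      ≤⟨ ℕ.*-monoʳ-≤ 2 (ℕ.*-monoʳ-≤ m (ℕ.≰⇒> N≰M)) ⟩
    2 ℕ.* (m ℕ.* occurrences x xs)
      ≡⟨ cong (λ t → 2 ℕ.* (m ℕ.* t)) (sym (total-count (x Fin.≟_) xs)) ⟩
    2 ℕ.* (m ℕ.* total (λ y → ⟦ does (x Fin.≟ y) ⟧) xs) ∎
    where
    open ℕ.≤-Reasoning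
    lem : ∀ s j m → 2 ℕ.* 1 ℕ.* s ℕ.+ j ℕ.* (m ℕ.* 4) ℕ.+ 2 ℕ.* (s ℕ.* 1) ≡ 4 ℕ.* s ℕ.+ 4 ℕ.* (j ℕ.* m)
    lem = ℕR.solve-∀

square≤4C : ∀ {s} → 2 ℕ.≤ s → s ℕ.* s ℕ.≤ 4 ℕ.* (s C 2)
square≤4C {s} 2≤s = ℕ.+-cancelʳ-≤ (2 ℕ.* s) (s ℕ.* s) (4 ℕ.* (s C 2)) (begin
  s ℕ.* s ℕ.+ 2 ℕ.* s              ≤⟨ ℕ.+-monoʳ-≤ (s ℕ.* s) (ℕ.*-monoˡ-≤ s 2≤s) ⟩
  s ℕ.* s ℕ.+ s ℕ.* s              ≡⟨ cong₂ ℕ._+_ (sym (2*C2 s)) (sym (2*C2 s)) ⟩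
  2 ℕ.* (s C 2) ℕ.+ s ℕ.+ (2 ℕ.* (s C 2) ℕ.+ s)  ≡⟨ lem (s C 2) s ⟩
  4 ℕ.* (s C 2) ℕ.+ 2 ℕ.* s        ∎)
  where
  open ℕ.≤-Reasoning
  lem : ∀ c s → 2 ℕ.* c ℕ.+ s ℕ.+ (2 ℕ.* c ℕ.+ s) ≡ 4 ℕ.* c ℕ.+ 2 ℕ.* s
  lem = ℕR.solve-∀

-- A relative error of at least 1/(4Δ) of m r against its mean `s C 2`, cleared of denominators.
Deviates : (m Δ : ℕ) → ∀ {s} → Vec (Fin m) s → Set
Deviates m Δ {s} xs =
  s C 2 ℕ.+ 4 ℕ.* Δ ℕ.* (s C 2) ℕ.≤ 4 ℕ.* Δ ℕ.* (m ℕ.* ∣collisions∣ xs) ⊎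
  s C 2 ℕ.+ 4 ℕ.* Δ ℕ.* (m ℕ.* ∣collisions∣ xs) ℕ.≤ 4 ℕ.* Δ ℕ.* (s C 2)

-- Turns a relative gap of 1/(4Δ) into the threshold u = l c for a process scaled by Λ = 4Δl.
scale-gap : ∀ Δ l c x y → c ℕ.+ 4 ℕ.* Δ ℕ.* x ℕ.≤ 4 ℕ.* Δ ℕ.* y →
  l ℕ.* c ℕ.+ 4 ℕ.* Δ ℕ.* l ℕ.* x ℕ.≤ 4 ℕ.* Δ ℕ.* l ℕ.* y
scale-gap Δ l c x y le = subst₂ ℕ._≤_ (lem Δ l c x) (lem′ Δ l y) (ℕ.*-monoʳ-≤ l le)
  where
  lem : ∀ d l c x → l ℕ.* (c ℕ.+ 4 ℕ.* d ℕ.* x) ≡ l ℕ.* c ℕ.+ 4 ℕ.* d ℕ.* l ℕ.* x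
  lem = ℕR.solve-∀
  lem′ : ∀ d l y → l ℕ.* (4 ℕ.* d ℕ.* y) ≡ 4 ℕ.* d ℕ.* l ℕ.* y
  lem′ = ℕR.solve-∀

-- Here the mean multiplicity s/m of an edge is at most 64L, so a multiplicity above a larger
-- multiple of L is rare and can serve as the stopping criterion.
module FewSamples (m s Δ L : ℕ) .{{_ : NonZero m}} .{{_ : NonZero Δ}} .{{_ : NonZero L}}
  (s²≤4C : s ℕ.* s ℕ.≤ 4 ℕ.* (s C 2))
  (large : 64 ℕ.* (16 ℕ.* 16) ℕ.* 144 ℕ.* (m ℕ.* (Δ ℕ.* Δ) ℕ.* (L ℕ.* L)) ℕ.≤ s ℕ.* s)
  (few : s ℕ.≤ 64 ℕ.* L ℕ.* m) where

  private
    M l Λ : ℕ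
    -- The requirement 2s/m + 2j of `frequent-unlikely` for s ≤ 64Lm and j = 8L: 128L + 16L.
    M = 144 ℕ.* L
    -- With W = Ms the growth 2Ws is 2Ms², and `large` bounds the term jD by another 2Ms²; their sum
    -- 4Ms² is at most 16M times `s C 2` because s² ≤ 4 (s C 2).
    l = 16 ℕ.* M
    Λ = 4 ℕ.* Δ ℕ.* l
    instance
      M≢0 : NonZero M
      M≢0 = ℕ.m*n≢0 144 L
      l≢0 : NonZero l
      l≢0 = ℕ.m*n≢0 16 M
      4Δ≢0 : NonZero (4 ℕ.* Δ)
      4Δ≢0 = ℕ.m*n≢0 4 Δ
      Λ≢0 : NonZero Λ
      Λ≢0 = ℕ.m*n≢0 (4 ℕ.* Δ) l

    open CollisionIncrements m
    open Deviation m Λ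

    Good : ∀ {k} → Pred (Vec (Fin m) k) 0ℓ
    Good {k} xs = k ℕ.≤ s × (∀ x → occurrences x xs ℕ.≤ M)

    good? : ∀ {k} → Decidable (Good {k})
    good? {k} xs = (k ℕ.≤? s) ×-dec Fin.all? (λ x → occurrences x xs ℕ.≤? M)

    -- Multiplicities only grow, so a bound on them at the end shows that the process was never
    -- stopped.
    good⇒always : ∀ {k} (xs : Vec (Fin m) k) → Good xs → Always Good xs
    good⇒always []       g          = g
    good⇒always (y ∷ xs) g@(k≤s , N≤M) =
      good⇒always xs (ℕ.≤-trans (ℕ.n≤1+n _) k≤s , λ x → ℕ.≤-trans (occurrences-∷ x y xs) (N≤M x)) , g

    -- k + 2r is the sum of the squared multiplicities, hence at most M times their sum k.
    variance : ∀ {k} (xs : Vec (Fin m) k) → Good xs →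
      m ℕ.* (k ℕ.+ 2 ℕ.* ∣collisions∣ xs) ℕ.≤ m ℕ.* (M ℕ.* s) ℕ.+ k ℕ.* k
    variance {k} xs (k≤s , N≤M) = ℕ.≤-trans (ℕ.*-monoʳ-≤ m (fromℕ-cancel-≤ (begin
      fromℕ (k ℕ.+ 2 ℕ.* ∣collisions∣ xs)
        ≡⟨ sym (sum-occurrences² xs) ⟩
      sum (λ x → fromℕ (occurrences x xs) * fromℕ (occurrences x xs))
        ≤⟨ sum-mono (λ x → *-monoʳ-≤ (0≤fromℕ (occurrences x xs)) (fromℕ-mono-≤ (N≤M x))) ⟩
      sum (λ x → fromℕ M * fromℕ (occurrences x xs))
        ≡⟨ trans (sym (*-distribˡ-sum (fromℕ M) (λ x → fromℕ (occurrences x xs)))) (cong (fromℕ M *_) (sum-occurrences xs)) ⟩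
      fromℕ M * fromℕ k
        ≡⟨ sym (fromℕ-* M k) ⟩
      fromℕ (M ℕ.* k)
        ≤⟨ fromℕ-mono-≤ (ℕ.*-monoʳ-≤ M k≤s) ⟩
      fromℕ (M ℕ.* s) ∎))) (ℕ.m≤m+n (m ℕ.* (M ℕ.* s)) (k ℕ.* k))
      where open ℚ.≤-Reasoning

    64Lm≤mM : 64 ℕ.* L ℕ.* m ℕ.≤ m ℕ.* M
    64Lm≤mM = subst (64 ℕ.* L ℕ.* m ℕ.≤_) (ℕ.*-comm M m) (ℕ.*-monoˡ-≤ m (ℕ.*-monoˡ-≤ L (ℕ.m≤m+n 64 80)))

    bounded : ∀ {k} (xs : Vec (Fin m) k) → Good xs →
      ∀ x → 2 ℕ.* ℤ.∣ + (m ℕ.* occurrences x xs) ℤ.- + k ∣ ℕ.≤ m ℕ.* Λ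
    bounded {k} xs (k≤s , N≤M) x = begin
      2 ℕ.* ℤ.∣ + (m ℕ.* occurrences x xs) ℤ.- + k ∣
        ≤⟨ ℕ.*-monoʳ-≤ 2 (∣m-n∣≤ (ℕ.*-monoʳ-≤ m (N≤M x)) (ℕ.≤-trans k≤s (ℕ.≤-trans few 64Lm≤mM))) ⟩
      2 ℕ.* (m ℕ.* M)
        ≤⟨ ℕ.*-monoˡ-≤ (m ℕ.* M) (ℕ.≤-trans (ℕ.m≤m+n 2 62) (ℕ.m≤m*n 64 Δ)) ⟩
      64 ℕ.* Δ ℕ.* (m ℕ.* M)
        ≡⟨ lem Δ m M ⟩
      m ℕ.* (4 ℕ.* Δ ℕ.* (16 ℕ.* M)) ∎
      where
      open ℕ.≤-Reasoning
      lem : ∀ d m k → 64 ℕ.* d ℕ.* (m ℕ.* k) ≡ m ℕ.* (4 ℕ.* d ℕ.* (16 ℕ.* k))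
      lem = ℕR.solve-∀

    u-large : 2 ℕ.* (M ℕ.* s) ℕ.* s ℕ.+ 8 ℕ.* L ℕ.* (m ℕ.* (Λ ℕ.* Λ)) ℕ.≤ l ℕ.* (s C 2)
    u-large = begin
      2 ℕ.* (M ℕ.* s) ℕ.* s ℕ.+ 8 ℕ.* L ℕ.* (m ℕ.* (Λ ℕ.* Λ))
        ≡⟨ lem₁ 16 M s L m Δ ⟩
      2 ℕ.* M ℕ.* (s ℕ.* s) ℕ.+ 2 ℕ.* M ℕ.* (64 ℕ.* (16 ℕ.* 16) ℕ.* (L ℕ.* (m ℕ.* (Δ ℕ.* Δ)) ℕ.* M))
        ≡⟨ cong (λ z → 2 ℕ.* M ℕ.* (s ℕ.* s) ℕ.+ 2 ℕ.* M ℕ.* z) (lem₂ (64 ℕ.* (16 ℕ.* 16)) 144 L m Δ) ⟩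
      2 ℕ.* M ℕ.* (s ℕ.* s) ℕ.+ 2 ℕ.* M ℕ.* (64 ℕ.* (16 ℕ.* 16) ℕ.* 144 ℕ.* (m ℕ.* (Δ ℕ.* Δ) ℕ.* (L ℕ.* L)))
        ≤⟨ ℕ.+-monoʳ-≤ (2 ℕ.* M ℕ.* (s ℕ.* s)) (ℕ.*-monoʳ-≤ (2 ℕ.* M) large) ⟩
      2 ℕ.* M ℕ.* (s ℕ.* s) ℕ.+ 2 ℕ.* M ℕ.* (s ℕ.* s)
        ≡⟨ lem₃ M (s ℕ.* s) ⟩
      4 ℕ.* M ℕ.* (s ℕ.* s)
        ≤⟨ ℕ.*-monoʳ-≤ (4 ℕ.* M) s²≤4C ⟩
      4 ℕ.* M ℕ.* (4 ℕ.* (s C 2))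
        ≡⟨ lem₄ M (s C 2) ⟩
      l ℕ.* (s C 2) ∎
      where
      open ℕ.≤-Reasoning
      lem₁ : ∀ e M s L m d → 2 ℕ.* (M ℕ.* s) ℕ.* s ℕ.+ 8 ℕ.* L ℕ.* (m ℕ.* (4 ℕ.* d ℕ.* (e ℕ.* M) ℕ.* (4 ℕ.* d ℕ.* (e ℕ.* M)))) ≡
        2 ℕ.* M ℕ.* (s ℕ.* s) ℕ.+ 2 ℕ.* M ℕ.* (64 ℕ.* (e ℕ.* e) ℕ.* (L ℕ.* (m ℕ.* (d ℕ.* d)) ℕ.* M))
      lem₁ = ℕR.solve-∀
      lem₂ : ∀ a b L m d → a ℕ.* (L ℕ.* (m ℕ.* (d ℕ.* d)) ℕ.* (b ℕ.* L)) ≡ a ℕ.* b ℕ.* (m ℕ.* (d ℕ.* d) ℕ.* (L ℕ.* L))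
      lem₂ = ℕR.solve-∀
      lem₃ : ∀ M x → 2 ℕ.* M ℕ.* x ℕ.+ 2 ℕ.* M ℕ.* x ≡ 4 ℕ.* M ℕ.* x
      lem₃ = ℕR.solve-∀
      lem₄ : ∀ M x → 4 ℕ.* M ℕ.* (4 ℕ.* x) ≡ 16 ℕ.* M ℕ.* x
      lem₄ = ℕR.solve-∀

    M-large : 4 ℕ.* s ℕ.+ 4 ℕ.* (8 ℕ.* L ℕ.* m) ℕ.≤ 2 ℕ.* (m ℕ.* suc M)
    M-large = begin
      4 ℕ.* s ℕ.+ 4 ℕ.* (8 ℕ.* L ℕ.* m)                   ≤⟨ ℕ.+-monoˡ-≤ (4 ℕ.* (8 ℕ.* L ℕ.* m)) (ℕ.*-monoʳ-≤ 4 few) ⟩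
      4 ℕ.* (64 ℕ.* L ℕ.* m) ℕ.+ 4 ℕ.* (8 ℕ.* L ℕ.* m)     ≡⟨ lem L m ⟩
      2 ℕ.* (m ℕ.* (144 ℕ.* L))                           ≤⟨ ℕ.*-monoʳ-≤ 2 (ℕ.*-monoʳ-≤ m (ℕ.n≤1+n M)) ⟩
      2 ℕ.* (m ℕ.* suc M)                                 ∎
      where
      open ℕ.≤-Reasoning
      lem : ∀ L m → 4 ℕ.* (64 ℕ.* L ℕ.* m) ℕ.+ 4 ℕ.* (8 ℕ.* L ℕ.* m) ≡ 2 ℕ.* (m ℕ.* (144 ℕ.* L))
      lem = ℕR.solve-∀

    module Up = Stopped (uniform m) (M ℕ.* s) excess excess[]≡0 good?
      (λ xs g → excess-growth xs (variance xs g) (bounded xs g))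
    module Down = Stopped (uniform m) (M ℕ.* s) deficit deficit[]≡0 good?
      (λ xs g → deficit-growth xs (variance xs g) (bounded xs g))

  concentrated : Unlikely (repeat s (uniform m)) (Deviates m Δ) (fromℕ m * ½ ^ (8 ℕ.* L) + (½ ^ (8 ℕ.* L) + ½ ^ (8 ℕ.* L)))
  concentrated = unlikely-mono sample split ℚ.≤-refl
    (unlikely-∪ sample (frequent-unlikely m s (8 ℕ.* L) M M-large) (unlikely-∪ sample
      (Up.stopped-tail {j = 8 ℕ.* L}
        {B = λ xs → Good xs × s C 2 ℕ.+ 4 ℕ.* Δ ℕ.* (s C 2) ℕ.≤ 4 ℕ.* Δ ℕ.* (m ℕ.* ∣collisions∣ xs)} u-large λ xs (g , b) →
        subst (λ z → + (l ℕ.* (s C 2)) ℤ.≤ + Λ ℤ.* z) (sym (Up.alive⇒stopped≡Z xs (good⇒always xs g)))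
          (≤-gap (l ℕ.* (s C 2)) Λ (m ℕ.* ∣collisions∣ xs) (s C 2) (scale-gap Δ l (s C 2) (s C 2) _ b)))
      (Down.stopped-tail {j = 8 ℕ.* L}
        {B = λ xs → Good xs × s C 2 ℕ.+ 4 ℕ.* Δ ℕ.* (m ℕ.* ∣collisions∣ xs) ℕ.≤ 4 ℕ.* Δ ℕ.* (s C 2)} u-large λ xs (g , b) →
        subst (λ z → + (l ℕ.* (s C 2)) ℤ.≤ + Λ ℤ.* z) (sym (Down.alive⇒stopped≡Z xs (good⇒always xs g)))
          (≤-gap (l ℕ.* (s C 2)) Λ (s C 2) (m ℕ.* ∣collisions∣ xs) (scale-gap Δ l (s C 2) _ (s C 2) b)))))
    where
    sample = repeat s (uniform m)
    split : ∀ xs → Deviates m Δ xs → (∃[ x ] ¬ occurrences x xs ℕ.≤ M) ⊎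
      (Good xs × s C 2 ℕ.+ 4 ℕ.* Δ ℕ.* (s C 2) ℕ.≤ 4 ℕ.* Δ ℕ.* (m ℕ.* ∣collisions∣ xs)) ⊎
      (Good xs × s C 2 ℕ.+ 4 ℕ.* Δ ℕ.* (m ℕ.* ∣collisions∣ xs) ℕ.≤ 4 ℕ.* Δ ℕ.* (s C 2))
    split xs b with Fin.all? (λ x → occurrences x xs ℕ.≤? M)
    ... | no ¬all = inj₁ (Fin.¬∀⟶∃¬ m _ (λ x → occurrences x xs ℕ.≤? M) ¬all)
    split xs (inj₁ b) | yes N≤M = inj₂ (inj₁ ((ℕ.≤-refl , N≤M) , b))
    split xs (inj₂ b) | yes N≤M = inj₂ (inj₂ ((ℕ.≤-refl , N≤M) , b))

-- `g` and `h` are s/(8Δm) and s/(64Δ²) rounded up. `g` sets the tolerated excess m s g, of order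
-- s²/(8Δ). `A` is a variable tied to its value by an equation only, so that the numeral stays out
-- of the ring identities.
module ManySamples (m s Δ L : ℕ) .{{_ : NonZero m}} .{{_ : NonZero Δ}} .{{_ : NonZero L}}
  (s²≤4C : s ℕ.* s ℕ.≤ 4 ℕ.* (s C 2))
  (A : ℕ) (24*1024≡A : 24 ℕ.* 1024 ≡ A) (8A+4096≤A² : 8 ℕ.* A ℕ.+ 4096 ℕ.≤ A ℕ.* A)
  (large : A ℕ.* A ℕ.* (m ℕ.* (Δ ℕ.* Δ) ℕ.* (L ℕ.* L)) ℕ.≤ s ℕ.* s)
  (many : 64 ℕ.* L ℕ.* m ℕ.≤ s)
  (g h : ℕ) (s≤8Δmg : s ℕ.≤ 8 ℕ.* Δ ℕ.* m ℕ.* g) (8Δmg≤ : 8 ℕ.* Δ ℕ.* m ℕ.* g ℕ.≤ s ℕ.+ 8 ℕ.* Δ ℕ.* m) (1≤g : 1 ℕ.≤ g)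
  (s≤64Δ²h : s ℕ.≤ 64 ℕ.* (Δ ℕ.* Δ) ℕ.* h) (64Δ²h≤ : 64 ℕ.* (Δ ℕ.* Δ) ℕ.* h ℕ.≤ s ℕ.+ 64 ℕ.* (Δ ℕ.* Δ)) where

  private
    l Λ W : ℕ
    -- 48g pays for the growth 2Ws in `u-large`, and the product 48g · h yields 4W ≤ Λ², from which
    -- single increments are bounded.
    l = 48 ℕ.* g ℕ.+ h
    Λ = 4 ℕ.* Δ ℕ.* l
    W = s ℕ.+ 2 ℕ.* (s ℕ.* g)
    instance
      l≢0 : NonZero l
      l≢0 = ℕ.>-nonZero (ℕ.≤-trans 1≤g (ℕ.≤-trans (ℕ.m≤n*m g 48) (ℕ.m≤m+n (48 ℕ.* g) h)))
      4Δ≢0 : NonZero (4 ℕ.* Δ)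
      4Δ≢0 = ℕ.m*n≢0 4 Δ
      Λ≢0 : NonZero Λ
      Λ≢0 = ℕ.m*n≢0 (4 ℕ.* Δ) l

    open CollisionIncrements m
    open Deviation m Λ

    Good : ∀ {k} → Pred (Vec (Fin m) k) 0ℓ
    Good {k} xs = k ℕ.≤ s × m ℕ.* ∣collisions∣ xs ℕ.≤ k C 2 ℕ.+ m ℕ.* (s ℕ.* g)

    good? : ∀ {k} → Decidable (Good {k})
    good? {k} xs = (k ℕ.≤? s) ×-dec (_ ℕ.≤? _)

    -- 2 (k C 2) ≤ k² cancels the main part of 2mr; what remains for W is s and twice the tolerated
    -- excess s g.
    variance : ∀ {k} (xs : Vec (Fin m) k) → Good xs →
      m ℕ.* (k ℕ.+ 2 ℕ.* ∣collisions∣ xs) ℕ.≤ m ℕ.* W ℕ.+ k ℕ.* k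
    variance {k} xs (k≤s , r≤) = begin
      m ℕ.* (k ℕ.+ 2 ℕ.* ∣collisions∣ xs)
        ≡⟨ lem₁ m k (∣collisions∣ xs) ⟩
      m ℕ.* k ℕ.+ 2 ℕ.* (m ℕ.* ∣collisions∣ xs)
        ≤⟨ ℕ.+-mono-≤ (ℕ.*-monoʳ-≤ m k≤s) (ℕ.*-monoʳ-≤ 2 r≤) ⟩
      m ℕ.* s ℕ.+ 2 ℕ.* (k C 2 ℕ.+ m ℕ.* (s ℕ.* g))
        ≡⟨ lem₂ m s g (k C 2) ⟩
      m ℕ.* W ℕ.+ 2 ℕ.* (k C 2)
        ≤⟨ ℕ.+-monoʳ-≤ (m ℕ.* W) (subst (2 ℕ.* (k C 2) ℕ.≤_) (2*C2 k) (ℕ.m≤m+n _ k)) ⟩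
      m ℕ.* W ℕ.+ k ℕ.* k ∎
      where
      open ℕ.≤-Reasoning
      lem₁ : ∀ m k r → m ℕ.* (k ℕ.+ 2 ℕ.* r) ≡ m ℕ.* k ℕ.+ 2 ℕ.* (m ℕ.* r)
      lem₁ = ℕR.solve-∀
      lem₂ : ∀ m s g c → m ℕ.* s ℕ.+ 2 ℕ.* (c ℕ.+ m ℕ.* (s ℕ.* g)) ≡ m ℕ.* (s ℕ.+ 2 ℕ.* (s ℕ.* g)) ℕ.+ 2 ℕ.* c
      lem₂ = ℕR.solve-∀

    4W≤Λ² : 4 ℕ.* W ℕ.≤ Λ ℕ.* Λ
    4W≤Λ² = begin
      4 ℕ.* (s ℕ.+ 2 ℕ.* (s ℕ.* g))
        ≤⟨ ℕ.*-monoʳ-≤ 4 (ℕ.+-monoˡ-≤ (2 ℕ.* (s ℕ.* g)) (subst (ℕ._≤ s ℕ.* g) (ℕ.*-identityʳ s) (ℕ.*-monoʳ-≤ s 1≤g))) ⟩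
      4 ℕ.* (s ℕ.* g ℕ.+ 2 ℕ.* (s ℕ.* g))
        ≡⟨ lem₁ s g ⟩
      12 ℕ.* (g ℕ.* s)
        ≤⟨ ℕ.*-monoʳ-≤ 12 (ℕ.*-monoʳ-≤ g s≤64Δ²h) ⟩
      12 ℕ.* (g ℕ.* (64 ℕ.* (Δ ℕ.* Δ) ℕ.* h))
        ≡⟨ lem₂ g Δ h ⟩
      16 ℕ.* (Δ ℕ.* Δ) ℕ.* (48 ℕ.* g ℕ.* h)
        ≤⟨ ℕ.*-monoʳ-≤ (16 ℕ.* (Δ ℕ.* Δ)) (ℕ.*-mono-≤ (ℕ.m≤m+n (48 ℕ.* g) h) (ℕ.m≤n+m h (48 ℕ.* g))) ⟩
      16 ℕ.* (Δ ℕ.* Δ) ℕ.* (l ℕ.* l)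
        ≡⟨ lem₃ Δ l ⟩
      Λ ℕ.* Λ ∎
      where
      open ℕ.≤-Reasoning
      lem₁ : ∀ s g → 4 ℕ.* (s ℕ.* g ℕ.+ 2 ℕ.* (s ℕ.* g)) ≡ 12 ℕ.* (g ℕ.* s)
      lem₁ = ℕR.solve-∀
      lem₂ : ∀ g d h → 12 ℕ.* (g ℕ.* (64 ℕ.* (d ℕ.* d) ℕ.* h)) ≡ 16 ℕ.* (d ℕ.* d) ℕ.* (48 ℕ.* g ℕ.* h)
      lem₂ = ℕR.solve-∀
      lem₃ : ∀ d l → 16 ℕ.* (d ℕ.* d) ℕ.* (l ℕ.* l) ≡ 4 ℕ.* d ℕ.* l ℕ.* (4 ℕ.* d ℕ.* l)
      lem₃ = ℕR.solve-∀

    -- A single squared deviation is at most the sum of all of them.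
    bounded : ∀ {k} (xs : Vec (Fin m) k) → Good xs →
      ∀ x → 2 ℕ.* ℤ.∣ + (m ℕ.* occurrences x xs) ℤ.- + k ∣ ℕ.≤ m ℕ.* Λ
    bounded {k} xs good x = square-cancel-≤ (begin
      2 ℕ.* a ℕ.* (2 ℕ.* a)              ≡⟨ lem₁ a ⟩
      4 ℕ.* (a ℕ.* a)                    ≤⟨ ℕ.*-monoʳ-≤ 4 a²≤ ⟩
      4 ℕ.* (m ℕ.* (m ℕ.* W))            ≡⟨ lem₂ m W ⟩
      m ℕ.* m ℕ.* (4 ℕ.* W)              ≤⟨ ℕ.*-monoʳ-≤ (m ℕ.* m) 4W≤Λ² ⟩
      m ℕ.* m ℕ.* (Λ ℕ.* Λ)              ≡⟨ lem₃ m Λ ⟩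
      m ℕ.* Λ ℕ.* (m ℕ.* Λ)              ∎)
      where
      open ℕ.≤-Reasoning
      i = + (m ℕ.* occurrences x xs) ℤ.- + k
      a = ℤ.∣ i ∣
      z : Fin m → ℚ
      z y = fromℕ (m ℕ.* occurrences y xs) - fromℕ k
      lem₁ : ∀ a → 2 ℕ.* a ℕ.* (2 ℕ.* a) ≡ 4 ℕ.* (a ℕ.* a)
      lem₁ = ℕR.solve-∀
      lem₂ : ∀ m w → 4 ℕ.* (m ℕ.* (m ℕ.* w)) ≡ m ℕ.* m ℕ.* (4 ℕ.* w)
      lem₂ = ℕR.solve-∀
      lem₃ : ∀ m l → m ℕ.* m ℕ.* (l ℕ.* l) ≡ m ℕ.* l ℕ.* (m ℕ.* l)
      lem₃ = ℕR.solve-∀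
      +a²≡i² : + (a ℕ.* a) ≡ i ℤ.* i
      +a²≡i² with i
      ... | + n      = ℤ.pos-* n n
      ... | -[1+ n ] = refl
      a²≤ : a ℕ.* a ℕ.≤ m ℕ.* (m ℕ.* W)
      a²≤ = fromℕ-cancel-≤ (ℚ.≤-trans (ℚ.≤-reflexive
          (trans (cong fromℤ +a²≡i²) (trans (fromℤ-* i i) (cong (λ y → y * y) (fromℤ-m-n (m ℕ.* occurrences x xs) k)))))
        (ℚ.≤-trans (term≤sum (λ y → z y * z y) (λ y → 0≤x² (z y)) x)
        (ℚ.≤-trans (ℚ.≤-reflexive sum≡m𝔼)
        (ℚ.≤-trans (*-monoˡ-≤ (0≤fromℕ m) (𝔼z²≤ xs (variance xs good)))
          (ℚ.≤-reflexive (sym (fromℕ-* m (m ℕ.* W))))))))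
        where
        sum≡m𝔼 : sum (λ y → z y * z y) ≡ fromℕ m * (inv m * sum (λ y → z y * z y))
        sum≡m𝔼 = trans (sym (ℚ.*-identityˡ _)) (trans (cong (_* sum (λ y → z y * z y)) (sym (trans (ℚ.*-comm (fromℕ m) (inv m)) (inv-* m))))
          (ℚ.*-assoc (fromℕ m) (inv m) (sum (λ y → z y * z y))))

    ALΔ≤s : A ℕ.* (L ℕ.* Δ) ℕ.≤ s
    ALΔ≤s = square-cancel-≤ (ℕ.≤-trans (le A) large)
      where
      lem : ∀ a L d → a ℕ.* (L ℕ.* d) ℕ.* (a ℕ.* (L ℕ.* d)) ≡ a ℕ.* a ℕ.* (d ℕ.* d ℕ.* (L ℕ.* L))
      lem = ℕR.solve-∀
      le : ∀ a → a ℕ.* (L ℕ.* Δ) ℕ.* (a ℕ.* (L ℕ.* Δ)) ℕ.≤ a ℕ.* a ℕ.* (m ℕ.* (Δ ℕ.* Δ) ℕ.* (L ℕ.* L))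
      le a = subst (ℕ._≤ a ℕ.* a ℕ.* (m ℕ.* (Δ ℕ.* Δ) ℕ.* (L ℕ.* L))) (sym (lem a L Δ))
        (ℕ.*-monoʳ-≤ (a ℕ.* a) (ℕ.*-monoˡ-≤ (L ℕ.* L) (ℕ.m≤n*m (Δ ℕ.* Δ) m)))

    -- After multiplication by 4 the two parts of l contribute about ALΔ · s and 64Lm · s, each at
    -- most s², and rounding g and h adds a third s². The value of `A` arises here: 4 · 1024 · 48 /
    -- 8 = 24 · 1024.
    1024LmΔ²l≤s² : 1024 ℕ.* (L ℕ.* m ℕ.* (Δ ℕ.* Δ)) ℕ.* l ℕ.≤ s ℕ.* s
    1024LmΔ²l≤s² = ℕ.*-cancelˡ-≤ 4 (begin
      4 ℕ.* (1024 ℕ.* (L ℕ.* m ℕ.* (Δ ℕ.* Δ)) ℕ.* (48 ℕ.* g ℕ.+ h))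
        ≡⟨ lem₁ 1024 64 A L m Δ g h 24*1024≡A refl ⟩
      A ℕ.* (L ℕ.* Δ) ℕ.* (8 ℕ.* Δ ℕ.* m ℕ.* g) ℕ.+ 64 ℕ.* L ℕ.* m ℕ.* (64 ℕ.* (Δ ℕ.* Δ) ℕ.* h)
        ≤⟨ ℕ.+-mono-≤ (ℕ.*-monoʳ-≤ (A ℕ.* (L ℕ.* Δ)) 8Δmg≤) (ℕ.*-monoʳ-≤ (64 ℕ.* L ℕ.* m) 64Δ²h≤) ⟩
      A ℕ.* (L ℕ.* Δ) ℕ.* (s ℕ.+ 8 ℕ.* Δ ℕ.* m) ℕ.+ 64 ℕ.* L ℕ.* m ℕ.* (s ℕ.+ 64 ℕ.* (Δ ℕ.* Δ))
        ≡⟨ lem₂ A L m Δ s ⟩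
      A ℕ.* (L ℕ.* Δ) ℕ.* s ℕ.+ 64 ℕ.* L ℕ.* m ℕ.* s ℕ.+ (8 ℕ.* A ℕ.+ 4096) ℕ.* (m ℕ.* (Δ ℕ.* Δ) ℕ.* L)
        ≤⟨ ℕ.+-mono-≤ (ℕ.+-mono-≤ (ℕ.*-monoˡ-≤ s ALΔ≤s) (ℕ.*-monoˡ-≤ s many))
             (ℕ.≤-trans (ℕ.*-mono-≤ 8A+4096≤A² (ℕ.*-monoʳ-≤ (m ℕ.* (Δ ℕ.* Δ)) (ℕ.m≤m*n L L))) large) ⟩
      s ℕ.* s ℕ.+ s ℕ.* s ℕ.+ s ℕ.* s
        ≤⟨ ℕ.m≤m+n _ (s ℕ.* s) ⟩
      s ℕ.* s ℕ.+ s ℕ.* s ℕ.+ s ℕ.* s ℕ.+ s ℕ.* s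
        ≡⟨ lem₃ (s ℕ.* s) ⟩
      4 ℕ.* (s ℕ.* s) ∎)
      where
      open ℕ.≤-Reasoning
      lem₁′ : ∀ a L m d g h → 4 ℕ.* (a ℕ.* (L ℕ.* m ℕ.* (d ℕ.* d)) ℕ.* (48 ℕ.* g ℕ.+ h)) ≡
        24 ℕ.* a ℕ.* (L ℕ.* d ℕ.* (8 ℕ.* d ℕ.* m ℕ.* g)) ℕ.+ 4 ℕ.* a ℕ.* (L ℕ.* m ℕ.* (d ℕ.* d) ℕ.* h)
      lem₁′ = ℕR.solve-∀
      lem₁″ : ∀ A e L m d g h → A ℕ.* (L ℕ.* d ℕ.* (8 ℕ.* d ℕ.* m ℕ.* g)) ℕ.+ e ℕ.* e ℕ.* (L ℕ.* m ℕ.* (d ℕ.* d) ℕ.* h) ≡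
        A ℕ.* (L ℕ.* d) ℕ.* (8 ℕ.* d ℕ.* m ℕ.* g) ℕ.+ e ℕ.* L ℕ.* m ℕ.* (e ℕ.* (d ℕ.* d) ℕ.* h)
      lem₁″ = ℕR.solve-∀
      lem₁ : ∀ a e A L m d g h → 24 ℕ.* a ≡ A → 4 ℕ.* a ≡ e ℕ.* e →
        4 ℕ.* (a ℕ.* (L ℕ.* m ℕ.* (d ℕ.* d)) ℕ.* (48 ℕ.* g ℕ.+ h)) ≡
        A ℕ.* (L ℕ.* d) ℕ.* (8 ℕ.* d ℕ.* m ℕ.* g) ℕ.+ e ℕ.* L ℕ.* m ℕ.* (e ℕ.* (d ℕ.* d) ℕ.* h)
      lem₁ a e A L m d g h p q = trans (lem₁′ a L m d g h) (trans
        (cong₂ (λ x y → x ℕ.* (L ℕ.* d ℕ.* (8 ℕ.* d ℕ.* m ℕ.* g)) ℕ.+ y ℕ.* (L ℕ.* m ℕ.* (d ℕ.* d) ℕ.* h)) p q)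
        (lem₁″ A e L m d g h))
      lem₂ : ∀ a L m d s → a ℕ.* (L ℕ.* d) ℕ.* (s ℕ.+ 8 ℕ.* d ℕ.* m) ℕ.+ 64 ℕ.* L ℕ.* m ℕ.* (s ℕ.+ 64 ℕ.* (d ℕ.* d)) ≡
        a ℕ.* (L ℕ.* d) ℕ.* s ℕ.+ 64 ℕ.* L ℕ.* m ℕ.* s ℕ.+ (8 ℕ.* a ℕ.+ 4096) ℕ.* (m ℕ.* (d ℕ.* d) ℕ.* L)
      lem₂ = ℕR.solve-∀
      lem₃ : ∀ x → x ℕ.+ x ℕ.+ x ℕ.+ x ≡ 4 ℕ.* x
      lem₃ = ℕR.solve-∀

    -- Eight times the left side is at most 48g · s² + 1024LmΔ²l · l. Each summand is at most l s²,
    -- the first because 48g ≤ l, and 2l s² ≤ 8l (s C 2).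
    u-large : 2 ℕ.* W ℕ.* s ℕ.+ 8 ℕ.* L ℕ.* (m ℕ.* (Λ ℕ.* Λ)) ℕ.≤ l ℕ.* (s C 2)
    u-large = ℕ.*-cancelˡ-≤ 8 (begin
      8 ℕ.* (2 ℕ.* (s ℕ.+ 2 ℕ.* (s ℕ.* g)) ℕ.* s ℕ.+ 8 ℕ.* L ℕ.* (m ℕ.* (Λ ℕ.* Λ)))
        ≤⟨ ℕ.*-monoʳ-≤ 8 (ℕ.+-monoˡ-≤ (8 ℕ.* L ℕ.* (m ℕ.* (Λ ℕ.* Λ))) (ℕ.*-monoˡ-≤ s (ℕ.*-monoʳ-≤ 2 (ℕ.+-monoˡ-≤ (2 ℕ.* (s ℕ.* g)) (subst (ℕ._≤ s ℕ.* g) (ℕ.*-identityʳ s) (ℕ.*-monoʳ-≤ s 1≤g)))))) ⟩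
      8 ℕ.* (2 ℕ.* (s ℕ.* g ℕ.+ 2 ℕ.* (s ℕ.* g)) ℕ.* s ℕ.+ 8 ℕ.* L ℕ.* (m ℕ.* (Λ ℕ.* Λ)))
        ≡⟨ lem₁ s g L m Δ l ⟩
      48 ℕ.* g ℕ.* (s ℕ.* s) ℕ.+ 1024 ℕ.* (L ℕ.* m ℕ.* (Δ ℕ.* Δ)) ℕ.* l ℕ.* l
        ≤⟨ ℕ.+-mono-≤ (ℕ.*-monoˡ-≤ (s ℕ.* s) (ℕ.m≤m+n (48 ℕ.* g) h)) (ℕ.*-monoˡ-≤ l 1024LmΔ²l≤s²) ⟩
      l ℕ.* (s ℕ.* s) ℕ.+ s ℕ.* s ℕ.* l
        ≡⟨ lem₂ l (s ℕ.* s) ⟩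
      2 ℕ.* l ℕ.* (s ℕ.* s)
        ≤⟨ ℕ.*-monoʳ-≤ (2 ℕ.* l) s²≤4C ⟩
      2 ℕ.* l ℕ.* (4 ℕ.* (s C 2))
        ≡⟨ lem₃ l (s C 2) ⟩
      8 ℕ.* (l ℕ.* (s C 2)) ∎)
      where
      open ℕ.≤-Reasoning
      lem₁ : ∀ s g L m d l → 8 ℕ.* (2 ℕ.* (s ℕ.* g ℕ.+ 2 ℕ.* (s ℕ.* g)) ℕ.* s ℕ.+ 8 ℕ.* L ℕ.* (m ℕ.* (4 ℕ.* d ℕ.* l ℕ.* (4 ℕ.* d ℕ.* l)))) ≡
        48 ℕ.* g ℕ.* (s ℕ.* s) ℕ.+ 1024 ℕ.* (L ℕ.* m ℕ.* (d ℕ.* d)) ℕ.* l ℕ.* l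
      lem₁ = ℕR.solve-∀
      lem₂ : ∀ l x → l ℕ.* x ℕ.+ x ℕ.* l ≡ 2 ℕ.* l ℕ.* x
      lem₂ = ℕR.solve-∀
      lem₃ : ∀ l x → 2 ℕ.* l ℕ.* (4 ℕ.* x) ≡ 8 ℕ.* (l ℕ.* x)
      lem₃ = ℕR.solve-∀

    module Up = Stopped (uniform m) W excess excess[]≡0 good?
      (λ xs g → excess-growth xs (variance xs g) (bounded xs g))
    module Down = Stopped (uniform m) W deficit deficit[]≡0 good?
      (λ xs g → deficit-growth xs (variance xs g) (bounded xs g))

    u : ℕ
    u = l ℕ.* (s C 2)

    C≤4Δmsg : s C 2 ℕ.≤ 4 ℕ.* Δ ℕ.* (m ℕ.* (s ℕ.* g))
    C≤4Δmsg = ℕ.*-cancelˡ-≤ 2 (begin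
      2 ℕ.* (s C 2)                               ≤⟨ ℕ.m≤m+n (2 ℕ.* (s C 2)) s ⟩
      2 ℕ.* (s C 2) ℕ.+ s                         ≡⟨ 2*C2 s ⟩
      s ℕ.* s                                     ≤⟨ ℕ.*-monoʳ-≤ s s≤8Δmg ⟩
      s ℕ.* (8 ℕ.* Δ ℕ.* m ℕ.* g)                 ≡⟨ lem s Δ m g ⟩
      2 ℕ.* (4 ℕ.* Δ ℕ.* (m ℕ.* (s ℕ.* g)))       ∎)
      where
      open ℕ.≤-Reasoning
      lem : ∀ s d m g → s ℕ.* (8 ℕ.* d ℕ.* m ℕ.* g) ≡ 2 ℕ.* (4 ℕ.* d ℕ.* (m ℕ.* (s ℕ.* g)))
      lem = ℕR.solve-∀

    -- Leaving `Good` means an excess above m s g, which by the choice of g is at least the fraction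
    -- 1/(4Δ) of `s C 2`. Being stopped is thus itself an upper deviation, even when it happens
    -- before time s.
    exit : ∀ {k} (xs : Vec (Fin m) k) → k ℕ.≤ s → ¬ Good xs → + u ℤ.≤ + Λ ℤ.* excess xs
    exit {k} xs k≤s ¬good = ≤-gap u Λ (m ℕ.* ∣collisions∣ xs) (k C 2) (scale-gap Δ l (s C 2) (k C 2) _ (begin
      s C 2 ℕ.+ 4 ℕ.* Δ ℕ.* (k C 2)
        ≤⟨ ℕ.+-monoˡ-≤ (4 ℕ.* Δ ℕ.* (k C 2)) C≤4Δmsg ⟩
      4 ℕ.* Δ ℕ.* (m ℕ.* (s ℕ.* g)) ℕ.+ 4 ℕ.* Δ ℕ.* (k C 2)
        ≡⟨ lem Δ (m ℕ.* (s ℕ.* g)) (k C 2) ⟩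
      4 ℕ.* Δ ℕ.* (k C 2 ℕ.+ m ℕ.* (s ℕ.* g))
        ≤⟨ ℕ.*-monoʳ-≤ (4 ℕ.* Δ) (ℕ.<⇒≤ (ℕ.≰⇒> (λ r≤ → ¬good (k≤s , r≤)))) ⟩
      4 ℕ.* Δ ℕ.* (m ℕ.* ∣collisions∣ xs) ∎))
      where
      open ℕ.≤-Reasoning
      lem : ∀ d x y → 4 ℕ.* d ℕ.* x ℕ.+ 4 ℕ.* d ℕ.* y ≡ 4 ℕ.* d ℕ.* (y ℕ.+ x)
      lem = ℕR.solve-∀

    -- Goes back to the first bad prefix, whose value the stopped process has kept. There is one,
    -- because the empty sample is good.
    dead⇒u≤ : ∀ {k} (xs : Vec (Fin m) k) → k ℕ.≤ s → ¬ Always Good xs → + u ℤ.≤ + Λ ℤ.* Up.stopped xs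
    dead⇒u≤ []       _   dead = contradiction (ℕ.z≤n , subst (ℕ._≤ m ℕ.* (s ℕ.* g)) (sym (ℕ.*-zeroʳ m)) ℕ.z≤n) dead
    dead⇒u≤ (x ∷ xs) k≤s dead = go (always? good? xs)
      where
      go : Dec (Always Good xs) → + u ℤ.≤ + Λ ℤ.* Up.stopped (x ∷ xs)
      go (no dead′)  = subst (λ z → + u ℤ.≤ + Λ ℤ.* z) (sym (Up.stopped-dead x xs dead′))
        (dead⇒u≤ xs (ℕ.≤-trans (ℕ.n≤1+n _) k≤s) dead′)
      go (yes alive) = subst (λ z → + u ℤ.≤ + Λ ℤ.* z) (sym (Up.stopped-alive x xs alive))
        (exit (x ∷ xs) k≤s (λ good → dead (alive , good)))

  -- The upper tail of the stopped process also covers the event of having been stopped, so the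
  -- lower deviation need only be bounded on surviving samples.
  concentrated : Unlikely (repeat s (uniform m)) (Deviates m Δ) (½ ^ (8 ℕ.* L) + ½ ^ (8 ℕ.* L))
  concentrated = unlikely-mono sample split ℚ.≤-refl (unlikely-∪ sample
    (Up.stopped-tail {j = 8 ℕ.* L} {B = λ xs → ¬ Always Good xs ⊎ (Always Good xs × s C 2 ℕ.+ 4 ℕ.* Δ ℕ.* (s C 2) ℕ.≤ 4 ℕ.* Δ ℕ.* (m ℕ.* ∣collisions∣ xs))}
      u-large λ where
        xs (inj₁ dead)        → dead⇒u≤ xs ℕ.≤-refl dead
        xs (inj₂ (alive , b)) → subst (λ z → + u ℤ.≤ + Λ ℤ.* z) (sym (Up.alive⇒stopped≡Z xs alive))
          (≤-gap u Λ (m ℕ.* ∣collisions∣ xs) (s C 2) (scale-gap Δ l (s C 2) (s C 2) _ b)))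
    (Down.stopped-tail {j = 8 ℕ.* L} {B = λ xs → Always Good xs × s C 2 ℕ.+ 4 ℕ.* Δ ℕ.* (m ℕ.* ∣collisions∣ xs) ℕ.≤ 4 ℕ.* Δ ℕ.* (s C 2)}
      u-large λ xs (alive , b) → subst (λ z → + u ℤ.≤ + Λ ℤ.* z) (sym (Down.alive⇒stopped≡Z xs alive))
        (≤-gap u Λ (s C 2) (m ℕ.* ∣collisions∣ xs) (scale-gap Δ l (s C 2) _ (s C 2) b))))
    where
    sample = repeat s (uniform m)
    split : ∀ xs → Deviates m Δ xs →
      (¬ Always Good xs ⊎ (Always Good xs × s C 2 ℕ.+ 4 ℕ.* Δ ℕ.* (s C 2) ℕ.≤ 4 ℕ.* Δ ℕ.* (m ℕ.* ∣collisions∣ xs))) ⊎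
      (Always Good xs × s C 2 ℕ.+ 4 ℕ.* Δ ℕ.* (m ℕ.* ∣collisions∣ xs) ℕ.≤ 4 ℕ.* Δ ℕ.* (s C 2))
    split xs b with always? good? xs
    ... | no dead = inj₁ (inj₁ dead)
    split xs (inj₁ b) | yes alive = inj₁ (inj₂ (alive , b))
    split xs (inj₂ b) | yes alive = inj₂ (alive , b)

-- One bound for both regimes: the summand with the factor m is the union over edges made in
-- `FewSamples`, and is mere slack in `ManySamples`.
collisions-concentrated : ∀ m s Δ L A .{{_ : NonZero m}} .{{_ : NonZero Δ}} .{{_ : NonZero L}} → 24 ℕ.* 1024 ≡ A →
  2 ℕ.≤ s → A ℕ.* A ℕ.* (m ℕ.* (Δ ℕ.* Δ) ℕ.* (L ℕ.* L)) ℕ.≤ s ℕ.* s →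
  Unlikely (repeat s (uniform m)) (Deviates m Δ) (fromℕ m * ½ ^ (8 ℕ.* L) + (½ ^ (8 ℕ.* L) + ½ ^ (8 ℕ.* L)))
collisions-concentrated m s Δ L A eq 2≤s large = go (ℕ.≤-total s (64 ℕ.* L ℕ.* m))
  where
  s²≤4C : s ℕ.* s ℕ.≤ 4 ℕ.* (s C 2)
  s²≤4C = square≤4C 2≤s
  FewSamples-constant≤A² : 64 ℕ.* (16 ℕ.* 16) ℕ.* 144 ℕ.≤ A ℕ.* A
  FewSamples-constant≤A² = subst (λ a → 64 ℕ.* (16 ℕ.* 16) ℕ.* 144 ℕ.≤ a ℕ.* a) eq (ℕ.≤ᵇ⇒≤ (64 ℕ.* (16 ℕ.* 16) ℕ.* 144) (24 ℕ.* 1024 ℕ.* (24 ℕ.* 1024)) tt)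
  8A+4096≤A² : 8 ℕ.* A ℕ.+ 4096 ℕ.≤ A ℕ.* A
  8A+4096≤A² = subst (λ a → 8 ℕ.* a ℕ.+ 4096 ℕ.≤ a ℕ.* a) eq (ℕ.≤ᵇ⇒≤ (8 ℕ.* (24 ℕ.* 1024) ℕ.+ 4096) (24 ℕ.* 1024 ℕ.* (24 ℕ.* 1024)) tt)
  0≤½^ : 0ℚ ≤ fromℕ m * ½ ^ (8 ℕ.* L)
  0≤½^ = *-nonNeg (0≤fromℕ m) (^-nonNeg (8 ℕ.* L) (ℚ.nonNegative⁻¹ ½))
  go : s ℕ.≤ 64 ℕ.* L ℕ.* m ⊎ 64 ℕ.* L ℕ.* m ℕ.≤ s →
    Unlikely (repeat s (uniform m)) (Deviates m Δ) (fromℕ m * ½ ^ (8 ℕ.* L) + (½ ^ (8 ℕ.* L) + ½ ^ (8 ℕ.* L)))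
  go (inj₁ few)  = FewSamples.concentrated m s Δ L s²≤4C
    (ℕ.≤-trans (ℕ.*-monoˡ-≤ (m ℕ.* (Δ ℕ.* Δ) ℕ.* (L ℕ.* L)) FewSamples-constant≤A²) large) few
  go (inj₂ many) with ceiling-quotient s (8 ℕ.* Δ ℕ.* m) {{ℕ.m*n≢0 (8 ℕ.* Δ) m {{ℕ.m*n≢0 8 Δ}}}}
                    | ceiling-quotient s (64 ℕ.* (Δ ℕ.* Δ)) {{ℕ.m*n≢0 64 (Δ ℕ.* Δ) {{_}} {{ℕ.m*n≢0 Δ Δ}}}}
  ... | g , s≤g , g≤ , 1≤g | h , s≤h , h≤ , _ = unlikely-mono (repeat s (uniform m)) (λ _ b → b)
    (≤-by 0≤½^ (ℚ.+-comm (fromℕ m * ½ ^ (8 ℕ.* L)) (½ ^ (8 ℕ.* L) + ½ ^ (8 ℕ.* L))))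
    (ManySamples.concentrated m s Δ L s²≤4C A eq 8A+4096≤A² large many g h s≤g g≤ 1≤g s≤h h≤)

-- The collision test

has-no-collision : ∀ {m k} (xs : Vec (Fin m) k) → Unique xs → ∣collisions∣ xs ≡ 0
has-no-collision []       _            = refl
has-no-collision (x ∷ xs) (x∉xs ∷ xs!) = cong₂ ℕ._+_ (absent xs x∉xs) (has-no-collision xs xs!)
  where
  absent : ∀ {k} (xs : Vec _ k) → VecAll.All (x ≢_) xs → occurrences x xs ≡ 0
  absent []       _               = refl
  absent (y ∷ ys) (x≢y ∷ x∉ys) = trans (count-∷ (x Fin.≟_) y ys)
    (cong₂ ℕ._+_ (cong ⟦_⟧ (dec-false (x Fin.≟ y) x≢y)) (absent ys x∉ys))

no-collision⇒unique : ∀ {m k} (xs : Vec (Fin m) k) → ∣collisions∣ xs ≡ 0 → Unique xs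
no-collision⇒unique []       _   = []
no-collision⇒unique (x ∷ xs) r≡0 = absent xs (ℕ.m+n≡0⇒m≡0 (occurrences x xs) r≡0) ∷
  no-collision⇒unique xs (ℕ.m+n≡0⇒n≡0 (occurrences x xs) r≡0)
  where
  absent : ∀ {k} (xs : Vec _ k) → occurrences x xs ≡ 0 → VecAll.All (x ≢_) xs
  absent []       _   = []
  absent (y ∷ ys) N≡0 = differs ∷ absent ys (ℕ.m+n≡0⇒n≡0 ⟦ does (x Fin.≟ y) ⟧ N≡0′)
    where
    N≡0′ = trans (sym (count-∷ (x Fin.≟_) y ys)) N≡0
    differs : x ≢ y
    differs x≡y with trans (sym (cong ⟦_⟧ (dec-true (x Fin.≟ y) x≡y))) (ℕ.m+n≡0⇒m≡0 ⟦ does (x Fin.≟ y) ⟧ N≡0′)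
    ... | ()

unique? : ∀ {m k} → Decidable (Unique {A = Fin m} {k})
unique? = allPairs? λ x y → ¬? (x Fin.≟ y)

module _ (m : ℕ) .{{_ : NonZero m}} where

  open CollisionIncrements m using (𝔼N)

  private
    q = fromℕ m
    c = uniform m

  𝔼-collisions : ∀ k → q * 𝔼 (repeat k c) (fromℕ ∘ ∣collisions∣) ≡ fromℕ (k C 2)
  𝔼-collisions zero    = ℚ.*-zeroʳ q
  𝔼-collisions (suc k) = begin
    q * 𝔼 (repeat (suc k) c) (fromℕ ∘ ∣collisions∣)
      ≡⟨ cong (q *_) (𝔼-repeat k c (fromℕ ∘ ∣collisions∣)) ⟩
    q * 𝔼 (repeat k c) (λ xs → 𝔼 c (λ x → fromℕ (∣collisions∣ (x ∷ xs))))
      ≡⟨ sym (𝔼-* (repeat k c) q _) ⟩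
    𝔼 (repeat k c) (λ xs → q * 𝔼 c (λ x → fromℕ (∣collisions∣ (x ∷ xs))))
      ≡⟨ 𝔼-cong (repeat k c) step ⟩
    𝔼 (repeat k c) (λ xs → fromℕ k + q * fromℕ (∣collisions∣ xs))
      ≡⟨ trans (𝔼-+ (repeat k c) (λ _ → fromℕ k) (λ xs → q * fromℕ (∣collisions∣ xs))) (cong₂ _+_ (𝔼-const (repeat k c) (fromℕ k)) (trans (𝔼-* (repeat k c) q (fromℕ ∘ ∣collisions∣)) (𝔼-collisions k))) ⟩
    fromℕ k + fromℕ (k C 2)
      ≡⟨ trans (sym (fromℕ-+ k (k C 2))) (cong fromℕ (sym (suc-C-2 k))) ⟩
    fromℕ (suc k C 2) ∎
    where
    open ≡-Reasoning
    step : ∀ xs → q * 𝔼 c (λ x → fromℕ (∣collisions∣ (x ∷ xs))) ≡ fromℕ k + q * fromℕ (∣collisions∣ xs)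
    step xs = begin
      q * 𝔼 c (λ x → fromℕ (occurrences x xs ℕ.+ ∣collisions∣ xs))
        ≡⟨ cong (q *_) (trans (𝔼-cong c (λ x → fromℕ-+ (occurrences x xs) (∣collisions∣ xs)))
             (trans (𝔼-+ c (λ x → fromℕ (occurrences x xs)) (λ _ → fromℕ (∣collisions∣ xs)))
               (cong (λ z → 𝔼 c (λ x → fromℕ (occurrences x xs)) + z) (𝔼-const c (fromℕ (∣collisions∣ xs)))))) ⟩
      q * (𝔼 c (λ x → fromℕ (occurrences x xs)) + fromℕ (∣collisions∣ xs))
        ≡⟨ ℚ.*-distribˡ-+ q _ _ ⟩
      q * 𝔼 c (λ x → fromℕ (occurrences x xs)) + q * fromℕ (∣collisions∣ xs)
        ≡⟨ cong (_+ q * fromℕ (∣collisions∣ xs)) (𝔼N xs) ⟩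
      fromℕ k + q * fromℕ (∣collisions∣ xs) ∎

  isZero : ℕ → ℚ
  isZero zero    = 1ℚ
  isZero (suc _) = 0ℚ

  0≤isZero : ∀ n → 0ℚ ≤ isZero n
  0≤isZero zero    = ℚ.nonNegative⁻¹ 1ℚ
  0≤isZero (suc _) = ℚ.≤-refl

  no-collision⇒occurrences≤1 : ∀ {k} x (xs : Vec (Fin m) k) → ∣collisions∣ xs ≡ 0 → occurrences x xs ℕ.≤ 1
  no-collision⇒occurrences≤1 x []       _ = ℕ.z≤n
  no-collision⇒occurrences≤1 x (y ∷ ys) r≡0 with x Fin.≟ y
  ... | yes refl = ℕ.s≤s (ℕ.≤-reflexive (ℕ.m+n≡0⇒m≡0 (occurrences x ys) r≡0))
  ... | no _     = no-collision⇒occurrences≤1 x ys (ℕ.m+n≡0⇒n≡0 (occurrences y ys) r≡0)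

  -- With an earlier collision both sides vanish. Without one the multiplicity N of x is 0 or 1, and
  -- 1 - N is exactly the indicator that x is new; being affine in N, it has a computable mean.
  isZero-∷ : ∀ {k} x (xs : Vec (Fin m) k) →
    isZero (∣collisions∣ (x ∷ xs)) ≤ isZero (∣collisions∣ xs) * (1ℚ - fromℕ (occurrences x xs))
  isZero-∷ x xs = go (∣collisions∣ xs) (occurrences x xs) (no-collision⇒occurrences≤1 x xs)
    where
    go : ∀ r N → (r ≡ 0 → N ℕ.≤ 1) → isZero (N ℕ.+ r) ≤ isZero r * (1ℚ - fromℕ N)
    go (suc r) N _ = subst (λ k → isZero k ≤ 0ℚ * (1ℚ - fromℕ N)) (sym (ℕ.+-suc N r))
      (ℚ.≤-reflexive (sym (ℚ.*-zeroˡ (1ℚ - fromℕ N))))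
    go zero zero          _   = ℚ.≤-refl
    go zero (suc zero)    _   = ℚ.≤-refl
    go zero (suc (suc N)) N≤1 with N≤1 refl
    ... | ℕ.s≤s ()

  -- ∏ (1 - i/m) ≤ 1 / ∏ (1 + i/m) ≤ 1 / (1 + Σ i/m)
  𝔼-no-collision : ∀ k → 𝔼 (repeat k c) (isZero ∘ ∣collisions∣) * (q + fromℕ (k C 2)) ≤ q
  𝔼-no-collision zero    = ℚ.≤-reflexive (trans (ℚ.*-identityˡ (q + 0ℚ)) (ℚ.+-identityʳ q))
  𝔼-no-collision (suc k) = *-cancelˡ-≤ {q} (ℚ.positive⁻¹ q {{ℚ.normalize-pos m 1}}) (begin
    q * (p′ * (q + fromℕ (suc k C 2)))       ≡⟨ trans (sym (ℚ.*-assoc q p′ _)) (cong (λ z → q * p′ * (q + z)) (trans (cong fromℕ (suc-C-2 k)) (fromℕ-+ k (k C 2)))) ⟩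
    q * p′ * (q + (K + B))                   ≤⟨ *-monoʳ-≤ (+-nonNeg (0≤fromℕ m) (+-nonNeg (0≤fromℕ k) (0≤fromℕ (k C 2)))) qp′≤ ⟩
    p * (q - K) * (q + (K + B))              ≤⟨ ≤-by (*-nonNeg 0≤p (+-nonNeg (0≤x² K) (*-nonNeg (0≤fromℕ k) (0≤fromℕ (k C 2))))) (lem p q K B) ⟩
    p * (q + B) * q                          ≤⟨ *-monoʳ-≤ (0≤fromℕ m) (𝔼-no-collision k) ⟩
    q * q                                    ∎)
    where
    open ℚ.≤-Reasoning
    p p′ K B : ℚ
    p = 𝔼 (repeat k c) (isZero ∘ ∣collisions∣)
    p′ = 𝔼 (repeat (suc k) c) (isZero ∘ ∣collisions∣)
    K = fromℕ k
    B = fromℕ (k C 2)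
    0≤p : 0ℚ ≤ p
    0≤p = ℚ.≤-trans (ℚ.≤-reflexive (sym (𝔼-const (repeat k c) 0ℚ))) (𝔼-mono (repeat k c) (0≤isZero ∘ ∣collisions∣))
    lem : ∀ p q k b → p * (q + b) * q ≡ p * (q - k) * (q + (k + b)) + p * (k * k + k * b)
    lem = solve-∀ ℚ-ring
    qp′≤ : q * p′ ≤ p * (q - K)
    qp′≤ = begin
      q * p′
        ≡⟨ cong (q *_) (𝔼-repeat k c (isZero ∘ ∣collisions∣)) ⟩
      q * 𝔼 (repeat k c) (λ xs → 𝔼 c (λ x → isZero (∣collisions∣ (x ∷ xs))))
        ≤⟨ *-monoˡ-≤ (0≤fromℕ m) (𝔼-mono (repeat k c) (λ xs → 𝔼-mono c (λ x → isZero-∷ x xs))) ⟩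
      q * 𝔼 (repeat k c) (λ xs → 𝔼 c (λ x → isZero (∣collisions∣ xs) * (1ℚ - fromℕ (occurrences x xs))))
        ≡⟨ sym (𝔼-* (repeat k c) q _) ⟩
      𝔼 (repeat k c) (λ xs → q * 𝔼 c (λ x → isZero (∣collisions∣ xs) * (1ℚ - fromℕ (occurrences x xs))))
        ≡⟨ 𝔼-cong (repeat k c) step ⟩
      𝔼 (repeat k c) (λ xs → (q - K) * isZero (∣collisions∣ xs))
        ≡⟨ trans (𝔼-* (repeat k c) (q - K) (isZero ∘ ∣collisions∣)) (ℚ.*-comm (q - K) p) ⟩
      p * (q - K) ∎
      where
      lem₁ : ∀ z n → z * (1ℚ - n) ≡ z + (- z) * n
      lem₁ = solve-∀ ℚ-ring
      lem₂ : ∀ q z e → q * (z + (- z) * e) ≡ (q - q * e) * z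
      lem₂ = solve-∀ ℚ-ring
      step : ∀ xs → q * 𝔼 c (λ x → isZero (∣collisions∣ xs) * (1ℚ - fromℕ (occurrences x xs))) ≡ (q - K) * isZero (∣collisions∣ xs)
      step xs = begin-equality
        q * 𝔼 c (λ x → z * (1ℚ - N x))           ≡⟨ cong (q *_) (𝔼-cong c (λ x → lem₁ z (N x))) ⟩
        q * 𝔼 c (λ x → z + (- z) * N x)          ≡⟨ cong (q *_) (trans (𝔼-+ c (λ _ → z) (λ x → (- z) * N x)) (cong₂ _+_ (𝔼-const c z) (𝔼-* c (- z) N))) ⟩
        q * (z + (- z) * 𝔼 c N)                  ≡⟨ lem₂ q z (𝔼 c N) ⟩
        (q - q * 𝔼 c N) * z                      ≡⟨ cong (λ y → (q - y) * z) (𝔼N xs) ⟩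
        (q - K) * z                              ∎
        where
        z = isZero (∣collisions∣ xs)
        N : Fin m → ℚ
        N x = fromℕ (occurrences x xs)

  -- Markov's inequality: a collision means r ≥ 1, and m 𝔼r = `k C 2`.
  collision-probability : ∀ k → 4 ℕ.* (k C 2) ℕ.≤ m → 𝔼 (repeat k c) (λ xs → fromℕ ⟦ not (does (unique? xs)) ⟧) ≤ + 1 / 4
  collision-probability k 4C≤m = *-cancelˡ-≤ {fromℕ 4 * q} (*-pos (ℚ.positive⁻¹ (fromℕ 4)) (ℚ.positive⁻¹ q {{ℚ.normalize-pos m 1}})) (begin
    fromℕ 4 * q * 𝔼 (repeat k c) (λ xs → fromℕ ⟦ not (does (unique? xs)) ⟧)
      ≤⟨ *-monoˡ-≤ (*-nonNeg (0≤fromℕ 4) (0≤fromℕ m)) (𝔼-mono (repeat k c) pointwise) ⟩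
    fromℕ 4 * q * 𝔼 (repeat k c) (fromℕ ∘ ∣collisions∣)
      ≡⟨ trans (ℚ.*-assoc (fromℕ 4) q _) (cong (fromℕ 4 *_) (𝔼-collisions k)) ⟩
    fromℕ 4 * fromℕ (k C 2)
      ≡⟨ sym (fromℕ-* 4 (k C 2)) ⟩
    fromℕ (4 ℕ.* (k C 2))
      ≤⟨ fromℕ-mono-≤ 4C≤m ⟩
    q
      ≡⟨ trans (sym (ℚ.*-identityˡ q)) (trans (ℚ.*-assoc (+ 1 / 4) (fromℕ 4) q) (ℚ.*-comm (+ 1 / 4) (fromℕ 4 * q))) ⟩
    fromℕ 4 * q * (+ 1 / 4) ∎)
    where
    open ℚ.≤-Reasoning
    pointwise : ∀ xs → fromℕ ⟦ not (does (unique? xs)) ⟧ ≤ fromℕ (∣collisions∣ xs)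
    pointwise xs = go (unique? xs)
      where
      go : (u? : Dec (Unique xs)) → fromℕ ⟦ not (does u?) ⟧ ≤ fromℕ (∣collisions∣ xs)
      go (yes _) = 0≤fromℕ (∣collisions∣ xs)
      go (no ¬u) = fromℕ-mono-≤ (ℕ.n≢0⇒n>0 (λ r≡0 → ¬u (no-collision⇒unique xs r≡0)))

  -- `𝔼-no-collision` bounds the probability by m / (m + k C 2), which is 1/4 at `k C 2` = 3m.
  no-collision-probability : ∀ k → 3 ℕ.* m ℕ.≤ k C 2 → 𝔼 (repeat k c) (λ xs → fromℕ ⟦ not (not (does (unique? xs))) ⟧) ≤ + 1 / 4
  no-collision-probability k 3m≤C = *-cancelˡ-≤ {fromℕ 4 * q} (*-pos (ℚ.positive⁻¹ (fromℕ 4)) (ℚ.positive⁻¹ q {{ℚ.normalize-pos m 1}})) (begin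
    fromℕ 4 * q * 𝔼 (repeat k c) (λ xs → fromℕ ⟦ not (not (does (unique? xs))) ⟧)
      ≤⟨ *-monoˡ-≤ (*-nonNeg (0≤fromℕ 4) (0≤fromℕ m)) (𝔼-mono (repeat k c) pointwise) ⟩
    fromℕ 4 * q * p
      ≡⟨ lem₁ q p ⟩
    p * (q + fromℕ 3 * q)
      ≡⟨ cong (λ z → p * (q + z)) (sym (fromℕ-* 3 m)) ⟩
    p * (q + fromℕ (3 ℕ.* m))
      ≤⟨ *-monoˡ-≤ 0≤p (ℚ.+-monoʳ-≤ q (fromℕ-mono-≤ 3m≤C)) ⟩
    p * (q + fromℕ (k C 2))
      ≤⟨ 𝔼-no-collision k ⟩
    q
      ≡⟨ trans (sym (ℚ.*-identityˡ q)) (trans (ℚ.*-assoc (+ 1 / 4) (fromℕ 4) q) (ℚ.*-comm (+ 1 / 4) (fromℕ 4 * q))) ⟩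
    fromℕ 4 * q * (+ 1 / 4) ∎)
    where
    open ℚ.≤-Reasoning
    p = 𝔼 (repeat k c) (isZero ∘ ∣collisions∣)
    0≤p : 0ℚ ≤ p
    0≤p = ℚ.≤-trans (ℚ.≤-reflexive (sym (𝔼-const (repeat k c) 0ℚ))) (𝔼-mono (repeat k c) (0≤isZero ∘ ∣collisions∣))
    lem₁ : ∀ q p → fromℕ 4 * q * p ≡ p * (q + fromℕ 3 * q)
    lem₁ = solve-∀ ℚ-ring
    pointwise : ∀ xs → fromℕ ⟦ not (not (does (unique? xs))) ⟧ ≤ isZero (∣collisions∣ xs)
    pointwise xs = go (unique? xs)
      where
      go : (u? : Dec (Unique xs)) → fromℕ ⟦ not (not (does u?)) ⟧ ≤ isZero (∣collisions∣ xs)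
      go (no _)  = 0≤isZero (∣collisions∣ xs)
      go (yes u) = ℚ.≤-reflexive (cong isZero (sym (has-no-collision xs u)))

-- Markov's inequality for 4^wrong: a round multiplies its mean by at most 1 + 3/4, while N/2 wrong
-- rounds make it 2^N. So failure has probability at most (7/8)^N, and (7/8)^6 ≤ 1/2 explains six
-- rounds per halving.
majority : ∀ (c : Rand Bool) (wrong : Bool → Bool) → 𝔼 c (λ b → fromℕ ⟦ wrong b ⟧) ≤ + 1 / 4 →
  ∀ N j → 6 ℕ.* j ℕ.≤ N → Unlikely (repeat N c) (λ ks → N ℕ.≤ 2 ℕ.* total (⟦_⟧ ∘ wrong) ks) (½ ^ j)
majority c wrong p≤¼ N j 6j≤N = unlikely-mono (repeat N c) (λ _ b → b) (begin
  𝔼 (repeat N c) (λ ks → ½ ^ N * Φ ks)   ≡⟨ 𝔼-* (repeat N c) (½ ^ N) Φ ⟩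
  ½ ^ N * 𝔼 (repeat N c) Φ               ≤⟨ *-monoˡ-≤ (^-nonNeg N (ℚ.nonNegative⁻¹ ½)) (supermartingale c Φ (ℚ.nonNegative⁻¹ 7/4) step N) ⟩
  ½ ^ N * (7/4 ^ N * 1ℚ)                 ≡⟨ trans (cong (½ ^ N *_) (ℚ.*-identityʳ (7/4 ^ N))) (sym (*-^ ½ 7/4 N)) ⟩
  (½ * 7/4) ^ N                          ≤⟨ ^-antimonoʳ-≤ (ℚ.nonNegative⁻¹ (½ * 7/4)) (ℚ.≤ᵇ⇒≤ {½ * 7/4} {1ℚ} tt) 6j≤N ⟩
  (½ * 7/4) ^ (6 ℕ.* j)                  ≡⟨ trans (cong ((½ * 7/4) ^_) (ℕ.*-comm 6 j)) (^-* (½ * 7/4) j 6) ⟩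
  ((½ * 7/4) ^ 6) ^ j                    ≤⟨ ^-mono-≤ j (ℚ.nonNegative⁻¹ ((½ * 7/4) ^ 6)) (ℚ.≤ᵇ⇒≤ {(½ * 7/4) ^ 6} {½} tt) ⟩
  ½ ^ j                                  ∎)
  (markov (repeat N c) (λ ks → ½ ^ N * Φ ks) (λ ks → *-nonNeg (^-nonNeg N (ℚ.nonNegative⁻¹ ½)) (0≤Φ ks)) λ ks N≤ → begin
    1ℚ                                              ≡⟨ sym (1^ N) ⟩
    (½ * fromℕ 2) ^ N                               ≡⟨ *-^ ½ (fromℕ 2) N ⟩
    ½ ^ N * fromℕ 2 ^ N                             ≤⟨ *-monoˡ-≤ (^-nonNeg N (ℚ.nonNegative⁻¹ ½)) (^-monoʳ-≤ (ℚ.≤ᵇ⇒≤ {1ℚ} {fromℕ 2} tt) N≤) ⟩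
    ½ ^ N * fromℕ 2 ^ (2 ℕ.* total (⟦_⟧ ∘ wrong) ks) ≡⟨ cong (½ ^ N *_) (trans (cong (fromℕ 2 ^_) (ℕ.*-comm 2 (total (⟦_⟧ ∘ wrong) ks))) (^-* (fromℕ 2) (total (⟦_⟧ ∘ wrong) ks) 2)) ⟩
    ½ ^ N * Φ ks                                    ∎)
  where
  open ℚ.≤-Reasoning
  7/4 : ℚ
  7/4 = + 7 / 4
  Φ : ∀ {k} → Vec Bool k → ℚ
  Φ ks = fromℕ 4 ^ total (⟦_⟧ ∘ wrong) ks
  0≤Φ : ∀ {k} (ks : Vec Bool k) → 0ℚ ≤ Φ ks
  0≤Φ ks = ^-nonNeg (total (⟦_⟧ ∘ wrong) ks) (0≤fromℕ 4)
  1^ : ∀ k → 1ℚ ^ k ≡ 1ℚ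
  1^ zero    = refl
  1^ (suc k) = trans (ℚ.*-identityˡ (1ℚ ^ k)) (1^ k)
  step : ∀ {k} (ks : Vec Bool k) → 𝔼 c (λ b → Φ (b ∷ ks)) ≤ 7/4 * Φ ks
  step ks = begin
    𝔼 c (λ b → Φ (b ∷ ks))                                ≡⟨ 𝔼-cong c pointwise ⟩
    𝔼 c (λ b → Φ ks * (1ℚ + fromℕ 3 * fromℕ ⟦ wrong b ⟧)) ≡⟨ trans (𝔼-* c (Φ ks) _) (cong (Φ ks *_) (trans (𝔼-+ c (λ _ → 1ℚ) _) (cong₂ _+_ (𝔼-const c 1ℚ) (𝔼-* c (fromℕ 3) _)))) ⟩
    Φ ks * (1ℚ + fromℕ 3 * 𝔼 c (λ b → fromℕ ⟦ wrong b ⟧)) ≤⟨ *-monoˡ-≤ (0≤Φ ks) (ℚ.+-monoʳ-≤ 1ℚ (*-monoˡ-≤ (0≤fromℕ 3) p≤¼)) ⟩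
    Φ ks * (1ℚ + fromℕ 3 * (+ 1 / 4))                     ≡⟨ ℚ.*-comm (Φ ks) 7/4 ⟩
    7/4 * Φ ks                                            ∎
    where
    pointwise : ∀ b → Φ (b ∷ ks) ≡ Φ ks * (1ℚ + fromℕ 3 * fromℕ ⟦ wrong b ⟧)
    pointwise b = bools (wrong b) (total (⟦_⟧ ∘ wrong) ks)
      where
      bools : ∀ b k → fromℕ 4 ^ (⟦ b ⟧ ℕ.+ k) ≡ fromℕ 4 ^ k * (1ℚ + fromℕ 3 * fromℕ ⟦ b ⟧)
      bools true  k = ℚ.*-comm (fromℕ 4) (fromℕ 4 ^ k)
      bools false k = sym (ℚ.*-identityʳ (fromℕ 4 ^ k))

-- Ceilings, square roots and logarithms

floor-≤ : ∀ p → fromℤ (ℚ.floor p) ≤ p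
floor-≤ p@record{} = subst (_≤ p) (sym (fromℤ≡mkℚ (ℚ.floor p)))
  (*≤* (subst (ℚ.floor p ℤ.* ℚ.↧ p ℤ.≤_) (sym (ℤ.*-identityʳ (ℚ.↥ p))) (ℤ.[n/d]*d≤n (ℚ.↥ p) (ℚ.↧ p))))

≤-ceiling : ∀ p → p ≤ fromℤ (ℚ.ceiling p)
≤-ceiling p@record{} = begin
  p                                   ≡⟨ lem p ⟩
  - (- p)                             ≤⟨ ℚ.neg-antimono-≤ (floor-≤ (- p)) ⟩
  - fromℤ (ℚ.floor (- p))             ≡⟨ sym (fromℤ-neg (ℚ.floor (- p))) ⟩
  fromℤ (ℤ.- ℚ.floor (- p))           ∎
  where
  open ℚ.≤-Reasoning
  lem : ∀ p → p ≡ - (- p)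
  lem = solve-∀ ℚ-ring

≤-∣ceiling∣ : ∀ p → p ≤ fromℕ ℤ.∣ ℚ.ceiling p ∣
≤-∣ceiling∣ p = ℚ.≤-trans (≤-ceiling p) (fromℤ-mono-≤ (i≤∣i∣ (ℚ.ceiling p)))
  where
  i≤∣i∣ : ∀ i → i ℤ.≤ + ℤ.∣ i ∣
  i≤∣i∣ (+ n)    = ℤ.≤-refl
  i≤∣i∣ -[1+ n ] = ℤ.-≤+

-- `least` returns its bound b without testing it, so P b must be supplied.
least-holds : ∀ {P : Pred ℕ 0ℓ} (P? : Decidable P) b → P b → P (least P? b)
least-holds P? zero    Pb = Pb
least-holds P? (suc b) Pb with P? 0
... | yes P0 = P0
... | no _   = least-holds (P? ∘ suc) b Pb

least-≤ : ∀ {P : Pred ℕ 0ℓ} (P? : Decidable P) b {k} → P k → least P? b ℕ.≤ k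
least-≤ P? zero    Pk = ℕ.z≤n
least-≤ P? (suc b) {k} Pk with P? 0
... | yes _ = ℕ.z≤n
least-≤ P? (suc b) {zero}  Pk | no ¬P0 = contradiction Pk ¬P0
least-≤ P? (suc b) {suc k} Pk | no _   = ℕ.s≤s (least-≤ (P? ∘ suc) b Pk)

fromℕ-square : ∀ k → fromℕ k ^ 2 ≡ fromℕ (k ℕ.* k)
fromℕ-square k = trans (cong (fromℕ k *_) (ℚ.*-identityʳ (fromℕ k))) (sym (fromℕ-* k k))

√-holds : ∀ x y → x ^ 2 * y ≤ fromℕ ⌈ x √ y ⌉ ^ 2
√-holds x y = least-holds (λ k → x ^ 2 * y ℚ.≤? fromℕ k ^ 2) b (begin
  x ^ 2 * y           ≤⟨ ≤-∣ceiling∣ (x ^ 2 * y) ⟩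
  fromℕ b             ≤⟨ fromℕ-mono-≤ (b≤b² b) ⟩
  fromℕ (b ℕ.* b)     ≡⟨ sym (fromℕ-square b) ⟩
  fromℕ b ^ 2         ∎)
  where
  open ℚ.≤-Reasoning
  b = ℤ.∣ ℚ.ceiling (x ^ 2 * y) ∣
  b≤b² : ∀ b → b ℕ.≤ b ℕ.* b
  b≤b² zero    = ℕ.z≤n
  b≤b² (suc b) = ℕ.m≤m*n (suc b) (suc b)

√-≤ : ∀ x y {k} → x ^ 2 * y ≤ fromℕ k ^ 2 → ⌈ x √ y ⌉ ℕ.≤ k
√-≤ x y = least-≤ (λ k → x ^ 2 * y ℚ.≤? fromℕ k ^ 2) ℤ.∣ ℚ.ceiling (x ^ 2 * y) ∣

log-holds : ∀ γ .{{_ : Positive γ}} n → fromℕ n ≤ (1ℚ + γ) ^ ⌈log[1+ γ ] n ⌉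
log-holds γ n = least-holds (λ i → fromℕ n ℚ.≤? (1ℚ + γ) ^ i) b (begin
  fromℕ n                       ≡⟨ sym (trans (ℚ.*-assoc (fromℕ n) γ⁻¹ γ) (trans (cong (fromℕ n *_) (ℚ.*-inverseˡ γ {{ℚ.pos⇒nonZero γ}})) (ℚ.*-identityʳ (fromℕ n)))) ⟩
  fromℕ n * γ⁻¹ * γ             ≤⟨ *-monoʳ-≤ 0≤γ (≤-∣ceiling∣ (fromℕ n * γ⁻¹)) ⟩
  fromℕ b * γ                   ≤⟨ ≤-by (ℚ.nonNegative⁻¹ 1ℚ) (ℚ.+-comm 1ℚ (fromℕ b * γ)) ⟩
  1ℚ + fromℕ b * γ              ≤⟨ bernoulli b (ℚ.≤-trans (ℚ.nonPositive⁻¹ (- 1ℚ)) 0≤γ) ⟩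
  (1ℚ + γ) ^ b                  ∎)
  where
  open ℚ.≤-Reasoning
  γ⁻¹ = (ℚ.1/ γ) {{ℚ.pos⇒nonZero γ}}
  b = ℤ.∣ ℚ.ceiling (fromℕ n * γ⁻¹) ∣
  0≤γ : 0ℚ ≤ γ
  0≤γ = ℚ.<⇒≤ (ℚ.positive⁻¹ γ)

log-≤ : ∀ γ .{{_ : Positive γ}} n {k} → fromℕ n ≤ (1ℚ + γ) ^ k → ⌈log[1+ γ ] n ⌉ ℕ.≤ k
log-≤ γ n = least-≤ (λ i → fromℕ n ℚ.≤? (1ℚ + γ) ^ i) ℤ.∣ ℚ.ceiling (fromℕ n * (ℚ.1/ γ) {{ℚ.pos⇒nonZero γ}}) ∣

-- Induction by halving, since n ≤ 2⌈n/2⌉ and the logarithm of ⌈n/2⌉ is smaller by one.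
n≤2^⌈log₂n⌉ : ∀ n → n ℕ.≤ 2 ℕ.^ ⌈log₂ n ⌉
n≤2^⌈log₂n⌉ = <-rec _ go
  where
  go : ∀ n → (∀ {k} → k ℕ.< n → k ℕ.≤ 2 ℕ.^ ⌈log₂ k ⌉) → n ℕ.≤ 2 ℕ.^ ⌈log₂ n ⌉
  go zero          _   = ℕ.z≤n
  go (suc zero)    _   = ℕ.≤-refl
  go n@(suc (suc n-2)) rec = begin
    n                                     ≡⟨ sym (ℕ.⌊n/2⌋+⌈n/2⌉≡n n) ⟩
    ℕ.⌊ n /2⌋ ℕ.+ ℕ.⌈ n /2⌉               ≤⟨ ℕ.+-monoˡ-≤ ℕ.⌈ n /2⌉ (ℕ.⌊n/2⌋≤⌈n/2⌉ n) ⟩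
    ℕ.⌈ n /2⌉ ℕ.+ ℕ.⌈ n /2⌉               ≡⟨ cong (ℕ.⌈ n /2⌉ ℕ.+_) (sym (ℕ.+-identityʳ ℕ.⌈ n /2⌉)) ⟩
    2 ℕ.* ℕ.⌈ n /2⌉                       ≤⟨ ℕ.*-monoʳ-≤ 2 (rec (ℕ.⌈n/2⌉<n n-2)) ⟩
    2 ℕ.* 2 ℕ.^ ⌈log₂ ℕ.⌈ n /2⌉ ⌉         ≡⟨ cong (λ l → 2 ℕ.* 2 ℕ.^ l) (⌈log₂⌈n/2⌉⌉≡⌈log₂n⌉∸1 n) ⟩
    2 ℕ.^ suc (⌈log₂ n ⌉ ℕ.∸ 1)           ≡⟨ cong (2 ℕ.^_) (ℕ.m+[n∸m]≡n (1≤log n (ℕ.s≤s (ℕ.s≤s ℕ.z≤n)))) ⟩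
    2 ℕ.^ ⌈log₂ n ⌉                       ∎
    where
    open ℕ.≤-Reasoning
    1≤log : ∀ n → 2 ℕ.≤ n → 1 ℕ.≤ ⌈log₂ n ⌉
    1≤log n 2≤n = subst (ℕ._≤ ⌈log₂ n ⌉) (⌈log₂2^n⌉≡n 1) (⌈log₂⌉-mono-≤ 2≤n)

1≤⌈log₂n⌉ : ∀ {n} → 2 ℕ.≤ n → 1 ℕ.≤ ⌈log₂ n ⌉
1≤⌈log₂n⌉ {n} 2≤n = subst (ℕ._≤ ⌈log₂ n ⌉) (⌈log₂2^n⌉≡n 1) (⌈log₂⌉-mono-≤ 2≤n)

edge⇒2≤n : ∀ {n} (G : SimpleGraph n) → .{{NonZero (∣E∣ G)}} → 2 ℕ.≤ n
edge⇒2≤n {suc (suc n)} G = ℕ.s≤s (ℕ.s≤s ℕ.z≤n)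

length-cartesianProduct : ∀ (xs : List X) (ys : List Y) →
  List.length (List.cartesianProduct xs ys) ≡ List.length xs ℕ.* List.length ys
length-cartesianProduct []       ys = refl
length-cartesianProduct (x ∷ xs) ys = trans (List.length-++ (List.map (x ,_) ys))
  (cong₂ ℕ._+_ (List.length-map (x ,_) ys) (length-cartesianProduct xs ys))

∣E∣≤n² : ∀ {n} (G : SimpleGraph n) → ∣E∣ G ℕ.≤ n ℕ.* n
∣E∣≤n² {n} G = ℕ.≤-trans
  (List.length-filter (λ (u , v) → u Fin.<? v ×-dec SimpleGraph._~?_ G u v) (List.cartesianProduct (List.allFin n) (List.allFin n)))
  (ℕ.≤-reflexive (trans (length-cartesianProduct (List.allFin n) (List.allFin n))
    (cong₂ ℕ._*_ (List.length-tabulate {n = n} (λ i → i)) (List.length-tabulate {n = n} (λ i → i)))))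

total-not : ∀ {k} (ks : Vec Bool k) → total ⟦_⟧ ks ℕ.+ total (⟦_⟧ ∘ not) ks ≡ k
total-not []           = refl
total-not (true ∷ ks)  = cong suc (total-not ks)
total-not (false ∷ ks) = trans (ℕ.+-suc (total ⟦_⟧ ks) (total (⟦_⟧ ∘ not) ks)) (cong suc (total-not ks))

countᵇ-id : ∀ {k} (ks : Vec Bool k) → Vec.countᵇ (λ k → k) ks ≡ total ⟦_⟧ ks
countᵇ-id []           = refl
countᵇ-id (true ∷ ks)  = cong suc (countᵇ-id ks)
countᵇ-id (false ∷ ks) = countᵇ-id ks

module CollisionTest {n : ℕ} (G : SimpleGraph n) .{{_ : NonZero (∣E∣ G)}}
  (ε : ℚ) .{{_ : Positive ε}} (h : HiddenFactors) (48≤R : 48 ℕ.≤ HiddenFactors.roundsFactor h) where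

  open Algorithm G ε h using (isCollision; rounds; hasCollision; randEdge; logn)

  private
    m = ∣E∣ G
    q = ⌈ 1ℚ √ fromℕ (2 ℕ.* n) ⌉
    bit = repeat q randEdge >>= λ xs → pure (hasCollision xs)
    2≤n : 2 ℕ.≤ n
    2≤n = edge⇒2≤n G

    enough-rounds : 6 ℕ.* (8 ℕ.* logn) ℕ.≤ rounds
    enough-rounds = subst (ℕ._≤ rounds) (ℕ.*-assoc 6 8 logn) (ℕ.*-monoˡ-≤ logn 48≤R)

    1²*2n : 1ℚ ^ 2 * fromℕ (2 ℕ.* n) ≡ fromℕ (2 ℕ.* n)
    1²*2n = ℚ.*-identityˡ (fromℕ (2 ℕ.* n))

    2n≤q² : 2 ℕ.* n ℕ.≤ q ℕ.* q
    2n≤q² = fromℕ-cancel-≤ (subst₂ _≤_ 1²*2n (fromℕ-square q) (√-holds 1ℚ (fromℕ (2 ℕ.* n))))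

    2≤q : 2 ℕ.≤ q
    2≤q = square-cancel-≤ (ℕ.≤-trans (ℕ.*-monoʳ-≤ 2 2≤n) 2n≤q²)

    -- Minimality gives (q - 1)² < 2n, and 2 (q C 2) = (q - 1)² + (q - 1) is at most twice that
    -- square.
    C≤2n : ∀ q → (∀ {k} → 2 ℕ.* n ℕ.≤ k ℕ.* k → q ℕ.≤ k) → q C 2 ℕ.≤ 2 ℕ.* n
    C≤2n zero     _   = ℕ.z≤n
    C≤2n (suc q′) min = ℕ.*-cancelˡ-≤ 2 (ℕ.+-cancelʳ-≤ (suc q′) _ _ (begin
      2 ℕ.* (suc q′ C 2) ℕ.+ suc q′                  ≡⟨ 2*C2 (suc q′) ⟩
      suc q′ ℕ.* suc q′                              ≡⟨ lem q′ ⟩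
      q′ ℕ.* q′ ℕ.+ q′ ℕ.+ suc q′                    ≤⟨ ℕ.+-monoˡ-≤ (suc q′) (ℕ.+-mono-≤ q′²≤2n (ℕ.≤-trans (q′≤q′² q′) q′²≤2n)) ⟩
      2 ℕ.* n ℕ.+ 2 ℕ.* n ℕ.+ suc q′                 ≡⟨ cong (ℕ._+ suc q′) (cong (2 ℕ.* n ℕ.+_) (sym (ℕ.+-identityʳ (2 ℕ.* n)))) ⟩
      2 ℕ.* (2 ℕ.* n) ℕ.+ suc q′                     ∎))
      where
      open ℕ.≤-Reasoning
      lem : ∀ q → suc q ℕ.* suc q ≡ q ℕ.* q ℕ.+ q ℕ.+ suc q
      lem = ℕR.solve-∀
      q′≤q′² : ∀ q → q ℕ.≤ q ℕ.* q
      q′≤q′² zero    = ℕ.z≤n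
      q′≤q′² (suc q) = ℕ.m≤m*n (suc q) (suc q)
      q′²≤2n : q′ ℕ.* q′ ℕ.≤ 2 ℕ.* n
      q′²≤2n = ℕ.<⇒≤ (ℕ.≰⇒> λ 2n≤q′² → ℕ.n≮n q′ (min 2n≤q′²))

    q-least : ∀ {k} → 2 ℕ.* n ℕ.≤ k ℕ.* k → q ℕ.≤ k
    q-least {k} le = √-≤ 1ℚ (fromℕ (2 ℕ.* n)) (subst₂ _≤_ (sym 1²*2n) (sym (fromℕ-square k)) (fromℕ-mono-≤ le))

    𝔼-bit : ∀ f → 𝔼 bit f ≡ 𝔼 (repeat q randEdge) (f ∘ hasCollision)
    𝔼-bit = 𝔼->>= (repeat q randEdge) (λ xs → pure (hasCollision xs))

  -- 4 (q C 2) ≤ 8n ≤ m makes a collision in a single round have probability at most 1/4.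
  many-edges⇒no-collision : 8 ℕ.* n ℕ.≤ m → Unlikely isCollision (_≡ true) (½ ^ (8 ℕ.* logn))
  many-edges⇒no-collision 8n≤m = unlikely-map (repeat rounds bit) _
    (majority bit (λ b → b) (subst (_≤ + 1 / 4) (sym (𝔼-bit (fromℕ ∘ ⟦_⟧)))
      (collision-probability m q (ℕ.≤-trans (ℕ.*-monoʳ-≤ 4 (C≤2n q q-least)) (ℕ.≤-trans (ℕ.≤-reflexive (sym (ℕ.*-assoc 4 2 n))) 8n≤m))))
      rounds (8 ℕ.* logn) enough-rounds)
    λ ks eq → subst (λ c → rounds ℕ.≤ 2 ℕ.* c) (countᵇ-id ks) (ℕ.<⇒≤ (ℕ.<ᵇ⇒< rounds _ (subst T (sym eq) tt)))

  -- 12m ≤ 2n ≤ q² ≤ 4 (q C 2), so a round without collision has probability at most 1/4.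
  few-edges⇒collision : 6 ℕ.* m ℕ.≤ n → Unlikely isCollision (_≡ false) (½ ^ (8 ℕ.* logn))
  few-edges⇒collision 6m≤n = unlikely-map (repeat rounds bit) _
    (majority bit not (subst (_≤ + 1 / 4) (sym (𝔼-bit (fromℕ ∘ ⟦_⟧ ∘ not)))
      (no-collision-probability m q 3m≤C))
      rounds (8 ℕ.* logn) enough-rounds)
    λ ks eq → outvoted ks (ℕ.≮⇒≥ λ lt → subst T eq (ℕ.<⇒<ᵇ lt))
    where
    open ℕ.≤-Reasoning
    3m≤C : 3 ℕ.* m ℕ.≤ q C 2
    3m≤C = ℕ.*-cancelˡ-≤ 4 (begin
      4 ℕ.* (3 ℕ.* m)       ≡⟨ lem m ⟩
      2 ℕ.* (6 ℕ.* m)       ≤⟨ ℕ.*-monoʳ-≤ 2 6m≤n ⟩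
      2 ℕ.* n               ≤⟨ 2n≤q² ⟩
      q ℕ.* q               ≤⟨ square≤4C 2≤q ⟩
      4 ℕ.* (q C 2)         ∎)
      where
      lem : ∀ m → 4 ℕ.* (3 ℕ.* m) ≡ 2 ℕ.* (6 ℕ.* m)
      lem = ℕR.solve-∀
    outvoted : ∀ ks → 2 ℕ.* Vec.countᵇ (λ k → k) ks ℕ.≤ rounds → rounds ℕ.≤ 2 ℕ.* total (⟦_⟧ ∘ not) ks
    outvoted ks 2c≤N = ℕ.+-cancelˡ-≤ rounds _ _ (begin
      rounds ℕ.+ rounds                                             ≡⟨ cong₂ ℕ._+_ (sym (total-not ks)) (sym (total-not ks)) ⟩
      total ⟦_⟧ ks ℕ.+ f ℕ.+ (total ⟦_⟧ ks ℕ.+ f)                    ≡⟨ lem (total ⟦_⟧ ks) f ⟩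
      2 ℕ.* total ⟦_⟧ ks ℕ.+ 2 ℕ.* f                                ≤⟨ ℕ.+-monoˡ-≤ (2 ℕ.* f) (subst (λ c → 2 ℕ.* c ℕ.≤ rounds) (countᵇ-id ks) 2c≤N) ⟩
      rounds ℕ.+ 2 ℕ.* f                                            ∎)
      where
      f = total (⟦_⟧ ∘ not) ks
      lem : ∀ a f → a ℕ.+ f ℕ.+ (a ℕ.+ f) ≡ 2 ℕ.* a ℕ.+ 2 ℕ.* f
      lem = ℕR.solve-∀

-- Double counting of edge endpoints

𝟙 : Bool → ℚ
𝟙 b = if b then 1ℚ else 0ℚ

0≤𝟙 : ∀ b → 0ℚ ≤ 𝟙 b
0≤𝟙 true  = ℚ.nonNegative⁻¹ 1ℚ
0≤𝟙 false = ℚ.≤-refl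

fromℕ⟦⟧ : ∀ b → fromℕ ⟦ b ⟧ ≡ 𝟙 b
fromℕ⟦⟧ true  = refl
fromℕ⟦⟧ false = refl

sumᴸ : (X → ℚ) → List X → ℚ
sumᴸ f []       = 0ℚ
sumᴸ f (x ∷ xs) = f x + sumᴸ f xs

sum-lookup : ∀ (f : X → ℚ) xs → sum (λ i → f (List.lookup xs i)) ≡ sumᴸ f xs
sum-lookup f []       = refl
sum-lookup f (x ∷ xs) = cong (λ z → f x + z) (sum-lookup f xs)

sumᴸ-cong : ∀ {f g : X → ℚ} → (∀ x → f x ≡ g x) → ∀ xs → sumᴸ f xs ≡ sumᴸ g xs
sumᴸ-cong f≗g []       = refl
sumᴸ-cong f≗g (x ∷ xs) = cong₂ _+_ (f≗g x) (sumᴸ-cong f≗g xs)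

sumᴸ-filter : ∀ {P : Pred X 0ℓ} (P? : Decidable P) (f : X → ℚ) xs →
  sumᴸ f (List.filter P? xs) ≡ sumᴸ (λ x → 𝟙 (does (P? x)) * f x) xs
sumᴸ-filter P? f []       = refl
sumᴸ-filter P? f (x ∷ xs) with does (P? x)
... | true  = cong₂ _+_ (sym (ℚ.*-identityˡ (f x))) (sumᴸ-filter P? f xs)
... | false = trans (sumᴸ-filter P? f xs) (sym (trans (cong (_+ _) (ℚ.*-zeroˡ (f x))) (ℚ.+-identityˡ _)))

sumᴸ-++ : ∀ (f : X → ℚ) xs ys → sumᴸ f (xs List.++ ys) ≡ sumᴸ f xs + sumᴸ f ys
sumᴸ-++ f []       ys = sym (ℚ.+-identityˡ _)
sumᴸ-++ f (x ∷ xs) ys = trans (cong (λ z → f x + z) (sumᴸ-++ f xs ys)) (sym (ℚ.+-assoc (f x) (sumᴸ f xs) (sumᴸ f ys)))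

sumᴸ-map : ∀ (f : Y → ℚ) (g : X → Y) xs → sumᴸ f (List.map g xs) ≡ sumᴸ (f ∘ g) xs
sumᴸ-map f g []       = refl
sumᴸ-map f g (x ∷ xs) = cong (λ z → f (g x) + z) (sumᴸ-map f g xs)

sumᴸ-cartesianProduct : ∀ (f : X × Y → ℚ) xs ys →
  sumᴸ f (List.cartesianProduct xs ys) ≡ sumᴸ (λ x → sumᴸ (λ y → f (x , y)) ys) xs
sumᴸ-cartesianProduct f []       ys = refl
sumᴸ-cartesianProduct f (x ∷ xs) ys = trans (sumᴸ-++ f (List.map (x ,_) ys) (List.cartesianProduct xs ys))
  (cong₂ _+_ (sumᴸ-map f (x ,_) ys) (sumᴸ-cartesianProduct f xs ys))

sumᴸ-tabulate : ∀ {n} (f : X → ℚ) (g : Fin n → X) → sumᴸ f (List.tabulate g) ≡ sum (f ∘ g)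
sumᴸ-tabulate {n = zero}  f g = refl
sumᴸ-tabulate {n = suc n} f g = cong (λ z → f (g Fin.zero) + z) (sumᴸ-tabulate f (g ∘ Fin.suc))

fromℕ-length : ∀ (xs : List X) → fromℕ (List.length xs) ≡ sumᴸ (λ _ → 1ℚ) xs
fromℕ-length []       = refl
fromℕ-length (x ∷ xs) = trans (fromℕ-+ 1 (List.length xs)) (cong (λ z → 1ℚ + z) (fromℕ-length xs))

module Handshake {n : ℕ} (G : SimpleGraph n) where

  open SimpleGraph G using (_~_; _~?_; ~-sym; ~-irrefl; deg; edges)

  adjacent : Fin n → Fin n → ℚ
  adjacent u v = 𝟙 (does (u ~? v))

  0≤adjacent : ∀ u v → 0ℚ ≤ adjacent u v
  0≤adjacent u v = 0≤𝟙 (does (u ~? v))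

  adjacent-sym : ∀ u v → adjacent u v ≡ adjacent v u
  adjacent-sym u v with u ~? v | v ~? u
  ... | yes _   | yes _   = refl
  ... | no _    | no _    = refl
  ... | yes u~v | no ¬v~u = contradiction (~-sym u~v) ¬v~u
  ... | no ¬u~v | yes v~u = contradiction (~-sym v~u) ¬u~v

  deg≡sum : ∀ v → fromℕ (deg v) ≡ sum (adjacent v)
  deg≡sum v = begin
    fromℕ (deg v)                                                        ≡⟨ fromℕ-length (List.filter (v ~?_) (List.allFin n)) ⟩
    sumᴸ (λ _ → 1ℚ) (List.filter (v ~?_) (List.allFin n))                ≡⟨ sumᴸ-filter (v ~?_) (λ _ → 1ℚ) (List.allFin n) ⟩
    sumᴸ (λ u → adjacent v u * 1ℚ) (List.allFin n)                       ≡⟨ sumᴸ-tabulate (λ u → adjacent v u * 1ℚ) (λ u → u) ⟩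
    sum (λ u → adjacent v u * 1ℚ)                                        ≡⟨ sum-cong-≗ (λ u → ℚ.*-identityʳ (adjacent v u)) ⟩
    sum (adjacent v)                                                     ∎
    where open ≡-Reasoning

  private
    below? : ∀ (e : Fin n × Fin n) → Dec (proj₁ e Fin.< proj₂ e × proj₁ e ~ proj₂ e)
    below? (u , v) = u Fin.<? v ×-dec u ~? v

    below : Fin n → Fin n → ℚ
    below u v = 𝟙 (does (below? (u , v)))

    𝟙-∧ : ∀ a b → 𝟙 (a ∧ b) ≡ 𝟙 a * 𝟙 b
    𝟙-∧ true  b = sym (ℚ.*-identityˡ (𝟙 b))
    𝟙-∧ false b = sym (ℚ.*-zeroˡ (𝟙 b))

    -- Trichotomy: off the diagonal exactly one order holds, and on it both sides vanish because
    -- there are no loops.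
    below-either : ∀ u v → below u v + below v u ≡ adjacent u v
    below-either u v = begin
      below u v + below v u
        ≡⟨ cong₂ _+_ (𝟙-∧ (does (u Fin.<? v)) (does (u ~? v))) (trans (𝟙-∧ (does (v Fin.<? u)) (does (v ~? u))) (cong (𝟙 (does (v Fin.<? u)) *_) (adjacent-sym v u))) ⟩
      𝟙 (does (u Fin.<? v)) * adjacent u v + 𝟙 (does (v Fin.<? u)) * adjacent u v
        ≡⟨ sym (ℚ.*-distribʳ-+ (adjacent u v) (𝟙 (does (u Fin.<? v))) (𝟙 (does (v Fin.<? u)))) ⟩
      (𝟙 (does (u Fin.<? v)) + 𝟙 (does (v Fin.<? u))) * adjacent u v
        ≡⟨ compare (Fin.<-cmp u v) ⟩
      adjacent u v ∎
      where
      open ≡-Reasoning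
      compare : Tri (u Fin.< v) (u ≡ v) (v Fin.< u) →
        (𝟙 (does (u Fin.<? v)) + 𝟙 (does (v Fin.<? u))) * adjacent u v ≡ adjacent u v
      compare (tri< u<v _ v≮u) = trans (cong₂ (λ a b → (𝟙 a + 𝟙 b) * adjacent u v) (dec-true (u Fin.<? v) u<v) (dec-false (v Fin.<? u) v≮u)) (ℚ.*-identityˡ (adjacent u v))
      compare (tri> u≮v _ v<u) = trans (cong₂ (λ a b → (𝟙 a + 𝟙 b) * adjacent u v) (dec-false (u Fin.<? v) u≮v) (dec-true (v Fin.<? u) v<u)) (ℚ.*-identityˡ (adjacent u v))
      compare (tri≈ _ u≡v _)   = trans (cong (x *_) isolated) (trans (ℚ.*-zeroʳ x) (sym isolated))
        where
        x = 𝟙 (does (u Fin.<? v)) + 𝟙 (does (v Fin.<? u))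
        isolated : adjacent u v ≡ 0ℚ
        isolated = cong 𝟙 (dec-false (u ~? v) λ u~v → ~-irrefl (subst (u ~_) (sym u≡v) u~v))

  sum-edges : ∀ (f : Fin n × Fin n → ℚ) → sumᴸ f edges ≡ sum (λ u → sum (λ v → below u v * f (u , v)))
  sum-edges f = begin
    sumᴸ f (List.filter below? (List.cartesianProduct (List.allFin n) (List.allFin n)))
      ≡⟨ sumᴸ-filter below? f (List.cartesianProduct (List.allFin n) (List.allFin n)) ⟩
    sumᴸ (λ e → 𝟙 (does (below? e)) * f e) (List.cartesianProduct (List.allFin n) (List.allFin n))
      ≡⟨ sumᴸ-cartesianProduct (λ e → 𝟙 (does (below? e)) * f e) (List.allFin n) (List.allFin n) ⟩
    sumᴸ (λ u → sumᴸ (λ v → below u v * f (u , v)) (List.allFin n)) (List.allFin n)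
      ≡⟨ sumᴸ-tabulate (λ u → sumᴸ (λ v → below u v * f (u , v)) (List.allFin n)) (λ u → u) ⟩
    sum (λ u → sumᴸ (λ v → below u v * f (u , v)) (List.allFin n))
      ≡⟨ sum-cong-≗ (λ u → sumᴸ-tabulate (λ v → below u v * f (u , v)) (λ v → v)) ⟩
    sum (λ u → sum (λ v → below u v * f (u , v))) ∎
    where open ≡-Reasoning

  -- Swapping u and v in the second half turns the sum over u < v into one over all ordered adjacent
  -- pairs. For f = 1 this is the handshake lemma.
  sum-endpoints : ∀ (f : Fin n → ℚ) → sumᴸ (λ e → f (proj₁ e) + f (proj₂ e)) edges ≡ sum (λ v → f v * fromℕ (deg v))
  sum-endpoints f = begin
    sumᴸ (λ e → f (proj₁ e) + f (proj₂ e)) edges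
      ≡⟨ sum-edges (λ e → f (proj₁ e) + f (proj₂ e)) ⟩
    sum (λ u → sum (λ v → below u v * (f u + f v)))
      ≡⟨ sum-cong-≗ (λ u → trans (sum-cong-≗ (λ v → ℚ.*-distribˡ-+ (below u v) (f u) (f v))) (∑-distrib-+ (λ v → below u v * f u) (λ v → below u v * f v))) ⟩
    sum (λ u → sum (λ v → below u v * f u) + sum (λ v → below u v * f v))
      ≡⟨ ∑-distrib-+ (λ u → sum (λ v → below u v * f u)) (λ u → sum (λ v → below u v * f v)) ⟩
    sum (λ u → sum (λ v → below u v * f u)) + sum (λ u → sum (λ v → below u v * f v))
      ≡⟨ cong (λ z → sum (λ u → sum (λ v → below u v * f u)) + z) (∑-comm (λ u v → below u v * f v)) ⟩
    sum (λ u → sum (λ v → below u v * f u)) + sum (λ u → sum (λ v → below v u * f u))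
      ≡⟨ sym (∑-distrib-+ (λ u → sum (λ v → below u v * f u)) (λ u → sum (λ v → below v u * f u))) ⟩
    sum (λ u → sum (λ v → below u v * f u) + sum (λ v → below v u * f u))
      ≡⟨ sum-cong-≗ (λ u → trans (sym (∑-distrib-+ (λ v → below u v * f u) (λ v → below v u * f u))) (trans (sum-cong-≗ (λ v → collect u v)) (trans (sym (*-distribˡ-sum (f u) (adjacent u))) (cong (f u *_) (sym (deg≡sum u)))))) ⟩
    sum (λ v → f v * fromℕ (deg v)) ∎
    where
    open ≡-Reasoning
    lem : ∀ x y z → x * z + y * z ≡ z * (x + y)
    lem = solve-∀ ℚ-ring
    collect : ∀ u v → below u v * f u + below v u * f u ≡ f u * adjacent u v
    collect u v = trans (lem (below u v) (below v u) (f u)) (cong (f u *_) (below-either u v))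

  sum-deg : sum (λ v → fromℕ (deg v)) ≡ fromℕ (2 ℕ.* ∣E∣ G)
  sum-deg = begin
    sum (λ v → fromℕ (deg v))                    ≡⟨ sum-cong-≗ (λ v → sym (ℚ.*-identityˡ (fromℕ (deg v)))) ⟩
    sum (λ v → 1ℚ * fromℕ (deg v))               ≡⟨ sym (sum-endpoints (λ _ → 1ℚ)) ⟩
    sumᴸ (λ _ → 1ℚ + 1ℚ) edges                   ≡⟨ double edges ⟩
    (1ℚ + 1ℚ) * sumᴸ (λ _ → 1ℚ) edges            ≡⟨ cong (fromℕ 2 *_) (sym (fromℕ-length edges)) ⟩
    fromℕ 2 * fromℕ (∣E∣ G)                      ≡⟨ sym (fromℕ-* 2 (∣E∣ G)) ⟩
    fromℕ (2 ℕ.* ∣E∣ G)                          ∎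
    where
    open ≡-Reasoning
    lem : ∀ s → (1ℚ + 1ℚ) + (1ℚ + 1ℚ) * s ≡ (1ℚ + 1ℚ) * (1ℚ + s)
    lem = solve-∀ ℚ-ring
    double : ∀ (es : List (Fin n × Fin n)) → sumᴸ (λ _ → 1ℚ + 1ℚ) es ≡ (1ℚ + 1ℚ) * sumᴸ (λ _ → 1ℚ) es
    double []       = refl
    double (e ∷ es) = trans (cong (λ z → (1ℚ + 1ℚ) + z) (double es)) (lem (sumᴸ (λ _ → 1ℚ) es))

  -- A random endpoint of a random edge equals v with probability deg v / 2m.
  𝔼-randEndpoint : ∀ .{{_ : NonZero (∣E∣ G)}} ε .{{_ : Positive ε}} h (f : Fin n → ℚ) →
    fromℕ (2 ℕ.* ∣E∣ G) * 𝔼 (Algorithm.randEndpoint G ε h) f ≡ sum (λ v → f v * fromℕ (deg v))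
  𝔼-randEndpoint ε h f = begin
    fromℕ (2 ℕ.* m) * (inv m * sum (λ e → ½ * (f (proj₁ (List.lookup edges e)) + (f (proj₂ (List.lookup edges e)) + 0ℚ))))
      ≡⟨ cong₂ (λ x y → x * (inv m * y)) (fromℕ-* 2 m) (trans (sum-cong-≗ (λ e → cong (λ z → ½ * (f (proj₁ (List.lookup edges e)) + z)) (ℚ.+-identityʳ (f (proj₂ (List.lookup edges e))))))
           (sym (*-distribˡ-sum ½ (λ e → f (proj₁ (List.lookup edges e)) + f (proj₂ (List.lookup edges e)))))) ⟩
    fromℕ 2 * fromℕ m * (inv m * (½ * s))
      ≡⟨ lem (fromℕ m) (inv m) s ⟩
    inv m * fromℕ m * s
      ≡⟨ trans (cong (_* s) (inv-* m)) (ℚ.*-identityˡ s) ⟩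
    s
      ≡⟨ sum-lookup (λ e → f (proj₁ e) + f (proj₂ e)) edges ⟩
    sumᴸ (λ e → f (proj₁ e) + f (proj₂ e)) edges
      ≡⟨ sum-endpoints f ⟩
    sum (λ v → f v * fromℕ (deg v)) ∎
    where
    open ≡-Reasoning
    m = ∣E∣ G
    s = sum (λ e → f (proj₁ (List.lookup edges e)) + f (proj₂ (List.lookup edges e)))
    lem : ∀ m i s → fromℕ 2 * m * (i * (½ * s)) ≡ i * m * s
    lem = solve-∀ ℚ-ring

  -- An edge with an endpoint outside U either ends in U or joins two
  -- non-isolated vertices outside U.
  2∣E∣≤ : ∀ (U : Fin n → Bool) (ℓ : Fin n → ℚ) → (∀ v → 0ℚ ≤ ℓ v) →
    (∀ v → U v ≡ false → 1 ℕ.≤ deg v → 1ℚ ≤ ℓ v) →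
    fromℕ (2 ℕ.* ∣E∣ G) ≤ (1ℚ + 1ℚ) * sum (λ v → 𝟙 (U v) * fromℕ (deg v)) + sum ℓ * sum ℓ
  2∣E∣≤ U ℓ 0≤ℓ ℓ-large = begin
    fromℕ (2 ℕ.* ∣E∣ G)
      ≡⟨ sym sum-deg ⟩
    sum (λ v → fromℕ (deg v))
      ≡⟨ sum-cong-≗ deg≡sum ⟩
    sum (λ v → sum (λ u → adjacent v u))
      ≤⟨ sum-mono (λ v → sum-mono (λ u → pointwise v u)) ⟩
    sum (λ v → sum (λ u → 𝟙 (U v) * adjacent v u + (𝟙 (U u) * adjacent u v + ℓ v * ℓ u)))
      ≡⟨ trans (sum-cong-≗ (λ v → trans (∑-distrib-+ (λ u → 𝟙 (U v) * adjacent v u) (λ u → 𝟙 (U u) * adjacent u v + ℓ v * ℓ u))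
           (cong (λ z → sum (λ u → 𝟙 (U v) * adjacent v u) + z) (∑-distrib-+ (λ u → 𝟙 (U u) * adjacent u v) (λ u → ℓ v * ℓ u)))))
         (trans (∑-distrib-+ (λ v → sum (λ u → 𝟙 (U v) * adjacent v u)) (λ v → sum (λ u → 𝟙 (U u) * adjacent u v) + sum (λ u → ℓ v * ℓ u)))
           (cong (λ z → sum (λ v → sum (λ u → 𝟙 (U v) * adjacent v u)) + z) (∑-distrib-+ (λ v → sum (λ u → 𝟙 (U u) * adjacent u v)) (λ v → sum (λ u → ℓ v * ℓ u))))) ⟩
    sum (λ v → sum (λ u → 𝟙 (U v) * adjacent v u)) + (sum (λ v → sum (λ u → 𝟙 (U u) * adjacent u v)) + sum (λ v → sum (λ u → ℓ v * ℓ u)))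
      ≡⟨ cong₂ _+_ inU (cong₂ _+_ (trans (∑-comm (λ v u → 𝟙 (U u) * adjacent u v)) inU) light) ⟩
    s + (s + sum ℓ * sum ℓ)
      ≡⟨ lem s (sum ℓ * sum ℓ) ⟩
    (1ℚ + 1ℚ) * s + sum ℓ * sum ℓ ∎
    where
    open ℚ.≤-Reasoning
    s = sum (λ v → 𝟙 (U v) * fromℕ (deg v))
    lem : ∀ s t → s + (s + t) ≡ (1ℚ + 1ℚ) * s + t
    lem = solve-∀ ℚ-ring
    inU : sum (λ v → sum (λ u → 𝟙 (U v) * adjacent v u)) ≡ s
    inU = sum-cong-≗ (λ v → trans (sym (*-distribˡ-sum (𝟙 (U v)) (adjacent v))) (cong (𝟙 (U v) *_) (sym (deg≡sum v))))
    light : sum (λ v → sum (λ u → ℓ v * ℓ u)) ≡ sum ℓ * sum ℓ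
    light = trans (sum-cong-≗ (λ v → trans (sym (*-distribˡ-sum (ℓ v) ℓ)) (ℚ.*-comm (ℓ v) (sum ℓ)))) (sym (*-distribˡ-sum (sum ℓ) ℓ))
    1≤deg : ∀ v u → v ~ u → 1 ℕ.≤ deg v
    1≤deg v u v~u = fromℕ-cancel-≤ (begin
      1ℚ                ≡⟨ sym (cong 𝟙 (dec-true (v ~? u) v~u)) ⟩
      adjacent v u      ≤⟨ term≤sum (adjacent v) (0≤adjacent v) u ⟩
      sum (adjacent v)  ≡⟨ sym (deg≡sum v) ⟩
      fromℕ (deg v)     ∎)
    pointwise : ∀ v u → adjacent v u ≤ 𝟙 (U v) * adjacent v u + (𝟙 (U u) * adjacent u v + ℓ v * ℓ u)
    pointwise v u = go (U v) (U u) refl refl (v ~? u)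
      where
      0≤ℓℓ : 0ℚ ≤ ℓ v * ℓ u
      0≤ℓℓ = *-nonNeg (0≤ℓ v) (0≤ℓ u)
      go : ∀ a b → U v ≡ a → U u ≡ b → Dec (v ~ u) → adjacent v u ≤ 𝟙 a * adjacent v u + (𝟙 b * adjacent u v + ℓ v * ℓ u)
      go true b _ _ _ = ≤-by (+-nonNeg (*-nonNeg (0≤𝟙 b) (0≤adjacent u v)) 0≤ℓℓ)
        (cong (_+ (𝟙 b * adjacent u v + ℓ v * ℓ u)) (ℚ.*-identityˡ (adjacent v u)))
      go false true _ _ _ = ≤-by 0≤ℓℓ (trans (cong₂ (λ x y → x + (y + ℓ v * ℓ u)) (ℚ.*-zeroˡ (adjacent v u)) (trans (ℚ.*-identityˡ (adjacent u v)) (adjacent-sym u v)))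
        (ℚ.+-identityˡ (adjacent v u + ℓ v * ℓ u)))
      go false false Uv Uu (no ¬v~u) = subst (_≤ 0ℚ * adjacent v u + (0ℚ * adjacent u v + ℓ v * ℓ u)) (sym (cong 𝟙 (dec-false (v ~? u) ¬v~u)))
        (+-nonNeg (*-nonNeg ℚ.≤-refl (0≤adjacent v u)) (+-nonNeg (*-nonNeg ℚ.≤-refl (0≤adjacent u v)) 0≤ℓℓ))
      go false false Uv Uu (yes v~u) = begin
        adjacent v u      ≡⟨ cong 𝟙 (dec-true (v ~? u) v~u) ⟩
        1ℚ * 1ℚ           ≤⟨ *-mono-≤ (ℚ.nonNegative⁻¹ 1ℚ) (ℓ-large v Uv (1≤deg v u v~u)) (ℚ.nonNegative⁻¹ 1ℚ) (ℓ-large u Uu (1≤deg u v (~-sym v~u))) ⟩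
        ℓ v * ℓ u         ≤⟨ ≤-by (+-nonNeg (*-nonNeg ℚ.≤-refl (0≤adjacent v u)) (*-nonNeg ℚ.≤-refl (0≤adjacent u v))) (lem′ (ℓ v * ℓ u) (0ℚ * adjacent v u) (0ℚ * adjacent u v)) ⟩
        0ℚ * adjacent v u + (0ℚ * adjacent u v + ℓ v * ℓ u) ∎
        where
        lem′ : ∀ x y z → y + (z + x) ≡ x + (y + z)
        lem′ = solve-∀ ℚ-ring

-- Degree classes and the weights induced by a vertex sample

fromℕ-sum : ∀ {n} (f : Fin n → ℕ) → fromℕ (sumᴺ f) ≡ sum (fromℕ ∘ f)
fromℕ-sum {zero}  f = refl
fromℕ-sum {suc n} f = trans (fromℕ-+ (f Fin.zero) (sumᴺ (f ∘ Fin.suc))) (cong (λ z → fromℕ (f Fin.zero) + z) (fromℕ-sum (f ∘ Fin.suc)))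

if-≡-𝟙* : ∀ b x → (if b then x else 0ℚ) ≡ 𝟙 b * x
if-≡-𝟙* true  x = sym (ℚ.*-identityˡ x)
if-≡-𝟙* false x = sym (ℚ.*-zeroˡ x)

fromℕ-if : ∀ b k → fromℕ (if b then k else 0) ≡ 𝟙 b * fromℕ k
fromℕ-if true  k = sym (ℚ.*-identityˡ (fromℕ k))
fromℕ-if false k = sym (ℚ.*-zeroˡ (fromℕ k))

maximum : ∀ {n} (f : Fin (suc n) → ℚ) → ∃[ i ] ∀ j → f j ≤ f i
maximum {zero}  f = Fin.zero , λ where Fin.zero → ℚ.≤-refl
maximum {suc n} f with maximum (f ∘ Fin.suc)
... | i , max with ℚ.≤-total (f Fin.zero) (f (Fin.suc i))
...   | inj₁ le = Fin.suc i , λ where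
  Fin.zero    → le
  (Fin.suc j) → max j
...   | inj₂ ge = Fin.zero , λ where
  Fin.zero    → ℚ.≤-refl
  (Fin.suc j) → ℚ.≤-trans (max j) ge

-- The sum is at most t times its maximum, so a bound on the square of each t · f i already bounds
-- the square of the whole sum.
sum-square-≤ : ∀ {t} (f : Fin t → ℚ) c K → (∀ i → 0ℚ ≤ f i) → 0ℚ ≤ c → 0ℚ ≤ K →
  (∀ i → c * (fromℕ t * f i) ^ 2 ≤ K) → c * (sum f * sum f) ≤ K
sum-square-≤ {zero}  f c K 0≤f 0≤c 0≤K le = subst (_≤ K) (sym (ℚ.*-zeroʳ c)) 0≤K
sum-square-≤ {suc t} f c K 0≤f 0≤c 0≤K le with maximum f
... | i , max = begin
  c * (sum f * sum f)                  ≤⟨ *-monoˡ-≤ 0≤c (*-mono-≤ 0≤sum sum≤ 0≤sum sum≤) ⟩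
  c * (fromℕ (suc t) * f i * (fromℕ (suc t) * f i)) ≡⟨ cong (λ z → c * (fromℕ (suc t) * f i * z)) (sym (ℚ.*-identityʳ (fromℕ (suc t) * f i))) ⟩
  c * (fromℕ (suc t) * f i) ^ 2        ≤⟨ le i ⟩
  K                                    ∎
  where
  open ℚ.≤-Reasoning
  0≤sum : 0ℚ ≤ sum f
  0≤sum = ℚ.≤-trans (0≤f i) (term≤sum f 0≤f i)
  sum≤ : sum f ≤ fromℕ (suc t) * f i
  sum≤ = subst (sum f ≤_) (sum-const (suc t) (f i)) (sum-mono max)

module Weights {n : ℕ} (G : SimpleGraph n) .{{_ : NonZero (∣E∣ G)}}
  (ε : ℚ) .{{_ : Positive ε}} (h : HiddenFactors) where

  open Algorithm G ε h
  open Handshake G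
  open SimpleGraph G using (deg)

  1+γ : ℚ
  1+γ = 1ℚ + γ

  0≤ε : 0ℚ ≤ ε
  0≤ε = ℚ.<⇒≤ (ℚ.positive⁻¹ ε)

  0≤γ : 0ℚ ≤ γ
  0≤γ = *-nonNeg 0≤ε (ℚ.nonNegative⁻¹ (+ 1 / 10))

  1≤1+γ : 1ℚ ≤ 1+γ
  1≤1+γ = ≤-by 0≤γ refl

  0≤1+γ : 0ℚ ≤ 1+γ
  0≤1+γ = ℚ.≤-trans (ℚ.nonNegative⁻¹ 1ℚ) 1≤1+γ

  level : Fin t → ℚ
  level i = 1+γ ^ toℕ i

  0≤level : ∀ i → 0ℚ ≤ level i
  0≤level i = ^-nonNeg (toℕ i) 0≤1+γ

  member : Fin n → Fin t → Bool
  member v i = does (v ∈B? i)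

  matches : ∀ {k} → Vec (Fin n) k → Fin t → Fin n → ℕ
  matches S i x = count (λ y → x Fin.≟ y ×-dec y ∈B? i) S

  members : ∀ {k} → Vec (Fin n) k → Fin t → ℕ
  members S i = count (_∈B? i) S

  classSize : Fin t → ℕ
  classSize i = sumᴺ (λ v → ⟦ member v i ⟧)

  -- The total degree of the sampled vertices of class i, with multiplicity, written as a sum over V
  -- because that is the form in which a random endpoint averages.
  classDegree : ∀ {k} → Vec (Fin n) k → Fin t → ℚ
  classDegree S i = sum (λ v → fromℕ (matches S i v) * fromℕ (deg v))

  member-deg-≤ : ∀ v i → 𝟙 (member v i) * fromℕ (deg v) ≤ 𝟙 (member v i) * level i
  member-deg-≤ v i = go (v ∈B? i)
    where
    go : (v∈? : Dec (v ∈B i)) → 𝟙 (does v∈?) * fromℕ (deg v) ≤ 𝟙 (does v∈?) * level i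
    go (yes (_ , le)) = *-monoˡ-≤ (ℚ.nonNegative⁻¹ 1ℚ) le
    go (no _)         = ℚ.≤-reflexive (trans (ℚ.*-zeroˡ (fromℕ (deg v))) (sym (ℚ.*-zeroˡ (level i))))

  member-level-≤ : ∀ v i → 𝟙 (member v i) * level i ≤ 1+γ * (𝟙 (member v i) * fromℕ (deg v))
  member-level-≤ v i = go (v ∈B? i)
    where
    go : (v∈? : Dec (v ∈B i)) → 𝟙 (does v∈?) * level i ≤ 1+γ * (𝟙 (does v∈?) * fromℕ (deg v))
    go (yes (lt , _)) = subst₂ _≤_ (sym (ℚ.*-identityˡ (level i))) (cong (1+γ *_) (sym (ℚ.*-identityˡ (fromℕ (deg v))))) (ℚ.<⇒≤ lt)
    go (no _)         = ℚ.≤-reflexive (trans (ℚ.*-zeroˡ (level i)) (sym (trans (cong (1+γ *_) (ℚ.*-zeroˡ (fromℕ (deg v)))) (ℚ.*-zeroʳ 1+γ))))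

  classDegree-[] : ∀ i → classDegree [] i ≡ 0ℚ
  classDegree-[] i = trans (sum-cong-≗ {n} (λ v → ℚ.*-zeroˡ (fromℕ (deg v)))) (trans (sum-const n 0ℚ) (ℚ.*-zeroʳ (fromℕ n)))

  classDegree-∷ : ∀ {k} y (ys : Vec (Fin n) k) i →
    classDegree (y ∷ ys) i ≡ 𝟙 (member y i) * fromℕ (deg y) + classDegree ys i
  classDegree-∷ y ys i = begin
    sum (λ v → fromℕ (matches (y ∷ ys) i v) * fromℕ (deg v))
      ≡⟨ sum-cong-≗ pointwise ⟩
    sum (λ v → (if does (v Fin.≟ y) then 𝟙 (member y i) * fromℕ (deg v) else 0ℚ) + fromℕ (matches ys i v) * fromℕ (deg v))
      ≡⟨ ∑-distrib-+ (λ v → if does (v Fin.≟ y) then 𝟙 (member y i) * fromℕ (deg v) else 0ℚ) (λ v → fromℕ (matches ys i v) * fromℕ (deg v)) ⟩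
    sum (λ v → if does (v Fin.≟ y) then 𝟙 (member y i) * fromℕ (deg v) else 0ℚ) + classDegree ys i
      ≡⟨ cong (_+ classDegree ys i) (sum-select y (λ v → 𝟙 (member y i) * fromℕ (deg v))) ⟩
    𝟙 (member y i) * fromℕ (deg y) + classDegree ys i ∎
    where
    open ≡-Reasoning
    bools : ∀ a b d k → fromℕ (⟦ a ∧ b ⟧ ℕ.+ k) * d ≡ (if a then 𝟙 b * d else 0ℚ) + fromℕ k * d
    bools true  b d k = trans (cong (_* d) (trans (fromℕ-+ ⟦ b ⟧ k) (cong (_+ fromℕ k) (fromℕ⟦⟧ b)))) (ℚ.*-distribʳ-+ d (𝟙 b) (fromℕ k))
    bools false b d k = sym (ℚ.+-identityˡ (fromℕ k * d))
    pointwise : ∀ v → fromℕ (matches (y ∷ ys) i v) * fromℕ (deg v) ≡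
      (if does (v Fin.≟ y) then 𝟙 (member y i) * fromℕ (deg v) else 0ℚ) + fromℕ (matches ys i v) * fromℕ (deg v)
    pointwise v = trans (cong (λ k → fromℕ k * fromℕ (deg v)) (count-∷ (λ y → v Fin.≟ y ×-dec y ∈B? i) y ys))
      (bools (does (v Fin.≟ y)) (member y i) (fromℕ (deg v)) (matches ys i v))

  members-∷ : ∀ {k} y (ys : Vec (Fin n) k) i →
    fromℕ (members (y ∷ ys) i) * level i ≡ 𝟙 (member y i) * level i + fromℕ (members ys i) * level i
  members-∷ y ys i = trans
    (cong (_* level i) (trans (cong fromℕ (count-∷ (_∈B? i) y ys)) (trans (fromℕ-+ ⟦ member y i ⟧ (members ys i)) (cong (_+ fromℕ (members ys i)) (fromℕ⟦⟧ (member y i))))))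
    (ℚ.*-distribʳ-+ (level i) (𝟙 (member y i)) (fromℕ (members ys i)))

  classDegree-≤ : ∀ {k} (S : Vec (Fin n) k) i → classDegree S i ≤ fromℕ (members S i) * level i
  classDegree-≤ []       i = ℚ.≤-reflexive (trans (classDegree-[] i) (sym (ℚ.*-zeroˡ (level i))))
  classDegree-≤ (y ∷ ys) i = subst₂ _≤_ (sym (classDegree-∷ y ys i)) (sym (members-∷ y ys i))
    (ℚ.+-mono-≤ (member-deg-≤ y i) (classDegree-≤ ys i))

  members-level-≤ : ∀ {k} (S : Vec (Fin n) k) i → fromℕ (members S i) * level i ≤ 1+γ * classDegree S i
  members-level-≤ []       i = ℚ.≤-reflexive (trans (ℚ.*-zeroˡ (level i)) (sym (trans (cong (1+γ *_) (classDegree-[] i)) (ℚ.*-zeroʳ 1+γ))))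
  members-level-≤ (y ∷ ys) i = subst₂ _≤_ (sym (members-∷ y ys i)) (sym (trans (cong (1+γ *_) (classDegree-∷ y ys i)) (ℚ.*-distribˡ-+ 1+γ _ _)))
    (ℚ.+-mono-≤ (member-level-≤ y i) (members-level-≤ ys i))

  -- The condition `Heavy` as a function of S alone: the weights below must be fixed before T is
  -- drawn.
  HeavyIn : Vec (Fin n) ∣S∣ → Fin t → Set
  HeavyIn S i = ε * fromℕ ∣S∣ ^ 2 ≤ fromℕ (6 ℕ.* n) * (fromℕ t * fromℕ (members S i)) ^ 2

  heavyIn? : ∀ S i → Dec (HeavyIn S i)
  heavyIn? S i = _ ℚ.≤? _

  module _ (S : Vec (Fin n) ∣S∣) where

    -- What one picked vertex x contributes to the sum of |Tᵢ| over heavy classes. For fixed S this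
    -- makes p̃ a multiple of a sum of independent weights.
    weight : Fin n → ℕ
    weight x = sumᴺ (λ i → if does (heavyIn? S i) then matches S i x else 0)

    fromℕ-weight : ∀ x → fromℕ (weight x) ≡ sum (λ i → 𝟙 (does (heavyIn? S i)) * fromℕ (matches S i x))
    fromℕ-weight x = trans (fromℕ-sum (λ i → if does (heavyIn? S i) then matches S i x else 0)) (sum-cong-≗ (λ i → fromℕ-if (does (heavyIn? S i)) (matches S i x)))

    -- Each class contributes at most the multiplicity of x in S; the factor t is paid for by the
    -- number of edge queries.
    weight-≤ : ∀ M → (∀ x → occurrences x S ℕ.≤ M) → ∀ x → weight x ℕ.≤ t ℕ.* M
    weight-≤ M N≤M x = fromℕ-cancel-≤ (begin
      fromℕ (weight x)                                        ≡⟨ fromℕ-weight x ⟩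
      sum (λ i → 𝟙 (does (heavyIn? S i)) * fromℕ (matches S i x))      ≤⟨ sum-mono (λ i → ℚ.≤-trans (*-monoʳ-≤ (0≤fromℕ (matches S i x)) (𝟙≤1 (does (heavyIn? S i)))) (ℚ.≤-trans (ℚ.≤-reflexive (ℚ.*-identityˡ (fromℕ (matches S i x)))) (fromℕ-mono-≤ (ℕ.≤-trans (matches≤ S i x) (N≤M x))))) ⟩
      sum {t} (λ _ → fromℕ M)                                 ≡⟨ sum-const t (fromℕ M) ⟩
      fromℕ t * fromℕ M                                       ≡⟨ sym (fromℕ-* t M) ⟩
      fromℕ (t ℕ.* M)                                         ∎)
      where
      open ℚ.≤-Reasoning
      𝟙≤1 : ∀ b → 𝟙 b ≤ 1ℚ
      𝟙≤1 true  = ℚ.≤-refl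
      𝟙≤1 false = ℚ.nonNegative⁻¹ 1ℚ
      ⟦∧⟧≤ : ∀ a b → ⟦ a ∧ b ⟧ ℕ.≤ ⟦ a ⟧
      ⟦∧⟧≤ true  b = ⟦⟧≤1 b
      ⟦∧⟧≤ false b = ℕ.z≤n
      matches≤ : ∀ {k} (S : Vec (Fin n) k) i x → matches S i x ℕ.≤ occurrences x S
      matches≤ []       i x = ℕ.z≤n
      matches≤ (y ∷ ys) i x = subst₂ ℕ._≤_ (sym (count-∷ (λ y → x Fin.≟ y ×-dec y ∈B? i) y ys)) (sym (count-∷ (x Fin.≟_) y ys))
        (ℕ.+-mono-≤ (⟦∧⟧≤ (does (x Fin.≟ y)) (member y i)) (matches≤ ys i x))

    sumHeavy-matches : ∀ {k} (T : Vec (Fin n) k) →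
      sum (λ i → if does (heavyIn? S i) then fromℕ (Vec.sum (Vec.map (matches S i) T)) else 0ℚ) ≡ fromℕ (total weight T)
    sumHeavy-matches []       = trans (sum-cong-≗ (λ i → trans (if-≡-𝟙* (does (heavyIn? S i)) 0ℚ) (ℚ.*-zeroʳ (𝟙 (does (heavyIn? S i)))))) (trans (sum-const t 0ℚ) (ℚ.*-zeroʳ (fromℕ t)))
    sumHeavy-matches (x ∷ xs) = begin
      sum (λ i → if does (heavyIn? S i) then fromℕ (matches S i x ℕ.+ rest i) else 0ℚ)
        ≡⟨ sum-cong-≗ pointwise ⟩
      sum (λ i → 𝟙 (does (heavyIn? S i)) * fromℕ (matches S i x) + (if does (heavyIn? S i) then fromℕ (rest i) else 0ℚ))
        ≡⟨ ∑-distrib-+ (λ i → 𝟙 (does (heavyIn? S i)) * fromℕ (matches S i x)) (λ i → if does (heavyIn? S i) then fromℕ (rest i) else 0ℚ) ⟩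
      sum (λ i → 𝟙 (does (heavyIn? S i)) * fromℕ (matches S i x)) + sum (λ i → if does (heavyIn? S i) then fromℕ (rest i) else 0ℚ)
        ≡⟨ cong₂ _+_ (sym (fromℕ-weight x)) (sumHeavy-matches xs) ⟩
      fromℕ (weight x) + fromℕ (total weight xs)
        ≡⟨ sym (fromℕ-+ (weight x) (total weight xs)) ⟩
      fromℕ (total weight (x ∷ xs)) ∎
      where
      open ≡-Reasoning
      rest : Fin t → ℕ
      rest i = Vec.sum (Vec.map (matches S i) xs)
      bools : ∀ b k l → (if b then fromℕ (k ℕ.+ l) else 0ℚ) ≡ 𝟙 b * fromℕ k + (if b then fromℕ l else 0ℚ)
      bools true  k l = trans (fromℕ-+ k l) (cong (_+ fromℕ l) (sym (ℚ.*-identityˡ (fromℕ k))))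
      bools false k l = sym (trans (ℚ.+-identityʳ (0ℚ * fromℕ k)) (ℚ.*-zeroˡ (fromℕ k)))
      pointwise : ∀ i → (if does (heavyIn? S i) then fromℕ (matches S i x ℕ.+ rest i) else 0ℚ) ≡
        𝟙 (does (heavyIn? S i)) * fromℕ (matches S i x) + (if does (heavyIn? S i) then fromℕ (rest i) else 0ℚ)
      pointwise i = bools (does (heavyIn? S i)) (matches S i x) (rest i)

    -- By `𝔼-randEndpoint`, 2m times the mean weight of a random endpoint.
    sampledDegree : ℕ
    sampledDegree = sumᴺ (λ v → weight v ℕ.* deg v)

    fromℕ-sampledDegree : fromℕ sampledDegree ≡ sum (λ i → 𝟙 (does (heavyIn? S i)) * classDegree S i)
    fromℕ-sampledDegree = begin
      fromℕ sampledDegree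
        ≡⟨ trans (fromℕ-sum (λ v → weight v ℕ.* deg v)) (sum-cong-≗ (λ v → trans (fromℕ-* (weight v) (deg v)) (cong (_* fromℕ (deg v)) (fromℕ-weight v)))) ⟩
      sum (λ v → sum (λ i → 𝟙 (does (heavyIn? S i)) * fromℕ (matches S i v)) * fromℕ (deg v))
        ≡⟨ sum-cong-≗ (λ v → trans (ℚ.*-comm _ (fromℕ (deg v))) (trans (*-distribˡ-sum (fromℕ (deg v)) (λ i → 𝟙 (does (heavyIn? S i)) * fromℕ (matches S i v))) (sum-cong-≗ (λ i → lem (fromℕ (deg v)) (𝟙 (does (heavyIn? S i))) (fromℕ (matches S i v)))))) ⟩
      sum (λ v → sum (λ i → 𝟙 (does (heavyIn? S i)) * (fromℕ (matches S i v) * fromℕ (deg v))))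
        ≡⟨ ∑-comm (λ v i → 𝟙 (does (heavyIn? S i)) * (fromℕ (matches S i v) * fromℕ (deg v))) ⟩
      sum (λ i → sum (λ v → 𝟙 (does (heavyIn? S i)) * (fromℕ (matches S i v) * fromℕ (deg v))))
        ≡⟨ sum-cong-≗ (λ i → sym (*-distribˡ-sum (𝟙 (does (heavyIn? S i))) (λ v → fromℕ (matches S i v) * fromℕ (deg v)))) ⟩
      sum (λ i → 𝟙 (does (heavyIn? S i)) * classDegree S i) ∎
      where
      open ≡-Reasoning
      lem : ∀ d a b → d * (a * b) ≡ a * (b * d)
      lem = solve-∀ ℚ-ring

    -- d̃ without its factor n/|S|: the degrees counted by `sampledDegree`, each rounded up to the
    -- top of its class.
    roundedDegree : ℚ
    roundedDegree = sum (λ i → if does (heavyIn? S i) then fromℕ (members S i) * level i else 0ℚ)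

    private
      roundedDegree≡ : roundedDegree ≡ sum (λ i → 𝟙 (does (heavyIn? S i)) * (fromℕ (members S i) * level i))
      roundedDegree≡ = sum-cong-≗ (λ i → if-≡-𝟙* (does (heavyIn? S i)) (fromℕ (members S i) * level i))

    sampledDegree-≤ : fromℕ sampledDegree ≤ roundedDegree
    sampledDegree-≤ = subst₂ _≤_ (sym fromℕ-sampledDegree) (sym roundedDegree≡)
      (sum-mono (λ i → *-monoˡ-≤ (0≤𝟙 (does (heavyIn? S i))) (classDegree-≤ S i)))

    roundedDegree-≤ : roundedDegree ≤ 1+γ * fromℕ sampledDegree
    roundedDegree-≤ = subst₂ _≤_ (sym roundedDegree≡) (sym (trans (cong (1+γ *_) fromℕ-sampledDegree) (*-distribˡ-sum 1+γ (λ i → 𝟙 (does (heavyIn? S i)) * classDegree S i))))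
      (sum-mono (λ i → ℚ.≤-trans (*-monoˡ-≤ (0≤𝟙 (does (heavyIn? S i))) (members-level-≤ S i)) (ℚ.≤-reflexive (lem (𝟙 (does (heavyIn? S i))) 1+γ (classDegree S i)))))
      where
      lem : ∀ a b c → a * (b * c) ≡ b * (a * c)
      lem = solve-∀ ℚ-ring

-- Large classes carry a constant fraction of the edges

-- In terms of roots: β ≥ √(6εn)/(5t) and σ/N ≥ (5/6)β/n give σ/N ≥ √(ε/(6n))/t, the threshold of
-- the algorithm. This fixes the constants 6 and 25 in `Large`.
heavy-criterion : ∀ {ε q N t β σ} → 0ℚ < fromℕ 6 * q → 0ℚ ≤ N → 0ℚ ≤ β →
  fromℕ 6 * ε * q ≤ fromℕ 25 * (t * β) ^ 2 → fromℕ 5 * (N * β) ≤ fromℕ 6 * (q * σ) →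
  ε * N ^ 2 ≤ fromℕ 6 * q * (t * σ) ^ 2
heavy-criterion {ε} {q} {N} {t} {β} {σ} 0<6q 0≤N 0≤β large representative = *-cancelˡ-≤ 0<6q (begin
  fromℕ 6 * q * (ε * N ^ 2)
    ≡⟨ lem₁ ε q N ⟩
  N * N * (fromℕ 6 * ε * q)
    ≤⟨ *-monoˡ-≤ (0≤x² N) large ⟩
  N * N * (fromℕ 25 * (t * β) ^ 2)
    ≡⟨ lem₂ N t β ⟩
  t * t * (fromℕ 5 * (N * β) * (fromℕ 5 * (N * β)))
    ≤⟨ *-monoˡ-≤ (0≤x² t) (*-mono-≤ 0≤5Nβ representative 0≤5Nβ representative) ⟩
  t * t * (fromℕ 6 * (q * σ) * (fromℕ 6 * (q * σ)))
    ≡⟨ lem₃ q t σ ⟩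
  fromℕ 6 * q * (fromℕ 6 * q * (t * σ) ^ 2) ∎)
  where
  open ℚ.≤-Reasoning
  0≤5Nβ : 0ℚ ≤ fromℕ 5 * (N * β)
  0≤5Nβ = *-nonNeg (0≤fromℕ 5) (*-nonNeg 0≤N 0≤β)
  lem₁ : ∀ e q N → fromℕ 6 * q * (e * (N * (N * 1ℚ))) ≡ N * N * (fromℕ 6 * e * q)
  lem₁ = solve-∀ ℚ-ring
  lem₂ : ∀ N t b → N * N * (fromℕ 25 * (t * b * (t * b * 1ℚ))) ≡ t * t * (fromℕ 5 * (N * b) * (fromℕ 5 * (N * b)))
  lem₂ = solve-∀ ℚ-ring
  lem₃ : ∀ q t s → t * t * (fromℕ 6 * (q * s) * (fromℕ 6 * (q * s))) ≡ fromℕ 6 * q * (fromℕ 6 * q * (t * s * (t * s * 1ℚ)))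
  lem₃ = solve-∀ ℚ-ring

module LargeClasses {n : ℕ} (G : SimpleGraph n) .{{_ : NonZero (∣E∣ G)}}
  (ε : ℚ) .{{_ : Positive ε}} (ε<1 : ε < 1ℚ) (h : HiddenFactors) where

  open Algorithm G ε h
  open Handshake G
  open Weights G ε h
  open SimpleGraph G using (deg)

  private
    m = ∣E∣ G
    q = fromℕ n
    N = fromℕ ∣S∣

  Large : Fin t → Set
  Large i = fromℕ 6 * ε * q ≤ fromℕ 25 * (fromℕ t * fromℕ (classSize i)) ^ 2

  large? : Decidable Large
  large? i = _ ℚ.≤? _

  deg≤n : ∀ v → deg v ℕ.≤ n
  deg≤n v = ℕ.≤-trans (List.length-filter (SimpleGraph._~?_ G v) (List.allFin n)) (ℕ.≤-reflexive (List.length-tabulate {n = n} (λ i → i)))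

  -- Descends to the least k with deg v ≤ (1+γ)^k. If k > 0, minimality is the strict lower bound;
  -- if k = 0, it reads 1 < (1+γ) deg v.
  covered : ∀ v → 1 ℕ.≤ deg v → ∃[ i ] v ∈B i
  covered v 1≤d = search (⌈log[1+_]_⌉ γ {{γ>0}} n) (ℚ.≤-trans (fromℕ-mono-≤ (deg≤n v)) (log-holds γ {{γ>0}} n)) (ℕ.m<m+n _ (ℕ.s≤s ℕ.z≤n))
    where
    γ>0 : Positive γ
    γ>0 = ℚ.pos*pos⇒pos ε (+ 1 / 10)
    d = fromℕ (deg v)
    1≤d′ : 1ℚ ≤ d
    1≤d′ = fromℕ-mono-≤ 1≤d
    0<1+γ : 0ℚ < 1+γ
    0<1+γ = ℚ.<-≤-trans (ℚ.positive⁻¹ 1ℚ) 1≤1+γ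
    index : ∀ k → (k<t : k ℕ.< t) → 1+γ ^ k < 1+γ * d → d ≤ 1+γ ^ k → ∃[ i ] v ∈B i
    index k k<t lt le = Fin.fromℕ< k<t ,
      subst (λ j → 1+γ ^ j < 1+γ * d × d ≤ 1+γ ^ j) (sym (Fin.toℕ-fromℕ< k<t)) (lt , le)
    search : ∀ k → d ≤ 1+γ ^ k → k ℕ.< t → ∃[ i ] v ∈B i
    search zero le 0<t = index zero 0<t (begin-strict
      1ℚ            <⟨ subst (_< 1+γ) (ℚ.+-identityʳ 1ℚ) (ℚ.+-monoʳ-< 1ℚ (ℚ.positive⁻¹ γ {{γ>0}})) ⟩
      1+γ           ≡⟨ sym (ℚ.*-identityʳ 1+γ) ⟩
      1+γ * 1ℚ      ≤⟨ *-monoˡ-≤ 0≤1+γ 1≤d′ ⟩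
      1+γ * d       ∎) le
      where open ℚ.≤-Reasoning
    search (suc k) le k<t = go (d ℚ.≤? 1+γ ^ k)
      where
      go : Dec (d ≤ 1+γ ^ k) → ∃[ i ] v ∈B i
      go (yes le′) = search k le′ (ℕ.<-trans (ℕ.n<1+n k) k<t)
      go (no ≰)    = index (suc k) k<t (ℚ.*-monoʳ-<-pos 1+γ {{ℚ.positive 0<1+γ}} (ℚ.≰⇒> ≰)) le

  private
    largeᵇ : Fin t → Bool
    largeᵇ i = does (large? i)

    inLarge : Fin n → Bool
    inLarge v = does (Fin.any? (λ i → large? i ×-dec (v ∈B? i)))

    -- The number of non-large classes containing v. Counting classes instead of using an indicator
    -- lets its total be found by exchanging two sums.
    ℓ : Fin n → ℚ
    ℓ v = sum (λ i → 𝟙 (not (largeᵇ i)) * 𝟙 (member v i))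

    sum0 : ∀ k → sum {k} (λ _ → 0ℚ) ≡ 0ℚ
    sum0 k = trans (sum-const k 0ℚ) (ℚ.*-zeroʳ (fromℕ k))

    0≤ℓ : ∀ v → 0ℚ ≤ ℓ v
    0≤ℓ v = subst (_≤ ℓ v) (sum0 t) (sum-mono (λ i → *-nonNeg (0≤𝟙 (not (largeᵇ i))) (0≤𝟙 (member v i))))

    ℓ-large : ∀ v → inLarge v ≡ false → 1 ℕ.≤ deg v → 1ℚ ≤ ℓ v
    ℓ-large v notLarge 1≤d = go (covered v 1≤d)
      where
      term : Fin t → ℚ
      term i = 𝟙 (not (largeᵇ i)) * 𝟙 (member v i)
      largeIn? : Dec (∃[ i ] Large i × v ∈B i)
      largeIn? = Fin.any? (λ i → large? i ×-dec (v ∈B? i))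
      absurd : ∀ (d : Dec (∃[ i ] Large i × v ∈B i)) → does d ≡ false → ¬ (∃[ i ] Large i × v ∈B i)
      absurd (no ¬p) _ = ¬p
      go : ∃[ i ] v ∈B i → 1ℚ ≤ ℓ v
      go (i , v∈i) = subst (_≤ ℓ v)
        (cong₂ (λ a b → 𝟙 (not a) * 𝟙 b) (dec-false (large? i) (λ lrg → absurd largeIn? notLarge (i , lrg , v∈i))) (dec-true (v ∈B? i) v∈i))
        (term≤sum term (λ i → *-nonNeg (0≤𝟙 (not (largeᵇ i))) (0≤𝟙 (member v i))) i)

    classSize≡ : ∀ i → fromℕ (classSize i) ≡ sum (λ v → 𝟙 (member v i))
    classSize≡ i = trans (fromℕ-sum (λ v → ⟦ member v i ⟧)) (sum-cong-≗ (λ v → fromℕ⟦⟧ (member v i)))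

    smallSize : Fin t → ℚ
    smallSize i = 𝟙 (not (largeᵇ i)) * fromℕ (classSize i)

    sum-ℓ : sum ℓ ≡ sum smallSize
    sum-ℓ = trans (∑-comm (λ v i → 𝟙 (not (largeᵇ i)) * 𝟙 (member v i)))
      (sum-cong-≗ (λ i → trans (sym (*-distribˡ-sum (𝟙 (not (largeᵇ i))) (λ v → 𝟙 (member v i)))) (cong (𝟙 (not (largeᵇ i)) *_) (sym (classSize≡ i)))))

    -- Each non-large class satisfies 25 (tβ)² < 6εn ≤ 6n. The factor t in `Large` is there so that
    -- t such classes together obey the same bound.
    few-small : fromℕ 25 * (sum ℓ * sum ℓ) ≤ fromℕ 6 * q
    few-small = subst (λ s → fromℕ 25 * (s * s) ≤ fromℕ 6 * q) (sym sum-ℓ)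
      (sum-square-≤ smallSize (fromℕ 25) (fromℕ 6 * q) (λ i → *-nonNeg (0≤𝟙 (not (largeᵇ i))) (0≤fromℕ (classSize i))) (0≤fromℕ 25) (*-nonNeg (0≤fromℕ 6) (0≤fromℕ n)) (λ i → small i (large? i)))
      where
      open ℚ.≤-Reasoning
      lem₀ : ∀ t z → fromℕ 25 * (t * (0ℚ * z) * (t * (0ℚ * z) * 1ℚ)) ≡ 0ℚ
      lem₀ = solve-∀ ℚ-ring
      small : ∀ i (l? : Dec (Large i)) → fromℕ 25 * (fromℕ t * (𝟙 (not (does l?)) * fromℕ (classSize i))) ^ 2 ≤ fromℕ 6 * q
      small i (yes _) = subst (_≤ fromℕ 6 * q) (sym (lem₀ (fromℕ t) (fromℕ (classSize i)))) (*-nonNeg (0≤fromℕ 6) (0≤fromℕ n))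
      small i (no ¬l) = begin
        fromℕ 25 * (fromℕ t * (1ℚ * fromℕ (classSize i))) ^ 2   ≡⟨ cong (λ z → fromℕ 25 * (fromℕ t * z) ^ 2) (ℚ.*-identityˡ (fromℕ (classSize i))) ⟩
        fromℕ 25 * (fromℕ t * fromℕ (classSize i)) ^ 2          ≤⟨ ℚ.<⇒≤ (ℚ.≰⇒> ¬l) ⟩
        fromℕ 6 * ε * q                                         ≤⟨ *-monoʳ-≤ (0≤fromℕ n) (*-monoˡ-≤ (0≤fromℕ 6) (ℚ.<⇒≤ ε<1)) ⟩
        fromℕ 6 * 1ℚ * q                                        ≡⟨ cong (_* q) (ℚ.*-identityʳ (fromℕ 6)) ⟩
        fromℕ 6 * q                                             ∎

    largeLevels : ℚ
    largeLevels = sum (λ i → 𝟙 (largeᵇ i) * (fromℕ (classSize i) * level i))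

    inLarge-deg-≤ : sum (λ v → 𝟙 (inLarge v) * fromℕ (deg v)) ≤ largeLevels
    inLarge-deg-≤ = begin
      sum (λ v → 𝟙 (inLarge v) * fromℕ (deg v))
        ≤⟨ sum-mono (λ v → pointwise v (Fin.any? (λ i → large? i ×-dec (v ∈B? i)))) ⟩
      sum (λ v → sum (λ i → 𝟙 (largeᵇ i) * (𝟙 (member v i) * level i)))
        ≡⟨ ∑-comm (λ v i → 𝟙 (largeᵇ i) * (𝟙 (member v i) * level i)) ⟩
      sum (λ i → sum (λ v → 𝟙 (largeᵇ i) * (𝟙 (member v i) * level i)))
        ≡⟨ sum-cong-≗ (λ i → trans (sym (*-distribˡ-sum (𝟙 (largeᵇ i)) (λ v → 𝟙 (member v i) * level i)))
             (cong (𝟙 (largeᵇ i) *_) (trans (trans (sum-cong-≗ (λ v → ℚ.*-comm (𝟙 (member v i)) (level i))) (sym (*-distribˡ-sum (level i) (λ v → 𝟙 (member v i)))))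
               (trans (ℚ.*-comm (level i) (sum (λ v → 𝟙 (member v i)))) (cong (_* level i) (sym (classSize≡ i))))))) ⟩
      largeLevels ∎
      where
      open ℚ.≤-Reasoning
      0≤term : ∀ v i → 0ℚ ≤ 𝟙 (largeᵇ i) * (𝟙 (member v i) * level i)
      0≤term v i = *-nonNeg (0≤𝟙 (largeᵇ i)) (*-nonNeg (0≤𝟙 (member v i)) (0≤level i))
      pointwise : ∀ v (l? : Dec (∃[ i ] Large i × v ∈B i)) → 𝟙 (does l?) * fromℕ (deg v) ≤ sum (λ i → 𝟙 (largeᵇ i) * (𝟙 (member v i) * level i))
      pointwise v (no _) = subst₂ _≤_ (sym (ℚ.*-zeroˡ (fromℕ (deg v)))) refl (subst (_≤ sum (λ i → 𝟙 (largeᵇ i) * (𝟙 (member v i) * level i))) (sum0 t) (sum-mono (0≤term v)))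
      pointwise v (yes (i , lrg , v∈i)) = begin
        1ℚ * fromℕ (deg v)                               ≡⟨ ℚ.*-identityˡ (fromℕ (deg v)) ⟩
        fromℕ (deg v)                                    ≤⟨ proj₂ v∈i ⟩
        level i                                          ≡⟨ sym (trans (cong₂ (λ a b → 𝟙 a * (𝟙 b * level i)) (dec-true (large? i) lrg) (dec-true (v ∈B? i) v∈i)) (trans (ℚ.*-identityˡ (1ℚ * level i)) (ℚ.*-identityˡ (level i)))) ⟩
        𝟙 (largeᵇ i) * (𝟙 (member v i) * level i)        ≤⟨ term≤sum (λ i → 𝟙 (largeᵇ i) * (𝟙 (member v i) * level i)) (0≤term v) i ⟩
        sum (λ i → 𝟙 (largeᵇ i) * (𝟙 (member v i) * level i)) ∎

  -- The ordered pairs of vertices outside the large classes number at most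
  -- (6/25) n ≤ (36/25) m, out of 2m.
  largeLevels-≥ : n ℕ.≤ 6 ℕ.* m → fromℕ 14 * fromℕ m ≤ fromℕ 50 * largeLevels
  largeLevels-≥ n≤6m = cancel (begin
    fromℕ 50 * fromℕ m
      ≡⟨ lem₁ (fromℕ m) ⟩
    fromℕ 25 * (fromℕ 2 * fromℕ m)
      ≡⟨ cong (fromℕ 25 *_) (sym (fromℕ-* 2 m)) ⟩
    fromℕ 25 * fromℕ (2 ℕ.* m)
      ≤⟨ *-monoˡ-≤ (0≤fromℕ 25) (2∣E∣≤ inLarge ℓ 0≤ℓ ℓ-large) ⟩
    fromℕ 25 * ((1ℚ + 1ℚ) * sum (λ v → 𝟙 (inLarge v) * fromℕ (deg v)) + sum ℓ * sum ℓ)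
      ≡⟨ lem₂ (sum (λ v → 𝟙 (inLarge v) * fromℕ (deg v))) (sum ℓ * sum ℓ) ⟩
    fromℕ 50 * sum (λ v → 𝟙 (inLarge v) * fromℕ (deg v)) + fromℕ 25 * (sum ℓ * sum ℓ)
      ≤⟨ ℚ.+-mono-≤ (*-monoˡ-≤ (0≤fromℕ 50) inLarge-deg-≤) few-small ⟩
    fromℕ 50 * largeLevels + fromℕ 6 * q
      ≤⟨ ℚ.+-monoʳ-≤ (fromℕ 50 * largeLevels) (*-monoˡ-≤ (0≤fromℕ 6) (fromℕ-mono-≤ n≤6m)) ⟩
    fromℕ 50 * largeLevels + fromℕ 6 * fromℕ (6 ℕ.* m)
      ≡⟨ cong (λ z → fromℕ 50 * largeLevels + fromℕ 6 * z) (fromℕ-* 6 m) ⟩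
    fromℕ 50 * largeLevels + fromℕ 6 * (fromℕ 6 * fromℕ m) ∎)
    where
    open ℚ.≤-Reasoning
    lem₁ : ∀ m → fromℕ 50 * m ≡ fromℕ 25 * (fromℕ 2 * m)
    lem₁ = solve-∀ ℚ-ring
    lem₂ : ∀ a b → fromℕ 25 * ((1ℚ + 1ℚ) * a + b) ≡ fromℕ 50 * a + fromℕ 25 * b
    lem₂ = solve-∀ ℚ-ring
    lem₃ : ∀ m → fromℕ 14 * m ≡ fromℕ 50 * m - fromℕ 6 * (fromℕ 6 * m)
    lem₃ = solve-∀ ℚ-ring
    lem₄ : ∀ x m → x + fromℕ 6 * (fromℕ 6 * m) - fromℕ 6 * (fromℕ 6 * m) ≡ x
    lem₄ = solve-∀ ℚ-ring
    cancel : fromℕ 50 * fromℕ m ≤ fromℕ 50 * largeLevels + fromℕ 6 * (fromℕ 6 * fromℕ m) →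
      fromℕ 14 * fromℕ m ≤ fromℕ 50 * largeLevels
    cancel le = subst₂ _≤_ (sym (lem₃ (fromℕ m))) (lem₄ (fromℕ 50 * largeLevels) (fromℕ m)) (ℚ.+-monoˡ-≤ (- (fromℕ 6 * (fromℕ 6 * fromℕ m))) le)

  module _ (S : Vec (Fin n) ∣S∣)
    (representative : ∀ i → Large i → 5 ℕ.* (∣S∣ ℕ.* classSize i) ℕ.≤ 6 ℕ.* (n ℕ.* members S i)) where

    private
      representativeℚ : ∀ i → Large i → fromℕ 5 * (N * fromℕ (classSize i)) ≤ fromℕ 6 * (q * fromℕ (members S i))
      representativeℚ i lrg = subst₂ _≤_
        (trans (fromℕ-* 5 (∣S∣ ℕ.* classSize i)) (cong (fromℕ 5 *_) (fromℕ-* ∣S∣ (classSize i))))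
        (trans (fromℕ-* 6 (n ℕ.* members S i)) (cong (fromℕ 6 *_) (fromℕ-* n (members S i))))
        (fromℕ-mono-≤ {5 ℕ.* (∣S∣ ℕ.* classSize i)} {6 ℕ.* (n ℕ.* members S i)} (representative i lrg))

      0<6n : 0ℚ < fromℕ 6 * q
      0<6n = *-pos (ℚ.positive⁻¹ (fromℕ 6)) (ℚ.positive⁻¹ q {{ℚ.normalize-pos n 1 {{_}} {{∣E∣-nonZero⇒nonZero G}}}})

    large⇒heavy : ∀ i → Large i → does (heavyIn? S i) ≡ true
    large⇒heavy i lrg = dec-true (heavyIn? S i) heavy
      where
      heavy : HeavyIn S i
      heavy = subst (λ z → ε * N ^ 2 ≤ z * (fromℕ t * fromℕ (members S i)) ^ 2) (sym (fromℕ-* 6 n))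
        (heavy-criterion {ε} {q} {N} {fromℕ t} {fromℕ (classSize i)} {fromℕ (members S i)}
          0<6n (0≤fromℕ ∣S∣) (0≤fromℕ (classSize i)) lrg (representativeℚ i lrg))

    largeLevels-≤ : fromℕ 5 * N * largeLevels ≤ fromℕ 6 * q * roundedDegree S
    largeLevels-≤ = subst₂ _≤_ (sym (*-distribˡ-sum (fromℕ 5 * N) (λ i → 𝟙 (largeᵇ i) * (fromℕ (classSize i) * level i))))
      (sym (*-distribˡ-sum (fromℕ 6 * q) (λ i → if does (heavyIn? S i) then fromℕ (members S i) * level i else 0ℚ)))
      (sum-mono (λ i → pointwise i (large? i)))
      where
      open ℚ.≤-Reasoning
      lem₁ : ∀ N b l → fromℕ 5 * N * (1ℚ * (b * l)) ≡ fromℕ 5 * (N * b) * l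
      lem₁ = solve-∀ ℚ-ring
      lem₂ : ∀ q s l → fromℕ 6 * (q * s) * l ≡ fromℕ 6 * q * (s * l)
      lem₂ = solve-∀ ℚ-ring
      0≤if : ∀ b {x} → 0ℚ ≤ x → 0ℚ ≤ (if b then x else 0ℚ)
      0≤if true  0≤x = 0≤x
      0≤if false _   = ℚ.≤-refl
      pointwise : ∀ i (l? : Dec (Large i)) → fromℕ 5 * N * (𝟙 (does l?) * (fromℕ (classSize i) * level i)) ≤
        fromℕ 6 * q * (if does (heavyIn? S i) then fromℕ (members S i) * level i else 0ℚ)
      pointwise i (no _) = subst (_≤ fromℕ 6 * q * (if does (heavyIn? S i) then fromℕ (members S i) * level i else 0ℚ))
        (sym (trans (cong (fromℕ 5 * N *_) (ℚ.*-zeroˡ (fromℕ (classSize i) * level i))) (ℚ.*-zeroʳ (fromℕ 5 * N))))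
        (*-nonNeg (*-nonNeg (0≤fromℕ 6) (0≤fromℕ n)) (0≤if (does (heavyIn? S i)) (*-nonNeg (0≤fromℕ (members S i)) (0≤level i))))
      pointwise i (yes lrg) = begin
        fromℕ 5 * N * (1ℚ * (fromℕ (classSize i) * level i))   ≡⟨ lem₁ N (fromℕ (classSize i)) (level i) ⟩
        fromℕ 5 * (N * fromℕ (classSize i)) * level i          ≤⟨ *-monoʳ-≤ (0≤level i) (representativeℚ i lrg) ⟩
        fromℕ 6 * (q * fromℕ (members S i)) * level i          ≡⟨ lem₂ q (fromℕ (members S i)) (level i) ⟩
        fromℕ 6 * q * (fromℕ (members S i) * level i)
          ≡⟨ cong (λ b → fromℕ 6 * q * (if b then fromℕ (members S i) * level i else 0ℚ)) (sym (large⇒heavy i lrg)) ⟩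
        fromℕ 6 * q * (if does (heavyIn? S i) then fromℕ (members S i) * level i else 0ℚ) ∎

    -- The constant is 14/50 · 5/6 · 6/7 = 1/5: the share of m carried by large classes, the
    -- sampling loss, and the rounding loss 1+γ ≤ 7/6.
    sampledDegree-≥ : n ℕ.≤ 6 ℕ.* m → ∣S∣ ℕ.* m ℕ.≤ 5 ℕ.* (n ℕ.* sampledDegree S)
    sampledDegree-≥ n≤6m = fromℕ-cancel-≤ (*-cancelˡ-≤ {fromℕ 70} (ℚ.positive⁻¹ (fromℕ 70)) (begin
      fromℕ 70 * fromℕ (∣S∣ ℕ.* m)
        ≡⟨ trans (cong (fromℕ 70 *_) (fromℕ-* ∣S∣ m)) (lem₁ N (fromℕ m)) ⟩
      fromℕ 5 * N * (fromℕ 14 * fromℕ m)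
        ≤⟨ *-monoˡ-≤ (*-nonNeg (0≤fromℕ 5) (0≤fromℕ ∣S∣)) (largeLevels-≥ n≤6m) ⟩
      fromℕ 5 * N * (fromℕ 50 * largeLevels)
        ≡⟨ lem₂ N largeLevels ⟩
      fromℕ 50 * (fromℕ 5 * N * largeLevels)
        ≤⟨ *-monoˡ-≤ (0≤fromℕ 50) largeLevels-≤ ⟩
      fromℕ 50 * (fromℕ 6 * q * roundedDegree S)
        ≤⟨ *-monoˡ-≤ (0≤fromℕ 50) (*-monoˡ-≤ (*-nonNeg (0≤fromℕ 6) (0≤fromℕ n)) (roundedDegree-≤ S)) ⟩
      fromℕ 50 * (fromℕ 6 * q * (1+γ * A))
        ≤⟨ *-monoˡ-≤ (0≤fromℕ 50) (*-monoˡ-≤ (*-nonNeg (0≤fromℕ 6) (0≤fromℕ n)) (*-monoʳ-≤ (0≤fromℕ (sampledDegree S)) 1+γ≤7/6)) ⟩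
      fromℕ 50 * (fromℕ 6 * q * (+ 7 / 6 * A))
        ≡⟨ lem₃ q A ⟩
      fromℕ 70 * (fromℕ 5 * (q * A))
        ≡⟨ cong (fromℕ 70 *_) (sym (trans (fromℕ-* 5 (n ℕ.* sampledDegree S)) (cong (fromℕ 5 *_) (fromℕ-* n (sampledDegree S))))) ⟩
      fromℕ 70 * fromℕ (5 ℕ.* (n ℕ.* sampledDegree S)) ∎))
      where
      open ℚ.≤-Reasoning
      A = fromℕ (sampledDegree S)
      1+γ≤7/6 : 1+γ ≤ + 7 / 6
      1+γ≤7/6 = ℚ.≤-trans (ℚ.+-monoʳ-≤ 1ℚ (*-monoʳ-≤ (ℚ.nonNegative⁻¹ (+ 1 / 10)) (ℚ.<⇒≤ ε<1))) (ℚ.≤ᵇ⇒≤ {1ℚ + 1ℚ * (+ 1 / 10)} {+ 7 / 6} tt)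
      lem₁ : ∀ N m → fromℕ 70 * (N * m) ≡ fromℕ 5 * N * (fromℕ 14 * m)
      lem₁ = solve-∀ ℚ-ring
      lem₂ : ∀ N l → fromℕ 5 * N * (fromℕ 50 * l) ≡ fromℕ 50 * (fromℕ 5 * N * l)
      lem₂ = solve-∀ ℚ-ring
      lem₃ : ∀ q A → fromℕ 50 * (fromℕ 6 * q * (+ 7 / 6 * A)) ≡ fromℕ 70 * (fromℕ 5 * (q * A))
      lem₃ = solve-∀ ℚ-ring

-- Accuracy of the estimates

÷?-just : ∀ p q → q ≢ 0ℚ → ∃[ r ] p ÷? q ≡ just r × r * q ≡ p
÷?-just p q q≢0 with q ℚ.≟ 0ℚ
... | yes q≡0 = contradiction q≡0 q≢0
... | no q≢0′ = p * q⁻¹ , refl , trans (ℚ.*-assoc p q⁻¹ q) (trans (cong (p *_) (ℚ.*-inverseˡ q {{ℚ.≢-nonZero q≢0′}})) (ℚ.*-identityʳ p))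
  where q⁻¹ = (ℚ.1/ q) {{ℚ.≢-nonZero q≢0′}}

>>=-just : ∀ {mx my : Maybe X} {x y} (f : X → X → Maybe Y) → mx ≡ just x → my ≡ just y →
  (mx Maybe.>>= λ x → my Maybe.>>= λ y → f x y) ≡ f x y
>>=-just f refl refl = refl

0<⇒≢0 : ∀ {p} → 0ℚ < p → p ≢ 0ℚ
0<⇒≢0 0<p refl = ℚ.<-irrefl refl 0<p

0<fromℕ : ∀ k .{{_ : NonZero k}} → 0ℚ < fromℕ k
0<fromℕ k = ℚ.positive⁻¹ (fromℕ k) {{ℚ.normalize-pos k 1}}

∣∣-≤ : ∀ {x y} → x ≤ y → - x ≤ y → ℚ.∣ x ∣ ≤ y
∣∣-≤ {x} {y} x≤y -x≤y with ℚ.∣p∣≡p∨∣p∣≡-p x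
... | inj₁ eq = subst (_≤ y) (sym eq) x≤y
... | inj₂ eq = subst (_≤ y) (sym eq) -x≤y

module Accuracy (ε : ℚ) (0≤ε : 0ℚ ≤ ε) (ε≤1 : ε ≤ 1ℚ) where

  private
    ¼ : ℚ
    ¼ = + 1 / 4
    1/10 : ℚ
    1/10 = + 1 / 10

  -- The common core of both estimates r = p/q: p agrees with x up to 1 + ε/10 and mq up to 1 ± ε/4.
  -- The margins suffice because 1 + ε/10 ≤ (1+ε)(1-ε/4) and (1-ε)(1+ε/4) ≤ 1.
  ratio-accurate : ∀ {r p q x} m → 0ℚ ≤ x → 0ℚ < q → r * q ≡ p →
    x ≤ p → p ≤ (1ℚ + ε * 1/10) * x →
    (1ℚ - ε * ¼) * x ≤ m * q → m * q ≤ (1ℚ + ε * ¼) * x →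
    ℚ.∣ r - m ∣ ≤ ε * m
  ratio-accurate {r} {p} {q} {x} m 0≤x 0<q rq≡p x≤p p≤ mq≥ mq≤ = ∣∣-≤
    (subst (r - m ≤_) (lem₁ ε m) (ℚ.+-monoˡ-≤ (- m) (*-cancelˡ-≤ 0<q (begin
      q * r                              ≡⟨ trans (ℚ.*-comm q r) rq≡p ⟩
      p                                  ≤⟨ p≤ ⟩
      (1ℚ + ε * 1/10) * x                ≤⟨ ≤-by (*-nonNeg (+-nonNeg (*-nonNeg 0≤ε (ℚ.nonNegative⁻¹ (+ 2 / 5))) (*-nonNeg (*-nonNeg 0≤ε (ℚ.nonNegative⁻¹ ¼)) 0≤1-ε)) 0≤x) (lem₂ ε x) ⟩
      (1ℚ + ε) * ((1ℚ - ε * ¼) * x)      ≤⟨ *-monoˡ-≤ (+-nonNeg (ℚ.nonNegative⁻¹ 1ℚ) 0≤ε) mq≥ ⟩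
      (1ℚ + ε) * (m * q)                 ≡⟨ lem₃ ε m q ⟩
      q * ((1ℚ + ε) * m)                 ∎))))
    (subst (_≤ ε * m) (lem₄ r m) (subst (m - r ≤_) (lem₅ ε m) (ℚ.+-monoʳ-≤ m (ℚ.neg-antimono-≤ (*-cancelˡ-≤ 0<q (begin
      q * ((1ℚ - ε) * m)                 ≡⟨ lem₆ ε m q ⟩
      (1ℚ - ε) * (m * q)                 ≤⟨ *-monoˡ-≤ 0≤1-ε mq≤ ⟩
      (1ℚ - ε) * ((1ℚ + ε * ¼) * x)      ≤⟨ ≤-by (*-nonNeg (+-nonNeg (*-nonNeg 0≤ε (ℚ.nonNegative⁻¹ (+ 3 / 4))) (*-nonNeg (ℚ.nonNegative⁻¹ ¼) (0≤x² ε))) 0≤x) (lem₇ ε x) ⟩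
      x                                  ≤⟨ x≤p ⟩
      p                                  ≡⟨ sym (trans (ℚ.*-comm q r) rq≡p) ⟩
      q * r                              ∎))))))
    where
    open ℚ.≤-Reasoning
    0≤1-ε : 0ℚ ≤ 1ℚ - ε
    0≤1-ε = p≤q⇒0≤q-p ε≤1
    lem₁ : ∀ e m → (1ℚ + e) * m - m ≡ e * m
    lem₁ = solve-∀ ℚ-ring
    lem₂ : ∀ e x → (1ℚ + e) * ((1ℚ - e * (+ 1 / 4)) * x) ≡ (1ℚ + e * (+ 1 / 10)) * x + (e * (+ 2 / 5) + e * (+ 1 / 4) * (1ℚ - e)) * x
    lem₂ = solve-∀ ℚ-ring
    lem₃ : ∀ e m q → (1ℚ + e) * (m * q) ≡ q * ((1ℚ + e) * m)
    lem₃ = solve-∀ ℚ-ring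
    lem₄ : ∀ r m → m - r ≡ - (r - m)
    lem₄ = solve-∀ ℚ-ring
    lem₅ : ∀ e m → m - (1ℚ - e) * m ≡ e * m
    lem₅ = solve-∀ ℚ-ring
    lem₆ : ∀ e m q → q * ((1ℚ - e) * m) ≡ (1ℚ - e) * (m * q)
    lem₆ = solve-∀ ℚ-ring
    lem₇ : ∀ e x → x ≡ (1ℚ - e) * ((1ℚ + e * (+ 1 / 4)) * x) + (e * (+ 3 / 4) + (+ 1 / 4) * (e * e)) * x
    lem₇ = solve-∀ ℚ-ring

  -- Since 1/Δ ≤ ε, the integral tolerance 1/(4Δ) of the concentration bounds implies the tolerance
  -- ε/4 of `ratio-accurate`.
  module _ (Δ : ℕ) .{{_ : NonZero Δ}} (1≤εΔ : 1ℚ ≤ ε * fromℕ Δ) (x y : ℕ) where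

    private
      4Δ = fromℕ (4 ℕ.* Δ)
      0<4Δ : 0ℚ < 4Δ
      0<4Δ = 0<fromℕ (4 ℕ.* Δ) {{ℕ.m*n≢0 4 Δ}}

    relative-≤ : 4 ℕ.* Δ ℕ.* y ℕ.≤ x ℕ.+ 4 ℕ.* Δ ℕ.* x → fromℕ y ≤ (1ℚ + ε * ¼) * fromℕ x
    relative-≤ le = *-cancelˡ-≤ 0<4Δ (begin
      4Δ * fromℕ y                                ≡⟨ sym (fromℕ-* (4 ℕ.* Δ) y) ⟩
      fromℕ (4 ℕ.* Δ ℕ.* y)                       ≤⟨ fromℕ-mono-≤ {4 ℕ.* Δ ℕ.* y} {x ℕ.+ 4 ℕ.* Δ ℕ.* x} le ⟩
      fromℕ (x ℕ.+ 4 ℕ.* Δ ℕ.* x)                 ≡⟨ trans (fromℕ-+ x (4 ℕ.* Δ ℕ.* x)) (cong₂ _+_ (sym (ℚ.*-identityˡ (fromℕ x))) (fromℕ-* (4 ℕ.* Δ) x)) ⟩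
      1ℚ * fromℕ x + 4Δ * fromℕ x                 ≤⟨ ℚ.+-monoˡ-≤ (4Δ * fromℕ x) (*-monoʳ-≤ (0≤fromℕ x) 1≤εΔ) ⟩
      ε * fromℕ Δ * fromℕ x + 4Δ * fromℕ x        ≡⟨ cong (λ d → ε * fromℕ Δ * fromℕ x + d * fromℕ x) (fromℕ-* 4 Δ) ⟩
      ε * fromℕ Δ * fromℕ x + fromℕ 4 * fromℕ Δ * fromℕ x ≡⟨ lem ε (fromℕ Δ) (fromℕ x) ⟩
      fromℕ 4 * fromℕ Δ * ((1ℚ + ε * ¼) * fromℕ x) ≡⟨ cong (_* ((1ℚ + ε * ¼) * fromℕ x)) (sym (fromℕ-* 4 Δ)) ⟩
      4Δ * ((1ℚ + ε * ¼) * fromℕ x)               ∎)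
      where
      open ℚ.≤-Reasoning
      lem : ∀ e d x → e * d * x + fromℕ 4 * d * x ≡ fromℕ 4 * d * ((1ℚ + e * (+ 1 / 4)) * x)
      lem = solve-∀ ℚ-ring

    relative-≥ : 4 ℕ.* Δ ℕ.* x ℕ.≤ x ℕ.+ 4 ℕ.* Δ ℕ.* y → (1ℚ - ε * ¼) * fromℕ x ≤ fromℕ y
    relative-≥ le = *-cancelˡ-≤ 0<4Δ (begin
      4Δ * ((1ℚ - ε * ¼) * fromℕ x)                        ≡⟨ cong (_* ((1ℚ - ε * ¼) * fromℕ x)) (fromℕ-* 4 Δ) ⟩
      fromℕ 4 * fromℕ Δ * ((1ℚ - ε * ¼) * fromℕ x)         ≡⟨ lem ε (fromℕ Δ) (fromℕ x) ⟩
      fromℕ 4 * fromℕ Δ * fromℕ x - ε * fromℕ Δ * fromℕ x  ≡⟨ cong (λ d → d * fromℕ x - ε * fromℕ Δ * fromℕ x) (sym (fromℕ-* 4 Δ)) ⟩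
      4Δ * fromℕ x - ε * fromℕ Δ * fromℕ x                 ≤⟨ ℚ.+-monoʳ-≤ (4Δ * fromℕ x) (ℚ.neg-antimono-≤ (*-monoʳ-≤ (0≤fromℕ x) 1≤εΔ)) ⟩
      4Δ * fromℕ x - 1ℚ * fromℕ x                          ≡⟨ cong₂ _-_ (sym (fromℕ-* (4 ℕ.* Δ) x)) (ℚ.*-identityˡ (fromℕ x)) ⟩
      fromℕ (4 ℕ.* Δ ℕ.* x) - fromℕ x                      ≤⟨ ℚ.+-monoˡ-≤ (- fromℕ x) (fromℕ-mono-≤ {4 ℕ.* Δ ℕ.* x} {x ℕ.+ 4 ℕ.* Δ ℕ.* y} le) ⟩
      fromℕ (x ℕ.+ 4 ℕ.* Δ ℕ.* y) - fromℕ x                ≡⟨ cong (_- fromℕ x) (fromℕ-+ x (4 ℕ.* Δ ℕ.* y)) ⟩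
      fromℕ x + fromℕ (4 ℕ.* Δ ℕ.* y) - fromℕ x            ≡⟨ lem′ (fromℕ x) (fromℕ (4 ℕ.* Δ ℕ.* y)) ⟩
      fromℕ (4 ℕ.* Δ ℕ.* y)                                ≡⟨ fromℕ-* (4 ℕ.* Δ) y ⟩
      4Δ * fromℕ y                                         ∎)
      where
      open ℚ.≤-Reasoning
      lem : ∀ e d x → fromℕ 4 * d * ((1ℚ - e * (+ 1 / 4)) * x) ≡ fromℕ 4 * d * x - e * d * x
      lem = solve-∀ ℚ-ring
      lem′ : ∀ x y → x + y - x ≡ y
      lem′ = solve-∀ ℚ-ring

  -- For k = 0 the hypothesis would read 4Δx < x. Concentration therefore also guarantees that the
  -- estimates divide by a nonzero number.
  relative-≥⇒nonZero : ∀ Δ .{{_ : NonZero Δ}} x m k → .{{_ : NonZero x}} →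
    4 ℕ.* Δ ℕ.* x ℕ.< x ℕ.+ 4 ℕ.* Δ ℕ.* (m ℕ.* k) → NonZero k
  relative-≥⇒nonZero Δ x m (suc k) _  = _
  relative-≥⇒nonZero Δ x m zero    lt = contradiction lt (ℕ.≤⇒≯ (begin
    x ℕ.+ 4 ℕ.* Δ ℕ.* (m ℕ.* 0)   ≡⟨ cong (λ z → x ℕ.+ 4 ℕ.* Δ ℕ.* z) (ℕ.*-zeroʳ m) ⟩
    x ℕ.+ 4 ℕ.* Δ ℕ.* 0           ≡⟨ trans (cong (x ℕ.+_) (ℕ.*-zeroʳ (4 ℕ.* Δ))) (ℕ.+-identityʳ x) ⟩
    x                             ≤⟨ ℕ.m≤n*m x (4 ℕ.* Δ) {{ℕ.m*n≢0 4 Δ}} ⟩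
    4 ℕ.* Δ ℕ.* x                 ∎))
    where open ℕ.≤-Reasoning

-- `ratio-accurate` with p = x = `s C 2` and q = r. The first component is what the test r > 0 of
-- the algorithm asks for.
collision-estimate : ∀ ε → 0ℚ ≤ ε → ε ≤ 1ℚ → ∀ Δ .{{_ : NonZero Δ}} → 1ℚ ≤ ε * fromℕ Δ →
  ∀ m {s} (xs : Vec (Fin m) s) → .{{_ : NonZero (s C 2)}} → ¬ Deviates m Δ xs →
  NonZero (∣collisions∣ xs) × Approximates ε (fromℕ m) (fromℕ (s C 2) ÷? fromℕ (∣collisions∣ xs))
collision-estimate ε 0≤ε ε≤1 Δ 1≤εΔ m {s} xs close = r≢0 , approx
  where
  open Accuracy ε 0≤ε ε≤1
  c = s C 2
  r = ∣collisions∣ xs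
  upper : 4 ℕ.* Δ ℕ.* (m ℕ.* r) ℕ.< c ℕ.+ 4 ℕ.* Δ ℕ.* c
  upper = ℕ.≰⇒> (close ∘ inj₁)
  lower : 4 ℕ.* Δ ℕ.* c ℕ.< c ℕ.+ 4 ℕ.* Δ ℕ.* (m ℕ.* r)
  lower = ℕ.≰⇒> (close ∘ inj₂)
  r≢0 : NonZero r
  r≢0 = relative-≥⇒nonZero Δ c m r lower
  0<r : 0ℚ < fromℕ r
  0<r = 0<fromℕ r {{r≢0}}
  approx : Approximates ε (fromℕ m) (fromℕ c ÷? fromℕ r)
  approx = go (÷?-just (fromℕ c) (fromℕ r) (0<⇒≢0 0<r))
    where
    lem : ∀ e x → (1ℚ + e * (+ 1 / 10)) * x ≡ x + e * (+ 1 / 10) * x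
    lem = solve-∀ ℚ-ring
    go : ∃[ q ] fromℕ c ÷? fromℕ r ≡ just q × q * fromℕ r ≡ fromℕ c → Approximates ε (fromℕ m) (fromℕ c ÷? fromℕ r)
    go (q , eq , qr≡c) = subst (Approximates ε (fromℕ m)) (sym eq) (MaybeAny.just
      (ratio-accurate {q} {fromℕ c} {fromℕ r} {fromℕ c} (fromℕ m) (0≤fromℕ c) 0<r qr≡c ℚ.≤-refl
        (≤-by (*-nonNeg (*-nonNeg 0≤ε (ℚ.nonNegative⁻¹ (+ 1 / 10))) (0≤fromℕ c)) (lem ε (fromℕ c)))
        (subst ((1ℚ - ε * (+ 1 / 4)) * fromℕ c ≤_) (fromℕ-* m r) (relative-≥ Δ 1≤εΔ c (m ℕ.* r) (ℕ.<⇒≤ lower)))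
        (subst (_≤ (1ℚ + ε * (+ 1 / 4)) * fromℕ c) (fromℕ-* m r) (relative-≤ Δ 1≤εΔ c (m ℕ.* r) (ℕ.<⇒≤ upper)))))

-- The degree-based estimate for a fixed vertex sample

module EdgeSampling {n : ℕ} (G : SimpleGraph n) .{{_ : NonZero (∣E∣ G)}}
  (ε : ℚ) .{{_ : Positive ε}} (ε<1 : ε < 1ℚ) (h : HiddenFactors)
  (Δ : ℕ) .{{_ : NonZero Δ}} (1≤εΔ : 1ℚ ≤ ε * fromℕ Δ)
  (S≢0 : NonZero (Algorithm.∣S∣ G ε h)) (T≢0 : NonZero (Algorithm.∣T∣ G ε h)) where

  open Algorithm G ε h
  open Weights G ε h
  open Accuracy ε 0≤ε (ℚ.<⇒≤ ε<1)

  private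
    m = ∣E∣ G
    τ = ∣T∣

  -- A relative error of at least 1/(4Δ) of 2mP against its conditional mean τA given S.
  Skewed : Vec (Fin n) ∣S∣ → Vec (Fin n) ∣T∣ → Set
  Skewed S T =
    τ ℕ.* A ℕ.+ 4 ℕ.* Δ ℕ.* (τ ℕ.* A) ℕ.≤ 4 ℕ.* Δ ℕ.* (2 ℕ.* m ℕ.* P) ⊎
    τ ℕ.* A ℕ.+ 4 ℕ.* Δ ℕ.* (2 ℕ.* m ℕ.* P) ℕ.≤ 4 ℕ.* Δ ℕ.* (τ ℕ.* A)
    where
    A = sampledDegree S
    P = total (weight S) T

  module _ (S : Vec (Fin n) ∣S∣) (T : Vec (Fin n) ∣T∣) (A≢0 : NonZero (sampledDegree S)) (close : ¬ Skewed S T) where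

    private
      A P : ℕ
      A = sampledDegree S
      P = total (weight S) T
      d p′ : ℚ
      d = roundedDegree S
      p′ = sum (λ i → if does (heavyIn? S i) then fromℕ (Vec.sum (Vec.map (matches S i) T)) else 0ℚ)
      n≢0 : NonZero n
      n≢0 = ∣E∣-nonZero⇒nonZero G
      upper : 4 ℕ.* Δ ℕ.* (2 ℕ.* m ℕ.* P) ℕ.< τ ℕ.* A ℕ.+ 4 ℕ.* Δ ℕ.* (τ ℕ.* A)
      upper = ℕ.≰⇒> (close ∘ inj₁)
      lower : 4 ℕ.* Δ ℕ.* (τ ℕ.* A) ℕ.< τ ℕ.* A ℕ.+ 4 ℕ.* Δ ℕ.* (2 ℕ.* m ℕ.* P)
      lower = ℕ.≰⇒> (close ∘ inj₂)
      P≢0 : NonZero P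
      P≢0 = relative-≥⇒nonZero Δ (τ ℕ.* A) (2 ℕ.* m) P {{ℕ.m*n≢0 τ A {{T≢0}} {{A≢0}}}} lower

      estimate : ∀ {a b} → fromℕ n ÷? fromℕ ∣S∣ ≡ just a → 1ℚ ÷? fromℕ ∣T∣ ≡ just b →
        nonCollEstimate S T ≡ (½ * (a * d)) ÷? (a * b * p′)
      estimate {a} {b} eq₁ eq₂ = trans
        (>>=-just (λ a b → (½ * (a * sumHeavy S T (λ i → fromℕ (∣S∩B_∣ S T i) * 1+γ ^ toℕ i))) ÷? (a * b * sumHeavy S T (λ i → fromℕ (∣T∩S_∣ S T i)))) eq₁ eq₂)
        (cong₂ (λ x y → (½ * (a * x)) ÷? (a * b * y))
          (sum-cong-≗ (λ i → cong (λ b → if b then fromℕ (members S i) * level i else 0ℚ) (heavy≡ i)))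
          (sum-cong-≗ (λ i → cong (λ b → if b then fromℕ (Vec.sum (Vec.map (matches S i) T)) else 0ℚ) (heavy≡ i))))
        where
        heavy≡ : ∀ i → does (heavy? S T i) ≡ does (heavyIn? S i)
        heavy≡ i = refl

    -- `ratio-accurate` with x = τA, p = τ · `roundedDegree` and q = 2P, once the factors a = n/|S|
    -- and b = 1/|T| are cancelled from the quotient.
    accurate : Approximates ε (fromℕ m) (nonCollEstimate S T)
    accurate = go (÷?-just (fromℕ n) (fromℕ ∣S∣) (0<⇒≢0 (0<fromℕ ∣S∣ {{S≢0}}))) (÷?-just 1ℚ (fromℕ τ) (0<⇒≢0 (0<fromℕ τ {{T≢0}})))
      where
      0<2P : 0ℚ < fromℕ 2 * fromℕ P
      0<2P = *-pos (ℚ.positive⁻¹ (fromℕ 2)) (0<fromℕ P {{P≢0}})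
      0<-cancelʳ : ∀ {x y z} → 0ℚ ≤ y → x * y ≡ z → 0ℚ < z → 0ℚ < x
      0<-cancelʳ {x} {y} 0≤y xy≡z 0<z = ℚ.≰⇒> λ x≤0 → ℚ.<-irrefl refl (ℚ.<-≤-trans 0<z
        (subst₂ _≤_ xy≡z (ℚ.*-zeroˡ y) (*-monoʳ-≤ 0≤y x≤0)))
      x≡ : fromℕ (τ ℕ.* A) ≡ fromℕ τ * fromℕ A
      x≡ = fromℕ-* τ A
      y≡ : fromℕ (2 ℕ.* m ℕ.* P) ≡ fromℕ m * (fromℕ 2 * fromℕ P)
      y≡ = trans (fromℕ-* (2 ℕ.* m) P) (trans (cong (_* fromℕ P) (fromℕ-* 2 m)) (lem (fromℕ m) (fromℕ P)))
        where
        lem : ∀ m p → fromℕ 2 * m * p ≡ m * (fromℕ 2 * p)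
        lem = solve-∀ ℚ-ring
      go : ∃[ a ] fromℕ n ÷? fromℕ ∣S∣ ≡ just a × a * fromℕ ∣S∣ ≡ fromℕ n →
           ∃[ b ] 1ℚ ÷? fromℕ τ ≡ just b × b * fromℕ τ ≡ 1ℚ →
           Approximates ε (fromℕ m) (nonCollEstimate S T)
      go (a , eq₁ , aN≡n) (b , eq₂ , bτ≡1) = subst (Approximates ε (fromℕ m)) (sym (estimate eq₁ eq₂)) (finish (÷?-just (½ * (a * d)) (a * b * p′) (0<⇒≢0 0<abp)))
        where
        0<a : 0ℚ < a
        0<a = 0<-cancelʳ (0≤fromℕ ∣S∣) aN≡n (0<fromℕ n {{n≢0}})
        0<b : 0ℚ < b
        0<b = 0<-cancelʳ (0≤fromℕ τ) bτ≡1 (ℚ.positive⁻¹ 1ℚ)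
        p′≡P : p′ ≡ fromℕ P
        p′≡P = sumHeavy-matches S T
        0<abp : 0ℚ < a * b * p′
        0<abp = *-pos (*-pos 0<a 0<b) (subst (0ℚ <_) (sym p′≡P) (0<fromℕ P {{P≢0}}))
        finish : ∃[ r ] (½ * (a * d)) ÷? (a * b * p′) ≡ just r × r * (a * b * p′) ≡ ½ * (a * d) →
          Approximates ε (fromℕ m) ((½ * (a * d)) ÷? (a * b * p′))
        finish (r , eq , r*≡) = subst (Approximates ε (fromℕ m)) (sym eq) (MaybeAny.just
          (ratio-accurate {r = r} (fromℕ m) (0≤fromℕ (τ ℕ.* A)) 0<2P r2P≡ x≤p p≤
            (subst ((1ℚ - ε * (+ 1 / 4)) * fromℕ (τ ℕ.* A) ≤_) y≡ (relative-≥ Δ 1≤εΔ (τ ℕ.* A) (2 ℕ.* m ℕ.* P) (ℕ.<⇒≤ lower)))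
            (subst (_≤ (1ℚ + ε * (+ 1 / 4)) * fromℕ (τ ℕ.* A)) y≡ (relative-≤ Δ 1≤εΔ (τ ℕ.* A) (2 ℕ.* m ℕ.* P) (ℕ.<⇒≤ upper)))))
          where
          lem₁ : ∀ a b r p t → a * (b * t * (r * (fromℕ 2 * p))) ≡ fromℕ 2 * t * (r * (a * b * p))
          lem₁ = solve-∀ ℚ-ring
          lem₂ : ∀ a d t → fromℕ 2 * t * (½ * (a * d)) ≡ a * (t * d)
          lem₂ = solve-∀ ℚ-ring
          a*≡ : a * (r * (fromℕ 2 * fromℕ P)) ≡ a * (fromℕ τ * d)
          a*≡ = begin
            a * (r * (fromℕ 2 * fromℕ P))                          ≡⟨ cong (a *_) (sym (trans (cong (_* (r * (fromℕ 2 * fromℕ P))) bτ≡1) (ℚ.*-identityˡ (r * (fromℕ 2 * fromℕ P))))) ⟩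
            a * (b * fromℕ τ * (r * (fromℕ 2 * fromℕ P)))          ≡⟨ lem₁ a b r (fromℕ P) (fromℕ τ) ⟩
            fromℕ 2 * fromℕ τ * (r * (a * b * fromℕ P))            ≡⟨ cong (fromℕ 2 * fromℕ τ *_) (trans (cong (λ z → r * (a * b * z)) (sym p′≡P)) r*≡) ⟩
            fromℕ 2 * fromℕ τ * (½ * (a * d))                      ≡⟨ lem₂ a d (fromℕ τ) ⟩
            a * (fromℕ τ * d)                                      ∎
            where open ≡-Reasoning
          r2P≡ : r * (fromℕ 2 * fromℕ P) ≡ fromℕ τ * d
          r2P≡ = ℚ.≤-antisym (*-cancelˡ-≤ 0<a (ℚ.≤-reflexive a*≡)) (*-cancelˡ-≤ 0<a (ℚ.≤-reflexive (sym a*≡)))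
          x≤p : fromℕ (τ ℕ.* A) ≤ fromℕ τ * d
          x≤p = subst (_≤ fromℕ τ * d) (sym x≡) (*-monoˡ-≤ {fromℕ τ} {fromℕ A} {d} (0≤fromℕ τ) (sampledDegree-≤ S))
          lem₃ : ∀ t g A → t * (g * A) ≡ g * (t * A)
          lem₃ = solve-∀ ℚ-ring
          p≤ : fromℕ τ * d ≤ (1ℚ + ε * (+ 1 / 10)) * fromℕ (τ ℕ.* A)
          p≤ = ℚ.≤-trans (*-monoˡ-≤ {fromℕ τ} {d} {1+γ * fromℕ A} (0≤fromℕ τ) (roundedDegree-≤ S))
            (ℚ.≤-reflexive (trans (lem₃ (fromℕ τ) 1+γ (fromℕ A)) (cong (1+γ *_) (sym x≡))))

-- Sample sizes required by the degree-based estimate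

module Sizes (n N τ t L Δ B : ℕ) .{{_ : NonZero n}} .{{_ : NonZero t}} .{{_ : NonZero L}} .{{_ : NonZero Δ}}
  (B-large₁ : 5 ℕ.* 288 ℕ.* 11 ℕ.* 19 ℕ.≤ B) (B-large₂ : 4 ℕ.* 1280 ℕ.* 8 ℕ.* 11 ℕ.≤ B) (16≤B : 16 ℕ.≤ B)
  (N-large : B ℕ.* (L ℕ.* L ℕ.* (Δ ℕ.* Δ ℕ.* Δ)) ℕ.* (B ℕ.* (L ℕ.* L ℕ.* (Δ ℕ.* Δ ℕ.* Δ))) ℕ.* n ℕ.≤ N ℕ.* N)
  (τ-large : B ℕ.* (L ℕ.* L ℕ.* (Δ ℕ.* Δ ℕ.* Δ)) ℕ.* (B ℕ.* (L ℕ.* L ℕ.* (Δ ℕ.* Δ ℕ.* Δ))) ℕ.* n ℕ.≤ τ ℕ.* τ)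
  (t-small : t ℕ.≤ 11 ℕ.* (Δ ℕ.* L)) where

  private
    -- Both samples have at least K√n elements. L²Δ³ is the order of j t Δ²: j is 8L, t is at most
    -- 11ΔL, and precision 1/Δ costs Δ².
    K j : ℕ
    K = B ℕ.* (L ℕ.* L ℕ.* (Δ ℕ.* Δ ℕ.* Δ))
    j = 8 ℕ.* L

    K≤N : K ℕ.≤ N
    K≤N = square-cancel-≤ (ℕ.≤-trans (ℕ.m≤m*n (K ℕ.* K) n) N-large)

    K≤τ : K ℕ.≤ τ
    K≤τ = square-cancel-≤ (ℕ.≤-trans (ℕ.m≤m*n (K ℕ.* K) n) τ-large)

    16L≤K : 16 ℕ.* L ℕ.≤ K
    16L≤K = ℕ.*-mono-≤ 16≤B (ℕ.≤-trans (ℕ.m≤m*n L L) (ℕ.m≤m*n (L ℕ.* L) (Δ ℕ.* Δ ℕ.* Δ) {{ℕ.m*n≢0 (Δ ℕ.* Δ) Δ {{ℕ.m*n≢0 Δ Δ}}}}))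

    1≤K : 1 ℕ.≤ K
    1≤K = ℕ.≤-trans (ℕ.≤-trans (ℕ.>-nonZero⁻¹ L) (ℕ.m≤n*m L 16)) 16L≤K

    K²n≤τN : K ℕ.* K ℕ.* n ℕ.≤ τ ℕ.* N
    K²n≤τN = square-cancel-≤ (ℕ.≤-trans (ℕ.*-mono-≤ τ-large N-large) (ℕ.≤-reflexive (lem τ N)))
      where
      lem : ∀ a b → a ℕ.* a ℕ.* (b ℕ.* b) ≡ a ℕ.* b ℕ.* (a ℕ.* b)
      lem = ℕR.solve-∀

  N≢0 : NonZero N
  N≢0 = ℕ.>-nonZero (ℕ.≤-trans 1≤K K≤N)

  τ≢0 : NonZero τ
  τ≢0 = ℕ.>-nonZero (ℕ.≤-trans 1≤K K≤τ)

  -- After squaring, β ≥ √(6n/(25Δ))/t and N ≥ K√n are compared with t(j + t), which is at most a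
  -- constant times L²Δ². The number 288 = 24²/2 is the demand of the Chernoff bound with Λ = 24.
  large-class-expectation : ∀ β → 6 ℕ.* n ℕ.≤ 25 ℕ.* Δ ℕ.* (t ℕ.* β ℕ.* (t ℕ.* β)) → 288 ℕ.* ((j ℕ.+ t) ℕ.* n) ℕ.≤ N ℕ.* β
  large-class-expectation β large = square-cancel-≤ (ℕ.*-cancelˡ-≤ c {{c≢0}} (begin
    c ℕ.* (288 ℕ.* (k ℕ.* n) ℕ.* (288 ℕ.* (k ℕ.* n)))
      ≡⟨ lem₁ 288 Δ t k n ⟩
    5 ℕ.* (288 ℕ.* (t ℕ.* k)) ℕ.* (5 ℕ.* (288 ℕ.* (t ℕ.* k))) ℕ.* Δ ℕ.* n ℕ.* n
      ≤⟨ ℕ.*-monoˡ-≤ n (ℕ.*-monoˡ-≤ n (ℕ.*-monoˡ-≤ Δ (ℕ.*-mono-≤ tk≤H tk≤H))) ⟩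
    H ℕ.* H ℕ.* Δ ℕ.* n ℕ.* n
      ≤⟨ ℕ.*-monoˡ-≤ n (ℕ.*-monoˡ-≤ n (ℕ.m≤m*n (H ℕ.* H ℕ.* Δ) Δ)) ⟩
    H ℕ.* H ℕ.* Δ ℕ.* Δ ℕ.* n ℕ.* n
      ≡⟨ cong (λ z → z ℕ.* n ℕ.* n) (lem₂ B L Δ) ⟩
    K ℕ.* K ℕ.* n ℕ.* n
      ≤⟨ ℕ.*-mono-≤ N-large (ℕ.≤-trans (ℕ.m≤n*m n 6) large) ⟩
    N ℕ.* N ℕ.* (25 ℕ.* Δ ℕ.* (t ℕ.* β ℕ.* (t ℕ.* β)))
      ≡⟨ lem₃ N Δ t β ⟩
    c ℕ.* (N ℕ.* β ℕ.* (N ℕ.* β)) ∎))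
    where
    open ℕ.≤-Reasoning
    k = j ℕ.+ t
    c = 25 ℕ.* (Δ ℕ.* (t ℕ.* t))
    c≢0 : NonZero c
    c≢0 = ℕ.m*n≢0 25 (Δ ℕ.* (t ℕ.* t))
      where instance
      t²≢0 : NonZero (t ℕ.* t)
      t²≢0 = ℕ.m*n≢0 t t
      Δt²≢0 : NonZero (Δ ℕ.* (t ℕ.* t))
      Δt²≢0 = ℕ.m*n≢0 Δ (t ℕ.* t)
    H = B ℕ.* (L ℕ.* L ℕ.* (Δ ℕ.* Δ))
    lem₀ : ∀ a b c d D L → a ℕ.* (b ℕ.* (c ℕ.* (D ℕ.* L) ℕ.* (d ℕ.* (D ℕ.* L)))) ≡ a ℕ.* b ℕ.* c ℕ.* d ℕ.* (L ℕ.* L ℕ.* (D ℕ.* D))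
    lem₀ = ℕR.solve-∀
    lem₁ : ∀ a D t k n → 25 ℕ.* (D ℕ.* (t ℕ.* t)) ℕ.* (a ℕ.* (k ℕ.* n) ℕ.* (a ℕ.* (k ℕ.* n))) ≡
      5 ℕ.* (a ℕ.* (t ℕ.* k)) ℕ.* (5 ℕ.* (a ℕ.* (t ℕ.* k))) ℕ.* D ℕ.* n ℕ.* n
    lem₁ = ℕR.solve-∀
    lem₂ : ∀ B L D → B ℕ.* (L ℕ.* L ℕ.* (D ℕ.* D)) ℕ.* (B ℕ.* (L ℕ.* L ℕ.* (D ℕ.* D))) ℕ.* D ℕ.* D ≡
      B ℕ.* (L ℕ.* L ℕ.* (D ℕ.* D ℕ.* D)) ℕ.* (B ℕ.* (L ℕ.* L ℕ.* (D ℕ.* D ℕ.* D)))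
    lem₂ = ℕR.solve-∀
    lem₃ : ∀ N D t b → N ℕ.* N ℕ.* (25 ℕ.* D ℕ.* (t ℕ.* b ℕ.* (t ℕ.* b))) ≡ 25 ℕ.* (D ℕ.* (t ℕ.* t)) ℕ.* (N ℕ.* b ℕ.* (N ℕ.* b))
    lem₃ = ℕR.solve-∀
    k≤19ΔL : k ℕ.≤ 19 ℕ.* (Δ ℕ.* L)
    k≤19ΔL = ℕ.≤-trans (ℕ.+-mono-≤ (ℕ.*-monoʳ-≤ 8 (ℕ.m≤n*m L Δ)) t-small) (ℕ.≤-reflexive (sym (ℕ.*-distribʳ-+ (Δ ℕ.* L) 8 11)))
    tk≤H : 5 ℕ.* (288 ℕ.* (t ℕ.* k)) ℕ.≤ H
    tk≤H = begin
      5 ℕ.* (288 ℕ.* (t ℕ.* k))                                        ≤⟨ ℕ.*-monoʳ-≤ 5 (ℕ.*-monoʳ-≤ 288 (ℕ.*-mono-≤ t-small k≤19ΔL)) ⟩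
      5 ℕ.* (288 ℕ.* (11 ℕ.* (Δ ℕ.* L) ℕ.* (19 ℕ.* (Δ ℕ.* L))))        ≡⟨ lem₀ 5 288 11 19 Δ L ⟩
      5 ℕ.* 288 ℕ.* 11 ℕ.* 19 ℕ.* (L ℕ.* L ℕ.* (Δ ℕ.* Δ))              ≤⟨ ℕ.*-monoˡ-≤ (L ℕ.* L ℕ.* (Δ ℕ.* Δ)) B-large₁ ⟩
      H ∎

  -- A ≥ Nm/(5n) reduces the claim to 1280F(2N + 3jn) ≤ τN with F = jtΔ². The summand 2N is absorbed
  -- by τ ≥ K alone; the summand 3jn, which dominates when S is sparse in V, needs τN ≥ K²n, a bound
  -- on the product of the two sample sizes.
  weight-expectation : ∀ m M A → n ℕ.* M ℕ.≤ 2 ℕ.* N ℕ.+ 3 ℕ.* (j ℕ.* n) → N ℕ.* m ℕ.≤ 5 ℕ.* (n ℕ.* A) →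
    256 ℕ.* (j ℕ.* (m ℕ.* (t ℕ.* M ℕ.* (Δ ℕ.* Δ)))) ℕ.≤ τ ℕ.* A
  weight-expectation m M A nM≤ Nm≤ = ℕ.*-cancelˡ-≤ (5 ℕ.* n) {{ℕ.m*n≢0 5 n}} (begin
    5 ℕ.* n ℕ.* (256 ℕ.* (j ℕ.* (m ℕ.* (t ℕ.* M ℕ.* (Δ ℕ.* Δ)))))   ≡⟨ lem₁ n j m t M (Δ ℕ.* Δ) ⟩
    m ℕ.* (1280 ℕ.* F ℕ.* (n ℕ.* M))                               ≤⟨ ℕ.*-monoʳ-≤ m (ℕ.*-monoʳ-≤ (1280 ℕ.* F) nM≤) ⟩
    m ℕ.* (1280 ℕ.* F ℕ.* (2 ℕ.* N ℕ.+ 3 ℕ.* (j ℕ.* n)))           ≤⟨ ℕ.*-monoʳ-≤ m main ⟩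
    m ℕ.* (τ ℕ.* N)                                                ≡⟨ lem₂ m τ N ⟩
    τ ℕ.* (N ℕ.* m)                                                ≤⟨ ℕ.*-monoʳ-≤ τ Nm≤ ⟩
    τ ℕ.* (5 ℕ.* (n ℕ.* A))                                        ≡⟨ lem₃ τ n A ⟩
    5 ℕ.* n ℕ.* (τ ℕ.* A)                                          ∎)
    where
    open ℕ.≤-Reasoning
    F = j ℕ.* (t ℕ.* (Δ ℕ.* Δ))
    lem₁ : ∀ n j m t M d → 5 ℕ.* n ℕ.* (256 ℕ.* (j ℕ.* (m ℕ.* (t ℕ.* M ℕ.* d)))) ≡ m ℕ.* (1280 ℕ.* (j ℕ.* (t ℕ.* d)) ℕ.* (n ℕ.* M))
    lem₁ = ℕR.solve-∀
    lem₂ : ∀ m a b → m ℕ.* (a ℕ.* b) ≡ a ℕ.* (b ℕ.* m)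
    lem₂ = ℕR.solve-∀
    lem₃ : ∀ a n A → a ℕ.* (5 ℕ.* (n ℕ.* A)) ≡ 5 ℕ.* n ℕ.* (a ℕ.* A)
    lem₃ = ℕR.solve-∀
    lem₄ : ∀ c F N j n → 2 ℕ.* (c ℕ.* F ℕ.* (2 ℕ.* N ℕ.+ 3 ℕ.* (j ℕ.* n))) ≡ 4 ℕ.* (c ℕ.* F) ℕ.* N ℕ.+ 6 ℕ.* (c ℕ.* F) ℕ.* (j ℕ.* n)
    lem₄ = ℕR.solve-∀
    lem₅ : ∀ x L n → 8 ℕ.* x ℕ.* (8 ℕ.* L ℕ.* n) ≡ 4 ℕ.* x ℕ.* (16 ℕ.* L) ℕ.* n
    lem₅ = ℕR.solve-∀
    lem₆ : ∀ c L a D → 4 ℕ.* (c ℕ.* (8 ℕ.* L ℕ.* (a ℕ.* (D ℕ.* L) ℕ.* (D ℕ.* D)))) ≡ 4 ℕ.* c ℕ.* 8 ℕ.* a ℕ.* (L ℕ.* L ℕ.* (D ℕ.* D ℕ.* D))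
    lem₆ = ℕR.solve-∀
    lem₇ : ∀ x → x ℕ.+ x ≡ 2 ℕ.* x
    lem₇ = ℕR.solve-∀
    4cF≤K : 4 ℕ.* (1280 ℕ.* F) ℕ.≤ K
    4cF≤K = begin
      4 ℕ.* (1280 ℕ.* (j ℕ.* (t ℕ.* (Δ ℕ.* Δ))))                        ≤⟨ ℕ.*-monoʳ-≤ 4 (ℕ.*-monoʳ-≤ 1280 (ℕ.*-monoʳ-≤ j (ℕ.*-monoˡ-≤ (Δ ℕ.* Δ) t-small))) ⟩
      4 ℕ.* (1280 ℕ.* (8 ℕ.* L ℕ.* (11 ℕ.* (Δ ℕ.* L) ℕ.* (Δ ℕ.* Δ))))   ≡⟨ lem₆ 1280 L 11 Δ ⟩
      4 ℕ.* 1280 ℕ.* 8 ℕ.* 11 ℕ.* (L ℕ.* L ℕ.* (Δ ℕ.* Δ ℕ.* Δ))         ≤⟨ ℕ.*-monoˡ-≤ (L ℕ.* L ℕ.* (Δ ℕ.* Δ ℕ.* Δ)) B-large₂ ⟩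
      K                                                                 ∎
    main : 1280 ℕ.* F ℕ.* (2 ℕ.* N ℕ.+ 3 ℕ.* (j ℕ.* n)) ℕ.≤ τ ℕ.* N
    main = ℕ.*-cancelˡ-≤ 2 (begin
      2 ℕ.* (1280 ℕ.* F ℕ.* (2 ℕ.* N ℕ.+ 3 ℕ.* (j ℕ.* n)))                       ≡⟨ lem₄ 1280 F N j n ⟩
      4 ℕ.* (1280 ℕ.* F) ℕ.* N ℕ.+ 6 ℕ.* (1280 ℕ.* F) ℕ.* (j ℕ.* n)              ≤⟨ ℕ.+-mono-≤ (ℕ.*-monoˡ-≤ N (ℕ.≤-trans 4cF≤K K≤τ)) (ℕ.*-monoˡ-≤ (j ℕ.* n) (ℕ.*-monoˡ-≤ (1280 ℕ.* F) (ℕ.m≤m+n 6 2))) ⟩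
      τ ℕ.* N ℕ.+ 8 ℕ.* (1280 ℕ.* F) ℕ.* (j ℕ.* n)                               ≡⟨ cong (τ ℕ.* N ℕ.+_) (lem₅ (1280 ℕ.* F) L n) ⟩
      τ ℕ.* N ℕ.+ 4 ℕ.* (1280 ℕ.* F) ℕ.* (16 ℕ.* L) ℕ.* n                        ≤⟨ ℕ.+-monoʳ-≤ (τ ℕ.* N) (ℕ.≤-trans (ℕ.*-monoˡ-≤ n (ℕ.*-mono-≤ 4cF≤K 16L≤K)) K²n≤τN) ⟩
      τ ℕ.* N ℕ.+ τ ℕ.* N                                                        ≡⟨ lem₇ (τ ℕ.* N) ⟩
      2 ℕ.* (τ ℕ.* N)                                                            ∎)

average-indicator : ∀ n .{{_ : NonZero n}} (b : Fin n → Bool) →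
  fromℕ n * 𝔼 (uniform n) (λ v → fromℕ ⟦ b v ⟧) ≡ fromℕ (sumᴺ (λ v → ⟦ b v ⟧))
average-indicator n b = begin
  fromℕ n * (inv n * s)     ≡⟨ sym (ℚ.*-assoc (fromℕ n) (inv n) s) ⟩
  fromℕ n * inv n * s       ≡⟨ cong (_* s) (trans (ℚ.*-comm (fromℕ n) (inv n)) (inv-* n)) ⟩
  1ℚ * s                    ≡⟨ ℚ.*-identityˡ s ⟩
  s                         ≡⟨ sym (fromℕ-sum (λ v → ⟦ b v ⟧)) ⟩
  fromℕ (sumᴺ (λ v → ⟦ b v ⟧)) ∎
  where
  open ≡-Reasoning
  s = sum (λ v → fromℕ ⟦ b v ⟧)

-- Pays for the union over the t classes: with tails ½^(j+t) the union costs at most ½^j, whatever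
-- the relation of t to n.
t*½^t≤1 : ∀ t → fromℕ t * ½ ^ t ≤ 1ℚ
t*½^t≤1 zero    = ℚ.≤-trans (ℚ.≤-reflexive (ℚ.*-zeroˡ 1ℚ)) (ℚ.nonNegative⁻¹ 1ℚ)
t*½^t≤1 (suc t) = begin
  fromℕ (suc t) * (½ * ½ ^ t)             ≡⟨ cong (_* (½ * ½ ^ t)) (fromℕ-+ 1 t) ⟩
  (1ℚ + fromℕ t) * (½ * ½ ^ t)            ≡⟨ lem (fromℕ t) (½ ^ t) ⟩
  ½ * ½ ^ t + ½ * (fromℕ t * ½ ^ t)       ≤⟨ ℚ.+-mono-≤ (*-monoˡ-≤ 0≤½ (^-antimonoʳ-≤ {½} {0} {t} 0≤½ (ℚ.≤ᵇ⇒≤ {½} {1ℚ} tt) ℕ.z≤n)) (*-monoˡ-≤ 0≤½ (t*½^t≤1 t)) ⟩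
  ½ * 1ℚ + ½ * 1ℚ                         ∎
  where
  open ℚ.≤-Reasoning
  0≤½ : 0ℚ ≤ ½
  0≤½ = ℚ.nonNegative⁻¹ ½
  lem : ∀ t p → (1ℚ + t) * (½ * p) ≡ ½ * p + ½ * (t * p)
  lem = solve-∀ ℚ-ring

-- The two Chernoff tails with Λ = 16ΔM and threshold 4M · Nμ; the growth term and the term jD take
-- 2M · Nμ each.
relative-deviation : ∀ (c : Rand X) (w : X → ℕ) (Q μ M : ℕ) .{{_ : NonZero Q}} .{{_ : NonZero M}} →
  fromℕ Q * 𝔼 c (fromℕ ∘ w) ≡ fromℕ μ → (∀ a → w a ℕ.≤ M) →
  ∀ N Δ j .{{_ : NonZero Δ}} → 128 ℕ.* (j ℕ.* (Q ℕ.* (M ℕ.* (Δ ℕ.* Δ)))) ℕ.≤ N ℕ.* μ →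
  Unlikely (repeat N c) (λ xs →
    N ℕ.* μ ℕ.+ 4 ℕ.* Δ ℕ.* (N ℕ.* μ) ℕ.≤ 4 ℕ.* Δ ℕ.* (Q ℕ.* total w xs) ⊎
    N ℕ.* μ ℕ.+ 4 ℕ.* Δ ℕ.* (Q ℕ.* total w xs) ℕ.≤ 4 ℕ.* Δ ℕ.* (N ℕ.* μ)) (½ ^ j + ½ ^ j)
relative-deviation c w Q μ M mean w≤M N Δ j large = unlikely-∪ (repeat N c)
  (unlikely-mono (repeat N c) (λ xs b → scale-gap Δ l (N ℕ.* μ) (N ℕ.* μ) (Q ℕ.* total w xs) b) ℚ.≤-refl
    (upper-tail N Λ j (l ℕ.* (N ℕ.* μ)) 2M≤Λ u-large))
  (unlikely-mono (repeat N c) (λ xs b → scale-gap Δ l (N ℕ.* μ) (Q ℕ.* total w xs) (N ℕ.* μ) b) ℚ.≤-refl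
    (lower-tail N Λ j (l ℕ.* (N ℕ.* μ)) 2M≤Λ u-large))
  where
  open Chernoff c w Q μ M mean w≤M
  l = 4 ℕ.* M
  Λ = 4 ℕ.* Δ ℕ.* l
  instance
    l≢0 : NonZero l
    l≢0 = ℕ.m*n≢0 4 M
    4Δ≢0 : NonZero (4 ℕ.* Δ)
    4Δ≢0 = ℕ.m*n≢0 4 Δ
    Λ≢0 : NonZero Λ
    Λ≢0 = ℕ.m*n≢0 (4 ℕ.* Δ) l
  2M≤Λ : 2 ℕ.* M ℕ.≤ Λ
  2M≤Λ = ℕ.≤-trans (ℕ.*-monoˡ-≤ M (ℕ.m≤m+n 2 2)) (ℕ.m≤n*m l (4 ℕ.* Δ))
  u-large : 2 ℕ.* (M ℕ.* μ) ℕ.* N ℕ.+ j ℕ.* (Q ℕ.* (Λ ℕ.* Λ)) ℕ.≤ l ℕ.* (N ℕ.* μ)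
  u-large = begin
    2 ℕ.* (M ℕ.* μ) ℕ.* N ℕ.+ j ℕ.* (Q ℕ.* (Λ ℕ.* Λ))
      ≡⟨ lem₁ M μ N j Q Δ ⟩
    2 ℕ.* M ℕ.* (N ℕ.* μ) ℕ.+ 2 ℕ.* M ℕ.* (128 ℕ.* (j ℕ.* (Q ℕ.* (M ℕ.* (Δ ℕ.* Δ)))))
      ≤⟨ ℕ.+-monoʳ-≤ (2 ℕ.* M ℕ.* (N ℕ.* μ)) (ℕ.*-monoʳ-≤ (2 ℕ.* M) large) ⟩
    2 ℕ.* M ℕ.* (N ℕ.* μ) ℕ.+ 2 ℕ.* M ℕ.* (N ℕ.* μ)
      ≡⟨ lem₂ M (N ℕ.* μ) ⟩
    l ℕ.* (N ℕ.* μ) ∎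
    where
    open ℕ.≤-Reasoning
    lem₁ : ∀ M A a j q d → 2 ℕ.* (M ℕ.* A) ℕ.* a ℕ.+ j ℕ.* (q ℕ.* (4 ℕ.* d ℕ.* (4 ℕ.* M) ℕ.* (4 ℕ.* d ℕ.* (4 ℕ.* M)))) ≡
      2 ℕ.* M ℕ.* (a ℕ.* A) ℕ.+ 2 ℕ.* M ℕ.* (128 ℕ.* (j ℕ.* (q ℕ.* (M ℕ.* (d ℕ.* d)))))
    lem₁ = ℕR.solve-∀
    lem₂ : ∀ M x → 2 ℕ.* M ℕ.* x ℕ.+ 2 ℕ.* M ℕ.* x ≡ 4 ℕ.* M ℕ.* x
    lem₂ = ℕR.solve-∀

-- M = q + 2j with q about 2N/n is large enough for `frequent-unlikely` and small enough for
-- `weight-expectation`.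
multiplicity-bound : ∀ N n j .{{_ : NonZero n}} → 1 ℕ.≤ j →
  ∃[ M ] 1 ℕ.≤ M × 4 ℕ.* N ℕ.+ 4 ℕ.* (j ℕ.* n) ℕ.≤ 2 ℕ.* (n ℕ.* suc M) × n ℕ.* M ℕ.≤ 2 ℕ.* N ℕ.+ 3 ℕ.* (j ℕ.* n)
multiplicity-bound N n j 1≤j with ceiling-quotient (2 ℕ.* N) n
... | q , 2N≤nq , nq≤2N+n , 1≤q = q ℕ.+ 2 ℕ.* j , ℕ.≤-trans 1≤q (ℕ.m≤m+n q (2 ℕ.* j)) , lower , upper
  where
  open ℕ.≤-Reasoning
  lower : 4 ℕ.* N ℕ.+ 4 ℕ.* (j ℕ.* n) ℕ.≤ 2 ℕ.* (n ℕ.* suc (q ℕ.+ 2 ℕ.* j))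
  lower = begin
    4 ℕ.* N ℕ.+ 4 ℕ.* (j ℕ.* n)                        ≡⟨ lem₁ N (j ℕ.* n) ⟩
    2 ℕ.* (2 ℕ.* N) ℕ.+ 4 ℕ.* (j ℕ.* n)                ≤⟨ ℕ.+-monoˡ-≤ (4 ℕ.* (j ℕ.* n)) (ℕ.*-monoʳ-≤ 2 2N≤nq) ⟩
    2 ℕ.* (n ℕ.* q) ℕ.+ 4 ℕ.* (j ℕ.* n)                ≡⟨ lem₂ n q j ⟩
    2 ℕ.* (n ℕ.* (q ℕ.+ 2 ℕ.* j))                      ≤⟨ ℕ.*-monoʳ-≤ 2 (ℕ.*-monoʳ-≤ n (ℕ.n≤1+n (q ℕ.+ 2 ℕ.* j))) ⟩
    2 ℕ.* (n ℕ.* suc (q ℕ.+ 2 ℕ.* j))                  ∎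
    where
    lem₁ : ∀ N x → 4 ℕ.* N ℕ.+ 4 ℕ.* x ≡ 2 ℕ.* (2 ℕ.* N) ℕ.+ 4 ℕ.* x
    lem₁ = ℕR.solve-∀
    lem₂ : ∀ n q j → 2 ℕ.* (n ℕ.* q) ℕ.+ 4 ℕ.* (j ℕ.* n) ≡ 2 ℕ.* (n ℕ.* (q ℕ.+ 2 ℕ.* j))
    lem₂ = ℕR.solve-∀
  upper : n ℕ.* (q ℕ.+ 2 ℕ.* j) ℕ.≤ 2 ℕ.* N ℕ.+ 3 ℕ.* (j ℕ.* n)
  upper = begin
    n ℕ.* (q ℕ.+ 2 ℕ.* j)                              ≡⟨ lem₁ n q j ⟩
    n ℕ.* q ℕ.+ 2 ℕ.* (j ℕ.* n)                        ≤⟨ ℕ.+-monoˡ-≤ (2 ℕ.* (j ℕ.* n)) nq≤2N+n ⟩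
    2 ℕ.* N ℕ.+ n ℕ.+ 2 ℕ.* (j ℕ.* n)                  ≤⟨ ℕ.+-monoˡ-≤ (2 ℕ.* (j ℕ.* n)) (ℕ.+-monoʳ-≤ (2 ℕ.* N) (ℕ.m≤n*m n j {{ℕ.>-nonZero 1≤j}})) ⟩
    2 ℕ.* N ℕ.+ j ℕ.* n ℕ.+ 2 ℕ.* (j ℕ.* n)            ≡⟨ lem₂ (2 ℕ.* N) (j ℕ.* n) ⟩
    2 ℕ.* N ℕ.+ 3 ℕ.* (j ℕ.* n)                        ∎
    where
    lem₁ : ∀ n q j → n ℕ.* (q ℕ.+ 2 ℕ.* j) ≡ n ℕ.* q ℕ.+ 2 ℕ.* (j ℕ.* n)
    lem₁ = ℕR.solve-∀
    lem₂ : ∀ a x → a ℕ.+ x ℕ.+ 2 ℕ.* x ≡ a ℕ.+ 3 ℕ.* x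
    lem₂ = ℕR.solve-∀

-- Accuracy of the degree-based estimate when m ≥ n/6

module NonAdaptive {n : ℕ} (G : SimpleGraph n) .{{_ : NonZero (∣E∣ G)}}
  (ε : ℚ) .{{_ : Positive ε}} (ε<1 : ε < 1ℚ) (h : HiddenFactors)
  (Δ : ℕ) .{{_ : NonZero Δ}} (1≤εΔ : 1ℚ ≤ ε * fromℕ Δ) (B : ℕ)
  (1≤logn : NonZero ⌈log₂ n ⌉)
  (B-large₁ : 5 ℕ.* 288 ℕ.* 11 ℕ.* 19 ℕ.≤ B) (B-large₂ : 4 ℕ.* 1280 ℕ.* 8 ℕ.* 11 ℕ.≤ B) (16≤B : 16 ℕ.≤ B)
  (S-large : B ℕ.* (⌈log₂ n ⌉ ℕ.* ⌈log₂ n ⌉ ℕ.* (Δ ℕ.* Δ ℕ.* Δ)) ℕ.* (B ℕ.* (⌈log₂ n ⌉ ℕ.* ⌈log₂ n ⌉ ℕ.* (Δ ℕ.* Δ ℕ.* Δ))) ℕ.* n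
             ℕ.≤ Algorithm.∣S∣ G ε h ℕ.* Algorithm.∣S∣ G ε h)
  (T-large : B ℕ.* (⌈log₂ n ⌉ ℕ.* ⌈log₂ n ⌉ ℕ.* (Δ ℕ.* Δ ℕ.* Δ)) ℕ.* (B ℕ.* (⌈log₂ n ⌉ ℕ.* ⌈log₂ n ⌉ ℕ.* (Δ ℕ.* Δ ℕ.* Δ))) ℕ.* n
             ℕ.≤ Algorithm.∣T∣ G ε h ℕ.* Algorithm.∣T∣ G ε h)
  (t-small : Algorithm.t G ε h ℕ.≤ 11 ℕ.* (Δ ℕ.* ⌈log₂ n ⌉))
  (n≤6m : n ℕ.≤ 6 ℕ.* ∣E∣ G) where

  open Algorithm G ε h
  open Weights G ε h
  open LargeClasses G ε ε<1 h
  open Handshake G using (𝔼-randEndpoint)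
  open SimpleGraph G using (deg)

  private
    instance
      n≢0 : NonZero n
      n≢0 = ∣E∣-nonZero⇒nonZero G
      t≢0 : NonZero t
      t≢0 = ℕ.>-nonZero (ℕ.m≤n+m 1 ⌈log[1+ γ ] n ⌉)
        where instance
        γ>0 : Positive γ
        γ>0 = ℚ.pos*pos⇒pos ε (+ 1 / 10)

    m j j₁ N τ : ℕ
    m = ∣E∣ G
    j = 8 ℕ.* logn
    j₁ = 8 ℕ.* logn ℕ.+ t
    N = ∣S∣
    τ = ∣T∣

    sampleS = repeat ∣S∣ randVertex
    sampleT = repeat ∣T∣ randEndpoint

    module Sz = Sizes n N τ t logn Δ B {{n≢0}} {{t≢0}} {{1≤logn}} B-large₁ B-large₂ 16≤B S-large T-large t-small

  open EdgeSampling G ε ε<1 h Δ 1≤εΔ Sz.N≢0 Sz.τ≢0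

  -- Largeness is part of the event, so that the same tail holds for every i and the union can run
  -- over all classes.
  Unrepresentative : Fin t → Vec (Fin n) ∣S∣ → Set
  Unrepresentative i S = Large i × ¬ 5 ℕ.* (N ℕ.* classSize i) ℕ.≤ 6 ℕ.* (n ℕ.* members S i)

  private
    large-ℕ : ∀ i → Large i → 6 ℕ.* n ℕ.≤ 25 ℕ.* Δ ℕ.* (t ℕ.* classSize i ℕ.* (t ℕ.* classSize i))
    large-ℕ i lrg = fromℕ-cancel-≤ {6 ℕ.* n} {25 ℕ.* Δ ℕ.* (t ℕ.* classSize i ℕ.* (t ℕ.* classSize i))} (begin
      fromℕ (6 ℕ.* n)                          ≡⟨ trans (fromℕ-* 6 n) (sym (ℚ.*-identityˡ (fromℕ 6 * q))) ⟩
      1ℚ * (fromℕ 6 * q)                       ≤⟨ *-monoʳ-≤ (*-nonNeg (0≤fromℕ 6) (0≤fromℕ n)) 1≤εΔ ⟩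
      ε * d * (fromℕ 6 * q)                    ≡⟨ lem₁ ε d q ⟩
      d * (fromℕ 6 * ε * q)                    ≤⟨ *-monoˡ-≤ (0≤fromℕ Δ) lrg ⟩
      d * (fromℕ 25 * (fromℕ t * β) ^ 2)       ≡⟨ lem₂ d (fromℕ t) β ⟩
      fromℕ 25 * d * (fromℕ t * β * (fromℕ t * β))
        ≡⟨ sym (trans (fromℕ-* (25 ℕ.* Δ) (tβ ℕ.* tβ)) (cong₂ _*_ (fromℕ-* 25 Δ) (trans (fromℕ-* tβ tβ) (cong (λ z → z * z) (fromℕ-* t (classSize i)))))) ⟩
      fromℕ (25 ℕ.* Δ ℕ.* (tβ ℕ.* tβ)) ∎)
      where
      open ℚ.≤-Reasoning
      q = fromℕ n
      d = fromℕ Δ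
      β = fromℕ (classSize i)
      tβ = t ℕ.* classSize i
      lem₁ : ∀ e d q → e * d * (fromℕ 6 * q) ≡ d * (fromℕ 6 * e * q)
      lem₁ = solve-∀ ℚ-ring
      lem₂ : ∀ d t b → d * (fromℕ 25 * (t * b * (t * b * 1ℚ))) ≡ fromℕ 25 * d * (t * b * (t * b))
      lem₂ = solve-∀ ℚ-ring

  -- The lower Chernoff tail with Λ = 24 and u = 4Nβ: u/Λ is the missing sixth of Nβ, and the
  -- remainder u - 2Nβ must cover j₁ n 24², that is, Nβ ≥ 288 j₁ n.
  unrepresentative-unlikely : ∀ i → Unlikely sampleS (Unrepresentative i) (½ ^ j₁)
  unrepresentative-unlikely i = go (large? i)
    where
    β = classSize i
    member-i : Fin n → ℕ
    member-i v = ⟦ member v i ⟧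
    u-large : Large i → 2 ℕ.* (1 ℕ.* β) ℕ.* N ℕ.+ j₁ ℕ.* (n ℕ.* (24 ℕ.* 24)) ℕ.≤ 4 ℕ.* (N ℕ.* β)
    u-large lrg = begin
      2 ℕ.* (1 ℕ.* β) ℕ.* N ℕ.+ j₁ ℕ.* (n ℕ.* (24 ℕ.* 24))    ≡⟨ lem₁ β N j₁ n ⟩
      2 ℕ.* (N ℕ.* β) ℕ.+ 2 ℕ.* (288 ℕ.* (j₁ ℕ.* n))           ≤⟨ ℕ.+-monoʳ-≤ (2 ℕ.* (N ℕ.* β)) (ℕ.*-monoʳ-≤ 2 (Sz.large-class-expectation β (large-ℕ i lrg))) ⟩
      2 ℕ.* (N ℕ.* β) ℕ.+ 2 ℕ.* (N ℕ.* β)                      ≡⟨ lem₂ (N ℕ.* β) ⟩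
      4 ℕ.* (N ℕ.* β)                                          ∎
      where
      open ℕ.≤-Reasoning
      lem₁ : ∀ b N j n → 2 ℕ.* (1 ℕ.* b) ℕ.* N ℕ.+ j ℕ.* (n ℕ.* (24 ℕ.* 24)) ≡ 2 ℕ.* (N ℕ.* b) ℕ.+ 2 ℕ.* (288 ℕ.* (j ℕ.* n))
      lem₁ = ℕR.solve-∀
      lem₂ : ∀ x → 2 ℕ.* x ℕ.+ 2 ℕ.* x ≡ 4 ℕ.* x
      lem₂ = ℕR.solve-∀
    event : ∀ S → Unrepresentative i S → 4 ℕ.* (N ℕ.* β) ℕ.+ 24 ℕ.* (n ℕ.* total member-i S) ℕ.≤ 24 ℕ.* (N ℕ.* β)
    event S (_ , ≰) = begin
      4 ℕ.* (N ℕ.* β) ℕ.+ 24 ℕ.* (n ℕ.* total member-i S)      ≡⟨ cong (λ z → 4 ℕ.* (N ℕ.* β) ℕ.+ 24 ℕ.* (n ℕ.* z)) (total-count (_∈B? i) S) ⟩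
      4 ℕ.* (N ℕ.* β) ℕ.+ 24 ℕ.* (n ℕ.* members S i)           ≡⟨ lem₁ (N ℕ.* β) (n ℕ.* members S i) ⟩
      4 ℕ.* (N ℕ.* β) ℕ.+ 4 ℕ.* (6 ℕ.* (n ℕ.* members S i))    ≤⟨ ℕ.+-monoʳ-≤ (4 ℕ.* (N ℕ.* β)) (ℕ.*-monoʳ-≤ 4 (ℕ.<⇒≤ (ℕ.≰⇒> ≰))) ⟩
      4 ℕ.* (N ℕ.* β) ℕ.+ 4 ℕ.* (5 ℕ.* (N ℕ.* β))              ≡⟨ lem₂ (N ℕ.* β) ⟩
      24 ℕ.* (N ℕ.* β)                                         ∎
      where
      open ℕ.≤-Reasoning
      lem₁ : ∀ x y → 4 ℕ.* x ℕ.+ 24 ℕ.* y ≡ 4 ℕ.* x ℕ.+ 4 ℕ.* (6 ℕ.* y)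
      lem₁ = ℕR.solve-∀
      lem₂ : ∀ x → 4 ℕ.* x ℕ.+ 4 ℕ.* (5 ℕ.* x) ≡ 24 ℕ.* x
      lem₂ = ℕR.solve-∀
    go : Dec (Large i) → Unlikely sampleS (Unrepresentative i) (½ ^ j₁)
    go (no ¬l)   = never sampleS (^-nonNeg j₁ (ℚ.nonNegative⁻¹ ½)) (λ _ u → ¬l (proj₁ u))
    go (yes lrg) = unlikely-mono sampleS event ℚ.≤-refl
      (Chernoff.lower-tail (uniform n) member-i n β 1 (average-indicator n (λ v → member v i)) (λ v → ⟦⟧≤1 (member v i))
        N 24 j₁ (4 ℕ.* (N ℕ.* β)) (ℕ.m≤m+n 2 22) (u-large lrg))

  -- M bounds the multiplicity of a vertex in S.
  module _ (M : ℕ) .{{_ : NonZero M}} (2N+2jn≤nM : 4 ℕ.* N ℕ.+ 4 ℕ.* (j ℕ.* n) ℕ.≤ 2 ℕ.* (n ℕ.* suc M))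
    (nM≤2N+3jn : n ℕ.* M ℕ.≤ 2 ℕ.* N ℕ.+ 3 ℕ.* (j ℕ.* n)) where

    BadS : Vec (Fin n) ∣S∣ → Set
    BadS S = (∃[ i ] Unrepresentative i S) ⊎ (∃[ x ] ¬ occurrences x S ℕ.≤ M)

    badS? : Decidable BadS
    badS? S = Fin.any? (λ i → large? i ×-dec ¬? (_ ℕ.≤? _)) ⊎-dec Fin.any? (λ x → ¬? (_ ℕ.≤? _))

    badS-unlikely : Unlikely sampleS BadS (½ ^ j + fromℕ n * ½ ^ j)
    badS-unlikely = unlikely-∪ sampleS
      (unlikely-mono sampleS (λ _ b → b) t½^≤ (unlikely-⋃ sampleS unrepresentative-unlikely))
      (frequent-unlikely n N j M 2N+2jn≤nM)
      where
      open ℚ.≤-Reasoning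
      lem : ∀ t a b → t * (a * b) ≡ a * (t * b)
      lem = solve-∀ ℚ-ring
      t½^≤ : fromℕ t * ½ ^ j₁ ≤ ½ ^ j
      t½^≤ = begin
        fromℕ t * ½ ^ (j ℕ.+ t)      ≡⟨ trans (cong (fromℕ t *_) (^-+ ½ j t)) (lem (fromℕ t) (½ ^ j) (½ ^ t)) ⟩
        ½ ^ j * (fromℕ t * ½ ^ t)    ≤⟨ *-monoˡ-≤ (^-nonNeg j (ℚ.nonNegative⁻¹ ½)) (t*½^t≤1 t) ⟩
        ½ ^ j * 1ℚ                   ≡⟨ ℚ.*-identityʳ (½ ^ j) ⟩
        ½ ^ j                        ∎

    module _ (S : Vec (Fin n) ∣S∣) (good : ¬ BadS S) where

      private
        A = sampledDegree S
        M′ = t ℕ.* M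
        instance
          m≢0 : NonZero (2 ℕ.* m)
          m≢0 = ℕ.m*n≢0 2 m
          M′≢0 : NonZero M′
          M′≢0 = ℕ.m*n≢0 t M

        representative : ∀ i → Large i → 5 ℕ.* (N ℕ.* classSize i) ℕ.≤ 6 ℕ.* (n ℕ.* members S i)
        representative i lrg = decidable-stable (_ ℕ.≤? _) (λ ≰ → good (inj₁ (i , lrg , ≰)))

        occurrences≤M : ∀ x → occurrences x S ℕ.≤ M
        occurrences≤M x = decidable-stable (_ ℕ.≤? _) (λ ≰ → good (inj₂ (x , ≰)))

        A-large : N ℕ.* m ℕ.≤ 5 ℕ.* (n ℕ.* A)
        A-large = sampledDegree-≥ S representative n≤6m

        A≢0 : NonZero A
        A≢0 = ℕ.≢-nonZero λ A≡0 → ℕ.≢-nonZero⁻¹ (N ℕ.* m) {{ℕ.m*n≢0 N m {{Sz.N≢0}}}}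
          (ℕ.n≤0⇒n≡0 (subst (N ℕ.* m ℕ.≤_) (trans (cong (λ a → 5 ℕ.* (n ℕ.* a)) A≡0) (cong (5 ℕ.*_) (ℕ.*-zeroʳ n))) A-large))

        mean : fromℕ (2 ℕ.* m) * 𝔼 randEndpoint (fromℕ ∘ weight S) ≡ fromℕ A
        mean = trans (𝔼-randEndpoint ε h (fromℕ ∘ weight S))
          (sym (trans (fromℕ-sum (λ v → weight S v ℕ.* deg v)) (sum-cong-≗ (λ v → fromℕ-* (weight S v) (deg v)))))

        τA-large : 128 ℕ.* (j ℕ.* (2 ℕ.* m ℕ.* (M′ ℕ.* (Δ ℕ.* Δ)))) ℕ.≤ τ ℕ.* A
        τA-large = subst (ℕ._≤ τ ℕ.* A) (lem j m (M′ ℕ.* (Δ ℕ.* Δ))) (Sz.weight-expectation m M A nM≤2N+3jn A-large)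
          where
          lem : ∀ j m x → 256 ℕ.* (j ℕ.* (m ℕ.* x)) ≡ 128 ℕ.* (j ℕ.* (2 ℕ.* m ℕ.* x))
          lem = ℕR.solve-∀

      skewed-unlikely : Unlikely sampleT (Skewed S) (½ ^ j + ½ ^ j)
      skewed-unlikely = relative-deviation randEndpoint (weight S) (2 ℕ.* m) A M′ mean (weight-≤ S M occurrences≤M) τ Δ j τA-large

      skewed? : Decidable (Skewed S)
      skewed? T = (_ ℕ.≤? _) ⊎-dec (_ ℕ.≤? _)

      inaccurate⇒skewed : ∀ T → ¬ Approximates ε (fromℕ m) (nonCollEstimate S T) → Skewed S T
      inaccurate⇒skewed T inaccurate = decidable-stable (skewed? T) (λ ¬skewed → inaccurate (accurate S T A≢0 ¬skewed))

    Inaccurate : Maybe ℚ → Set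
    Inaccurate m̃ = ¬ Approximates ε (fromℕ m) m̃

    rest : Vec (Fin n) ∣S∣ → Rand (Maybe ℚ)
    rest S = sampleT >>= λ T → pure (nonCollEstimate S T)

    rest-unlikely : ∀ S → Dec (BadS S) → BadS S ⊎ Unlikely (rest S) Inaccurate (½ ^ j + ½ ^ j)
    rest-unlikely S (yes bad) = inj₁ bad
    rest-unlikely S (no good) = inj₂ (unlikely-map sampleT (nonCollEstimate S) {B = Skewed S} {D = Inaccurate} (skewed-unlikely S good) (inaccurate⇒skewed S good))

    inaccurate-unlikely″ : Unlikely (sampleS >>= rest) Inaccurate (½ ^ j + fromℕ n * ½ ^ j + (½ ^ j + ½ ^ j))
    inaccurate-unlikely″ = unlikely->>= sampleS rest {B = BadS} {D = Inaccurate} {q = ½ ^ j + fromℕ n * ½ ^ j} {r = ½ ^ j + ½ ^ j}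
      (+-nonNeg (^-nonNeg j (ℚ.nonNegative⁻¹ ½)) (^-nonNeg j (ℚ.nonNegative⁻¹ ½))) badS-unlikely (λ S → rest-unlikely S (badS? S))

    nonAdaptiveEdge≡ : nonAdaptiveEdge ≡ (sampleS >>= rest)
    nonAdaptiveEdge≡ = refl

    inaccurate-unlikely′ : Unlikely nonAdaptiveEdge Inaccurate (½ ^ j + fromℕ n * ½ ^ j + (½ ^ j + ½ ^ j))
    inaccurate-unlikely′ = subst (λ c → Unlikely c Inaccurate (½ ^ j + fromℕ n * ½ ^ j + (½ ^ j + ½ ^ j))) (sym nonAdaptiveEdge≡) inaccurate-unlikely″

  inaccurate-unlikely : Unlikely nonAdaptiveEdge (λ m̃ → ¬ Approximates ε (fromℕ m) m̃) (½ ^ j + fromℕ n * ½ ^ j + (½ ^ j + ½ ^ j))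
  inaccurate-unlikely = go (multiplicity-bound N n j 1≤j)
    where
    1≤j : 1 ℕ.≤ j
    1≤j = ℕ.≤-trans (ℕ.>-nonZero⁻¹ logn {{1≤logn}}) (ℕ.m≤n*m logn 8)
    go : (∃[ M ] 1 ℕ.≤ M × 4 ℕ.* N ℕ.+ 4 ℕ.* (j ℕ.* n) ℕ.≤ 2 ℕ.* (n ℕ.* suc M) × n ℕ.* M ℕ.≤ 2 ℕ.* N ℕ.+ 3 ℕ.* (j ℕ.* n)) →
      Unlikely nonAdaptiveEdge (λ m̃ → ¬ Approximates ε (fromℕ m) m̃) (½ ^ j + fromℕ n * ½ ^ j + (½ ^ j + ½ ^ j))
    go (M , 1≤M , lower , upper) = inaccurate-unlikely′ M {{ℕ.>-nonZero 1≤M}} lower upper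

-- The integer Δ and the resulting sample sizes

^1 : ∀ x → x ^ 1 ≡ x
^1 = ℚ.*-identityʳ

^2 : ∀ x → x ^ 2 ≡ x * x
^2 x = cong (x *_) (^1 x)

module Parameters (ε : ℚ) .{{_ : Positive ε}} (ε<1 : ε < 1ℚ) where

  ε⁻¹ : ℚ
  ε⁻¹ = (ℚ.1/ ε) {{ℚ.pos⇒nonZero ε}}

  ε*ε⁻¹ : ε * ε⁻¹ ≡ 1ℚ
  ε*ε⁻¹ = ℚ.*-inverseʳ ε {{ℚ.pos⇒nonZero ε}}

  0≤ε′ : 0ℚ ≤ ε
  0≤ε′ = ℚ.<⇒≤ (ℚ.positive⁻¹ ε)

  0≤ε⁻¹ : 0ℚ ≤ ε⁻¹
  0≤ε⁻¹ = ℚ.<⇒≤ (ℚ.positive⁻¹ ε⁻¹ {{ℚ.1/pos⇒pos ε}})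

  1≤ε⁻¹ : 1ℚ ≤ ε⁻¹
  1≤ε⁻¹ = subst₂ _≤_ ε*ε⁻¹ (ℚ.*-identityˡ ε⁻¹) (*-monoʳ-≤ 0≤ε⁻¹ (ℚ.<⇒≤ ε<1))

  private
    enough? : Decidable (λ k → 1ℚ ≤ ε * fromℕ k)
    enough? k = 1ℚ ℚ.≤? ε * fromℕ k
    bound = ℤ.∣ ℚ.ceiling ε⁻¹ ∣

  -- ⌈1/ε⌉
  Δ : ℕ
  Δ = least enough? bound

  1≤εΔ : 1ℚ ≤ ε * fromℕ Δ
  1≤εΔ = least-holds enough? bound (subst (_≤ ε * fromℕ bound) ε*ε⁻¹ (*-monoˡ-≤ 0≤ε′ (≤-∣ceiling∣ ε⁻¹)))

  Δ≢0 : NonZero Δ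
  Δ≢0 = go Δ 1≤εΔ
    where
    go : ∀ k → 1ℚ ≤ ε * fromℕ k → NonZero k
    go zero    le = contradiction refl (ℚ.<⇒≢ (ℚ.<-≤-trans (ℚ.positive⁻¹ 1ℚ) (subst (1ℚ ≤_) (ℚ.*-zeroʳ ε) le)))
    go (suc k) _  = _

  -- For positive Δ, minimality gives ε(Δ - 1) < 1, and adding ε < 1 yields εΔ ≤ 2.
  Δ≤2ε⁻¹ : fromℕ Δ ≤ fromℕ 2 * ε⁻¹
  Δ≤2ε⁻¹ = begin
    fromℕ Δ                   ≡⟨ sym (ℚ.*-identityˡ (fromℕ Δ)) ⟩
    1ℚ * fromℕ Δ              ≡⟨ cong (_* fromℕ Δ) (sym ε*ε⁻¹) ⟩
    ε * ε⁻¹ * fromℕ Δ         ≡⟨ lem ε ε⁻¹ (fromℕ Δ) ⟩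
    ε * fromℕ Δ * ε⁻¹         ≤⟨ *-monoʳ-≤ 0≤ε⁻¹ (εΔ≤2 Δ (least-≤ enough? bound)) ⟩
    fromℕ 2 * ε⁻¹             ∎
    where
    open ℚ.≤-Reasoning
    lem : ∀ a b c → a * b * c ≡ a * c * b
    lem = solve-∀ ℚ-ring
    εΔ≤2 : ∀ d → (∀ {k} → 1ℚ ≤ ε * fromℕ k → d ℕ.≤ k) → ε * fromℕ d ≤ fromℕ 2
    εΔ≤2 zero    _   = subst (_≤ fromℕ 2) (sym (ℚ.*-zeroʳ ε)) (0≤fromℕ 2)
    εΔ≤2 (suc k) min = begin
      ε * fromℕ (suc k)       ≡⟨ trans (cong (ε *_) (fromℕ-+ 1 k)) (ℚ.*-distribˡ-+ ε 1ℚ (fromℕ k)) ⟩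
      ε * 1ℚ + ε * fromℕ k    ≤⟨ ℚ.+-mono-≤ (subst (_≤ 1ℚ) (sym (ℚ.*-identityʳ ε)) (ℚ.<⇒≤ ε<1)) (ℚ.<⇒≤ (ℚ.≰⇒> λ le → ℕ.n≮n k (min le))) ⟩
      1ℚ + 1ℚ                 ∎

  Δ³≤8ε⁻³ : fromℕ (Δ ℕ.* Δ ℕ.* Δ) ≤ fromℕ 8 * ε⁻¹ ^ 3
  Δ³≤8ε⁻³ = begin
    fromℕ (Δ ℕ.* Δ ℕ.* Δ)                                    ≡⟨ trans (fromℕ-* (Δ ℕ.* Δ) Δ) (cong (_* fromℕ Δ) (fromℕ-* Δ Δ)) ⟩
    fromℕ Δ * fromℕ Δ * fromℕ Δ                              ≤⟨ *-mono-≤ (*-nonNeg 0≤Δ 0≤Δ) (*-mono-≤ 0≤Δ Δ≤2ε⁻¹ 0≤Δ Δ≤2ε⁻¹) 0≤Δ Δ≤2ε⁻¹ ⟩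
    fromℕ 2 * ε⁻¹ * (fromℕ 2 * ε⁻¹) * (fromℕ 2 * ε⁻¹)        ≡⟨ lem ε⁻¹ ⟩
    fromℕ 8 * ε⁻¹ ^ 3                                        ∎
    where
    open ℚ.≤-Reasoning
    0≤Δ = 0≤fromℕ Δ
    lem : ∀ e → fromℕ 2 * e * (fromℕ 2 * e) * (fromℕ 2 * e) ≡ fromℕ 8 * (e * (e * (e * 1ℚ)))
    lem = solve-∀ ℚ-ring

  samples-large : ∀ R L n → R ℕ.* L ℕ.* Δ ℕ.* (R ℕ.* L ℕ.* Δ) ℕ.* n ℕ.≤
    4 ℕ.* (⌈ fromℕ (R ℕ.* L) * ε⁻¹ √ fromℕ n ⌉ ℕ.* ⌈ fromℕ (R ℕ.* L) * ε⁻¹ √ fromℕ n ⌉)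
  samples-large R L n = fromℕ-cancel-≤ {RLΔ ℕ.* RLΔ ℕ.* n} {4 ℕ.* (s ℕ.* s)} (begin
    fromℕ (RLΔ ℕ.* RLΔ ℕ.* n)
      ≡⟨ trans (fromℕ-* (RLΔ ℕ.* RLΔ) n) (cong (_* fromℕ n) (trans (fromℕ-* RLΔ RLΔ) (cong (λ z → z * z) (fromℕ-* (R ℕ.* L) Δ)))) ⟩
    fromℕ (R ℕ.* L) * fromℕ Δ * (fromℕ (R ℕ.* L) * fromℕ Δ) * fromℕ n
      ≤⟨ *-monoʳ-≤ (0≤fromℕ n) (*-mono-≤ 0≤xΔ xΔ≤ 0≤xΔ xΔ≤) ⟩
    fromℕ (R ℕ.* L) * (fromℕ 2 * ε⁻¹) * (fromℕ (R ℕ.* L) * (fromℕ 2 * ε⁻¹)) * fromℕ n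
      ≡⟨ lem (fromℕ (R ℕ.* L)) ε⁻¹ (fromℕ n) ⟩
    fromℕ 4 * ((fromℕ (R ℕ.* L) * ε⁻¹) ^ 2 * fromℕ n)
      ≤⟨ *-monoˡ-≤ (0≤fromℕ 4) (√-holds (fromℕ (R ℕ.* L) * ε⁻¹) (fromℕ n)) ⟩
    fromℕ 4 * fromℕ s ^ 2
      ≡⟨ trans (cong (fromℕ 4 *_) (fromℕ-square s)) (sym (fromℕ-* 4 (s ℕ.* s))) ⟩
    fromℕ (4 ℕ.* (s ℕ.* s)) ∎)
    where
    open ℚ.≤-Reasoning
    s = ⌈ fromℕ (R ℕ.* L) * ε⁻¹ √ fromℕ n ⌉
    RLΔ = R ℕ.* L ℕ.* Δ
    0≤xΔ : 0ℚ ≤ fromℕ (R ℕ.* L) * fromℕ Δ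
    0≤xΔ = *-nonNeg (0≤fromℕ (R ℕ.* L)) (0≤fromℕ Δ)
    xΔ≤ : fromℕ (R ℕ.* L) * fromℕ Δ ≤ fromℕ (R ℕ.* L) * (fromℕ 2 * ε⁻¹)
    xΔ≤ = *-monoˡ-≤ (0≤fromℕ (R ℕ.* L)) Δ≤2ε⁻¹
    lem : ∀ x e n → x * (fromℕ 2 * e) * (x * (fromℕ 2 * e)) * n ≡ fromℕ 4 * (x * e * (x * e * 1ℚ) * n)
    lem = solve-∀ ℚ-ring

  √-large : ∀ x y K n → fromℕ K ≤ x → 0ℚ ≤ y → fromℕ n ≤ y → K ℕ.* K ℕ.* n ℕ.≤ ⌈ x √ y ⌉ ℕ.* ⌈ x √ y ⌉
  √-large x y K n K≤x 0≤y n≤y = fromℕ-cancel-≤ {K ℕ.* K ℕ.* n} {⌈ x √ y ⌉ ℕ.* ⌈ x √ y ⌉} (begin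
    fromℕ (K ℕ.* K ℕ.* n)                    ≡⟨ trans (fromℕ-* (K ℕ.* K) n) (cong (_* fromℕ n) (fromℕ-* K K)) ⟩
    fromℕ K * fromℕ K * fromℕ n              ≤⟨ *-mono-≤ (*-nonNeg (0≤fromℕ K) (0≤fromℕ K)) (*-mono-≤ (0≤fromℕ K) K≤x (0≤fromℕ K) K≤x) (0≤fromℕ n) n≤y ⟩
    x * x * y                                ≡⟨ cong (_* y) (sym (^2 x)) ⟩
    x ^ 2 * y                                ≤⟨ √-holds x y ⟩
    fromℕ ⌈ x √ y ⌉ ^ 2                      ≡⟨ fromℕ-square ⌈ x √ y ⌉ ⟩
    fromℕ (⌈ x √ y ⌉ ℕ.* ⌈ x √ y ⌉)          ∎)
    where open ℚ.≤-Reasoning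

  -- One factor 1/ε is spent on the ε under the root: (K/ε)² · εn = K²n/ε ≥ K²n.
  √-large-ε : ∀ x K n → fromℕ K * ε⁻¹ ≤ x → K ℕ.* K ℕ.* n ℕ.≤ ⌈ x √ ε * fromℕ n ⌉ ℕ.* ⌈ x √ ε * fromℕ n ⌉
  √-large-ε x K n Kε⁻¹≤x = fromℕ-cancel-≤ {K ℕ.* K ℕ.* n} {s ℕ.* s} (begin
    fromℕ (K ℕ.* K ℕ.* n)                             ≡⟨ trans (fromℕ-* (K ℕ.* K) n) (cong (_* fromℕ n) (fromℕ-* K K)) ⟩
    k * k * fromℕ n                                   ≡⟨ sym (ℚ.*-identityʳ (k * k * fromℕ n)) ⟩
    k * k * fromℕ n * 1ℚ                              ≤⟨ *-monoˡ-≤ (*-nonNeg (*-nonNeg (0≤fromℕ K) (0≤fromℕ K)) (0≤fromℕ n)) 1≤ε⁻¹ ⟩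
    k * k * fromℕ n * ε⁻¹                             ≡⟨ trans (sym (ℚ.*-identityˡ (k * k * fromℕ n * ε⁻¹))) (cong (_* (k * k * fromℕ n * ε⁻¹)) (sym ε*ε⁻¹)) ⟩
    ε * ε⁻¹ * (k * k * fromℕ n * ε⁻¹)                 ≡⟨ lem ε ε⁻¹ k (fromℕ n) ⟩
    k * ε⁻¹ * (k * ε⁻¹) * (ε * fromℕ n)               ≤⟨ *-monoʳ-≤ (*-nonNeg 0≤ε′ (0≤fromℕ n)) (*-mono-≤ 0≤kε⁻¹ Kε⁻¹≤x 0≤kε⁻¹ Kε⁻¹≤x) ⟩
    x * x * (ε * fromℕ n)                             ≡⟨ cong (_* (ε * fromℕ n)) (sym (^2 x)) ⟩
    x ^ 2 * (ε * fromℕ n)                             ≤⟨ √-holds x (ε * fromℕ n) ⟩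
    fromℕ s ^ 2                                       ≡⟨ fromℕ-square s ⟩
    fromℕ (s ℕ.* s)                                   ∎)
    where
    open ℚ.≤-Reasoning
    s = ⌈ x √ ε * fromℕ n ⌉
    k = fromℕ K
    0≤kε⁻¹ : 0ℚ ≤ k * ε⁻¹
    0≤kε⁻¹ = *-nonNeg (0≤fromℕ K) 0≤ε⁻¹
    lem : ∀ e i k n → e * i * (k * k * n * i) ≡ k * i * (k * i) * (e * n)
    lem = solve-∀ ℚ-ring

  module _ (B L : ℕ) .{{_ : NonZero L}} where

    size-≤ : fromℕ (B ℕ.* (L ℕ.* L ℕ.* (Δ ℕ.* Δ ℕ.* Δ))) ≤ fromℕ (8 ℕ.* B) * fromℕ L ^ 2 * ε⁻¹ ^ 3
    size-≤ = begin
      fromℕ (B ℕ.* (L ℕ.* L ℕ.* (Δ ℕ.* Δ ℕ.* Δ)))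
        ≡⟨ trans (fromℕ-* B (L ℕ.* L ℕ.* (Δ ℕ.* Δ ℕ.* Δ))) (cong (fromℕ B *_) (trans (fromℕ-* (L ℕ.* L) (Δ ℕ.* Δ ℕ.* Δ)) (cong (_* fromℕ (Δ ℕ.* Δ ℕ.* Δ)) (sym (fromℕ-square L))))) ⟩
      fromℕ B * (fromℕ L ^ 2 * fromℕ (Δ ℕ.* Δ ℕ.* Δ))
        ≤⟨ *-monoˡ-≤ (0≤fromℕ B) (*-monoˡ-≤ (^-nonNeg 2 (0≤fromℕ L)) Δ³≤8ε⁻³) ⟩
      fromℕ B * (fromℕ L ^ 2 * (fromℕ 8 * ε⁻¹ ^ 3))
        ≡⟨ lem (fromℕ B) (fromℕ L ^ 2) (ε⁻¹ ^ 3) ⟩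
      fromℕ 8 * fromℕ B * fromℕ L ^ 2 * ε⁻¹ ^ 3
        ≡⟨ cong (λ z → z * fromℕ L ^ 2 * ε⁻¹ ^ 3) (sym (fromℕ-* 8 B)) ⟩
      fromℕ (8 ℕ.* B) * fromℕ L ^ 2 * ε⁻¹ ^ 3 ∎
      where
      open ℚ.≤-Reasoning
      lem : ∀ b l e → b * (l * (fromℕ 8 * e)) ≡ fromℕ 8 * b * l * e
      lem = solve-∀ ℚ-ring

    polyFactor-≤ : ∀ {C a b} k → 8 ℕ.* B ℕ.≤ C → 2 ℕ.≤ a → k ℕ.≤ b →
      fromℕ (8 ℕ.* B) * fromℕ L ^ 2 * ε⁻¹ ^ k ≤ fromℕ C * fromℕ L ^ a * ε⁻¹ ^ b
    polyFactor-≤ k 8B≤C 2≤a k≤b = *-mono-≤ (*-nonNeg (0≤fromℕ (8 ℕ.* B)) (^-nonNeg 2 (0≤fromℕ L)))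
      (*-mono-≤ (0≤fromℕ (8 ℕ.* B)) (fromℕ-mono-≤ 8B≤C) (^-nonNeg 2 (0≤fromℕ L)) (^-monoʳ-≤ (fromℕ-mono-≤ (ℕ.>-nonZero⁻¹ L)) 2≤a))
      (^-nonNeg k 0≤ε⁻¹) (^-monoʳ-≤ 1≤ε⁻¹ k≤b)

    -- Of the three powers of 1/ε in `size-≤`, two come with the prescribed ε^(-5/2), whose
    -- remaining half power is at least 1; the polynomial factor supplies the third.
    vertices-large : ∀ {C a b} n → 8 ℕ.* B ℕ.≤ C → 2 ℕ.≤ a → 1 ℕ.≤ b →
      let s = ⌈ fromℕ C * fromℕ L ^ a * ε⁻¹ ^ b * ε⁻¹ ^ 2 √ fromℕ n * ε⁻¹ ⌉
          K = B ℕ.* (L ℕ.* L ℕ.* (Δ ℕ.* Δ ℕ.* Δ))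
      in K ℕ.* K ℕ.* n ℕ.≤ s ℕ.* s
    vertices-large {C} {a} {b} n 8B≤C 2≤a 1≤b = √-large (fromℕ C * fromℕ L ^ a * ε⁻¹ ^ b * ε⁻¹ ^ 2) (fromℕ n * ε⁻¹)
      (B ℕ.* (L ℕ.* L ℕ.* (Δ ℕ.* Δ ℕ.* Δ))) n (begin
        fromℕ (B ℕ.* (L ℕ.* L ℕ.* (Δ ℕ.* Δ ℕ.* Δ)))              ≤⟨ size-≤ ⟩
        c * ε⁻¹ ^ 3                                              ≡⟨ cong (c *_) (^-+ ε⁻¹ 1 2) ⟩
        c * (ε⁻¹ ^ 1 * ε⁻¹ ^ 2)                                  ≡⟨ sym (ℚ.*-assoc c (ε⁻¹ ^ 1) (ε⁻¹ ^ 2)) ⟩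
        c * ε⁻¹ ^ 1 * ε⁻¹ ^ 2                                    ≤⟨ *-monoʳ-≤ (^-nonNeg 2 0≤ε⁻¹) (polyFactor-≤ 1 8B≤C 2≤a 1≤b) ⟩
        fromℕ C * fromℕ L ^ a * ε⁻¹ ^ b * ε⁻¹ ^ 2                ∎)
      (*-nonNeg (0≤fromℕ n) 0≤ε⁻¹) (subst (_≤ fromℕ n * ε⁻¹) (ℚ.*-identityʳ (fromℕ n)) (*-monoˡ-≤ (0≤fromℕ n) 1≤ε⁻¹))
      where
      open ℚ.≤-Reasoning
      c = fromℕ (8 ℕ.* B) * fromℕ L ^ 2

    -- Three powers of 1/ε for Δ³ and a fourth against the √ε in √(εn).
    edges-large : ∀ {C a b} n → 8 ℕ.* B ℕ.≤ C → 2 ℕ.≤ a → 4 ℕ.≤ b →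
      let s = ⌈ fromℕ C * fromℕ L ^ a * ε⁻¹ ^ b √ ε * fromℕ n ⌉
          K = B ℕ.* (L ℕ.* L ℕ.* (Δ ℕ.* Δ ℕ.* Δ))
      in K ℕ.* K ℕ.* n ℕ.≤ s ℕ.* s
    edges-large {C} {a} {b} n 8B≤C 2≤a 4≤b = √-large-ε (fromℕ C * fromℕ L ^ a * ε⁻¹ ^ b)
      (B ℕ.* (L ℕ.* L ℕ.* (Δ ℕ.* Δ ℕ.* Δ))) n (begin
        fromℕ (B ℕ.* (L ℕ.* L ℕ.* (Δ ℕ.* Δ ℕ.* Δ))) * ε⁻¹        ≤⟨ *-monoʳ-≤ 0≤ε⁻¹ size-≤ ⟩
        c * ε⁻¹ ^ 3 * ε⁻¹                                        ≡⟨ trans (ℚ.*-assoc c (ε⁻¹ ^ 3) ε⁻¹) (cong (c *_) (ℚ.*-comm (ε⁻¹ ^ 3) ε⁻¹)) ⟩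
        c * ε⁻¹ ^ 4                                              ≤⟨ polyFactor-≤ 4 8B≤C 2≤a 4≤b ⟩
        fromℕ C * fromℕ L ^ a * ε⁻¹ ^ b                          ∎)
      where
      open ℚ.≤-Reasoning
      c = fromℕ (8 ℕ.* B) * fromℕ L ^ 2

  -- By Bernoulli (1+γ)^(10Δ) ≥ 1 + 10Δγ = 1 + Δε ≥ 2, so the exponent 10ΔL reaches 2^L ≥ n; the
  -- additional 1 in t is covered by the eleventh ΔL.
  classes-few : ∀ n L .{{_ : NonZero L}} → n ℕ.≤ 2 ℕ.^ L → (γ>0 : Positive (ε * (+ 1 / 10))) →
    ⌈log[1+_]_⌉ (ε * (+ 1 / 10)) {{γ>0}} n ℕ.+ 1 ℕ.≤ 11 ℕ.* (Δ ℕ.* L)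
  classes-few n L n≤2^L γ>0 = ℕ.≤-trans (ℕ.+-mono-≤ (log-≤ γ {{γ>0}} n {10 ℕ.* (Δ ℕ.* L)} (begin
    fromℕ n                              ≤⟨ fromℕ-mono-≤ n≤2^L ⟩
    fromℕ (2 ℕ.^ L)                      ≡⟨ fromℕ-^ 2 L ⟩
    fromℕ 2 ^ L                          ≤⟨ ^-mono-≤ L (0≤fromℕ 2) doubles ⟩
    ((1ℚ + γ) ^ (10 ℕ.* Δ)) ^ L          ≡⟨ sym (^-* (1ℚ + γ) L (10 ℕ.* Δ)) ⟩
    (1ℚ + γ) ^ (L ℕ.* (10 ℕ.* Δ))        ≡⟨ cong ((1ℚ + γ) ^_) (lem L Δ) ⟩
    (1ℚ + γ) ^ (10 ℕ.* (Δ ℕ.* L))        ∎)) (ℕ.>-nonZero⁻¹ (Δ ℕ.* L) {{ℕ.m*n≢0 Δ L {{Δ≢0}}}})) (ℕ.≤-reflexive (lem′ (Δ ℕ.* L)))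
    where
    open ℚ.≤-Reasoning
    γ = ε * (+ 1 / 10)
    0≤γ : 0ℚ ≤ γ
    0≤γ = *-nonNeg 0≤ε′ (ℚ.nonNegative⁻¹ (+ 1 / 10))
    lem : ∀ L d → L ℕ.* (10 ℕ.* d) ≡ 10 ℕ.* (d ℕ.* L)
    lem = ℕR.solve-∀
    lem′ : ∀ x → 10 ℕ.* x ℕ.+ x ≡ 11 ℕ.* x
    lem′ = ℕR.solve-∀
    lem″ : ∀ e d → e * d ≡ fromℕ 10 * d * (e * (+ 1 / 10))
    lem″ = solve-∀ ℚ-ring
    doubles : fromℕ 2 ≤ (1ℚ + γ) ^ (10 ℕ.* Δ)
    doubles = begin
      1ℚ + 1ℚ                            ≤⟨ ℚ.+-monoʳ-≤ 1ℚ 1≤εΔ ⟩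
      1ℚ + ε * fromℕ Δ                   ≡⟨ cong (λ z → 1ℚ + z) (trans (lem″ ε (fromℕ Δ)) (cong (_* γ) (sym (fromℕ-* 10 Δ)))) ⟩
      1ℚ + fromℕ (10 ℕ.* Δ) * γ          ≤⟨ bernoulli (10 ℕ.* Δ) (ℚ.≤-trans (ℚ.nonPositive⁻¹ (- 1ℚ)) 0≤γ) ⟩
      (1ℚ + γ) ^ (10 ℕ.* Δ)              ∎

-- The algorithm

-- The failures add up to (m + n + 6) · 2^(-8L), and (m + n + 6) n ≤ 4n² · n ≤ n⁵ ≤ 2^(5L).
failure-bound : ∀ m n L → 2 ℕ.≤ n → m ℕ.≤ n ℕ.* n → n ℕ.≤ 2 ℕ.^ L →
  let p = ½ ^ (8 ℕ.* L) in
  (p + ((fromℕ m * p + (p + p)) + (p + fromℕ n * p + (p + p)))) * fromℕ n ≤ 1ℚ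
failure-bound m n L 2≤n m≤n² n≤2^L = begin
  (p + ((fromℕ m * p + (p + p)) + (p + fromℕ n * p + (p + p)))) * fromℕ n
    ≡⟨ lem₁ p (fromℕ m) (fromℕ n) ⟩
  (fromℕ m + fromℕ n + fromℕ 6) * fromℕ n * p
    ≡⟨ cong (_* p) (sym (trans (fromℕ-* (m ℕ.+ n ℕ.+ 6) n) (cong (_* fromℕ n) (trans (fromℕ-+ (m ℕ.+ n) 6) (cong (_+ fromℕ 6) (fromℕ-+ m n)))))) ⟩
  fromℕ ((m ℕ.+ n ℕ.+ 6) ℕ.* n) * p
    ≤⟨ *-monoʳ-≤ (^-nonNeg (8 ℕ.* L) (ℚ.nonNegative⁻¹ ½)) (fromℕ-mono-≤ count≤) ⟩
  fromℕ (2 ℕ.^ (8 ℕ.* L)) * p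
    ≡⟨ cong (_* p) (fromℕ-^ 2 (8 ℕ.* L)) ⟩
  fromℕ 2 ^ (8 ℕ.* L) * ½ ^ (8 ℕ.* L)
    ≡⟨ sym (*-^ (fromℕ 2) ½ (8 ℕ.* L)) ⟩
  1ℚ ^ (8 ℕ.* L)
    ≤⟨ ^-antimonoʳ-≤ {1ℚ} {0} {8 ℕ.* L} (ℚ.nonNegative⁻¹ 1ℚ) ℚ.≤-refl ℕ.z≤n ⟩
  1ℚ ∎
  where
  open ℚ.≤-Reasoning
  p = ½ ^ (8 ℕ.* L)
  lem₁ : ∀ p m n → (p + ((m * p + (p + p)) + (p + n * p + (p + p)))) * n ≡ (m + n + fromℕ 6) * n * p
  lem₁ = solve-∀ ℚ-ring
  count≤n⁵ : (m ℕ.+ n ℕ.+ 6) ℕ.* n ℕ.≤ n ℕ.* n ℕ.* (n ℕ.* n) ℕ.* n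
  count≤n⁵ = ℕ.*-monoˡ-≤ n (ℕ.≤-trans (ℕ.+-monoˡ-≤ 6 (ℕ.+-mono-≤ m≤n² (ℕ.m≤m*n n n {{n≢0}}))) (ℕ.≤-trans
    (ℕ.+-monoʳ-≤ (n ℕ.* n ℕ.+ n ℕ.* n) (ℕ.≤-trans (ℕ.m≤m+n 6 2) (ℕ.*-monoʳ-≤ 2 (ℕ.*-mono-≤ 2≤n 2≤n))))
    (ℕ.≤-trans (ℕ.≤-reflexive (lem₂ (n ℕ.* n))) (ℕ.*-monoˡ-≤ (n ℕ.* n) (ℕ.*-mono-≤ 2≤n 2≤n)))))
    where
    n≢0 : NonZero n
    n≢0 = ℕ.>-nonZero (ℕ.≤-trans (ℕ.s≤s ℕ.z≤n) 2≤n)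
    lem₂ : ∀ x → x ℕ.+ x ℕ.+ 2 ℕ.* x ≡ 4 ℕ.* x
    lem₂ = ℕR.solve-∀
  count≤ : (m ℕ.+ n ℕ.+ 6) ℕ.* n ℕ.≤ 2 ℕ.^ (8 ℕ.* L)
  count≤ = ℕ.≤-trans count≤n⁵ (ℕ.≤-trans (ℕ.*-mono-≤ (ℕ.*-mono-≤ (ℕ.*-mono-≤ n≤2^L n≤2^L) (ℕ.*-mono-≤ n≤2^L n≤2^L)) n≤2^L)
    (ℕ.≤-trans (ℕ.≤-reflexive (trans (lem₃ (2 ℕ.^ L)) (ℕ.^-*-assoc 2 L 5))) (ℕ.^-monoʳ-≤ 2 (ℕ.≤-trans (ℕ.*-monoʳ-≤ L (ℕ.m≤m+n 5 3)) (ℕ.≤-reflexive (ℕ.*-comm L 8))))))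
    where
    lem₃ : ∀ x → x ℕ.* x ℕ.* (x ℕ.* x) ℕ.* x ≡ x ℕ.* (x ℕ.* (x ℕ.* (x ℕ.* (x ℕ.* 1))))
    lem₃ = ℕR.solve-∀

-- m ≤ 8n together with the factor 4 from Δ ≤ 2/ε asks for R² ≥ 32A², and 6 is the least integer
-- whose square is at least 32.
samples-suffice : ∀ A R m n s L Δ .{{_ : NonZero L}} .{{_ : NonZero Δ}} .{{_ : NonZero m}} → 6 ℕ.* A ℕ.≤ R → m ℕ.≤ 8 ℕ.* n →
  R ℕ.* L ℕ.* Δ ℕ.* (R ℕ.* L ℕ.* Δ) ℕ.* n ℕ.≤ 4 ℕ.* (s ℕ.* s) →
  A ℕ.* A ℕ.* (m ℕ.* (Δ ℕ.* Δ) ℕ.* (L ℕ.* L)) ℕ.≤ s ℕ.* s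
samples-suffice A R m n s L Δ 6A≤R m≤8n large = ℕ.*-cancelˡ-≤ 4 (begin
  4 ℕ.* (A ℕ.* A ℕ.* (m ℕ.* (Δ ℕ.* Δ) ℕ.* (L ℕ.* L)))
    ≤⟨ ℕ.*-monoʳ-≤ 4 (ℕ.*-monoʳ-≤ (A ℕ.* A) (ℕ.*-monoˡ-≤ (L ℕ.* L) (ℕ.*-monoˡ-≤ (Δ ℕ.* Δ) m≤8n))) ⟩
  4 ℕ.* (A ℕ.* A ℕ.* (8 ℕ.* n ℕ.* (Δ ℕ.* Δ) ℕ.* (L ℕ.* L)))
    ≡⟨ lem₁ A n Δ L ⟩
  32 ℕ.* (A ℕ.* L ℕ.* Δ ℕ.* (A ℕ.* L ℕ.* Δ) ℕ.* n)
    ≤⟨ ℕ.*-monoˡ-≤ (A ℕ.* L ℕ.* Δ ℕ.* (A ℕ.* L ℕ.* Δ) ℕ.* n) (ℕ.m≤m+n 32 4) ⟩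
  36 ℕ.* (A ℕ.* L ℕ.* Δ ℕ.* (A ℕ.* L ℕ.* Δ) ℕ.* n)
    ≡⟨ lem₂ A n Δ L ⟩
  6 ℕ.* A ℕ.* L ℕ.* Δ ℕ.* (6 ℕ.* A ℕ.* L ℕ.* Δ) ℕ.* n
    ≤⟨ ℕ.*-monoˡ-≤ n (ℕ.*-mono-≤ 6ALΔ≤ 6ALΔ≤) ⟩
  R ℕ.* L ℕ.* Δ ℕ.* (R ℕ.* L ℕ.* Δ) ℕ.* n
    ≤⟨ large ⟩
  4 ℕ.* (s ℕ.* s) ∎)
  where
  open ℕ.≤-Reasoning
  6ALΔ≤ : 6 ℕ.* A ℕ.* L ℕ.* Δ ℕ.≤ R ℕ.* L ℕ.* Δ
  6ALΔ≤ = ℕ.*-monoˡ-≤ Δ (ℕ.*-monoˡ-≤ L 6A≤R)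
  lem₁ : ∀ A n d L → 4 ℕ.* (A ℕ.* A ℕ.* (8 ℕ.* n ℕ.* (d ℕ.* d) ℕ.* (L ℕ.* L))) ≡ 32 ℕ.* (A ℕ.* L ℕ.* d ℕ.* (A ℕ.* L ℕ.* d) ℕ.* n)
  lem₁ = ℕR.solve-∀
  lem₂ : ∀ A n d L → 36 ℕ.* (A ℕ.* L ℕ.* d ℕ.* (A ℕ.* L ℕ.* d) ℕ.* n) ≡ 6 ℕ.* A ℕ.* L ℕ.* d ℕ.* (6 ℕ.* A ℕ.* L ℕ.* d) ℕ.* n
  lem₂ = ℕR.solve-∀

2≤samples : ∀ A m s L Δ .{{_ : NonZero L}} .{{_ : NonZero Δ}} .{{_ : NonZero m}} → 2 ℕ.≤ A →
  A ℕ.* A ℕ.* (m ℕ.* (Δ ℕ.* Δ) ℕ.* (L ℕ.* L)) ℕ.≤ s ℕ.* s → 2 ℕ.≤ s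
2≤samples A m s L Δ 2≤A large = square-cancel-≤ (ℕ.≤-trans
  (ℕ.*-mono-≤ (ℕ.*-mono-≤ 2≤A 2≤A) (ℕ.>-nonZero⁻¹ (m ℕ.* (Δ ℕ.* Δ) ℕ.* (L ℕ.* L)) {{nz}})) large)
  where
  nz : NonZero (m ℕ.* (Δ ℕ.* Δ) ℕ.* (L ℕ.* L))
  nz = ℕ.m*n≢0 (m ℕ.* (Δ ℕ.* Δ)) (L ℕ.* L) {{ℕ.m*n≢0 m (Δ ℕ.* Δ)}} {{ℕ.m*n≢0 L L}}
    where instance
    Δ²≢0 : NonZero (Δ ℕ.* Δ)
    Δ²≢0 = ℕ.m*n≢0 Δ Δ

-- 48 is six rounds for each of the 8 log n halvings in `majority`; the 8 in 8B comes from Δ³ ≤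
-- 8/ε³.
minimalFactors : ℕ → ℕ → HiddenFactors
minimalFactors A B = record
  { roundsFactor   = 48
  ; samplesFactor  = 6 ℕ.* A
  ; verticesFactor = polyFactor (8 ℕ.* B) 2 1
  ; edgesFactor    = polyFactor (8 ℕ.* B) 2 4
  }

module Correctness (A B : ℕ) (24*1024≡A : 24 ℕ.* 1024 ≡ A) (2≤A : 2 ℕ.≤ A)
  (B-large₁ : 5 ℕ.* 288 ℕ.* 11 ℕ.* 19 ℕ.≤ B) (B-large₂ : 4 ℕ.* 1280 ℕ.* 8 ℕ.* 11 ℕ.≤ B) (16≤B : 16 ℕ.≤ B)
  (h : HiddenFactors) (h-large : minimalFactors A B ⊑ h)
  {n : ℕ} (G : SimpleGraph n) .{{_ : NonZero (∣E∣ G)}}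
  (ε : ℚ) .{{_ : Positive ε}} (ε<1 : ε < 1ℚ) where

  open Algorithm G ε h hiding (fullNonAdaptiveEdge)
  open HiddenFactors h using (roundsFactor; samplesFactor; verticesFactor; edgesFactor)
  open Parameters ε ε<1 using (Δ; Δ≢0; 1≤εΔ; samples-large; vertices-large; edges-large; classes-few)
  open _⊑_ h-large
  open _≼_ vertices≼ renaming (coeff≤ to coeff≤ⱽ; logExp≤ to logExp≤ⱽ; εExp≤ to εExp≤ⱽ)
  open _≼_ edges≼ renaming (coeff≤ to coeff≤ᴱ; logExp≤ to logExp≤ᴱ; εExp≤ to εExp≤ᴱ)

  private
    m L : ℕ
    m = ∣E∣ G
    L = ⌈log₂ n ⌉

    2≤n : 2 ℕ.≤ n
    2≤n = edge⇒2≤n G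

    instance
      L≢0 : NonZero L
      L≢0 = ℕ.>-nonZero (1≤⌈log₂n⌉ 2≤n)
      Δ-nonZero : NonZero Δ
      Δ-nonZero = Δ≢0

    p a b c : ℚ
    p = ½ ^ (8 ℕ.* L)
    a = p
    b = fromℕ m * p + (p + p)
    c = p + fromℕ n * p + (p + p)

    0≤p : 0ℚ ≤ p
    0≤p = ^-nonNeg (8 ℕ.* L) (ℚ.nonNegative⁻¹ ½)

    0≤b : 0ℚ ≤ b
    0≤b = +-nonNeg (*-nonNeg (0≤fromℕ m) 0≤p) (+-nonNeg 0≤p 0≤p)

    0≤c : 0ℚ ≤ c
    0≤c = +-nonNeg (+-nonNeg 0≤p (*-nonNeg (0≤fromℕ n) 0≤p)) (+-nonNeg 0≤p 0≤p)

    output : Bool → Vec (Fin m) s → Maybe ℚ → Maybe ℚ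
    output k xs m̃ = if (0 ℕ.<ᵇ ∣collisions∣ xs) ∧ k then fromℕ (s C 2) ÷? fromℕ (∣collisions∣ xs) else m̃

    Inaccurate : Pred (Maybe ℚ) 0ℓ
    Inaccurate m̃ = ¬ Approximates ε (fromℕ m) m̃

    afterSamples : Bool → Vec (Fin m) s → Rand (Maybe ℚ)
    afterSamples k xs = nonAdaptiveEdge >>= λ m̃ → pure (output k xs m̃)

    afterTest : Bool → Rand (Maybe ℚ)
    afterTest k = repeat s randEdge >>= afterSamples k

    algorithm≡ : fullNonAdaptiveEdge G ε h ≡ (isCollision >>= afterTest)
    algorithm≡ = refl

    -- One failure event per stage: K for the test, D for the collision sample, B for the
    -- degree-based estimate. In each range of m one of them is empty: B for few edges, where that
    -- estimate is never output, K in the middle range, where both estimates are accurate, and D for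
    -- many edges, where the collision estimate is never output.
    combine : ∀ {K : Pred Bool 0ℓ} {D : Pred (Vec (Fin m) s) 0ℓ} {B : Pred (Maybe ℚ) 0ℓ} →
      Decidable K → Decidable D →
      Unlikely isCollision K a → Unlikely (repeat s randEdge) D b → Unlikely nonAdaptiveEdge B c →
      (∀ k xs m̃ → ¬ K k → ¬ D xs → Inaccurate (output k xs m̃) → B m̃) →
      Unlikely (isCollision >>= afterTest) Inaccurate (a + (b + c))
    combine {K} {D} {B} K? D? K-unlikely D-unlikely B-unlikely inaccurate⇒B =
      unlikely->>= isCollision afterTest {B = K} {D = Inaccurate} {q = a} {r = b + c} (+-nonNeg 0≤b 0≤c) K-unlikely (λ k → test k (K? k))
      where
      sampled : ∀ k → ¬ K k → ∀ xs → Dec (D xs) → D xs ⊎ Unlikely (afterSamples k xs) Inaccurate c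
      sampled k ¬K xs (yes d)  = inj₁ d
      sampled k ¬K xs (no ¬d)  = inj₂ (unlikely-map nonAdaptiveEdge (output k xs) {B = B} {D = Inaccurate} B-unlikely (λ m̃ → inaccurate⇒B k xs m̃ ¬K ¬d))
      test : ∀ k → Dec (K k) → K k ⊎ Unlikely (afterTest k) Inaccurate (b + c)
      test k (yes y) = inj₁ y
      test k (no ¬K) = inj₂ (unlikely->>= (repeat s randEdge) (afterSamples k) {B = D} {D = Inaccurate} {q = b} {r = c} 0≤c D-unlikely (λ xs → sampled k ¬K xs (D? xs)))

    deviates? : Decidable (Deviates m Δ {s})
    deviates? xs = (_ ℕ.≤? _) ⊎-dec (_ ℕ.≤? _)

    module Concentrated (m≤8n : m ℕ.≤ 8 ℕ.* n) where

      s-large : A ℕ.* A ℕ.* (m ℕ.* (Δ ℕ.* Δ) ℕ.* (L ℕ.* L)) ℕ.≤ s ℕ.* s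
      s-large = samples-suffice A samplesFactor m n s L Δ samples≤ m≤8n (samples-large samplesFactor L n)

      2≤s : 2 ℕ.≤ s
      2≤s = 2≤samples A m s L Δ 2≤A s-large

      deviates-unlikely : Unlikely (repeat s randEdge) (Deviates m Δ {s}) b
      deviates-unlikely = collisions-concentrated m s Δ L A 24*1024≡A 2≤s s-large

      C≢0 : NonZero (s C 2)
      C≢0 = go (s C 2) (square≤4C 2≤s)
        where
        go : ∀ c → s ℕ.* s ℕ.≤ 4 ℕ.* c → NonZero c
        go (suc c) _  = _
        go zero    le = contradiction (ℕ.≤-trans (ℕ.*-mono-≤ 2≤s 2≤s) le) λ ()

      estimate : ∀ xs → ¬ Deviates m Δ {s} xs → NonZero (∣collisions∣ xs) × Approximates ε (fromℕ m) (fromℕ (s C 2) ÷? fromℕ (∣collisions∣ xs))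
      estimate xs = collision-estimate ε (ℚ.<⇒≤ (ℚ.positive⁻¹ ε)) (ℚ.<⇒≤ ε<1) Δ 1≤εΔ m {s} xs {{C≢0}}

    output-true : ∀ xs m̃ → NonZero (∣collisions∣ xs) → output true xs m̃ ≡ fromℕ (s C 2) ÷? fromℕ (∣collisions∣ xs)
    output-true xs m̃ r≢0 = cong (λ b → if b ∧ true then fromℕ (s C 2) ÷? fromℕ (∣collisions∣ xs) else m̃) (T⇒≡true (ℕ.<⇒<ᵇ (ℕ.>-nonZero⁻¹ (∣collisions∣ xs) {{r≢0}})))
      where
      T⇒≡true : ∀ {b} → T b → b ≡ true
      T⇒≡true {true} _ = refl

    output-false : ∀ xs m̃ → output false xs m̃ ≡ m̃
    output-false xs m̃ = go (0 ℕ.<ᵇ ∣collisions∣ xs)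
      where
      go : ∀ b → (if b ∧ false then fromℕ (s C 2) ÷? fromℕ (∣collisions∣ xs) else m̃) ≡ m̃
      go true  = refl
      go false = refl

    nonAdaptive-unlikely : n ℕ.≤ 6 ℕ.* m → Unlikely nonAdaptiveEdge Inaccurate c
    nonAdaptive-unlikely = NonAdaptive.inaccurate-unlikely G ε ε<1 h Δ 1≤εΔ B L≢0 B-large₁ B-large₂ 16≤B
      (vertices-large B L n coeff≤ⱽ logExp≤ⱽ εExp≤ⱽ)
      (edges-large B L n coeff≤ᴱ logExp≤ᴱ εExp≤ᴱ)
      (classes-few n L (n≤2^⌈log₂n⌉ n) (ℚ.pos*pos⇒pos ε (+ 1 / 10)))

    module Test = CollisionTest G ε h rounds≤

    few-edges : 6 ℕ.* m ℕ.≤ n → Unlikely (isCollision >>= afterTest) Inaccurate (a + (b + c))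
    few-edges 6m≤n = combine {K = _≡ false} {D = Deviates m Δ {s}} {B = λ _ → ⊥} (Bool._≟ false) deviates?
      (Test.few-edges⇒collision 6m≤n) deviates-unlikely (never nonAdaptiveEdge 0≤c (λ _ ()))
      good
      where
      open Concentrated (ℕ.≤-trans (ℕ.m≤n*m m 6) (ℕ.≤-trans 6m≤n (ℕ.m≤n*m n 8)))
      good : ∀ k xs m̃ → ¬ k ≡ false → ¬ Deviates m Δ {s} xs → Inaccurate (output k xs m̃) → ⊥
      good false xs m̃ k≢f _     _   = k≢f refl
      good true  xs m̃ _   close bad = bad (subst (Approximates ε (fromℕ m)) (sym (output-true xs m̃ (proj₁ (estimate xs close)))) (proj₂ (estimate xs close)))

    some-edges : n ℕ.≤ 6 ℕ.* m → m ℕ.≤ 8 ℕ.* n → Unlikely (isCollision >>= afterTest) Inaccurate (a + (b + c))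
    some-edges n≤6m m≤8n = combine {K = λ _ → ⊥} {D = Deviates m Δ {s}} {B = Inaccurate} (λ _ → no λ ()) deviates?
      (never isCollision 0≤p (λ _ ())) deviates-unlikely (nonAdaptive-unlikely n≤6m)
      good
      where
      open Concentrated m≤8n
      good : ∀ k xs m̃ → ¬ ⊥ → ¬ Deviates m Δ {s} xs → Inaccurate (output k xs m̃) → Inaccurate m̃
      good false xs m̃ _ _     bad = subst Inaccurate (output-false xs m̃) bad
      good true  xs m̃ _ close bad = ⊥-elim (bad (subst (Approximates ε (fromℕ m)) (sym (output-true xs m̃ (proj₁ (estimate xs close)))) (proj₂ (estimate xs close))))

    many-edges : n ℕ.≤ 6 ℕ.* m → 8 ℕ.* n ℕ.≤ m → Unlikely (isCollision >>= afterTest) Inaccurate (a + (b + c))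
    many-edges n≤6m 8n≤m = combine {K = _≡ true} {D = λ _ → ⊥} {B = Inaccurate} (Bool._≟ true) (λ _ → no λ ())
      (Test.many-edges⇒no-collision 8n≤m) (never (repeat s randEdge) 0≤b (λ _ ())) (nonAdaptive-unlikely n≤6m)
      good
      where
      good : ∀ k xs m̃ → ¬ k ≡ true → ¬ ⊥ → Inaccurate (output k xs m̃) → Inaccurate m̃
      good true  xs m̃ k≢t _ _   = contradiction refl k≢t
      good false xs m̃ _   _ bad = subst Inaccurate (output-false xs m̃) bad

    failure-unlikely : Unlikely (isCollision >>= afterTest) Inaccurate (a + (b + c))
    failure-unlikely = go (ℕ.≤-total (6 ℕ.* m) n) (ℕ.≤-total m (8 ℕ.* n))
      where
      go : 6 ℕ.* m ℕ.≤ n ⊎ n ℕ.≤ 6 ℕ.* m → m ℕ.≤ 8 ℕ.* n ⊎ 8 ℕ.* n ℕ.≤ m → Unlikely (isCollision >>= afterTest) Inaccurate (a + (b + c))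
      go (inj₁ 6m≤n) _           = few-edges 6m≤n
      go (inj₂ n≤6m) (inj₁ m≤8n) = some-edges n≤6m m≤8n
      go (inj₂ n≤6m) (inj₂ 8n≤m) = many-edges n≤6m 8n≤m

  private
    success : ℚ
    success = Pr[ fullNonAdaptiveEdge G ε h ∈ approximates? ε (fromℕ m) ]

  -- For c = 1 both exponents in `HighProbability` are 1, so a failure probability of at most 1/n is
  -- all that is asked.
  high-probability : HighProbability n 1ℚ success
  high-probability = begin
    (1ℚ - success) ^ 1 * fromℕ n ^ 1     ≡⟨ cong₂ _*_ (^1 (1ℚ - success)) (^1 (fromℕ n)) ⟩
    (1ℚ - success) * fromℕ n             ≤⟨ *-monoʳ-≤ (0≤fromℕ n) failure≤ ⟩
    (a + (b + c)) * fromℕ n              ≤⟨ failure-bound m n L 2≤n (∣E∣≤n² G) (n≤2^⌈log₂n⌉ n) ⟩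
    1ℚ                                   ∎
    where
    open ℚ.≤-Reasoning
    lem′ : ∀ x y → y ≡ (1ℚ - x) + (y - (1ℚ - x))
    lem′ = solve-∀ ℚ-ring
    lem″ : ∀ x y → x - (1ℚ - y) ≡ y - (1ℚ - x)
    lem″ = solve-∀ ℚ-ring
    success≥ : 1ℚ - (a + (b + c)) ≤ success
    success≥ = unlikely⇒Pr (fullNonAdaptiveEdge G ε h) (approximates? ε (fromℕ m))
      (subst (λ c′ → Unlikely c′ Inaccurate (a + (b + c))) (sym algorithm≡) failure-unlikely)
    failure≤ : 1ℚ - success ≤ a + (b + c)
    failure≤ = ≤-by (subst (0ℚ ≤_) (lem″ success (a + (b + c))) (p≤q⇒0≤q-p success≥)) (lem′ success (a + (b + c)))

lemma9 : ∃[ h₀ ] ∃[ c ] 0ℚ < c ×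
    (∀ (h : HiddenFactors) → h₀ ⊑ h →
    ∀ (n : ℕ) (G : SimpleGraph n) .{{_ : NonZero (∣E∣ G)}}
    (ε : ℚ) .{{_ : Positive ε}} → ε < 1ℚ →
    HighProbability n c
    Pr[ fullNonAdaptiveEdge G ε h ∈ approximates? ε (fromℕ (∣E∣ G)) ])
lemma9 = minimalFactors A B , 1ℚ , ℚ.positive⁻¹ 1ℚ , λ h h-large n G ε ε<1 →
  Correctness.high-probability A B refl (ℕ.≤ᵇ⇒≤ 2 A tt) (ℕ.≤ᵇ⇒≤ (5 ℕ.* 288 ℕ.* 11 ℕ.* 19) B tt) (ℕ.≤ᵇ⇒≤ (4 ℕ.* 1280 ℕ.* 8 ℕ.* 11) B tt) (ℕ.≤ᵇ⇒≤ 16 B tt)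
    h h-large G ε ε<1
  where
  A B : ℕ
  A = 24 ℕ.* 1024
  -- The least power of two above 5 · 288 · 11 · 19 = 300960 and 4 · 1280 · 8 · 11 = 450560.
  B = 2 ℕ.^ 19
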